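{- Let $p>3$ be a prime. If $p\equiv1\pmod3$, write $p=x^2+3y^2$ with integers $x,y$, $x\equiv1\pmod3$ and $y\equiv0$ or $1\pmod3$, and set $u=-2x$ if $3\mid y$ and $u=x-3y$ if $3\mid y-1$; then $$\sum_{k=0}^{p-1}(12k+1)\binom{ -1/6}k^4\equiv-pu+\frac{p^2}u+\frac{p^3}{u^3}\pmod{p^4}.$$ If $p\equiv2\pmod3$, then $$\sum_{k=0}^{p-1}(12k+1)\binom{ -1/6}k^4\equiv\frac{20\cdot2^{\frac{p+1}3}(2^{p-1}+3p-4)p^2}{3\binom{2(p+1)/3}{(p+1)/3}}\pmod{p^4}.$$
   Context: The general binomial coefficient is $\binom a0=1$, $\binom ak=a(a-1)\cdots(a-k+1)/k!$ for $k\ge1$. Congruences are in the ring of rationals with denominators prime to $p$. -}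

module Defs where

open import Data.Nat as ℕ using (ℕ; zero; suc; _!)
open import Data.Nat.Properties using (_!≢0)
open import Data.Nat.Divisibility using (_∣_)
open import Data.Integer as ℤ using (ℤ; +_; +[1+_]; -[1+_])
open import Data.Rational as ℚ using (ℚ; mkℚ; ↧ₙ_; 0ℚ; 1ℚ; _+_; _*_; _-_; 1/_)
open import Data.Product using (∃; _×_)
open import Relation.Nullary using (¬_)
open import Relation.Binary.PropositionalEquality using (_≡_)

ℕtoℚ : ℕ → ℚ
ℕtoℚ n = (+ n) ℚ./ 1

ℤtoℚ : ℤ → ℚ
ℤtoℚ z = z ℚ./ 1

_^ℚ_ : ℚ → ℕ → ℚ
q ^ℚ zero = 1ℚ
q ^ℚ suc n = q * (q ^ℚ n)

fall : ℚ → ℕ → ℚ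
fall a zero = 1ℚ
fall a (suc k) = fall a k * (a - ℕtoℚ k)

binom : ℚ → ℕ → ℚ
binom a k = ((+ 1) ℚ./ (k !)) {{k !≢0}} * fall a k

-- total reciprocal (1/0 := 0; only ever applied to nonzero values below)
inv : ℚ → ℚ
inv (mkℚ (+ zero) d c) = 0ℚ
inv q@(mkℚ +[1+ n ] d c) = 1/ q
inv q@(mkℚ -[1+ n ] d c) = 1/ q

_÷'_ : ℚ → ℚ → ℚ
a ÷' b = a * inv b

sumTo : ℕ → (ℕ → ℚ) → ℚ
sumTo zero f = 0ℚ
sumTo (suc n) f = sumTo n f + f n

pIntegral : ℕ → ℚ → Set
pIntegral p r = ¬ (p ∣ ↧ₙ r)

CongMod : ℕ → ℚ → ℚ → ℚ → Set
CongMod p a b m = ∃ λ r → pIntegral p r × (a - b ≡ m * r)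

S : ℕ → ℚ
S p = sumTo p (λ k → (ℕtoℚ (12 ℕ.* k ℕ.+ 1)) * (binom (-[1+ 0 ] ℚ./ 6) k ^ℚ 4))

{-# OPTIONS --safe #-}
module Submission where

open import Level using (0ℓ; _⊔_)
open import Data.Nat as ℕ using (ℕ; zero; suc)
open import Data.Nat.Primality using (Prime)
import Data.Nat.Divisibility as ℕD
import Data.Nat.Properties as ℕₚ
open import Data.Integer as ℤ using (ℤ; +_; -[1+_]; +[1+_])
import Data.Integer.Properties as ℤₚ
open import Data.Integer.Divisibility.Signed as ℤD using () renaming (_∣_ to _∣ᶻ_)
open import Data.Product using (∃; _,_; proj₁; proj₂; _×_)
open import Data.Sum as Sum using (_⊎_; inj₁; inj₂)
open import Data.Empty using (⊥; ⊥-elim)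
open import Data.Unit using (tt)
open import Relation.Nullary using (¬_; yes; no; Dec; contradiction)
open import Relation.Binary.PropositionalEquality as ≡ using (_≡_)
open import Algebra.Bundles using (CommutativeRing)
import Data.Nat.Solver
import Data.Integer.Solver

-- Let S be the sum, a = 1/6 and (a)_k the rising factorial. Since binom(-1/6, k)^4 = ((a)_k / k!)^4
-- and 12k + 1 = 6(2k + a), S is six times a truncated very-well-poised hypergeometric series. Take
-- e = 1 or e = 5 according to p modulo 6, write e p = 6n + 1 and put x = e p / 6. Then a = x - n,
-- and x^4 = 0 in the ring of p-integral rationals modulo p^4.
--
-- Summation. Deform the series to F(a, q) by replacing each term ratio (a+j)^4 / (j+1)^4 with
-- (a+j)((a+j)^3 - q) / ((j+1)((j+1)^3 + q)), where q^2 = 0. At a = -n the reflection of k into n -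
-- k changes the sign of the summands, so F(-n, q) = 0 (`F-zero`). For q = x^3 one has x q = 0, so
-- the mixed second difference of F in the two variables vanishes, and F(x - n, 0) = F(x - n, x^3)
-- (`F-independent-of-q`). The right side terminates at k = n; it is a terminating case of the
-- classical 5F4 summation, proved by creative telescoping in n (`recurrence`, `closed-form`). The
-- outcome is S = 6 x y = e p y modulo p^4, where y is the quotient of prod_{i<=n} (x^2 - i^2)
-- prod_{i<=2n} (i - 2x) by prod_{i<=n} (i - 2x)(i^3 + x^3).
--
-- Case p = 6n + 1. Here e = 1 and y matters modulo p^3. Let t(z) be the Teichmüller representative
-- of z and J the sum of t(z)^(5n) t(1-z)^(2n) over residues z. Because t(1-z) = (1 - t(z))^(p^2),
-- Newton interpolation in the exponent expresses J through binomial coefficients of orders 2n, 8n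
-- and 14n (`J-newton`, `tsum-value`); Wolstenholme's congruence and second-order expansions then
-- yield J = -y (`J-closed-form`). On the other hand J is the image of the Jacobi sum J(θ^5, θ^2) in
-- the Eisenstein integers, θ being the sextic residue character, and that sum has norm p
-- (`jacobi-norm`). Hence y^2 + u y + p = 0 with u the trace of the Jacobi sum, and since y is a
-- unit, y = -u + p/u + p^2/u^3 modulo p^3 (`unit-root`). To find u, write p = X^2 + 3Y^2. Elements
-- of norm p agree up to units and conjugation. Comparing J(θ^5, θ^2) with the cubic sum J(θ^2, θ^2)
-- modulo 2, reducing both at the prime above 3, and observing that they differ (one maps to a unit,
-- the other to a multiple of p) leaves u = -2X or u = X - 3Y (`Identify`).
--
-- Case p = 6g - 1. Here e = 5 and n = 5g - 1, and the product of the i - 2x contains p - 2x =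
-- -2p/3. So y = -(2p/3) w, and w matters modulo p^2. Reflecting factorials by i -> p - i and
-- splitting them by parity reduces w binom(4g, 2g) to powers of 2 and p (`unit-part`).

module NaturalBinomials where

  -- Factorials and binomial coefficients of natural numbers.

  open import Data.Nat
  open import Data.Nat.Properties
  open import Data.Nat.Combinatorics using (_C_; nCk≡n!/k![n-k]!; k![n∸k]!∣n!)
  open import Data.Nat.DivMod using (m/n*n≡m)
  open import Data.Nat.Solver using (module +-*-Solver)
  open import Relation.Binary.PropositionalEquality
  open ≡-Reasoning
  module ℕS = +-*-Solver

  nCk-factorial : ∀ {n k} → k ≤ n → (n C k) * (k ! * (n ∸ k) !) ≡ n !
  nCk-factorial {n} {k} k≤n = trans (cong (_* (k ! * (n ∸ k) !)) (nCk≡n!/k![n-k]! k≤n)) (m/n*n≡m (k![n∸k]!∣n! k≤n))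
    where instance _ = k !* (n ∸ k) !≢0

  rising : ℕ → ℕ → ℕ
  rising m zero = 1
  rising m (suc k) = rising m k * suc (m + k)

  !-rising : ∀ m k → (m + k) ! ≡ m ! * rising m k
  !-rising m zero = trans (cong _! (+-identityʳ m)) (sym (*-identityʳ _))
  !-rising m (suc k) = trans (cong _! (+-suc m k))
    (trans (cong (suc (m + k) *_) (!-rising m k))
      (trans (*-comm (suc (m + k)) _) (*-assoc (m !) (rising m k) _)))

  -- (m + k choose k) k! = (m + 1) ⋯ (m + k)
  nCk-rising : ∀ m k → ((m + k) C k) * k ! ≡ rising m k
  nCk-rising m k = *-cancelʳ-≡ _ _ (m !) {{m !≢0}} (begin
    ((m + k) C k) * k ! * m !              ≡⟨ *-assoc ((m + k) C k) (k !) (m !) ⟩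
    ((m + k) C k) * (k ! * m !)            ≡⟨ cong (λ z → ((m + k) C k) * (k ! * z !)) (m+n∸n≡m m k) ⟨
    ((m + k) C k) * (k ! * (m + k ∸ k) !)  ≡⟨ nCk-factorial (m≤n+m k m) ⟩
    (m + k) !                              ≡⟨ !-rising m k ⟩
    m ! * rising m k                       ≡⟨ *-comm (m !) _ ⟩
    rising m k * m !                       ∎)

  -- In the binomial coefficient of order 14n the prime p = 6n + 1 cancels.
  central : ∀ M n′ (let n = suc n′; p = suc M) → M ≡ 6 * n →
    ((14 * n) C (7 * n)) * M ! * (rising p n′ * rising p n′) ≡ 2 * rising p M * rising (p + p) (2 * n′)
  central M n′ M≡6n = *-cancelʳ-≡ _ _ (p * p * M !) (begin
    b * M ! * (r * r) * (p * p * M !)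
      ≡⟨ ℕS.solve 4 (λ b f r p → b ℕS.:* f ℕS.:* (r ℕS.:* r) ℕS.:* (p ℕS.:* p ℕS.:* f) ℕS.:= b ℕS.:* ((p ℕS.:* f ℕS.:* r) ℕS.:* (p ℕS.:* f ℕS.:* r))) refl b (M !) r p ⟩
    b * ((p ! * r) * (p ! * r))
      ≡⟨ cong (λ k → b * (k * k)) (trans (sym (!-rising p n′)) (cong _! p+n′≡7n)) ⟩
    b * ((7 * n) ! * (7 * n) !)
      ≡⟨ cong (λ k → b * ((7 * n) ! * k !)) (trans (sym (m+n∸m≡n (7 * n) (7 * n))) (cong (_∸ 7 * n) 7n+7n)) ⟩
    b * ((7 * n) ! * (14 * n ∸ 7 * n) !)
      ≡⟨ nCk-factorial (subst (7 * n ≤_) 7n+7n (m≤m+n (7 * n) (7 * n))) ⟩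
    (14 * n) !
      ≡⟨ cong _! 2p+2n′ ⟨
    (p + p + 2 * n′) !
      ≡⟨ !-rising (p + p) (2 * n′) ⟩
    (p + p) ! * rising (p + p) (2 * n′)
      ≡⟨ cong (_* rising (p + p) (2 * n′)) (trans (cong _! (+-suc p M)) (cong (suc (p + M) *_) (!-rising p M))) ⟩
    suc (p + M) * (p ! * rising p M) * rising (p + p) (2 * n′)
      ≡⟨ ℕS.solve 4 (λ M f a d → let p = ℕS.con 1 ℕS.:+ M in (ℕS.con 1 ℕS.:+ (p ℕS.:+ M)) ℕS.:* ((p ℕS.:* f) ℕS.:* a) ℕS.:* d
            ℕS.:= ℕS.con 2 ℕS.:* a ℕS.:* d ℕS.:* (p ℕS.:* p ℕS.:* f)) refl M (M !) (rising p M) (rising (p + p) (2 * n′)) ⟩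
    2 * rising p M * rising (p + p) (2 * n′) * (p * p * M !) ∎)
    where
    n = suc n′
    p = suc M
    b = (14 * n) C (7 * n)
    r = rising p n′
    instance
      _ = M !≢0
      _ = m*n≢0 (p * p) (M !)
    7n+7n : 7 * n + 7 * n ≡ 14 * n
    7n+7n = ℕS.solve 1 (λ n → ℕS.con 7 ℕS.:* n ℕS.:+ ℕS.con 7 ℕS.:* n ℕS.:= ℕS.con 14 ℕS.:* n) refl n
    p+n′≡7n : p + n′ ≡ 7 * n
    p+n′≡7n = trans (cong (λ m → suc m + n′) M≡6n) (ℕS.solve 1 (λ k → let n = ℕS.con 1 ℕS.:+ k in ℕS.con 1 ℕS.:+ ℕS.con 6 ℕS.:* n ℕS.:+ k ℕS.:= ℕS.con 7 ℕS.:* n) refl n′)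
    2p+2n′ : p + p + 2 * n′ ≡ 14 * n
    2p+2n′ = trans (cong (λ m → suc m + suc m + 2 * n′) M≡6n) (ℕS.solve 1 (λ k → let n = ℕS.con 1 ℕS.:+ k ; p = ℕS.con 1 ℕS.:+ ℕS.con 6 ℕS.:* n in p ℕS.:+ p ℕS.:+ ℕS.con 2 ℕS.:* k ℕS.:= ℕS.con 14 ℕS.:* n) refl n′)

-- Commutative rings: integer constants, units, divisibility, finite sums and products.

module RingKit {c ℓ} (R : CommutativeRing c ℓ) where

  open import Data.Maybe using (Maybe; just; nothing)
  open import Algebra.Solver.Ring.AlmostCommutativeRing
    using (fromCommutativeRing; _-Raw-AlmostCommutative⟶_)
  open import Algebra.Bundles.Raw using (RawRing)

  open CommutativeRing R using (ring; semiring; commutativeSemiring; setoid)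
  open CommutativeRing R public
    using (Carrier; _≈_; _+_; _*_; -_; _-_; 0#; 1#; refl; sym; trans; reflexive; +-cong; +-congˡ; +-congʳ; *-cong; *-congˡ; *-congʳ
      ; -‿cong; +-assoc; +-comm; +-identityˡ; +-identityʳ; -‿inverseˡ; -‿inverseʳ; *-assoc; *-comm; *-identityˡ; *-identityʳ; zeroˡ; zeroʳ; distribˡ; distribʳ)
  open import Algebra.Properties.Ring ring public
    using (-‿distribˡ-*; -‿distribʳ-*; -0#≈0#; -‿involutive; -‿+-comm)
  open import Relation.Binary.Reasoning.Setoid setoid public

  -- The separate clause for one makes the image of 1 compute to `1#`, so that the solver's
  -- coefficient morphism has `1-homo = refl`; numerals unfold to sums of `1#` with no trailing
  -- zero.
  ιₙ : ℕ → Carrier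
  ιₙ zero = 0#
  ιₙ (suc zero) = 1#
  ιₙ (suc (suc n)) = 1# + ιₙ (suc n)

  ι : ℤ → Carrier
  ι (+ n) = ιₙ n
  ι -[1+ n ] = - ιₙ (suc n)

  ιₙ-suc : ∀ n → ιₙ (suc n) ≈ 1# + ιₙ n
  ιₙ-suc zero = sym (+-identityʳ _)
  ιₙ-suc (suc n) = refl

  ιₙ-+ : ∀ m n → ιₙ (m ℕ.+ n) ≈ ιₙ m + ιₙ n
  ιₙ-+ zero n = sym (+-identityˡ _)
  ιₙ-+ (suc m) n = begin
    ιₙ (suc (m ℕ.+ n))      ≈⟨ ιₙ-suc (m ℕ.+ n) ⟩
    1# + ιₙ (m ℕ.+ n)       ≈⟨ +-congˡ (ιₙ-+ m n) ⟩
    1# + (ιₙ m + ιₙ n)      ≈⟨ +-assoc _ _ _ ⟨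
    (1# + ιₙ m) + ιₙ n      ≈⟨ +-congʳ (ιₙ-suc m) ⟨
    ιₙ (suc m) + ιₙ n       ∎

  ιₙ-* : ∀ m n → ιₙ (m ℕ.* n) ≈ ιₙ m * ιₙ n
  ιₙ-* zero n = sym (zeroˡ _)
  ιₙ-* (suc m) n = begin
    ιₙ (n ℕ.+ m ℕ.* n)       ≈⟨ ιₙ-+ n (m ℕ.* n) ⟩
    ιₙ n + ιₙ (m ℕ.* n)      ≈⟨ +-cong (sym (*-identityˡ _)) (ιₙ-* m n) ⟩
    1# * ιₙ n + ιₙ m * ιₙ n  ≈⟨ distribʳ _ _ _ ⟨
    (1# + ιₙ m) * ιₙ n       ≈⟨ *-congʳ (ιₙ-suc m) ⟨
    ιₙ (suc m) * ιₙ n        ∎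

  ι-- : ∀ z → ι (ℤ.- z) ≈ - ι z
  ι-- (+ zero) = sym -0#≈0#
  ι-- (+ suc n) = refl
  ι-- -[1+ n ] = sym (-‿involutive _)

  ι-⊖ : ∀ m n → ι (m ℤ.⊖ n) ≈ ιₙ m - ιₙ n
  ι-⊖ m zero = sym (trans (+-congˡ -0#≈0#) (+-identityʳ _))
  ι-⊖ zero (suc n) = sym (+-identityˡ _)
  ι-⊖ (suc m) (suc n) = begin
    ι (suc m ℤ.⊖ suc n)            ≡⟨ ≡.cong ι (ℤₚ.[1+m]⊖[1+n]≡m⊖n m n) ⟩
    ι (m ℤ.⊖ n)                    ≈⟨ ι-⊖ m n ⟩
    ιₙ m - ιₙ n                    ≈⟨ +-identityˡ _ ⟨
    0# + (ιₙ m - ιₙ n)             ≈⟨ +-congʳ (-‿inverseʳ 1#) ⟨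
    (1# - 1#) + (ιₙ m - ιₙ n)      ≈⟨ +-assoc _ _ _ ⟩
    1# + (- 1# + (ιₙ m - ιₙ n))    ≈⟨ +-congˡ (+-assoc _ _ _) ⟨
    1# + ((- 1# + ιₙ m) - ιₙ n)    ≈⟨ +-congˡ (+-congʳ (+-comm _ _)) ⟩
    1# + ((ιₙ m - 1#) - ιₙ n)      ≈⟨ +-congˡ (+-assoc _ _ _) ⟩
    1# + (ιₙ m + (- 1# - ιₙ n))    ≈⟨ +-assoc _ _ _ ⟨
    (1# + ιₙ m) + (- 1# - ιₙ n)    ≈⟨ +-congˡ (-‿+-comm _ _) ⟩
    (1# + ιₙ m) - (1# + ιₙ n)      ≈⟨ +-cong (ιₙ-suc m) (-‿cong (ιₙ-suc n)) ⟨
    ιₙ (suc m) - ιₙ (suc n)        ∎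

  ι-+ : ∀ x y → ι (x ℤ.+ y) ≈ ι x + ι y
  ι-+ (+ m) (+ n) = ιₙ-+ m n
  ι-+ (+ m) -[1+ n ] = ι-⊖ m (suc n)
  ι-+ -[1+ m ] (+ n) = trans (ι-⊖ n (suc m)) (+-comm _ _)
  ι-+ -[1+ m ] -[1+ n ] = begin
    - ιₙ (suc (suc (m ℕ.+ n)))      ≡⟨ ≡.cong (λ k → - ιₙ k) (ℕₚ.+-suc (suc m) n) ⟨
    - ιₙ (suc m ℕ.+ suc n)          ≈⟨ -‿cong (ιₙ-+ (suc m) (suc n)) ⟩
    - (ιₙ (suc m) + ιₙ (suc n))     ≈⟨ -‿+-comm _ _ ⟨
    - ιₙ (suc m) - ιₙ (suc n)       ∎

  ι-*-+ : ∀ m y → ι (+ m ℤ.* y) ≈ ιₙ m * ι y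
  ι-*-+ zero y = trans (reflexive (≡.cong ι (ℤₚ.*-zeroˡ y))) (sym (zeroˡ _))
  ι-*-+ (suc m) y = begin
    ι (+ suc m ℤ.* y)        ≡⟨ ≡.cong ι (ℤₚ.suc-* (+ m) y) ⟩
    ι (y ℤ.+ + m ℤ.* y)      ≈⟨ ι-+ y _ ⟩
    ι y + ι (+ m ℤ.* y)      ≈⟨ +-cong (sym (*-identityˡ _)) (ι-*-+ m y) ⟩
    1# * ι y + ιₙ m * ι y    ≈⟨ distribʳ _ _ _ ⟨
    (1# + ιₙ m) * ι y        ≈⟨ *-congʳ (ιₙ-suc m) ⟨
    ιₙ (suc m) * ι y         ∎

  ι-* : ∀ x y → ι (x ℤ.* y) ≈ ι x * ι y
  ι-* (+ m) y = ι-*-+ m y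
  ι-* -[1+ m ] y = begin
    ι (-[1+ m ] ℤ.* y)         ≡⟨ ≡.cong ι (ℤₚ.neg-distribˡ-* (+ suc m) y) ⟨
    ι (ℤ.- (+ suc m ℤ.* y))    ≈⟨ ι-- (+ suc m ℤ.* y) ⟩
    - ι (+ suc m ℤ.* y)        ≈⟨ -‿cong (ι-*-+ (suc m) y) ⟩
    - (ιₙ (suc m) * ι y)       ≈⟨ -‿distribˡ-* _ _ ⟩
    - ιₙ (suc m) * ι y         ∎

  private
    ℤ-raw : RawRing _ _
    ℤ-raw = record { Carrier = ℤ ; _≈_ = _≡_ ; _+_ = ℤ._+_ ; _*_ = ℤ._*_ ; -_ = ℤ.-_ ; 0# = + 0 ; 1# = + 1 }

    ι-morphism : ℤ-raw -Raw-AlmostCommutative⟶ fromCommutativeRing R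
    ι-morphism = record
      { ⟦_⟧ = ι ; +-homo = ι-+ ; *-homo = ι-* ; -‿homo = ι-- ; 0-homo = refl ; 1-homo = refl }

    ι≟ : ∀ x y → Maybe (ι x ≈ ι y)
    ι≟ x y with x ℤₚ.≟ y
    ... | yes eq = just (reflexive (≡.cong ι eq))
    ... | no _ = nothing

  open import Algebra.Solver.Ring ℤ-raw (fromCommutativeRing R) ι-morphism ι≟ public
    using (solve; _:=_; _:+_; _:*_; _:-_; :-_; con; _:^_; Polynomial)

  -- integer constants of the solver
  ♯ : ∀ {n} → ℕ → Polynomial n
  ♯ k = con (+ k)

  open import Algebra.Properties.Semiring.Exp semiring public
    using (_^_; ^-congˡ; ^-homo-*; ^-assocʳ)
  open import Algebra.Properties.CommutativeSemiring.Exp commutativeSemiring public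
    using (^-distrib-*)

  1^n≈1 : ∀ n → 1# ^ n ≈ 1#
  1^n≈1 zero = refl
  1^n≈1 (suc n) = trans (*-identityˡ _) (1^n≈1 n)

  0^1+n≈0 : ∀ n → 0# ^ suc n ≈ 0#
  0^1+n≈0 n = zeroˡ _

  -- The way nilpotence enters throughout: a polynomial identity checked by the solver displays the
  -- unwanted part as a multiple of `e`, which is then dropped.
  ≈-mod-zero : ∀ {a b e c} → a ≈ b + e * c → e ≈ 0# → a ≈ b
  ≈-mod-zero h e≈0 = trans h (trans (+-congˡ (trans (*-congʳ e≈0) (zeroˡ _))) (+-identityʳ _))

  a-b≈0⇒a≈b : ∀ {a b} → a - b ≈ 0# → a ≈ b
  a-b≈0⇒a≈b {a} {b} h = begin
    a              ≈⟨ solve 2 (λ a b → a := (a :- b) :+ b) refl a b ⟩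
    (a - b) + b    ≈⟨ +-congʳ h ⟩
    0# + b         ≈⟨ +-identityˡ _ ⟩
    b              ∎

  a≈b⇒a-b≈0 : ∀ {a b} → a ≈ b → a - b ≈ 0#
  a≈b⇒a-b≈0 h = trans (+-congʳ h) (-‿inverseʳ _)

  pull-out : ∀ {a b c d} → a * (b * (c * d)) ≈ c * (a * (b * d))
  pull-out {a} {b} {c} {d} = solve 4 (λ a b c d → a :* (b :* (c :* d)) := c :* (a :* (b :* d))) refl a b c d

  third-power≈0 : ∀ {x a} c → x ≈ a * c → a * a * a ≈ 0# → x * x * x ≈ 0#
  third-power≈0 {x} {a} c h a³ = begin
    x * x * x                       ≈⟨ *-cong (*-cong h h) h ⟩
    a * c * (a * c) * (a * c)       ≈⟨ solve 2 (λ a c → a :* c :* (a :* c) :* (a :* c) := a :* a :* a :* (c :* c :* c)) refl a c ⟩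
    a * a * a * (c * c * c)         ≈⟨ *-congʳ a³ ⟩
    0# * (c * c * c)                ≈⟨ zeroˡ _ ⟩
    0#                              ∎

  fourth-power≈0 : ∀ {x a} c → x ≈ a * c → a * a * a * a ≈ 0# → x * x * x * x ≈ 0#
  fourth-power≈0 {x} {a} c h a⁴ = begin
    x * x * x * x                             ≈⟨ *-cong (*-cong (*-cong h h) h) h ⟩
    a * c * (a * c) * (a * c) * (a * c)       ≈⟨ solve 2 (λ a c → a :* c :* (a :* c) :* (a :* c) :* (a :* c) := a :* a :* a :* a :* (c :* c :* c :* c)) refl a c ⟩
    a * a * a * a * (c * c * c * c)           ≈⟨ *-congʳ a⁴ ⟩
    0# * (c * c * c * c)                      ≈⟨ zeroˡ _ ⟩
    0#                                        ∎

  -- Units and divisibility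

  Unit : Carrier → Set _
  Unit a = ∃ λ b → a * b ≈ 1#

  unit-* : ∀ {a b} → Unit a → Unit b → Unit (a * b)
  unit-* {a} {b} (a' , h) (b' , k) = a' * b' , (begin
    (a * b) * (a' * b')  ≈⟨ solve 4 (λ a b a' b' → (a :* b) :* (a' :* b') := (a :* a') :* (b :* b')) refl a b a' b' ⟩
    (a * a') * (b * b')  ≈⟨ *-cong h k ⟩
    1# * 1#              ≈⟨ *-identityˡ _ ⟩
    1#                   ∎)

  unit-factor : ∀ {a b} → Unit (a * b) → Unit a
  unit-factor {a} {b} (c , h) = b * c , trans (sym (*-assoc _ _ _)) h

  unit-cong : ∀ {a b} → a ≈ b → Unit a → Unit b
  unit-cong e (a' , h) = a' , trans (*-congʳ (sym e)) h

  unit-1 : Unit 1#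
  unit-1 = 1# , *-identityˡ _

  unit-neg : ∀ {a} → Unit a → Unit (- a)
  unit-neg {a} (a' , h) = - a' , trans (solve 2 (λ a b → (:- a) :* (:- b) := a :* b) refl a a') h

  unit-cancel : ∀ {u a b} → Unit u → u * a ≈ u * b → a ≈ b
  unit-cancel {u} {a} {b} (v , h) e = begin
    a            ≈⟨ *-identityˡ _ ⟨
    1# * a       ≈⟨ *-congʳ h ⟨
    (u * v) * a  ≈⟨ solve 3 (λ u v a → (u :* v) :* a := v :* (u :* a)) refl u v a ⟩
    v * (u * a)  ≈⟨ *-congˡ e ⟩
    v * (u * b)  ≈⟨ solve 3 (λ u v a → v :* (u :* a) := (u :* v) :* a) refl u v b ⟩
    (u * v) * b  ≈⟨ *-congʳ h ⟩
    1# * b       ≈⟨ *-identityˡ _ ⟩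
    b            ∎

  unit-zero : ∀ {u a} → Unit u → u * a ≈ 0# → a ≈ 0#
  unit-zero u e = unit-cancel u (trans e (sym (zeroʳ _)))

  infix 4 _∣ʳ_
  _∣ʳ_ : Carrier → Carrier → Set _
  d ∣ʳ a = ∃ λ c → a ≈ d * c

  ∣ʳ-resp : ∀ {d a b} → a ≈ b → d ∣ʳ a → d ∣ʳ b
  ∣ʳ-resp e (c , h) = c , trans (sym e) h

  ∣ʳ-+ : ∀ {d a b} → d ∣ʳ a → d ∣ʳ b → d ∣ʳ a + b
  ∣ʳ-+ (c , h) (c' , k) = c + c' , trans (+-cong h k) (sym (distribˡ _ _ _))

  ∣ʳ-*ʳ : ∀ {d a} b → d ∣ʳ a → d ∣ʳ a * b
  ∣ʳ-*ʳ b (c , h) = c * b , trans (*-congʳ h) (*-assoc _ _ _)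

  ∣ʳ-*ˡ : ∀ {d a} b → d ∣ʳ a → d ∣ʳ b * a
  ∣ʳ-*ˡ b h = ∣ʳ-resp (*-comm _ _) (∣ʳ-*ʳ b h)

  ∣ʳ-neg : ∀ {d a} → d ∣ʳ a → d ∣ʳ - a
  ∣ʳ-neg (c , h) = - c , trans (-‿cong h) (-‿distribʳ-* _ _)

  ∣ʳ-0 : ∀ {d} → d ∣ʳ 0#
  ∣ʳ-0 = 0# , sym (zeroʳ _)

  -- Finite sums and products

  Σ< : ℕ → (ℕ → Carrier) → Carrier
  Σ< zero f = 0#
  Σ< (suc n) f = Σ< n f + f n

  Π< : ℕ → (ℕ → Carrier) → Carrier
  Π< zero f = 1#
  Π< (suc n) f = Π< n f * f n

  Σ-cong : ∀ n {f g} → (∀ i → i ℕ.< n → f i ≈ g i) → Σ< n f ≈ Σ< n g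
  Σ-cong zero h = refl
  Σ-cong (suc n) h = +-cong (Σ-cong n (λ i i<n → h i (ℕₚ.m<n⇒m<1+n i<n))) (h n ℕₚ.≤-refl)

  Π-cong : ∀ n {f g} → (∀ i → i ℕ.< n → f i ≈ g i) → Π< n f ≈ Π< n g
  Π-cong zero h = refl
  Π-cong (suc n) h = *-cong (Π-cong n (λ i i<n → h i (ℕₚ.m<n⇒m<1+n i<n))) (h n ℕₚ.≤-refl)

  Σ-+ : ∀ n f g → Σ< n (λ i → f i + g i) ≈ Σ< n f + Σ< n g
  Σ-+ zero f g = sym (+-identityˡ _)
  Σ-+ (suc n) f g = trans (+-congʳ (Σ-+ n f g))
    (solve 4 (λ a b c d → (a :+ b) :+ (c :+ d) := (a :+ c) :+ (b :+ d)) refl _ _ _ _)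

  Σ-*ˡ : ∀ n a f → Σ< n (λ i → a * f i) ≈ a * Σ< n f
  Σ-*ˡ zero a f = sym (zeroʳ _)
  Σ-*ˡ (suc n) a f = trans (+-congʳ (Σ-*ˡ n a f)) (sym (distribˡ _ _ _))

  Σ-*ʳ : ∀ n a f → Σ< n (λ i → f i * a) ≈ Σ< n f * a
  Σ-*ʳ zero a f = sym (zeroˡ _)
  Σ-*ʳ (suc n) a f = trans (+-congʳ (Σ-*ʳ n a f)) (sym (distribʳ _ _ _))

  Σ-neg : ∀ n f → Σ< n (λ i → - f i) ≈ - Σ< n f
  Σ-neg zero f = sym -0#≈0#
  Σ-neg (suc n) f = trans (+-congʳ (Σ-neg n f)) (-‿+-comm _ _)

  Σ-zero : ∀ n {f} → (∀ i → i ℕ.< n → f i ≈ 0#) → Σ< n f ≈ 0#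
  Σ-zero zero h = refl
  Σ-zero (suc n) h = trans (+-cong (Σ-zero n (λ i i<n → h i (ℕₚ.m<n⇒m<1+n i<n))) (h n ℕₚ.≤-refl)) (+-identityˡ _)

  Σ-const : ∀ n a → Σ< n (λ _ → a) ≈ ιₙ n * a
  Σ-const zero a = sym (zeroˡ _)
  Σ-const (suc n) a = begin
    Σ< n (λ _ → a) + a   ≈⟨ +-cong (Σ-const n a) (sym (*-identityˡ _)) ⟩
    ιₙ n * a + 1# * a    ≈⟨ distribʳ _ _ _ ⟨
    (ιₙ n + 1#) * a      ≈⟨ *-congʳ (trans (+-comm _ _) (sym (ιₙ-suc n))) ⟩
    ιₙ (suc n) * a       ∎

  Σ-swap : ∀ m n (f : ℕ → ℕ → Carrier) → Σ< m (λ i → Σ< n (f i)) ≈ Σ< n (λ j → Σ< m (λ i → f i j))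
  Σ-swap zero n f = sym (Σ-zero n (λ _ _ → refl))
  Σ-swap (suc m) n f = trans (+-congʳ (Σ-swap m n f)) (sym (Σ-+ n (λ j → Σ< m (λ i → f i j)) (f m)))

  Σ-head : ∀ n f → Σ< (suc n) f ≈ f 0 + Σ< n (λ i → f (suc i))
  Σ-head zero f = trans (+-identityˡ _) (sym (+-identityʳ _))
  Σ-head (suc n) f = trans (+-congʳ (Σ-head n f)) (+-assoc _ _ _)

  Π-head : ∀ n f → Π< (suc n) f ≈ f 0 * Π< n (λ i → f (suc i))
  Π-head zero f = trans (*-identityˡ _) (sym (*-identityʳ _))
  Π-head (suc n) f = trans (*-congʳ (Π-head n f)) (*-assoc _ _ _)

  Π-split : ∀ m n f → Π< (m ℕ.+ n) f ≈ Π< m f * Π< n (λ i → f (m ℕ.+ i))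
  Π-split m zero f = trans (reflexive (≡.cong (λ k → Π< k f) (ℕₚ.+-identityʳ m))) (sym (*-identityʳ _))
  Π-split m (suc n) f = begin
    Π< (m ℕ.+ suc n) f                                 ≡⟨ ≡.cong (λ k → Π< k f) (ℕₚ.+-suc m n) ⟩
    Π< (m ℕ.+ n) f * f (m ℕ.+ n)                       ≈⟨ *-congʳ (Π-split m n f) ⟩
    (Π< m f * Π< n (λ i → f (m ℕ.+ i))) * f (m ℕ.+ n)  ≈⟨ *-assoc _ _ _ ⟩
    Π< m f * Π< (suc n) (λ i → f (m ℕ.+ i))            ∎

  Σ-split : ∀ m n f → Σ< (m ℕ.+ n) f ≈ Σ< m f + Σ< n (λ i → f (m ℕ.+ i))
  Σ-split m zero f = trans (reflexive (≡.cong (λ k → Σ< k f) (ℕₚ.+-identityʳ m))) (sym (+-identityʳ _))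
  Σ-split m (suc n) f = begin
    Σ< (m ℕ.+ suc n) f                                 ≡⟨ ≡.cong (λ k → Σ< k f) (ℕₚ.+-suc m n) ⟩
    Σ< (m ℕ.+ n) f + f (m ℕ.+ n)                       ≈⟨ +-congʳ (Σ-split m n f) ⟩
    (Σ< m f + Σ< n (λ i → f (m ℕ.+ i))) + f (m ℕ.+ n)  ≈⟨ +-assoc _ _ _ ⟩
    Σ< m f + Σ< (suc n) (λ i → f (m ℕ.+ i))            ∎

  Σ-pick : ∀ n r (f : ℕ → Carrier) → r ℕ.< n → (∀ i → i ℕ.< n → ¬ i ≡ r → f i ≈ 0#) → Σ< n f ≈ f r
  Σ-pick (suc n) r f r<1+n h with n ℕ.≟ r
  ... | yes ≡.refl = trans (+-congʳ (Σ-zero n (λ i i<n → h i (ℕₚ.m<n⇒m<1+n i<n) (ℕₚ.<⇒≢ i<n)))) (+-identityˡ _)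
  ... | no n≢r = trans (+-cong (Σ-pick n r f (ℕₚ.≤∧≢⇒< (ℕₚ.≤-pred r<1+n) (λ e → n≢r (≡.sym e)))
                   (λ i i<n → h i (ℕₚ.m<n⇒m<1+n i<n))) (h n ℕₚ.≤-refl n≢r)) (+-identityʳ _)

  Π-* : ∀ n f g → Π< n (λ i → f i * g i) ≈ Π< n f * Π< n g
  Π-* zero f g = sym (*-identityˡ _)
  Π-* (suc n) f g = trans (*-congʳ (Π-* n f g))
    (solve 4 (λ a b c d → (a :* b) :* (c :* d) := (a :* c) :* (b :* d)) refl _ _ _ _)

  Π-const : ∀ n a → Π< n (λ _ → a) ≈ a ^ n
  Π-const zero a = refl
  Π-const (suc n) a = trans (*-comm _ _) (*-congˡ (Π-const n a))

  Π-rev : ∀ n f → Π< n f ≈ Π< n (λ i → f (n ℕ.∸ suc i))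
  Π-rev zero f = refl
  Π-rev (suc n) f = begin
    Π< n f * f n                              ≈⟨ *-congʳ (Π-rev n f) ⟩
    Π< n (λ i → f (n ℕ.∸ suc i)) * f n        ≈⟨ *-comm _ _ ⟩
    f n * Π< n (λ i → f (n ℕ.∸ suc i))        ≈⟨ Π-head n (λ i → f (n ℕ.∸ i)) ⟨
    Π< (suc n) (λ i → f (n ℕ.∸ i))            ∎

  Σ-rev : ∀ n f → Σ< n f ≈ Σ< n (λ i → f (n ℕ.∸ suc i))
  Σ-rev zero f = refl
  Σ-rev (suc n) f = begin
    Σ< n f + f n                              ≈⟨ +-congʳ (Σ-rev n f) ⟩
    Σ< n (λ i → f (n ℕ.∸ suc i)) + f n        ≈⟨ +-comm _ _ ⟩
    f n + Σ< n (λ i → f (n ℕ.∸ suc i))        ≈⟨ Σ-head n (λ i → f (n ℕ.∸ i)) ⟨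
    Σ< (suc n) (λ i → f (n ℕ.∸ i))            ∎

  Π-zero : ∀ n {f} j → j ℕ.< n → f j ≈ 0# → Π< n f ≈ 0#
  Π-zero (suc n) {f} j j<1+n h with j ℕ.≟ n
  ... | yes ≡.refl = trans (*-congˡ h) (zeroʳ _)
  ... | no j≢n = trans (*-congʳ (Π-zero n j (ℕₚ.≤∧≢⇒< (ℕₚ.≤-pred j<1+n) j≢n) h)) (zeroˡ _)

  Π-unit : ∀ n {f} → (∀ i → i ℕ.< n → Unit (f i)) → Unit (Π< n f)
  Π-unit zero h = unit-1
  Π-unit (suc n) h = unit-* (Π-unit n (λ i i<n → h i (ℕₚ.m<n⇒m<1+n i<n))) (h n ℕₚ.≤-refl)

  Σ-trunc : ∀ m n {f} → m ℕ.≤ n → (∀ i → m ℕ.≤ i → f i ≈ 0#) → Σ< n f ≈ Σ< m f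
  Σ-trunc zero n m≤n h = Σ-zero n (λ i _ → h i ℕ.z≤n)
  Σ-trunc (suc m) (suc n) {f} (ℕ.s≤s m≤n) h with m ℕ.≟ n
  ... | yes ≡.refl = refl
  ... | no m≢n = trans (+-cong (Σ-trunc (suc m) n (ℕₚ.≤∧≢⇒< m≤n m≢n) h)
                               (h n (ℕₚ.≤∧≢⇒< m≤n m≢n))) (+-identityʳ _)

  ∣ʳ-Σ : ∀ {d} n {f} → (∀ i → i ℕ.< n → d ∣ʳ f i) → d ∣ʳ Σ< n f
  ∣ʳ-Σ zero h = ∣ʳ-0
  ∣ʳ-Σ (suc n) h = ∣ʳ-+ (∣ʳ-Σ n (λ i i<n → h i (ℕₚ.m<n⇒m<1+n i<n))) (h n ℕₚ.≤-refl)

-- The binomial theorem and truncated expansions in a ring.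

module RingBinomials {c ℓ} (R : CommutativeRing c ℓ) where
  open RingKit R
  open NaturalBinomials
  open import Data.Nat as ℕ using (ℕ; zero; suc; _!; NonZero)
  open import Data.Nat.Combinatorics using (_C_; nCk≡n!/k![n-k]!; k![n∸k]!∣n!; nCk+nC[k+1]≡[n+1]C[k+1]; k>n⇒nCk≡0; nCn≡1; nC1≡n; nCk≡nC[n∸k])
  open import Data.Nat.DivMod using (m/n*n≡m)
  open import Data.Nat.Properties using (_!≢0; _!*_!≢0)

  ι-^ : ∀ z k → ι (z ℤ.^ k) ≈ ι z ^ k
  ι-^ z zero = refl
  ι-^ z (suc k) = trans (ι-* z (z ℤ.^ k)) (*-congˡ (ι-^ z k))

  nC0≡1 : ∀ n → n C 0 ≡ 1
  nC0≡1 n = ≡.trans (nCk≡nC[n∸k] {0} {n} ℕ.z≤n) (nCn≡1 n)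

  binomial : ∀ s y → (1# + y) ^ s ≈ Σ< (suc s) (λ i → ιₙ (s C i) * y ^ i)
  binomial zero y = trans (sym (*-identityˡ _)) (sym (+-identityˡ _))
  binomial (suc s) y = begin
    (1# + y) * (1# + y) ^ s
      ≈⟨ *-congˡ (binomial s y) ⟩
    (1# + y) * Σ< (suc s) b
      ≈⟨ solve 2 (λ y S → (♯ 1 :+ y) :* S := S :+ y :* S) refl _ _ ⟩
    Σ< (suc s) b + y * Σ< (suc s) b
      ≈⟨ +-cong (trans (sym (+-identityʳ _)) (+-congˡ (sym top))) (sym (Σ-*ˡ (suc s) y b)) ⟩
    Σ< (suc (suc s)) b + Σ< (suc s) (λ i → y * b i)
      ≈⟨ +-congʳ (Σ-head (suc s) b) ⟩
    (b 0 + Σ< (suc s) (λ i → b (suc i))) + Σ< (suc s) (λ i → y * b i)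
      ≈⟨ trans (+-assoc _ _ _) (+-congˡ (sym (Σ-+ (suc s) _ _))) ⟩
    b 0 + Σ< (suc s) (λ i → b (suc i) + y * b i)
      ≈⟨ +-cong (*-congʳ (reflexive (≡.cong ιₙ (≡.trans (nC0≡1 s) (≡.sym (nC0≡1 (suc s))))))) (Σ-cong (suc s) (λ i _ → pascal i)) ⟩
    b′ 0 + Σ< (suc s) (λ i → b′ (suc i))
      ≈⟨ Σ-head (suc s) b′ ⟨
    Σ< (suc (suc s)) b′ ∎
    where
    b b′ : ℕ → Carrier
    b i = ιₙ (s C i) * y ^ i
    b′ i = ιₙ (suc s C i) * y ^ i
    top : b (suc s) ≈ 0#
    top = trans (*-congʳ (reflexive (≡.cong ιₙ (k>n⇒nCk≡0 (ℕₚ.n<1+n s))))) (zeroˡ _)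
    pascal : ∀ i → b (suc i) + y * b i ≈ b′ (suc i)
    pascal i = begin
      ιₙ (s C suc i) * (y * y ^ i) + y * (ιₙ (s C i) * y ^ i)
        ≈⟨ solve 4 (λ a b y z → a :* (y :* z) :+ y :* (b :* z) := (b :+ a) :* (y :* z)) refl _ _ _ _ ⟩
      (ιₙ (s C i) + ιₙ (s C suc i)) * (y * y ^ i)
        ≈⟨ *-congʳ (ιₙ-+ (s C i) (s C suc i)) ⟨
      ιₙ (s C i ℕ.+ s C suc i) * (y * y ^ i)
        ≡⟨ ≡.cong (λ k → ιₙ k * (y * y ^ i)) (nCk+nC[k+1]≡[n+1]C[k+1] s i) ⟩
      b′ (suc i) ∎

  ιₙ-rising : ∀ m k → ιₙ (rising m k) ≈ Π< k (λ i → ιₙ (suc (m ℕ.+ i)))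
  ιₙ-rising m zero = refl
  ιₙ-rising m (suc k) = trans (ιₙ-* (rising m k) _) (*-congʳ (ιₙ-rising m k))

  -- First and second order expansions

  expand₁ : ∀ b d k → ∃ λ e → (b + d) ^ suc k ≈ b ^ suc k + ιₙ (suc k) * b ^ k * d + d * d * e
  expand₁ b d zero = 0# , solve 2 (λ b d → (b :+ d) :* ♯ 1 := b :* ♯ 1 :+ ♯ 1 :* ♯ 1 :* d :+ d :* d :* ♯ 0) refl b d
  expand₁ b d (suc k) with expand₁ b d k
  ... | e , h = ιₙ (suc k) * b ^ k + (b + d) * e , (begin
    (b + d) * (b + d) ^ suc k
      ≈⟨ *-congˡ h ⟩
    (b + d) * (b * b ^ k + ιₙ (suc k) * b ^ k * d + d * d * e)
      ≈⟨ solve 5 (λ b d B K e → (b :+ d) :* (b :* B :+ K :* B :* d :+ d :* d :* e)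
           := b :* (b :* B) :+ (♯ 1 :+ K) :* (b :* B) :* d :+ d :* d :* (K :* B :+ (b :+ d) :* e)) refl b d (b ^ k) (ιₙ (suc k)) e ⟩
    b * (b * b ^ k) + (1# + ιₙ (suc k)) * (b * b ^ k) * d + d * d * (ιₙ (suc k) * b ^ k + (b + d) * e) ∎)

  -- Doubling both sides clears the denominator of binom(k, 2), so the expansion holds in any ring.
  [1+e]^k : ∀ e k → e * e * e ≈ 0# → ιₙ 2 * (1# + e) ^ k ≈ ιₙ 2 + ιₙ 2 * ιₙ k * e + ιₙ k * (ιₙ k - 1#) * (e * e)
  [1+e]^k e zero e³ = solve 1 (λ e → ♯ 2 :* ♯ 1 := ♯ 2 :+ ♯ 2 :* ♯ 0 :* e :+ ♯ 0 :* (♯ 0 :- ♯ 1) :* (e :* e)) refl e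
  [1+e]^k e (suc k) e³ = begin
    ιₙ 2 * ((1# + e) * (1# + e) ^ k)
      ≈⟨ solve 2 (λ e x → ♯ 2 :* ((♯ 1 :+ e) :* x) := (♯ 1 :+ e) :* (♯ 2 :* x)) refl e _ ⟩
    (1# + e) * (ιₙ 2 * (1# + e) ^ k)
      ≈⟨ *-congˡ ([1+e]^k e k e³) ⟩
    (1# + e) * (ιₙ 2 + ιₙ 2 * K * e + K * (K - 1#) * (e * e))
      ≈⟨ ≈-mod-zero (solve 2 (λ e K → (♯ 1 :+ e) :* (♯ 2 :+ ♯ 2 :* K :* e :+ K :* (K :- ♯ 1) :* (e :* e))
           := ♯ 2 :+ ♯ 2 :* (♯ 1 :+ K) :* e :+ (♯ 1 :+ K) :* (♯ 1 :+ K :- ♯ 1) :* (e :* e) :+ e :* e :* e :* (K :* (K :- ♯ 1))) refl e K) e³ ⟩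
    ιₙ 2 + ιₙ 2 * (1# + K) * e + (1# + K) * (1# + K - 1#) * (e * e)
      ≈⟨ +-cong (+-congˡ (*-congʳ (*-congˡ (ιₙ-suc k)))) (*-congʳ (*-cong (ιₙ-suc k) (+-congʳ (ιₙ-suc k)))) ⟨
    ιₙ 2 + ιₙ 2 * ιₙ (suc k) * e + ιₙ (suc k) * (ιₙ (suc k) - 1#) * (e * e) ∎
    where K = ιₙ k

  -- Products Π (1 + v_i y) to second order in y.
  Π-expand₂ : ∀ k (v : ℕ → Carrier) y → y * y * y ≈ 0# →
    ιₙ 2 * Π< k (λ i → 1# + v i * y) ≈
    ιₙ 2 + ιₙ 2 * Σ< k v * y + (Σ< k v * Σ< k v - Σ< k (λ i → v i * v i)) * (y * y)
  Π-expand₂ zero v y y³ = solve 1 (λ y → ♯ 2 :* ♯ 1 := ♯ 2 :+ ♯ 2 :* ♯ 0 :* y :+ (♯ 0 :* ♯ 0 :- ♯ 0) :* (y :* y)) refl y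
  Π-expand₂ (suc k) v y y³ = begin
    ιₙ 2 * (Π< k (λ i → 1# + v i * y) * (1# + v k * y))
      ≈⟨ *-assoc _ _ _ ⟨
    ιₙ 2 * Π< k (λ i → 1# + v i * y) * (1# + v k * y)
      ≈⟨ *-congʳ (Π-expand₂ k v y y³) ⟩
    (ιₙ 2 + ιₙ 2 * h * y + (h * h - g) * (y * y)) * (1# + v k * y)
      ≈⟨ ≈-mod-zero (solve 4 (λ h g v y → (♯ 2 :+ ♯ 2 :* h :* y :+ (h :* h :- g) :* (y :* y)) :* (♯ 1 :+ v :* y)
           := ♯ 2 :+ ♯ 2 :* (h :+ v) :* y :+ ((h :+ v) :* (h :+ v) :- (g :+ v :* v)) :* (y :* y) :+ y :* y :* y :* ((h :* h :- g) :* v)) refl h g (v k) y) y³ ⟩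
    ιₙ 2 + ιₙ 2 * (h + v k) * y + ((h + v k) * (h + v k) - (g + v k * v k)) * (y * y) ∎
    where
    h = Σ< k v
    g = Σ< k (λ i → v i * v i)

-- Residues of integers modulo p.

module PrimeModulus (p : ℕ) (p-prime : Prime p) where
  open import Data.Nat.Primality using (Prime; euclidsLemma; prime⇒nonZero; prime⇒nonTrivial)

  open import Data.Nat.Coprimality using (coprime-Bézout; prime⇒coprime)
  open import Data.Nat.GCD using (module Bézout)
  open import Data.Integer.DivMod using (_%ℕ_; _/ℕ_; n%ℕd<d; a≡a%ℕn+[a/ℕn]*n)
  open import Data.Integer.Divisibility.Signed as ℤD using (_∣_; divides)
  open import Data.Integer.Solver using (module +-*-Solver)
  open +-*-Solver using (solve; _:=_; _:+_; _:*_; _:-_; :-_; con)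
  open import Relation.Binary.Definitions using (tri<; tri≈; tri>)
  open import Relation.Binary.PropositionalEquality as ≡ using (_≡_; refl; sym; trans; cong; cong₂; subst)

  instance
    p-nonZero = prime⇒nonZero p-prime

  infix 4 _≅_
  -- A record rather than a synonym, so that unification can recover `a` and `b`, which their
  -- difference does not determine.
  record _≅_ (a b : ℤ) : Set where
    constructor ≅-from
    field ≅⇒∣ : + p ∣ a ℤ.- b
  open _≅_ public

  infix 4 _≅?_
  _≅?_ : ∀ a b → Dec (a ≅ b)
  a ≅? b with + p ℤD.∣? (a ℤ.- b)
  ... | yes h = yes (≅-from h)
  ... | no h = no (λ k → h (≅⇒∣ k))

  ≅-reflexive : ∀ {a b} → a ≡ b → a ≅ b
  ≅-reflexive {a} refl = ≅-from (subst (+ p ∣_) (sym (ℤₚ.+-inverseʳ a)) (divides (+ 0) refl))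

  ≅-refl : ∀ {a} → a ≅ a
  ≅-refl = ≅-reflexive refl

  ≅-sym : ∀ {a b} → a ≅ b → b ≅ a
  ≅-sym {a} {b} (≅-from h) = ≅-from (subst (+ p ∣_) (solve 2 (λ a b → :- (a :- b) := b :- a) refl a b) (ℤD.∣m⇒∣-m h))

  ≅-trans : ∀ {a b c} → a ≅ b → b ≅ c → a ≅ c
  ≅-trans {a} {b} {c} (≅-from h) (≅-from k) = ≅-from (subst (+ p ∣_)
    (solve 3 (λ a b c → (a :- b) :+ (b :- c) := a :- c) refl a b c) (ℤD.∣m∣n⇒∣m+n h k))

  ≅-+ : ∀ {a b c d} → a ≅ b → c ≅ d → a ℤ.+ c ≅ b ℤ.+ d
  ≅-+ {a} {b} {c} {d} (≅-from h) (≅-from k) = ≅-from (subst (+ p ∣_)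
    (solve 4 (λ a b c d → (a :- b) :+ (c :- d) := (a :+ c) :- (b :+ d)) refl a b c d) (ℤD.∣m∣n⇒∣m+n h k))

  ≅-* : ∀ {a b c d} → a ≅ b → c ≅ d → a ℤ.* c ≅ b ℤ.* d
  ≅-* {a} {b} {c} {d} (≅-from h) (≅-from k) = ≅-from (subst (+ p ∣_)
    (solve 4 (λ a b c d → (a :- b) :* c :+ b :* (c :- d) := a :* c :- b :* d) refl a b c d)
    (ℤD.∣m∣n⇒∣m+n (ℤD.∣m⇒∣m*n c h) (ℤD.∣n⇒∣m*n b k)))

  ≅-neg : ∀ {a b} → a ≅ b → ℤ.- a ≅ ℤ.- b
  ≅-neg {a} {b} (≅-from h) = ≅-from (subst (+ p ∣_) (solve 2 (λ a b → :- (a :- b) := (:- a) :- (:- b)) refl a b) (ℤD.∣m⇒∣-m h))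

  ≅-- : ∀ {a b c d} → a ≅ b → c ≅ d → a ℤ.- c ≅ b ℤ.- d
  ≅-- h k = ≅-+ h (≅-neg k)

  ≅-^ : ∀ {a b} n → a ≅ b → a ℤ.^ n ≅ b ℤ.^ n
  ≅-^ zero h = ≅-refl
  ≅-^ (suc n) h = ≅-* h (≅-^ n h)

  ∣⇒≅0 : ∀ {a} → + p ∣ a → a ≅ + 0
  ∣⇒≅0 {a} h = ≅-from (subst (+ p ∣_) (sym (ℤₚ.+-identityʳ a)) h)

  ≅0⇒∣ : ∀ {a} → a ≅ + 0 → + p ∣ a
  ≅0⇒∣ {a} (≅-from h) = subst (+ p ∣_) (ℤₚ.+-identityʳ a) h

  euclid : ∀ a b → + p ∣ a ℤ.* b → + p ∣ a ⊎ + p ∣ b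
  euclid a b h = Sum.map ℤD.∣ᵤ⇒∣ ℤD.∣ᵤ⇒∣ (euclidsLemma ℤ.∣ a ∣ ℤ.∣ b ∣ p-prime
    (subst (p ℕD.∣_) (ℤₚ.abs-* a b) (ℤD.∣⇒∣ᵤ h)))

  ¬p∣small : ∀ j → 0 ℕ.< j → j ℕ.< p → ¬ (+ p ∣ + j)
  ¬p∣small (suc j) _ j<p h = ℕₚ.<⇒≱ j<p (ℕD.∣⇒≤ (ℤD.∣⇒∣ᵤ h))

  1<p : 1 ℕ.< p
  1<p = ℕ.nonTrivial⇒n>1 p {{prime⇒nonTrivial p-prime}}

  ¬p∣1 : ¬ (+ p ∣ + 1)
  ¬p∣1 = ¬p∣small 1 (ℕ.s≤s ℕ.z≤n) 1<p

  ≅-cancel : ∀ {c a b} → ¬ (+ p ∣ c) → c ℤ.* a ≅ c ℤ.* b → a ≅ b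
  ≅-cancel {c} {a} {b} ¬c (≅-from h) = Sum.[ (λ x → contradiction x ¬c) , ≅-from ]′
    (euclid c (a ℤ.- b) (subst (+ p ∣_) (solve 3 (λ c a b → c :* a :- c :* b := c :* (a :- b)) refl c a b) h))

  residue : ∀ z → ∃ λ r → r ℕ.< p × z ≅ + r
  residue z = z %ℕ p , n%ℕd<d z p , ≅-from (divides (z /ℕ p) (begin-eq z))
    where
    begin-eq : ∀ z → z ℤ.- + (z %ℕ p) ≡ (z /ℕ p) ℤ.* + p
    begin-eq z = trans (cong (ℤ._- + (z %ℕ p)) (a≡a%ℕn+[a/ℕn]*n z p))
      (solve 2 (λ r q → (r :+ q) :- r := q) refl (+ (z %ℕ p)) ((z /ℕ p) ℤ.* + p))

  residue-unique : ∀ r s → r ℕ.< p → s ℕ.< p → + r ≅ + s → r ≡ s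
  residue-unique r s r<p s<p h with ℕₚ.<-cmp r s
  ... | tri≈ _ e _ = e

  ... | tri> _ _ s<r = ⊥-elim (¬p∣small (r ℕ.∸ s) (ℕₚ.m<n⇒0<n∸m s<r) (ℕₚ.≤-<-trans (ℕₚ.m∸n≤m r s) r<p)
        (subst (+ p ∣_) (trans (ℤₚ.m-n≡m⊖n r s) (ℤₚ.⊖-≥ (ℕₚ.<⇒≤ s<r))) (≅⇒∣ h)))

  ... | tri< r<s _ _ = ⊥-elim (¬p∣small (s ℕ.∸ r) (ℕₚ.m<n⇒0<n∸m r<s) (ℕₚ.≤-<-trans (ℕₚ.m∸n≤m s r) s<p)
        (subst (+ p ∣_) (trans (ℤₚ.m-n≡m⊖n s r) (ℤₚ.⊖-≥ (ℕₚ.<⇒≤ r<s))) (≅⇒∣ (≅-sym h))))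


  bezout-nat : ∀ r → 0 ℕ.< r → r ℕ.< p → ∃ λ y → + r ℤ.* y ≅ + 1
  bezout-nat r@(suc _) _ r<p with coprime-Bézout (prime⇒coprime p-prime r<p)
  ... | Bézout.+- x y e = ℤ.- (+ y) , ≅-from (divides (ℤ.- + x) (trans
        (solve 2 (λ r y → r :* (:- y) :- con (+ 1) := :- (con (+ 1) :+ y :* r)) refl (+ r) (+ y))
        (trans (cong ℤ.-_ eq) (ℤₚ.neg-distribˡ-* (+ x) (+ p)))))
    where
    eq : + 1 ℤ.+ + y ℤ.* + r ≡ + x ℤ.* + p
    eq = trans (cong (ℤ._+_ (+ 1)) (sym (ℤₚ.pos-* y r))) (trans (cong +_ e) (ℤₚ.pos-* x p))
  ... | Bézout.-+ x y e = + y , ≅-from (divides (+ x) (trans (cong (ℤ._- + 1) (trans (ℤₚ.*-comm (+ r) (+ y)) (sym eq)))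
        (solve 1 (λ a → (con (+ 1) :+ a) :- con (+ 1) := a) refl (+ x ℤ.* + p))))
    where
    eq : + 1 ℤ.+ + x ℤ.* + p ≡ + y ℤ.* + r
    eq = trans (cong (ℤ._+_ (+ 1)) (sym (ℤₚ.pos-* x p))) (trans (cong +_ e) (ℤₚ.pos-* y r))

  inverse : ∀ z → ¬ (+ p ∣ z) → ∃ λ y → z ℤ.* y ≅ + 1
  inverse z ¬z with residue z
  ... | zero , _ , z≅0 = contradiction (≅0⇒∣ z≅0) ¬z
  ... | suc r , r<p , z≅r with bezout-nat (suc r) (ℕ.s≤s ℕ.z≤n) r<p
  ...   | y , h = y , ≅-trans (≅-* z≅r (≅-refl)) h

  -- Sending multiples of p to 0 makes inversion an involution of all p residues, so complete
  -- residue sums can be reindexed by it.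
  recip : ℤ → ℤ
  recip z with + p ℤD.∣? z
  ... | yes _ = + 0
  ... | no ¬z = proj₁ (inverse z ¬z)

  recip-zero : ∀ {z} → + p ∣ z → recip z ≡ + 0
  recip-zero {z} h with + p ℤD.∣? z
  ... | yes _ = refl
  ... | no ¬z = contradiction h ¬z

  recip-inverse : ∀ {z} → ¬ (+ p ∣ z) → z ℤ.* recip z ≅ + 1
  recip-inverse {z} h with + p ℤD.∣? z
  ... | yes z≅0 = contradiction z≅0 h
  ... | no ¬z = proj₂ (inverse z ¬z)

  unit-recip : ∀ {z} → ¬ (+ p ∣ z) → ¬ (+ p ∣ recip z)
  unit-recip {z} ¬z h = ¬p∣1 (≅0⇒∣ (≅-trans
    (≅-sym (recip-inverse ¬z)) (∣⇒≅0 (ℤD.∣n⇒∣m*n z h))))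

  -- recip is an involution in the form needed for reindexing.
  recip-transpose : ∀ a b → recip a ≅ b → a ≅ recip b
  recip-transpose a b h = go (+ p ℤD.∣? a)
    where
    a′ = recip a
    b′ = recip b
    go : Dec (+ p ∣ a) → a ≅ recip b
    go (yes a0) = ≅-trans (∣⇒≅0 a0) (≅-reflexive (sym (recip-zero
      (≅0⇒∣ (≅-trans (≅-sym h) (≅-reflexive (recip-zero a0)))))))
    go (no ¬a) = ≅-cancel ¬b
      (≅-trans
        (≅-trans
          (≅-trans (≅-* (≅-sym h) (≅-refl))
             (≅-reflexive (ℤₚ.*-comm a′ a))) (recip-inverse ¬a))
        (≅-sym (recip-inverse ¬b)))
      where
      ¬b : ¬ (+ p ∣ b)
      ¬b b0 = unit-recip ¬a (≅0⇒∣ (≅-trans h (∣⇒≅0 b0)))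

-- Sums over residues, multiplicative characters and Jacobi sums.

module ResidueSums {c ℓ} (R : CommutativeRing c ℓ) (p : ℕ) (p-prime : Prime p) where

  open RingKit R
  open PrimeModulus p p-prime
  open import Data.Integer.Solver using (module +-*-Solver)

  Periodic : (ℤ → Carrier) → Set _
  Periodic f = ∀ {a b} → a ≅ b → f a ≈ f b

  Σₚ : (ℤ → Carrier) → Carrier
  Σₚ f = Σ< p (λ i → f (+ i))

  Σₚ-cong : ∀ {f g} → (∀ z → f z ≈ g z) → Σₚ f ≈ Σₚ g
  Σₚ-cong h = Σ-cong p (λ i _ → h (+ i))

  δ : ℤ → ℤ → Carrier
  δ a b with a ≅? b
  ... | yes _ = 1#
  ... | no _ = 0#

  δ-yes : ∀ {a b} → a ≅ b → δ a b ≈ 1#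
  δ-yes {a} {b} h with a ≅? b
  ... | yes _ = refl
  ... | no k = contradiction h k

  δ-no : ∀ {a b} → ¬ a ≅ b → δ a b ≈ 0#
  δ-no {a} {b} h with a ≅? b
  ... | yes k = contradiction k h
  ... | no k = refl

  δ-cong : ∀ {a b c d} → (a ≅ b → c ≅ d) → (c ≅ d → a ≅ b) → δ a b ≈ δ c d
  δ-cong {a} {b} h k with a ≅? b
  ... | yes e = sym (δ-yes (h e))
  ... | no ¬e = sym (δ-no (λ e → ¬e (k e)))

  Σ-δ : ∀ z f → Periodic f → Σₚ (λ j → δ z j * f j) ≈ f z
  Σ-δ z f f-per with residue z
  ... | r , r<p , z≅r = begin
    Σₚ (λ j → δ z j * f j)   ≈⟨ Σ-pick p r _ r<p (λ i i<p i≢r → trans (*-congʳ (δ-no (λ z≅i →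
                                 i≢r (residue-unique i r i<p r<p (≅-trans (≅-sym z≅i) z≅r))))) (zeroˡ _)) ⟩
    δ z (+ r) * f (+ r)      ≈⟨ *-cong (δ-yes z≅r) (f-per (≅-sym z≅r)) ⟩
    1# * f z                 ≈⟨ *-identityˡ _ ⟩
    f z                      ∎

  -- Write f(σ i) as the sum over j of δ(σ i, j) f(j) and exchange the sums: the inner sum counts
  -- the preimages of j, of which τ j is the only one. No permutation of the index range has to be
  -- built.
  reindex : ∀ f (σ τ : ℤ → ℤ) → Periodic f →
    (∀ a b → σ a ≅ b → a ≅ τ b) → (∀ a b → a ≅ τ b → σ a ≅ b) →
    Σₚ (λ z → f (σ z)) ≈ Σₚ f
  reindex f σ τ f-per fwd bwd = begin
    Σₚ (λ i → f (σ i))                            ≈⟨ Σₚ-cong (λ i → sym (Σ-δ (σ i) f f-per)) ⟩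
    Σₚ (λ i → Σₚ (λ j → δ (σ i) j * f j))         ≈⟨ Σ-swap p p _ ⟩
    Σₚ (λ j → Σₚ (λ i → δ (σ i) j * f j))         ≈⟨ Σ-cong p (λ j _ → Σ-*ʳ p (f (+ j)) (λ i → δ (σ (+ i)) (+ j))) ⟩
    Σₚ (λ j → Σₚ (λ i → δ (σ i) j) * f j)         ≈⟨ Σ-cong p (λ j _ → trans (*-congʳ (one (+ j))) (*-identityˡ _)) ⟩
    Σₚ f                                          ∎
    where
    one : ∀ j → Σₚ (λ i → δ (σ i) j) ≈ 1#
    one j = trans (Σₚ-cong (λ i → trans (δ-cong {σ i} {j} {τ j} {i} (λ e → ≅-sym (fwd i j e)) (λ e → bwd i j (≅-sym e)))
                                        (sym (*-identityʳ _))))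
                  (Σ-δ (τ j) (λ _ → 1#) (λ _ → refl))

  reindex-affine : ∀ f a b → Periodic f → ¬ (+ p ∣ᶻ a) → Σₚ (λ z → f (a ℤ.* z ℤ.+ b)) ≈ Σₚ f
  reindex-affine f a b f-per ¬a = reindex f (λ z → a ℤ.* z ℤ.+ b) (λ w → recip a ℤ.* (w ℤ.- b)) f-per fwd bwd
    where
    open +-*-Solver using () renaming (solve to solveℤ; _:=_ to _:≡_; _:+_ to _⟨+⟩_; _:*_ to _⟨*⟩_; _:-_ to _⟨-⟩_; con to conℤ)
    aa : a ℤ.* recip a ≅ + 1
    aa = recip-inverse ¬a
    fwd : ∀ z w → a ℤ.* z ℤ.+ b ≅ w → z ≅ recip a ℤ.* (w ℤ.- b)
    fwd z w h = ≅-trans (≅-trans (≅-reflexive (≡.sym (ℤₚ.*-identityˡ z))) (≅-* (≅-sym aa) (≅-refl {z})))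
      (≅-trans (≅-reflexive (solveℤ 4 (λ a r z b → (a ⟨*⟩ r) ⟨*⟩ z :≡ r ⟨*⟩ ((a ⟨*⟩ z ⟨+⟩ b) ⟨-⟩ b)) ≡.refl a (recip a) z b))
        (≅-* (≅-refl {recip a}) (≅-- h (≅-refl {b}))))
    bwd : ∀ z w → z ≅ recip a ℤ.* (w ℤ.- b) → a ℤ.* z ℤ.+ b ≅ w
    bwd z w h = ≅-trans (≅-+ (≅-* (≅-refl {a}) h) (≅-refl {b}))
      (≅-trans (≅-reflexive (solveℤ 4 (λ a r w b → a ⟨*⟩ (r ⟨*⟩ (w ⟨-⟩ b)) ⟨+⟩ b :≡ (a ⟨*⟩ r) ⟨*⟩ (w ⟨-⟩ b) ⟨+⟩ b) ≡.refl a (recip a) w b))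
      (≅-trans (≅-+ (≅-* aa (≅-refl {w ℤ.- b})) (≅-refl {b}))
        (≅-reflexive (solveℤ 2 (λ w b → conℤ (+ 1) ⟨*⟩ (w ⟨-⟩ b) ⟨+⟩ b :≡ w) ≡.refl w b))))

  reindex-recip : ∀ f → Periodic f → Σₚ (λ z → f (recip z)) ≈ Σₚ f
  reindex-recip f f-per = reindex f recip recip f-per recip-transpose
    (λ a b h → ≅-sym (recip-transpose b a (≅-sym h)))

  -- Multiplicative characters, extended by zero.

  record Character : Set (c Level.⊔ ℓ) where
    field
      χ : ℤ → Carrier
      χ-periodic : Periodic χ
      χ-* : ∀ a b → χ (a ℤ.* b) ≈ χ a * χ b
      χ-1 : χ (+ 1) ≈ 1#
      χ-0 : χ (+ 0) ≈ 0#
  open Character public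

  -- Nontriviality is recorded through its consequence, orthogonality to the trivial character, the
  -- form in which `jacobi-norm` uses it.
  Nontrivial : Character → Set _
  Nontrivial X = Σₚ (χ X) ≈ 0#

  χ-zero : ∀ X {z} → + p ∣ᶻ z → χ X z ≈ 0#
  χ-zero X h = trans (χ-periodic X (∣⇒≅0 h)) (χ-0 X)

  χ-recip : ∀ X {z} → ¬ (+ p ∣ᶻ z) → χ X z * χ X (recip z) ≈ 1#
  χ-recip X {z} h = trans (sym (χ-* X z (recip z))) (trans (χ-periodic X (recip-inverse h)) (χ-1 X))

  -- A general ring has no complex conjugation; X(1/z), the inverse of X(z) at residues prime to p,
  -- takes the place of the conjugate value.
  conj : Character → Character
  conj X = record
    { χ = λ z → χ X (recip z)
    ; χ-periodic = λ {a} {b} h → χ-periodic X (recip-cong a b h)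
    ; χ-* = λ a b → trans (χ-periodic X (recip-* a b)) (χ-* X (recip a) (recip b))
    ; χ-1 = trans (χ-periodic X recip-1) (χ-1 X)
    ; χ-0 = χ-zero X (≡.subst (+ p ∣ᶻ_) (≡.sym (recip-zero (ℤD.divides (+ 0) ≡.refl))) (ℤD.divides (+ 0) ≡.refl))
    }
    where
    recip-cong : ∀ a b → a ≅ b → recip a ≅ recip b
    recip-cong a b h = ≅-sym (recip-transpose′ b (recip a) (≅-trans (≅-sym h) (recip-transpose a (recip a) ≅-refl)))
      where
      recip-transpose′ : ∀ a b → a ≅ recip b → recip a ≅ b
      recip-transpose′ a b h = ≅-sym (recip-transpose b a (≅-sym h))
    recip-1 : recip (+ 1) ≅ + 1
    recip-1 = ≅-trans (≅-reflexive (≡.sym (ℤₚ.*-identityˡ _))) (recip-inverse ¬p∣1)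
    recip-* : ∀ a b → recip (a ℤ.* b) ≅ recip a ℤ.* recip b
    recip-* a b = go (+ p ℤD.∣? a) (+ p ℤD.∣? b)
      where
      open +-*-Solver using () renaming (solve to solveℤ; _:=_ to _:≡_; _:*_ to _⟨*⟩_)
      go : Dec (+ p ∣ᶻ a) → Dec (+ p ∣ᶻ b) → recip (a ℤ.* b) ≅ recip a ℤ.* recip b
      go (yes ha) _ = ≅-trans (≅-reflexive (recip-zero (ℤD.∣m⇒∣m*n b ha)))
        (≅-sym (≅-trans (≅-* (≅-reflexive (recip-zero ha)) (≅-refl {recip b})) (≅-reflexive (ℤₚ.*-zeroˡ (recip b)))))
      go (no _) (yes hb) = ≅-trans (≅-reflexive (recip-zero (ℤD.∣n⇒∣m*n a hb)))
        (≅-sym (≅-trans (≅-* (≅-refl {recip a}) (≅-reflexive (recip-zero hb))) (≅-reflexive (ℤₚ.*-zeroʳ (recip a)))))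
      go (no ha) (no hb) = ≅-cancel ¬ab (≅-trans (recip-inverse ¬ab) (≅-sym
          (≅-trans (≅-reflexive (solveℤ 4 (λ a b c d → (a ⟨*⟩ b) ⟨*⟩ (c ⟨*⟩ d) :≡ (a ⟨*⟩ c) ⟨*⟩ (b ⟨*⟩ d)) ≡.refl a b (recip a) (recip b)))
            (≅-* (recip-inverse ha) (recip-inverse hb)))))
        where
        ¬ab : ¬ (+ p ∣ᶻ a ℤ.* b)
        ¬ab h with euclid a b h
        ... | Sum.inj₁ k = ha k
        ... | Sum.inj₂ k = hb k

  _·_ : Character → Character → Character
  X · Y = record
    { χ = λ z → χ X z * χ Y z
    ; χ-periodic = λ h → *-cong (χ-periodic X h) (χ-periodic Y h)
    ; χ-* = λ a b → trans (*-cong (χ-* X a b) (χ-* Y a b))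
        (solve 4 (λ a b c d → (a :* b) :* (c :* d) := (a :* c) :* (b :* d)) refl _ _ _ _)
    ; χ-1 = trans (*-cong (χ-1 X) (χ-1 Y)) (*-identityˡ _)
    ; χ-0 = trans (*-congʳ (χ-0 X)) (zeroˡ _)
    }

  jacobi : Character → Character → Carrier
  jacobi X Y = Σₚ (λ z → χ X z * χ Y (+ 1 ℤ.- z))

  -- |J(X,Y)|² = p: with x = t y, the double sum over x, y becomes
  -- Σ_t X(t) Σ_y Y((1 - t y)/(1 - y)), a sum over a Möbius orbit.
  module JacobiNorm (X Y : Character) (X≠1 : Nontrivial X) (Y≠1 : Nontrivial Y) (XY≠1 : Nontrivial (X · Y)) where

    private
      X̄ = conj X
      Ȳ = conj Y
      open +-*-Solver using () renaming (solve to solveℤ; _:=_ to _:≡_; _:+_ to _⟨+⟩_; _:*_ to _⟨*⟩_; _:-_ to _⟨-⟩_; con to conℤ)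

    mobius : ℤ → Carrier
    mobius t = Σₚ (λ y → χ Y (+ 1 ℤ.- t ℤ.* y) * χ Ȳ (+ 1 ℤ.- y))

    mobius-periodic : ∀ t → Periodic (λ y → χ Y (+ 1 ℤ.- t ℤ.* y) * χ Ȳ (+ 1 ℤ.- y))
    mobius-periodic t h = *-cong (χ-periodic Y (≅-- (≅-refl {+ 1}) (≅-* (≅-refl {t}) h)))
                                 (χ-periodic Ȳ (≅-- (≅-refl {+ 1}) h))

    line : ∀ t → Σₚ (λ z → χ Y ((+ 1 ℤ.- t) ℤ.* z ℤ.+ t)) ≈ ιₙ p * δ (+ 1) t
    line t with (+ 1) ≅? t
    ... | no t≢1 = trans (reindex-affine (χ Y) (+ 1 ℤ.- t) t (χ-periodic Y) (λ h → t≢1 (≅-from h)))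
                     (trans Y≠1 (sym (zeroʳ _)))
    ... | yes t≅1 = trans (Σₚ-cong (λ z → trans (χ-periodic Y (≅-trans (≅-+ (≅-* (∣⇒≅0 (≅⇒∣ t≅1)) (≅-refl {z})) (≅-sym t≅1))
                         (≅-reflexive (solveℤ 1 (λ z → conℤ (+ 0) ⟨*⟩ z ⟨+⟩ conℤ (+ 1) :≡ conℤ (+ 1)) ≡.refl z)))) (χ-1 Y)))
                      (Σ-const p 1#)

    -- With y = 1 - z the quotient (1 - ty)/(1 - y) becomes (1 - t)/z + t, so z -> 1/z turns the sum
    -- into one over a line (`line`). At z = 0 the line contributes Y(t), because `recip` sends 0 to
    -- 0, whereas the original summand is 0; hence the subtracted Y(t).
    mobius-value : ∀ t → mobius t ≈ ιₙ p * δ (+ 1) t - χ Y t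
    mobius-value t = begin
      mobius t
        ≈⟨ reindex-affine _ (ℤ.- + 1) (+ 1) (mobius-periodic t) (λ h → ¬p∣1 (≡.subst (+ p ∣ᶻ_) ≡.refl (ℤD.∣m⇒∣-m h))) ⟨
      Σₚ (λ z → χ Y (+ 1 ℤ.- t ℤ.* (ℤ.- + 1 ℤ.* z ℤ.+ + 1)) * χ Ȳ (+ 1 ℤ.- (ℤ.- + 1 ℤ.* z ℤ.+ + 1)))
        ≈⟨ Σₚ-cong pointwise ⟩
      Σₚ (λ z → f (recip z) - δ (+ 0) z * χ Y t)
        ≈⟨ trans (Σ-+ p _ _) (+-congˡ (Σ-neg p _)) ⟩
      Σₚ (λ z → f (recip z)) - Σₚ (λ z → δ (+ 0) z * χ Y t)
        ≈⟨ +-cong (trans (reindex-recip f f-per) (line t)) (-‿cong (Σ-δ (+ 0) (λ _ → χ Y t) (λ _ → refl))) ⟩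
      ιₙ p * δ (+ 1) t - χ Y t ∎
      where
      f : ℤ → Carrier
      f z = χ Y ((+ 1 ℤ.- t) ℤ.* z ℤ.+ t)
      f-per : Periodic f
      f-per h = χ-periodic Y (≅-+ (≅-* (≅-refl {+ 1 ℤ.- t}) h) (≅-refl {t}))
      arg : ∀ z → + 1 ℤ.- (ℤ.- + 1 ℤ.* z ℤ.+ + 1) ≡ z
      arg z = solveℤ 1 (λ z → conℤ (+ 1) ⟨-⟩ (conℤ (ℤ.- + 1) ⟨*⟩ z ⟨+⟩ conℤ (+ 1)) :≡ z) ≡.refl z
      pointwise : ∀ z → χ Y (+ 1 ℤ.- t ℤ.* (ℤ.- + 1 ℤ.* z ℤ.+ + 1)) * χ Ȳ (+ 1 ℤ.- (ℤ.- + 1 ℤ.* z ℤ.+ + 1))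
                      ≈ f (recip z) - δ (+ 0) z * χ Y t
      pointwise z with (+ 0) ≅? z
      ... | yes z≅0 = trans (trans (*-congˡ (trans (reflexive (≡.cong (χ Ȳ) (arg z))) (χ-zero Ȳ z0))) (zeroʳ _))
              (sym (trans (+-cong (χ-periodic Y ft) (-‿cong (*-identityˡ _))) (-‿inverseʳ _)))
        where
        z0 = ≅0⇒∣ (≅-sym z≅0)
        ft : (+ 1 ℤ.- t) ℤ.* recip z ℤ.+ t ≅ t
        ft = ≅-trans (≅-+ (≅-* (≅-refl {+ 1 ℤ.- t}) (≅-reflexive (recip-zero z0))) (≅-refl {t}))
               (≅-reflexive (solveℤ 1 (λ t → (conℤ (+ 1) ⟨-⟩ t) ⟨*⟩ conℤ (+ 0) ⟨+⟩ t :≡ t) ≡.refl t))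
      ... | no z≇0 = begin
        χ Y u * χ Ȳ v                       ≡⟨ ≡.cong (λ w → χ Y u * χ Ȳ w) (arg z) ⟩
        χ Y u * χ Y (recip z)               ≈⟨ χ-* Y u (recip z) ⟨
        χ Y (u ℤ.* recip z)                 ≈⟨ χ-periodic Y ≅f ⟩
        f (recip z)                         ≈⟨ solve 2 (λ a b → a := a :- ♯ 0 :* b) refl _ _ ⟩
        f (recip z) - 0# * χ Y t            ∎
        where
        u = + 1 ℤ.- t ℤ.* (ℤ.- + 1 ℤ.* z ℤ.+ + 1)
        v = + 1 ℤ.- (ℤ.- + 1 ℤ.* z ℤ.+ + 1)
        ≅f : u ℤ.* recip z ≅ (+ 1 ℤ.- t) ℤ.* recip z ℤ.+ t
        ≅f = ≅-trans (≅-reflexive (solveℤ 3 (λ t z r → (conℤ (+ 1) ⟨-⟩ t ⟨*⟩ (conℤ (ℤ.- + 1) ⟨*⟩ z ⟨+⟩ conℤ (+ 1))) ⟨*⟩ r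
                :≡ (conℤ (+ 1) ⟨-⟩ t) ⟨*⟩ r ⟨+⟩ t ⟨*⟩ (z ⟨*⟩ r)) ≡.refl t z (recip z)))
             (≅-+ (≅-refl {(+ 1 ℤ.- t) ℤ.* recip z}) (≅-trans (≅-* (≅-refl {t}) (recip-inverse (λ h → z≇0 (≅-sym (∣⇒≅0 h)))))
                (≅-reflexive (ℤₚ.*-identityʳ t))))

    jacobi-norm : jacobi X Y * jacobi X̄ Ȳ ≈ ιₙ p
    jacobi-norm = begin
      J * Σₚ (λ y → χ X̄ y * χ Ȳ (+ 1 ℤ.- y))
        ≈⟨ Σ-*ˡ p J _ ⟨
      Σₚ (λ y → J * (χ X̄ y * χ Ȳ (+ 1 ℤ.- y)))
        ≈⟨ Σₚ-cong pointwise ⟩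
      Σₚ (λ y → Σₚ (λ t → χ X t * (χ Y (+ 1 ℤ.- t ℤ.* y) * χ Ȳ (+ 1 ℤ.- y) - δ (+ 0) y)))
        ≈⟨ Σ-swap p p _ ⟩
      Σₚ (λ t → Σₚ (λ y → χ X t * (χ Y (+ 1 ℤ.- t ℤ.* y) * χ Ȳ (+ 1 ℤ.- y) - δ (+ 0) y)))
        ≈⟨ Σₚ-cong inner ⟩
      Σₚ (λ t → ιₙ p * (δ (+ 1) t * χ X t) + (- (χ X t * χ Y t) - χ X t))
        ≈⟨ trans (Σ-+ p _ _) (+-cong (Σ-*ˡ p (ιₙ p) _) (trans (Σ-+ p _ _) (+-cong (Σ-neg p _) (Σ-neg p _)))) ⟩
      ιₙ p * Σₚ (λ t → δ (+ 1) t * χ X t) + (- Σₚ (λ t → χ X t * χ Y t) - Σₚ (χ X))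
        ≈⟨ +-cong (*-congˡ (trans (Σ-δ (+ 1) (χ X) (χ-periodic X)) (χ-1 X))) (+-cong (-‿cong XY≠1) (-‿cong X≠1)) ⟩
      ιₙ p * 1# + (- 0# - 0#)
        ≈⟨ solve 1 (λ p → p :* ♯ 1 :+ (:- (♯ 0) :- ♯ 0) := p) refl (ιₙ p) ⟩
      ιₙ p ∎
      where
      J = jacobi X Y
      inner : ∀ t → Σₚ (λ y → χ X t * (χ Y (+ 1 ℤ.- t ℤ.* y) * χ Ȳ (+ 1 ℤ.- y) - δ (+ 0) y))
                  ≈ ιₙ p * (δ (+ 1) t * χ X t) + (- (χ X t * χ Y t) - χ X t)
      inner t = begin
        _ ≈⟨ Σ-*ˡ p (χ X t) _ ⟩
        _ ≈⟨ *-congˡ (trans (Σ-+ p _ _) (+-congˡ (Σ-neg p _))) ⟩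
        χ X t * (mobius t - Σₚ (δ (+ 0)))
          ≈⟨ *-congˡ (+-cong (mobius-value t) (-‿cong (trans (Σ-cong p (λ z _ → sym (*-identityʳ (δ (+ 0) (+ z))))) (Σ-δ (+ 0) (λ _ → 1#) (λ _ → refl))))) ⟩
        χ X t * (ιₙ p * δ (+ 1) t - χ Y t - 1#)
          ≈⟨ solve 4 (λ x p d y → x :* (p :* d :- y :- ♯ 1) := p :* (d :* x) :+ (:- (x :* y) :- x)) refl _ _ _ _ ⟩
        ιₙ p * (δ (+ 1) t * χ X t) + (- (χ X t * χ Y t) - χ X t) ∎
      -- For y prime to p this is the substitution of t y for the variable in J. At y = 0 the
      -- substitution degenerates: the left side is 0, and `δ (+ 0) y` cancels Y(1)Ȳ(1) = 1 on the
      -- right.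
      pointwise : ∀ y → J * (χ X̄ y * χ Ȳ (+ 1 ℤ.- y))
        ≈ Σₚ (λ t → χ X t * (χ Y (+ 1 ℤ.- t ℤ.* y) * χ Ȳ (+ 1 ℤ.- y) - δ (+ 0) y))
      pointwise y with (+ 0) ≅? y
      ... | yes y≅0 = trans (trans (*-congˡ (trans (*-congʳ (χ-zero X̄ (≅0⇒∣ (≅-sym y≅0)))) (zeroˡ _))) (zeroʳ _))
            (sym (trans (Σ-cong p (λ i _ → let t = + i in trans (*-congˡ {χ X t} (trans (+-congʳ (trans (*-cong (trans (χ-periodic Y (e₁ t)) (χ-1 Y))
                      (trans (χ-periodic Ȳ e₂) (χ-1 Ȳ))) (*-identityˡ _))) (-‿inverseʳ _))) (zeroʳ _)))
                 (Σ-zero p (λ _ _ → refl))))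
        where
        e₁ : ∀ t → + 1 ℤ.- t ℤ.* y ≅ + 1
        e₁ t = ≅-trans (≅-- (≅-refl {+ 1}) (≅-* (≅-refl {t}) (≅-sym y≅0)))
                 (≅-reflexive (solveℤ 1 (λ t → conℤ (+ 1) ⟨-⟩ t ⟨*⟩ conℤ (+ 0) :≡ conℤ (+ 1)) ≡.refl t))
        e₂ : + 1 ℤ.- y ≅ + 1
        e₂ = ≅-- (≅-refl {+ 1}) (≅-sym y≅0)
      ... | no y≇0 = begin
        J * (χ X̄ y * b)
          ≈⟨ *-congʳ (reindex-affine _ y (+ 0) (λ h → *-cong (χ-periodic X h) (χ-periodic Y (≅-- (≅-refl {+ 1}) h)))
               (λ h → y≇0 (≅-sym (∣⇒≅0 h)))) ⟨
        Σₚ (λ t → χ X (y ℤ.* t ℤ.+ + 0) * χ Y (+ 1 ℤ.- (y ℤ.* t ℤ.+ + 0))) * (χ X̄ y * b)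
          ≈⟨ Σ-*ʳ p (χ X̄ y * b) _ ⟨
        Σₚ (λ t → χ X (y ℤ.* t ℤ.+ + 0) * χ Y (+ 1 ℤ.- (y ℤ.* t ℤ.+ + 0)) * (χ X̄ y * b))
          ≈⟨ Σ-cong p (λ i _ → let t = + i in trans (*-congʳ (*-cong (trans (reflexive (≡.cong (χ X) (ℤₚ.+-identityʳ _))) (χ-* X y t))
               (reflexive (≡.cong (λ w → χ Y (+ 1 ℤ.- w)) (≡.trans (ℤₚ.+-identityʳ (y ℤ.* t)) (ℤₚ.*-comm y t))))))
               (trans (solve 5 (λ a t c d b → (a :* t) :* c :* (d :* b) := t :* (c :* b :- ♯ 0) :* (a :* d)) refl (χ X y) (χ X t) (χ Y (+ 1 ℤ.- t ℤ.* y)) (χ X̄ y) b)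
                 (trans (*-congˡ (χ-recip X (λ h → y≇0 (≅-sym (∣⇒≅0 h))))) (*-identityʳ _)))) ⟩
        Σₚ (λ t → χ X t * (χ Y (+ 1 ℤ.- t ℤ.* y) * b - 0#)) ∎
        where b = χ Ȳ (+ 1 ℤ.- y)

-- The truncated hypergeometric sum in a ring with x^4 = 0.

module HypergeometricSum {c ℓ} (R : CommutativeRing c ℓ) where
  open RingKit R

  module ClosedForm (x : Carrier) (x⁴≈0 : x * x * x * x ≈ 0#)
    (P : ℕ) (iv : ℕ → Carrier) (iv-inv : ∀ j → j ℕ.< P → ιₙ (suc j) * iv j ≈ 1#) (unit-2 : Unit (ιₙ 2)) where


    -- For q^2 = 0 the inverse of J^3 + q, J = j + 1, is 1/J^3 - q/J^6.
    W : Carrier → ℕ → Carrier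
    W q j = iv j * iv j * iv j - q * (iv j * iv j * iv j * (iv j * iv j * iv j))

    W-inv : ∀ q j → q * q ≈ 0# → j ℕ.< P →
            (ιₙ (suc j) * ιₙ (suc j) * ιₙ (suc j) + q) * W q j ≈ 1#
    W-inv q j qq j<P = begin
      (J * J * J + q) * W q j
        ≈⟨ solve 3 (λ J q v → (J :* J :* J :+ q) :* (v :* v :* v :- q :* (v :* v :* v :* (v :* v :* v)))
             := (J :* v) :* (J :* v) :* (J :* v)
                :- q :* (v :* v :* v) :* ((J :* v) :* (J :* v) :* (J :* v) :- ♯ 1)
                :+ q :* q :* (:- (v :* v :* v :* (v :* v :* v)))) refl J q (iv j) ⟩
      (J * iv j) * (J * iv j) * (J * iv j)
        - q * (iv j * iv j * iv j) * ((J * iv j) * (J * iv j) * (J * iv j) - 1#)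
        + q * q * (- (iv j * iv j * iv j * (iv j * iv j * iv j)))
        ≈⟨ +-cong (+-cong cube (-‿cong (*-congˡ (+-congʳ cube)))) (*-congʳ qq) ⟩
      1# - q * (iv j * iv j * iv j) * (1# - 1#) + 0# * _
        ≈⟨ solve 2 (λ a b → ♯ 1 :- a :* (♯ 1 :- ♯ 1) :+ ♯ 0 :* b := ♯ 1) refl _ _ ⟩
      1# ∎
      where
      J = ιₙ (suc j)
      cube : (J * iv j) * (J * iv j) * (J * iv j) ≈ 1#
      cube = trans (*-cong (*-cong h h) h) (trans (*-congʳ (*-identityˡ _)) (*-identityˡ _))
        where h = iv-inv j j<P

    -- Numerator of the deformed term ratio. At q = 0 the ratio is ((a+j)/(j+1))^4, so `T a 0# k` is
    -- ((a)_k / k!)^4, the fourth power of binom(-a, k).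
    numer : Carrier → Carrier → ℕ → Carrier
    numer a q j = (a + ιₙ j) * ((a + ιₙ j) * (a + ιₙ j) * (a + ιₙ j) - q)

    denom : Carrier → ℕ → Carrier
    denom q j = ιₙ j * (ιₙ j * ιₙ j * ιₙ j + q)

    T : Carrier → Carrier → ℕ → Carrier
    T a q k = Π< k (λ j → numer a q j * (iv j * W q j))

    F : Carrier → Carrier → Carrier
    F a q = Σ< (suc P) (λ k → (ιₙ 2 * ιₙ k + a) * T a q k)

    denom-inv : ∀ q j → q * q ≈ 0# → j ℕ.< P → denom q (suc j) * (iv j * W q j) ≈ 1#
    denom-inv q j qq j<P = begin
      denom q (suc j) * (iv j * W q j)
        ≈⟨ solve 4 (λ a b c d → (a :* b) :* (c :* d) := (a :* c) :* (b :* d)) refl _ _ _ _ ⟩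
      (ιₙ (suc j) * iv j) * ((ιₙ (suc j) * ιₙ (suc j) * ιₙ (suc j) + q) * W q j)
        ≈⟨ *-cong (iv-inv j j<P) (W-inv q j qq j<P) ⟩
      1# * 1# ≈⟨ *-identityˡ _ ⟩
      1# ∎

    -- At a = -n the summand changes sign under k ↦ n - k.
    module Antisymmetry (q : Carrier) (qq : q * q ≈ 0#) (n : ℕ) (n≤P : n ℕ.≤ P) where

      a : Carrier
      a = - ιₙ n

      B : ℕ → Carrier
      B k = Π< k (λ j → denom q (suc j))

      B-unit : ∀ k → k ℕ.≤ P → Unit (B k)
      B-unit k k≤P = Π-unit k (λ j j<k → _ , denom-inv q j qq (ℕₚ.<-≤-trans j<k k≤P))

      -- At a = -n the numerator factor at k equals the denominator factor at n - k. So T_k = B_n /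
      -- (B_k B_{n-k}), a generalised binomial coefficient, and its symmetry is visible.
      T-B : ∀ k m → k ℕ.+ m ≡ n → T a q k * B k * B m ≈ B n
      T-B zero m ≡.refl = trans (*-congʳ (*-identityˡ _)) (*-identityˡ _)
      T-B (suc k) m e = begin
        T a q k * (numer a q k * v) * (B k * denom q (suc k)) * B m
          ≈⟨ solve 6 (λ T N v B D M → T :* (N :* v) :* (B :* D) :* M := T :* B :* (M :* N) :* (D :* v)) refl _ _ _ _ _ _ ⟩
        T a q k * B k * (B m * numer a q k) * (denom q (suc k) * v)
          ≈⟨ *-cong (*-congˡ (*-congˡ numer-denom)) (denom-inv q k qq k<P) ⟩
        T a q k * B k * B (suc m) * 1#
          ≈⟨ *-identityʳ _ ⟩
        T a q k * B k * B (suc m)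
          ≈⟨ T-B k (suc m) (≡.trans (ℕₚ.+-suc k m) e) ⟩
        B n ∎
        where
        v = iv k * W q k
        k<P : k ℕ.< P
        k<P = ℕₚ.≤-trans (≡.subst (suc k ℕ.≤_) e (ℕₚ.m≤m+n (suc k) m)) n≤P
        shift : a + ιₙ k ≈ - ιₙ (suc m)
        shift = begin
          - ιₙ n + ιₙ k                     ≡⟨ ≡.cong (λ z → - ιₙ z + ιₙ k) (≡.trans (≡.sym e) (≡.sym (ℕₚ.+-suc k m))) ⟩
          - ιₙ (k ℕ.+ suc m) + ιₙ k         ≈⟨ +-congʳ (-‿cong (ιₙ-+ k (suc m))) ⟩
          - (ιₙ k + ιₙ (suc m)) + ιₙ k      ≈⟨ solve 2 (λ a b → :- (a :+ b) :+ a := :- b) refl _ _ ⟩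
          - ιₙ (suc m)                      ∎
        numer-denom : numer a q k ≈ denom q (suc m)
        numer-denom = trans (*-cong shift (+-congʳ (*-cong (*-cong shift shift) shift)))
          (solve 2 (λ M q → (:- M) :* ((:- M) :* (:- M) :* (:- M) :- q) := M :* (M :* M :* M :+ q)) refl _ _)

      T-symmetric : ∀ k m → k ℕ.+ m ≡ n → T a q k ≈ T a q m
      T-symmetric k m e = unit-cancel (unit-* (B-unit k k≤P) (B-unit m m≤P)) (begin
        B k * B m * T a q k     ≈⟨ solve 3 (λ a b c → a :* b :* c := c :* a :* b) refl _ _ _ ⟩
        T a q k * B k * B m     ≈⟨ T-B k m e ⟩
        B n                     ≈⟨ T-B m k e′ ⟨
        T a q m * B m * B k     ≈⟨ solve 3 (λ a b c → a :* b :* c := c :* b :* a) refl _ _ _ ⟩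
        B k * B m * T a q m     ∎)
        where
        e′ = ≡.trans (ℕₚ.+-comm m k) e
        k≤P = ℕₚ.≤-trans (≡.subst (k ℕ.≤_) e (ℕₚ.m≤m+n k m)) n≤P
        m≤P = ℕₚ.≤-trans (≡.subst (m ℕ.≤_) e′ (ℕₚ.m≤m+n m k)) n≤P

      T-vanishes : ∀ k → n ℕ.< k → T a q k ≈ 0#
      T-vanishes k n<k = Π-zero k n n<k
        (trans (*-congʳ (trans (*-congʳ (-‿inverseˡ _)) (zeroˡ _))) (zeroˡ _))

      f : ℕ → Carrier
      f k = (ιₙ 2 * ιₙ k + a) * T a q k

      f-antisymmetric : ∀ k → k ℕ.≤ n → f k + f (n ℕ.∸ k) ≈ 0#
      f-antisymmetric k k≤n = begin
        f k + f m                                             ≈⟨ +-congˡ (*-congˡ (T-symmetric k m e)) ⟨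
        (ιₙ 2 * ιₙ k + a) * t + (ιₙ 2 * ιₙ m + a) * t
          ≈⟨ solve 4 (λ K M a t → (♯ 2 :* K :+ a) :* t :+ (♯ 2 :* M :+ a) :* t := (K :+ M :+ a) :* (♯ 2 :* t)) refl _ _ _ _ ⟩
        (ιₙ k + ιₙ m + a) * (ιₙ 2 * t)                       ≈⟨ *-congʳ (+-congʳ (ιₙ-+ k m)) ⟨
        (ιₙ (k ℕ.+ m) + a) * (ιₙ 2 * t)                      ≡⟨ ≡.cong (λ z → (ιₙ z + a) * (ιₙ 2 * t)) e ⟩
        (ιₙ n + a) * (ιₙ 2 * t)                              ≈⟨ *-congʳ (-‿inverseʳ _) ⟩
        0# * (ιₙ 2 * t)                                       ≈⟨ zeroˡ _ ⟩
        0# ∎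
        where
        m = n ℕ.∸ k
        t = T a q k
        e = ℕₚ.m+[n∸m]≡n k≤n

      F-zero : F a q ≈ 0#
      F-zero = unit-zero unit-2 (begin
        ιₙ 2 * F a q                                ≈⟨ *-congˡ (Σ-trunc (suc n) (suc P) (ℕ.s≤s n≤P)
                                                         (λ k n<k → trans (*-congˡ (T-vanishes k n<k)) (zeroʳ _))) ⟩
        ιₙ 2 * Σ< (suc n) f                         ≈⟨ solve 1 (λ a → ♯ 2 :* a := a :+ a) refl _ ⟩
        Σ< (suc n) f + Σ< (suc n) f                 ≈⟨ +-congˡ (Σ-rev (suc n) f) ⟩
        Σ< (suc n) f + Σ< (suc n) (λ k → f (n ℕ.∸ k)) ≈⟨ Σ-+ (suc n) f _ ⟨
        Σ< (suc n) (λ k → f k + f (n ℕ.∸ k))        ≈⟨ Σ-zero (suc n) (λ k k<1+n → f-antisymmetric k (ℕₚ.≤-pred k<1+n)) ⟩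
        0#                                          ∎)

    -- Values g(a,0), g(a,q), g(a+x,0), g(a+x,q) of a polynomial function g:
    -- as x q = 0, the mixed second difference vanishes.
    module MixedDifference (q : Carrier) (xq : x * q ≈ 0#) where

      record Square : Set c where
        constructor sq
        field v₀₀ v₀₁ v₁₀ v₁₁ : Carrier
      open Square

      -- α and β are slopes in the q and x directions; the fourth corner receives both increments
      -- and nothing else. The property passes to sums and products, hence to F.
      Mixed : Square → Set _
      Mixed s = ∃ λ α → ∃ λ β → (v₀₁ s ≈ v₀₀ s + q * α) × (v₁₀ s ≈ v₀₀ s + x * β)
                              × (v₁₁ s ≈ v₀₀ s + q * α + x * β)

      mixed-const : ∀ b → Mixed (sq b b b b)
      mixed-const b = 0# , 0# , e , solve 2 (λ b x → b := b :+ x :* ♯ 0) refl b x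
                    , solve 3 (λ b q x → b := b :+ q :* ♯ 0 :+ x :* ♯ 0) refl b q x
        where e = solve 2 (λ b q → b := b :+ q :* ♯ 0) refl b q

      _⊕_ _⊛_ : Square → Square → Square
      s ⊕ t = sq (v₀₀ s + v₀₀ t) (v₀₁ s + v₀₁ t) (v₁₀ s + v₁₀ t) (v₁₁ s + v₁₁ t)
      s ⊛ t = sq (v₀₀ s * v₀₀ t) (v₀₁ s * v₀₁ t) (v₁₀ s * v₁₀ t) (v₁₁ s * v₁₁ t)

      mixed-+ : ∀ s t → Mixed s → Mixed t → Mixed (s ⊕ t)
      mixed-+ s t (α , β , a , b , d) (α′ , β′ , a′ , b′ , d′) = α + α′ , β + β′
        , trans (+-cong a a′) (solve 5 (λ f g q α α′ → (f :+ q :* α) :+ (g :+ q :* α′) := f :+ g :+ q :* (α :+ α′)) refl _ _ _ _ _)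
        , trans (+-cong b b′) (solve 5 (λ f g q α α′ → (f :+ q :* α) :+ (g :+ q :* α′) := f :+ g :+ q :* (α :+ α′)) refl _ _ _ _ _)
        , trans (+-cong d d′) (solve 8 (λ f g q α α′ x β β′ → (f :+ q :* α :+ x :* β) :+ (g :+ q :* α′ :+ x :* β′)
             := f :+ g :+ q :* (α :+ α′) :+ x :* (β :+ β′)) refl _ _ _ _ _ _ _ _)

      mixed-* : ∀ s t → Mixed s → Mixed t → Mixed (s ⊛ t)
      mixed-* s t (α , β , a , b , d) (α′ , β′ , a′ , b′ , d′) =
          f * α′ + α * g + q * (α * α′) , f * β′ + β * g + x * (β * β′)
        , trans (*-cong a a′) (solve 5 (λ f g q α α′ → (f :+ q :* α) :* (g :+ q :* α′)
             := f :* g :+ q :* (f :* α′ :+ α :* g :+ q :* (α :* α′))) refl _ _ _ _ _)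
        , trans (*-cong b b′) (solve 5 (λ f g q α α′ → (f :+ q :* α) :* (g :+ q :* α′)
             := f :* g :+ q :* (f :* α′ :+ α :* g :+ q :* (α :* α′))) refl _ _ _ _ _)
        -- The cross terms of the product all carry the factor x q, which is zero.
        , ≈-mod-zero (trans (*-cong d d′) (solve 8 (λ f g q α α′ x β β′ → (f :+ q :* α :+ x :* β) :* (g :+ q :* α′ :+ x :* β′)
             := f :* g :+ q :* (f :* α′ :+ α :* g :+ q :* (α :* α′)) :+ x :* (f :* β′ :+ β :* g :+ x :* (β :* β′))
                :+ (x :* q) :* (α :* β′ :+ β :* α′)) refl _ _ _ _ _ _ _ _)) xq
        where f = v₀₀ s
              g = v₀₀ t

      ΣSq ΠSq : ℕ → (ℕ → Square) → Square
      ΣSq n s = sq (Σ< n (λ k → v₀₀ (s k))) (Σ< n (λ k → v₀₁ (s k))) (Σ< n (λ k → v₁₀ (s k))) (Σ< n (λ k → v₁₁ (s k)))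
      ΠSq n s = sq (Π< n (λ k → v₀₀ (s k))) (Π< n (λ k → v₀₁ (s k))) (Π< n (λ k → v₁₀ (s k))) (Π< n (λ k → v₁₁ (s k)))

      mixed-Σ : ∀ n s → (∀ k → Mixed (s k)) → Mixed (ΣSq n s)
      mixed-Σ zero s h = mixed-const 0#
      mixed-Σ (suc n) s h = mixed-+ (ΣSq n s) (s n) (mixed-Σ n s h) (h n)

      mixed-Π : ∀ n s → (∀ k → Mixed (s k)) → Mixed (ΠSq n s)
      mixed-Π zero s h = mixed-const 1#
      mixed-Π (suc n) s h = mixed-* (ΠSq n s) (s n) (mixed-Π n s h) (h n)

      module _ (a : Carrier) where

        constant : Carrier → Square
        constant b = sq b b b b

        A -Q : Square
        A = sq a a (x + a) (x + a)
        -Q = sq (- 0#) (- q) (- 0#) (- q)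

        V : ℕ → Carrier
        V j = iv j * iv j * iv j * (iv j * iv j * iv j)

        -QV S numerator inverse ratio : ℕ → Square
        -QV j = sq (- (0# * V j)) (- (q * V j)) (- (0# * V j)) (- (q * V j))
        S j = A ⊕ constant (ιₙ j)
        numerator j = S j ⊛ (((S j ⊛ S j) ⊛ S j) ⊕ -Q)
        inverse j = constant (iv j) ⊛ (constant (iv j * iv j * iv j) ⊕ -QV j)
        ratio j = numerator j ⊛ inverse j

        summand : ℕ → Square
        summand k = (constant (ιₙ 2 * ιₙ k) ⊕ A) ⊛ ΠSq k ratio

        mixed-A : Mixed A
        mixed-A = 0# , 1# , solve 2 (λ a q → a := a :+ q :* ♯ 0) refl a q
          , solve 2 (λ a x → x :+ a := a :+ x :* ♯ 1) refl a x
          , solve 3 (λ a q x → x :+ a := a :+ q :* ♯ 0 :+ x :* ♯ 1) refl a q x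

        mixed--Q : Mixed -Q
        mixed--Q = - 1# , 0# , solve 1 (λ q → :- q := :- (♯ 0) :+ q :* (:- (♯ 1))) refl q
          , solve 1 (λ x → :- (♯ 0) := :- (♯ 0) :+ x :* ♯ 0) refl x
          , solve 2 (λ q x → :- q := :- (♯ 0) :+ q :* (:- (♯ 1)) :+ x :* ♯ 0) refl q x

        mixed--QV : ∀ j → Mixed (-QV j)
        mixed--QV j = - V j , 0# , solve 2 (λ q V → :- (q :* V) := :- (♯ 0 :* V) :+ q :* (:- V)) refl q (V j)
          , solve 2 (λ x V → :- (♯ 0 :* V) := :- (♯ 0 :* V) :+ x :* ♯ 0) refl x (V j)
          , solve 3 (λ q x V → :- (q :* V) := :- (♯ 0 :* V) :+ q :* (:- V) :+ x :* ♯ 0) refl q x (V j)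

        mixed-S : ∀ j → Mixed (S j)
        mixed-S j = mixed-+ A (constant (ιₙ j)) mixed-A (mixed-const (ιₙ j))

        mixed-ratio : ∀ j → Mixed (ratio j)
        mixed-ratio j = mixed-* (numerator j) (inverse j)
          (mixed-* (S j) (((S j ⊛ S j) ⊛ S j) ⊕ -Q) (mixed-S j)
            (mixed-+ ((S j ⊛ S j) ⊛ S j) -Q
              (mixed-* (S j ⊛ S j) (S j) (mixed-* (S j) (S j) (mixed-S j) (mixed-S j)) (mixed-S j)) mixed--Q))
          (mixed-* (constant (iv j)) (constant (iv j * iv j * iv j) ⊕ -QV j) (mixed-const (iv j))
            (mixed-+ (constant (iv j * iv j * iv j)) (-QV j) (mixed-const (iv j * iv j * iv j)) (mixed--QV j)))

        mixed-sum : Mixed (ΣSq (suc P) summand)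
        mixed-sum = mixed-Σ (suc P) summand (λ k → mixed-* (constant (ιₙ 2 * ιₙ k) ⊕ A) (ΠSq k ratio)
          (mixed-+ (constant (ιₙ 2 * ιₙ k)) A (mixed-const (ιₙ 2 * ιₙ k)) mixed-A) (mixed-Π k ratio mixed-ratio))

        mixed-F : Mixed (sq (F a 0#) (F a q) (F (x + a) 0#) (F (x + a) q))
        -- Holds by computation: the corners of `ΣSq (suc P) summand` unfold to F at the four
        -- arguments. For this reason `-Q` and `-QV` spell out `- 0#` and `0# * V j`.
        mixed-F = mixed-sum

      mixed-fourth : ∀ {a b c d} → Mixed (sq a b c d) → a ≈ 0# → b ≈ 0# → c ≈ d
      mixed-fourth {a} {b} {c} {d} (α , β , h₀₁ , h₁₀ , h₁₁) z₀ z₁ = begin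
        c                    ≈⟨ h₁₀ ⟩
        a + x * β            ≈⟨ +-congʳ (trans z₀ (sym z₁)) ⟩
        b + x * β            ≈⟨ +-congʳ h₀₁ ⟩
        a + q * α + x * β    ≈⟨ h₁₁ ⟨
        d                    ∎

      F-independent-of-q : ∀ a → F a 0# ≈ 0# → F a q ≈ 0# → F (x + a) 0# ≈ F (x + a) q
      F-independent-of-q a = mixed-fourth (mixed-F a)

    -- The creative telescoping certificate for the shift n ↦ n + 1 of
    -- Σ_k t n k, with m = n + 1 - x.
    certificate : Carrier → Carrier → Carrier
    certificate k m = m * (- (ιₙ 2 * (k * k) * m) + ιₙ 6 * k * (m * m) - ιₙ 5 * (m * m * m) + x * x * x)

    -- What is left of the telescoping relation after the common factors of the terms are divided
    -- out: m(m^3 + x^3) is the new first factor of the shifted product, the expression in k - m the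
    -- new last factor of the unshifted one. It is a polynomial identity over the integers;
    -- nilpotence of x plays no part in it.
    certificate-step : ∀ k m →
      (m * m * m - x * x * x) * ((ιₙ 2 * k - m) * (m * (m * m * m + x * x * x)))
      + ιₙ 2 * (m * m) * (ιₙ 2 * m - 1#) * ((ιₙ 2 * k + 1# - m) * ((k - m) * ((k - m) * (k - m) * (k - m) - x * x * x)))
      ≈ certificate (1# + k) m * ((k - m) * ((k - m) * (k - m) * (k - m) - x * x * x)) - certificate k m * (k * (k * k * k + x * x * x))
    certificate-step k m = solve 3 (λ k m x →
      let r : _ → _
          r = λ k → m :* (:- (♯ 2 :* (k :* k) :* m) :+ ♯ 6 :* k :* (m :* m) :- ♯ 5 :* (m :* m :* m) :+ x :* x :* x)
          g = (k :- m) :* ((k :- m) :* (k :- m) :* (k :- m) :- x :* x :* x) in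
      (m :* m :* m :- x :* x :* x) :* ((♯ 2 :* k :- m) :* (m :* (m :* m :* m :+ x :* x :* x)))
      :+ ♯ 2 :* (m :* m) :* (♯ 2 :* m :- ♯ 1) :* ((♯ 2 :* k :+ ♯ 1 :- m) :* g)
      := r (♯ 1 :+ k) :* g :- r k :* (k :* (k :* k :* k :+ x :* x :* x))) refl k m x

    q₃ : Carrier
    q₃ = x * x * x

    q₃q₃≈0 : q₃ * q₃ ≈ 0#
    q₃q₃≈0 = trans (solve 1 (λ x → x :* x :* x :* (x :* x :* x) := x :* x :* x :* x :* (x :* x)) refl x)
      (trans (*-congʳ x⁴≈0) (zeroˡ _))

    module Recurrence where

      g : ℕ → ℕ → Carrier
      g n j = numer (x - ιₙ n) q₃ j

      g-shift : ∀ n j → g (suc n) (suc j) ≈ g n j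
      g-shift n j = *-cong e (+-congʳ (*-cong (*-cong e e) e))
        where
        e : x - ιₙ (suc n) + ιₙ (suc j) ≈ x - ιₙ n + ιₙ j
        e = trans (+-cong (+-congˡ (-‿cong (ιₙ-suc n))) (ιₙ-suc j))
          (solve 3 (λ x n j → x :- (♯ 1 :+ n) :+ (♯ 1 :+ j) := x :- n :+ j) refl x (ιₙ n) (ιₙ j))

      -- The reason for q = x^3: at a = x - n and j = n the numerator is x(x^3 - q) = 0, so the
      -- series terminates although a is not a negative integer.
      g-diag : ∀ n → g n n ≈ 0#
      g-diag n = trans (*-congˡ (+-congʳ (*-cong (*-cong e e) e))) (trans (*-congˡ (-‿inverseʳ _)) (zeroʳ _))
        where
        e : x - ιₙ n + ιₙ n ≈ x
        e = solve 2 (λ x n → x :- n :+ n := x) refl x (ιₙ n)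

      I : ℕ → Carrier
      I k = Π< k (λ j → iv j * W q₃ j)

      Pn : ℕ → ℕ → Carrier
      Pn n k = Π< k (g n)

      t : ℕ → ℕ → Carrier
      t n k = (ιₙ 2 * ιₙ k + (x - ιₙ n)) * (Pn n k * I k)

      Φ : ℕ → Carrier
      Φ n = Σ< (suc n) (t n)

      m : ℕ → Carrier
      m n = ιₙ (suc n) - x

      c₁ c₀ : ℕ → Carrier
      c₁ n = m n * m n * m n - q₃
      c₀ n = - (ιₙ 2 * (m n * m n) * (ιₙ 2 * m n - 1#))

      Pn-shift : ∀ n k → Pn (suc n) (suc k) ≈ g (suc n) 0 * Pn n k
      Pn-shift n k = trans (Π-head k (g (suc n))) (*-congˡ (Π-cong k (λ j _ → g-shift n j)))

      telescoped : ∀ n k → k ℕ.≤ P →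
        Σ< (suc k) (λ i → c₁ n * t (suc n) i - c₀ n * t n i) ≈ certificate (ιₙ (suc k)) (m n) * (Pn n k * I k)
      telescoped n zero _ = begin
        0# + (c₁ n * t (suc n) 0 - c₀ n * t n 0)
          ≈⟨ +-congˡ (+-congʳ (*-congˡ (*-congʳ (+-congˡ (+-congˡ (-‿cong (ιₙ-suc n))))))) ⟩
        0# + (c₁ n * ((ιₙ 2 * 0# + (x - (1# + ιₙ n))) * (1# * 1#)) - c₀ n * t n 0)
          ≈⟨ +-congˡ (+-cong (*-congʳ (+-congʳ (*-cong (*-cong mm mm) mm)))
              (-‿cong (*-congʳ (-‿cong (*-cong (*-congˡ (*-cong mm mm)) (+-congʳ (*-congˡ mm))))))) ⟩
        _ ≈⟨ solve 2 (λ x n → let m = ♯ 1 :+ n :- x ; q = x :* x :* x in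
               ♯ 0 :+ ((m :* m :* m :- q) :* ((♯ 2 :* ♯ 0 :+ (x :- (♯ 1 :+ n))) :* (♯ 1 :* ♯ 1))
                  :- (:- (♯ 2 :* (m :* m) :* (♯ 2 :* m :- ♯ 1))) :* ((♯ 2 :* ♯ 0 :+ (x :- n)) :* (♯ 1 :* ♯ 1)))
               := m :* (:- (♯ 2 :* (♯ 1 :* ♯ 1) :* m) :+ ♯ 6 :* ♯ 1 :* (m :* m) :- ♯ 5 :* (m :* m :* m) :+ q) :* (♯ 1 :* ♯ 1)) refl x (ιₙ n) ⟩
        certificate 1# (1# + ιₙ n - x) * (1# * 1#)
          ≈⟨ *-congʳ (*-cong mm (+-congʳ (+-cong (+-cong (-‿cong (*-congˡ mm)) (*-congˡ (*-cong mm mm))) (-‿cong (*-congˡ (*-cong (*-cong mm mm) mm)))))) ⟨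
        certificate 1# (m n) * (1# * 1#) ∎
        where
        mm : m n ≈ 1# + ιₙ n - x
        mm = +-congʳ (ιₙ-suc n)
      telescoped n (suc k) k<P = begin
        Σ< (suc k) (λ i → c₁ n * t (suc n) i - c₀ n * t n i) + (c₁ n * t (suc n) (suc k) - c₀ n * t n (suc k))
          ≈⟨ +-cong (telescoped n k (ℕₚ.<⇒≤ k<P)) (+-cong (*-congˡ (*-cong tw (*-congʳ (trans (Pn-shift n k) (*-congʳ g0)))))
               (-‿cong (*-congˡ (*-cong tw′ (*-congʳ (*-congˡ gk)))))) ⟩
        certificate K M * (p * i)
          + (c₁ n * ((ιₙ 2 * K - M) * ((M * (M * M * M + q₃) * p) * (i * w)))
             - c₀ n * ((ιₙ 2 * K + 1# - M) * ((p * G) * (i * w))))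
          ≈⟨ +-congʳ (trans (*-congˡ (sym (*-identityʳ _))) (*-congˡ (*-congˡ (sym (denom-inv q₃ k q₃q₃≈0 k<P))))) ⟩
        certificate K M * ((p * i) * (denom q₃ (suc k) * w))
          + (c₁ n * ((ιₙ 2 * K - M) * ((M * (M * M * M + q₃) * p) * (i * w)))
             - c₀ n * ((ιₙ 2 * K + 1# - M) * ((p * G) * (i * w))))
          ≈⟨ solve 11 (λ r p i D w C X Y Z G E →
                r :* ((p :* i) :* (D :* w)) :+ (C :* (X :* ((Y :* p) :* (i :* w))) :- (:- Z) :* (E :* ((p :* G) :* (i :* w))))
                := (r :* D :+ (C :* (X :* Y) :+ Z :* (E :* G))) :* (p :* (i :* w))) refl
                (certificate K M) p i (denom q₃ (suc k)) w (c₁ n) (ιₙ 2 * K - M) (M * (M * M * M + q₃))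
                (ιₙ 2 * (M * M) * (ιₙ 2 * M - 1#)) G (ιₙ 2 * K + 1# - M) ⟩
        (certificate K M * denom q₃ (suc k) + (c₁ n * ((ιₙ 2 * K - M) * (M * (M * M * M + q₃)))
           + ιₙ 2 * (M * M) * (ιₙ 2 * M - 1#) * ((ιₙ 2 * K + 1# - M) * G))) * (p * (i * w))
          ≈⟨ *-congʳ (+-congˡ (certificate-step K M)) ⟩
        (certificate K M * denom q₃ (suc k) + (certificate (1# + K) M * G - certificate K M * denom q₃ (suc k))) * (p * (i * w))
          ≈⟨ solve 6 (λ r s G p i w → (r :+ (s :* G :- r)) :* (p :* (i :* w)) := s :* ((p :* G) :* (i :* w))) refl
               (certificate K M * denom q₃ (suc k)) (certificate (1# + K) M) G p i w ⟩
        certificate (1# + K) M * ((p * G) * (i * w))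
          ≈⟨ *-congˡ (*-congʳ (*-congˡ gk)) ⟨
        certificate (1# + K) M * ((p * g n k) * (i * w)) ∎
        where
        K = ιₙ (suc k)
        M = m n
        p = Pn n k
        i = I k
        w = iv k * W q₃ k
        G = (K - M) * ((K - M) * (K - M) * (K - M) - q₃)
        tw : ιₙ 2 * K + (x - ιₙ (suc n)) ≈ ιₙ 2 * K - M
        tw = solve 3 (λ a b x → a :+ (x :- b) := a :- (b :- x)) refl _ _ _
        tw′ : ιₙ 2 * K + (x - ιₙ n) ≈ ιₙ 2 * K + 1# - M
        tw′ = trans (solve 3 (λ a b x → a :+ (x :- b) := a :+ ♯ 1 :- (♯ 1 :+ b :- x)) refl _ _ _)
          (+-congˡ (-‿cong (+-congʳ (sym (ιₙ-suc n)))))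
        e₀ : x - ιₙ (suc n) + 0# ≈ - M
        e₀ = solve 2 (λ a x → x :- a :+ ♯ 0 := :- (a :- x)) refl _ _
        g0 : g (suc n) 0 ≈ M * (M * M * M + q₃)
        g0 = trans (*-cong e₀ (+-congʳ (*-cong (*-cong e₀ e₀) e₀)))
          (solve 2 (λ M q → (:- M) :* ((:- M) :* (:- M) :* (:- M) :- q) := M :* (M :* M :* M :+ q)) refl _ _)
        e₁ : x - ιₙ n + ιₙ k ≈ K - M
        e₁ = trans (solve 3 (λ x n k → x :- n :+ k := (♯ 1 :+ k) :- (♯ 1 :+ n :- x)) refl _ _ _)
          (sym (+-cong (ιₙ-suc k) (-‿cong (+-congʳ (ιₙ-suc n)))))
        gk : g n k ≈ G
        gk = *-cong e₁ (+-congʳ (*-cong (*-cong e₁ e₁) e₁))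

      recurrence : ∀ n → suc n ℕ.≤ P → c₁ n * Φ (suc n) ≈ c₀ n * Φ n
      recurrence n n<P = a-b≈0⇒a≈b (begin
        c₁ n * Φ (suc n) - c₀ n * Φ n
          ≈⟨ +-congˡ (-‿cong (*-congˡ (trans (sym (+-identityʳ _)) (+-congˡ (sym last))))) ⟩
        c₁ n * Φ (suc n) - c₀ n * Σ< (suc (suc n)) (t n)
          ≈⟨ +-cong (Σ-*ˡ (suc (suc n)) (c₁ n) (t (suc n))) (trans (Σ-neg (suc (suc n)) _) (-‿cong (Σ-*ˡ (suc (suc n)) (c₀ n) (t n)))) ⟨
        Σ< (suc (suc n)) (λ i → c₁ n * t (suc n) i) + Σ< (suc (suc n)) (λ i → - (c₀ n * t n i))
          ≈⟨ Σ-+ (suc (suc n)) _ _ ⟨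
        Σ< (suc (suc n)) (λ i → c₁ n * t (suc n) i - c₀ n * t n i)
          ≈⟨ telescoped n (suc n) n<P ⟩
        certificate (ιₙ (suc (suc n))) (m n) * (Pn n (suc n) * I (suc n))
          ≈⟨ *-congˡ (trans (*-congʳ vanish) (zeroˡ _)) ⟩
        certificate (ιₙ (suc (suc n))) (m n) * 0#
          ≈⟨ zeroʳ _ ⟩
        0# ∎)
        where
        vanish : Pn n (suc n) ≈ 0#
        vanish = trans (*-congˡ (g-diag n)) (zeroʳ _)
        last : t n (suc n) ≈ 0#
        last = trans (*-congˡ (trans (*-congʳ vanish) (zeroˡ _))) (zeroʳ _)

      -- The evaluation Φ n = x E n / (L n D n), kept as separate products: L n D n is a unit for n
      -- ≤ P, while E n may contain the factor p - 2x.
      L D E : ℕ → Carrier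
      L n = Π< n (λ i → ιₙ (suc i) - ιₙ 2 * x)
      D n = Π< n (λ i → ιₙ (suc i) * ιₙ (suc i) * ιₙ (suc i) + q₃)
      E n = Π< n (λ i → x * x - ιₙ (suc i) * ιₙ (suc i)) * Π< (2 ℕ.* n) (λ i → ιₙ (suc i) - ιₙ 2 * x)

      E-suc : ∀ n → E (suc n) ≈ E n * ((x * x - ιₙ (suc n) * ιₙ (suc n)) * (ιₙ 2 * m n - 1#) * (ιₙ 2 * m n))
      E-suc n = begin
        E (suc n)
          ≡⟨ ≡.cong (λ k → Π< n f * f n * Π< k h) (ℕₚ.*-suc 2 n) ⟩
        Π< n f * f n * (Π< (2 ℕ.* n) h * h (2 ℕ.* n) * h (suc (2 ℕ.* n)))
          ≈⟨ *-congˡ (*-cong (*-congˡ h₁) h₂) ⟩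
        Π< n f * f n * (Π< (2 ℕ.* n) h * (ιₙ 2 * m n - 1#) * (ιₙ 2 * m n))
          ≈⟨ solve 5 (λ a b c d e → a :* b :* (c :* d :* e) := a :* c :* (b :* d :* e)) refl _ _ _ _ _ ⟩
        E n * (f n * (ιₙ 2 * m n - 1#) * (ιₙ 2 * m n)) ∎
        where
        f h : ℕ → Carrier
        f i = x * x - ιₙ (suc i) * ιₙ (suc i)
        h i = ιₙ (suc i) - ιₙ 2 * x
        h₁ : h (2 ℕ.* n) ≈ ιₙ 2 * m n - 1#
        h₁ = begin
          ιₙ (suc (2 ℕ.* n)) - ιₙ 2 * x     ≈⟨ +-congʳ (trans (ιₙ-suc (2 ℕ.* n)) (+-congˡ (ιₙ-* 2 n))) ⟩
          1# + ιₙ 2 * ιₙ n - ιₙ 2 * x       ≈⟨ solve 2 (λ n x → ♯ 1 :+ ♯ 2 :* n :- ♯ 2 :* x := ♯ 2 :* (♯ 1 :+ n :- x) :- ♯ 1) refl _ _ ⟩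
          ιₙ 2 * (1# + ιₙ n - x) - 1#       ≈⟨ +-congʳ (*-congˡ (+-congʳ (ιₙ-suc n))) ⟨
          ιₙ 2 * m n - 1# ∎
        h₂ : h (suc (2 ℕ.* n)) ≈ ιₙ 2 * m n
        h₂ = begin
          ιₙ (suc (suc (2 ℕ.* n))) - ιₙ 2 * x ≈⟨ +-congʳ (+-congˡ (trans (ιₙ-suc (2 ℕ.* n)) (+-congˡ (ιₙ-* 2 n)))) ⟩
          1# + (1# + ιₙ 2 * ιₙ n) - ιₙ 2 * x  ≈⟨ solve 2 (λ n x → ♯ 1 :+ (♯ 1 :+ ♯ 2 :* n) :- ♯ 2 :* x := ♯ 2 :* (♯ 1 :+ n :- x)) refl _ _ ⟩
          ιₙ 2 * (1# + ιₙ n - x)              ≈⟨ *-congˡ (+-congʳ (ιₙ-suc n)) ⟨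
          ιₙ 2 * m n ∎

      unit-minus-nilpotent : ∀ j z → j ℕ.< P → z * z * z * z ≈ 0# → Unit (ιₙ (suc j) - z)
      unit-minus-nilpotent j z j<P z⁴≈0 = v * (1# + y + y * y + y * y * y) , (begin
          (ιₙ (suc j) - z) * (v * (1# + y + y * y + y * y * y))
            ≈⟨ solve 3 (λ N z v → let y = z :* v in (N :- z) :* (v :* (♯ 1 :+ y :+ y :* y :+ y :* y :* y))
                 := ♯ 1 :+ (N :* v :- ♯ 1) :* (♯ 1 :+ y :+ y :* y :+ y :* y :* y) :+ (z :* z :* z :* z) :* (:- (v :* v :* v :* v))) refl (ιₙ (suc j)) z v ⟩
          1# + (ιₙ (suc j) * v - 1#) * _ + (z * z * z * z) * _
            ≈⟨ +-cong (+-congˡ (*-congʳ (a≈b⇒a-b≈0 (iv-inv j j<P)))) (*-congʳ z⁴≈0) ⟩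
          1# + 0# * _ + 0# * _
            ≈⟨ solve 2 (λ a b → ♯ 1 :+ ♯ 0 :* a :+ ♯ 0 :* b := ♯ 1) refl _ _ ⟩
          1# ∎)
        where
        v = iv j
        y = z * v

      unit-LD : ∀ n → n ℕ.≤ P → Unit (L n * D n)
      unit-LD n n≤P = unit-* (Π-unit n (λ i i<n → unit-minus-nilpotent i (ιₙ 2 * x) (ℕₚ.<-≤-trans i<n n≤P) (fourth-power≈0 (ιₙ 2) (*-comm _ _) x⁴≈0)))
        (Π-unit n (λ i i<n → W q₃ i , W-inv q₃ i q₃q₃≈0 (ℕₚ.<-≤-trans i<n n≤P)))

      closed-form : ∀ n → n ℕ.≤ P → Φ n * (L n * D n) ≈ x * E n
      closed-form zero _ = solve 1 (λ x → (♯ 0 :+ (♯ 2 :* ♯ 0 :+ (x :- ♯ 0)) :* (♯ 1 :* ♯ 1)) :* (♯ 1 :* ♯ 1) := x :* (♯ 1 :* ♯ 1)) refl x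
      closed-form (suc n) n<P = begin
        Φ (suc n) * (L n * (N - ιₙ 2 * x) * (D n * (N * N * N + q₃)))
          -- (N - x)^3 - x^3 = (N - 2x)(N^2 - Nx + x^2), and N + x completes the second factor to
          -- N^3 + x^3. So c₁ times N + x supplies exactly the new factors of L and D.
          ≈⟨ solve 5 (λ Φ L D N x → Φ :* (L :* (N :- ♯ 2 :* x) :* (D :* (N :* N :* N :+ x :* x :* x)))
               := ((N :- x) :* (N :- x) :* (N :- x) :- x :* x :* x) :* Φ :* (L :* D :* (N :+ x))) refl _ _ _ _ _ ⟩
        c₁ n * Φ (suc n) * (L n * D n * (N + x))
          ≈⟨ *-congʳ (recurrence n n<P) ⟩
        c₀ n * Φ n * (L n * D n * (N + x))
          ≈⟨ solve 4 (λ c Φ B Z → c :* Φ :* (B :* Z) := Φ :* B :* (c :* Z)) refl (c₀ n) (Φ n) (L n * D n) (N + x) ⟩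
        Φ n * (L n * D n) * (c₀ n * (N + x))
          ≈⟨ *-congʳ (closed-form n (ℕₚ.<⇒≤ n<P)) ⟩
        x * E n * (c₀ n * (N + x))
          ≈⟨ solve 3 (λ x E N → let m = N :- x in x :* E :* ((:- (♯ 2 :* (m :* m) :* (♯ 2 :* m :- ♯ 1))) :* (N :+ x))
               := x :* (E :* ((x :* x :- N :* N) :* (♯ 2 :* m :- ♯ 1) :* (♯ 2 :* m)))) refl x (E n) N ⟩
        x * (E n * ((x * x - N * N) * (ιₙ 2 * m n - 1#) * (ιₙ 2 * m n)))
          ≈⟨ *-congˡ (E-suc n) ⟨
        x * E (suc n) ∎
        where N = ιₙ (suc n)

      F≈Φ : ∀ n → n ℕ.≤ P → F (x - ιₙ n) q₃ ≈ Φ n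
      F≈Φ n n≤P = begin
        F (x - ιₙ n) q₃      ≈⟨ Σ-cong (suc P) (λ k _ → *-congˡ (Π-* k _ _)) ⟩
        Σ< (suc P) (t n)     ≈⟨ Σ-trunc (suc n) (suc P) (ℕ.s≤s n≤P) (λ k n<k →
                                  trans (*-congˡ (trans (*-congʳ (Π-zero k n n<k (g-diag n))) (zeroˡ _))) (zeroʳ _)) ⟩
        Φ n ∎

    open Recurrence public using (L; D; E; unit-LD)

    -- `y` is any solution of the division problem, so that a caller may present it with a factor
    -- divisible by p already split off.
    F-closed-form : ∀ n y → n ℕ.≤ P → y * (L n * D n) ≈ E n → F (x - ιₙ n) 0# ≈ x * y
    F-closed-form n y n≤P hy = unit-cancel (unit-LD n n≤P) (begin
      L n * D n * F (x - ιₙ n) 0#    ≈⟨ *-comm _ _ ⟩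
      F (x - ιₙ n) 0# * (L n * D n)  ≈⟨ *-congʳ (trans (F-independent-of-q (- ιₙ n)
        (Antisymmetry.F-zero 0# (zeroˡ _) n n≤P) (Antisymmetry.F-zero q₃ q₃q₃≈0 n n≤P)) (Recurrence.F≈Φ n n≤P)) ⟩
      Recurrence.Φ n * (L n * D n)   ≈⟨ Recurrence.closed-form n n≤P ⟩
      x * E n                        ≈⟨ *-congˡ hy ⟨
      x * (y * (L n * D n))          ≈⟨ solve 3 (λ x y u → x :* (y :* u) := u :* (x :* y)) refl x y (L n * D n) ⟩
      L n * D n * (x * y)            ∎)
      where open MixedDifference q₃ (trans (solve 1 (λ x → x :* (x :* x :* x) := x :* x :* x :* x) refl x) x⁴≈0)

    quotient : ∀ n e → n ℕ.≤ P → ∃ λ y → y * (L n * D n) ≈ e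
    quotient n e n≤P = e * proj₁ u , trans (solve 3 (λ e w u → e :* w :* u := (u :* w) :* e) refl e (proj₁ u) (L n * D n)) (trans (*-congʳ (proj₂ u)) (*-identityˡ e))
      where u = unit-LD n n≤P

-- A ring with p³ = 0 that looks like ℤ/p³ for the integers in it.
record CubeNilpotent {c ℓ} (R : CommutativeRing c ℓ) (p : ℕ) : Set (c ⊔ ℓ) where
  open RingKit R
  field
    p³≈0 : ιₙ p * ιₙ p * ιₙ p ≈ 0#
    unit-ι : ∀ z → ¬ (+ p ∣ᶻ z) → Unit (ι z)
    ι-reflects : ∀ z → ιₙ p ∣ʳ ι z → + p ∣ᶻ z

-- Fermat's theorem, power sums and Teichmüller representatives modulo p^3.

module Teichmüller {c ℓ} (R : CommutativeRing c ℓ) (M : ℕ) (p-prime : Prime (suc M)) (Λ : CubeNilpotent R (suc M)) where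
  open RingKit R
  open CubeNilpotent Λ using (p³≈0; unit-ι; ι-reflects)
  private
    p : ℕ
    p = suc M


  open RingBinomials R
  open NaturalBinomials using (nCk-factorial)
  open PrimeModulus p p-prime
  open ResidueSums R p p-prime
  open import Data.Nat using (_!)
  open import Data.Nat.Combinatorics using (_C_; nC1≡n; nCk≡nC[n∸k]; nCn≡1)
  open import Data.Nat.DivMod using (m≡m%n+[m/n]*n; m%n<n)
  open import Data.Nat.Primality using (euclidsLemma)
  open import Data.Nat.Induction using (<-rec)

  pR : Carrier
  pR = ιₙ p

  infix 4 _≡ₚ_
  _≡ₚ_ : Carrier → Carrier → Set _
  a ≡ₚ b = pR ∣ʳ a - b

  ≡ₚ-refl : ∀ {a b} → a ≈ b → a ≡ₚ b
  ≡ₚ-refl h = ∣ʳ-resp (sym (a≈b⇒a-b≈0 h)) ∣ʳ-0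

  ≡ₚ-sym : ∀ {a b} → a ≡ₚ b → b ≡ₚ a
  ≡ₚ-sym {a} {b} h = ∣ʳ-resp (solve 2 (λ a b → :- (a :- b) := b :- a) refl a b) (∣ʳ-neg h)

  ≡ₚ-trans : ∀ {a b c} → a ≡ₚ b → b ≡ₚ c → a ≡ₚ c
  ≡ₚ-trans {a} {b} {c} h k = ∣ʳ-resp (solve 3 (λ a b c → (a :- b) :+ (b :- c) := a :- c) refl a b c) (∣ʳ-+ h k)

  ≡ₚ-+ : ∀ {a b c d} → a ≡ₚ b → c ≡ₚ d → a + c ≡ₚ b + d
  ≡ₚ-+ {a} {b} {c} {d} h k = ∣ʳ-resp (solve 4 (λ a b c d → (a :- b) :+ (c :- d) := (a :+ c) :- (b :+ d)) refl a b c d) (∣ʳ-+ h k)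

  ≡ₚ-neg : ∀ {a b} → a ≡ₚ b → - a ≡ₚ - b
  ≡ₚ-neg {a} {b} h = ∣ʳ-resp (solve 2 (λ a b → :- (a :- b) := (:- a) :- (:- b)) refl a b) (∣ʳ-neg h)

  ≡ₚ-* : ∀ {a b c d} → a ≡ₚ b → c ≡ₚ d → a * c ≡ₚ b * d
  ≡ₚ-* {a} {b} {c} {d} h k = ∣ʳ-resp (solve 4 (λ a b c d → (a :- b) :* c :+ b :* (c :- d) := a :* c :- b :* d) refl a b c d)
    (∣ʳ-+ (∣ʳ-*ʳ c h) (∣ʳ-*ˡ b k))

  ≡ₚ-^ : ∀ {a b} k → a ≡ₚ b → a ^ k ≡ₚ b ^ k
  ≡ₚ-^ zero h = ≡ₚ-refl refl
  ≡ₚ-^ (suc k) h = ≡ₚ-* h (≡ₚ-^ k h)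

  ≡ₚ-Σ : ∀ n {f g} → (∀ i → i ℕ.< n → f i ≡ₚ g i) → Σ< n f ≡ₚ Σ< n g
  ≡ₚ-Σ zero h = ≡ₚ-refl refl
  ≡ₚ-Σ (suc n) h = ≡ₚ-+ (≡ₚ-Σ n (λ i i<n → h i (ℕₚ.m<n⇒m<1+n i<n))) (h n ℕₚ.≤-refl)

  ≅⇒≡ₚ : ∀ {a b} → a ≅ b → ι a ≡ₚ ι b
  ≅⇒≡ₚ {a} {b} (≅-from (ℤD.divides q e)) = ι q , (begin
    ι a - ι b              ≈⟨ +-congˡ (ι-- b) ⟨
    ι a + ι (ℤ.- b)        ≈⟨ ι-+ a (ℤ.- b) ⟨
    ι (a ℤ.- b)            ≡⟨ ≡.cong ι e ⟩
    ι (q ℤ.* + p)          ≈⟨ ι-* q (+ p) ⟩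
    ι q * pR               ≈⟨ *-comm _ _ ⟩
    pR * ι q               ∎)

  ι≡ₚ⇒≅ : ∀ {a b} → ι a ≡ₚ ι b → a ≅ b
  ι≡ₚ⇒≅ {a} {b} h = ≅-from (ι-reflects (a ℤ.- b) (∣ʳ-resp (sym (trans (ι-+ a (ℤ.- b)) (+-congˡ (ι-- b)))) h))

  p≢1 : ¬ (pR ∣ʳ 1#)
  p≢1 h = ¬p∣1 (ι-reflects (+ 1) h)

  unit-≡ₚ : ∀ {u v} → Unit u → v ≡ₚ u → Unit v
  unit-≡ₚ {u} {v} (w , uw) (c , h) = w * (1# - y + y * y) , (begin
    v * (w * (1# - y + y * y))
      ≈⟨ *-congʳ v≈ ⟩
    (u + pR * c) * (w * (1# - y + y * y))
      ≈⟨ solve 4 (λ u w c p → let y = p :* (c :* w) in (u :+ p :* c) :* (w :* (♯ 1 :- y :+ y :* y))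
           := ♯ 1 :+ (u :* w :- ♯ 1) :* (♯ 1 :- y :+ y :* y) :+ (p :* p :* p) :* (c :* w :* (c :* w) :* (c :* w))) refl u w c pR ⟩
    1# + (u * w - 1#) * (1# - y + y * y) + (pR * pR * pR) * (c * w * (c * w) * (c * w))
      ≈⟨ +-cong (+-congˡ (*-congʳ (a≈b⇒a-b≈0 uw))) (*-congʳ p³≈0) ⟩
    1# + 0# * (1# - y + y * y) + 0# * (c * w * (c * w) * (c * w))
      ≈⟨ solve 2 (λ a b → ♯ 1 :+ ♯ 0 :* a :+ ♯ 0 :* b := ♯ 1) refl _ _ ⟩
    1# ∎)
    where
    y = pR * (c * w)
    v≈ : v ≈ u + pR * c
    v≈ = trans (solve 2 (λ u v → v := u :+ (v :- u)) refl u v) (+-congˡ h)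

  nonunit : ∀ {u} → Unit u → ¬ (pR ∣ʳ u)
  nonunit {u} (w , uw) h = p≢1 (∣ʳ-resp uw (∣ʳ-*ʳ w h))

  p∣cube≈0 : ∀ {e} → pR ∣ʳ e → e * e * e ≈ 0#
  p∣cube≈0 {e} (c , h) = begin
    e * e * e                       ≈⟨ *-cong (*-cong h h) h ⟩
    pR * c * (pR * c) * (pR * c)    ≈⟨ solve 2 (λ p c → p :* c :* (p :* c) :* (p :* c) := p :* p :* p :* (c :* c :* c)) refl pR c ⟩
    pR * pR * pR * (c * c * c)      ≈⟨ *-congʳ p³≈0 ⟩
    0# * (c * c * c)                ≈⟨ zeroˡ _ ⟩
    0# ∎

  -- Fermat

  p∤k! : ∀ k → k ℕ.< p → ¬ (p ℕD.∣ k !)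
  p∤k! zero _ h = ¬p∣1 (ℤD.∣ᵤ⇒∣ h)
  p∤k! (suc k) k<p h with euclidsLemma (suc k) (k !) p-prime h
  ... | inj₁ x = ¬p∣small (suc k) (ℕ.s≤s ℕ.z≤n) k<p (ℤD.∣ᵤ⇒∣ x)
  ... | inj₂ y = p∤k! k (ℕₚ.<⇒≤ k<p) y

  p∣pCk : ∀ k → 0 ℕ.< k → k ℕ.< p → p ℕD.∣ p C k
  p∣pCk k 0<k k<p with euclidsLemma (p C k) (k ! ℕ.* (p ℕ.∸ k) !) p-prime
    (≡.subst (p ℕD.∣_) (≡.sym (nCk-factorial (ℕₚ.<⇒≤ k<p))) (ℕD.m∣m*n {p} (M !)))
  ... | inj₁ x = x
  ... | inj₂ y with euclidsLemma (k !) ((p ℕ.∸ k) !) p-prime y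
  ...   | inj₁ z = ⊥-elim (p∤k! k k<p z)
  ...   | inj₂ z = ⊥-elim (p∤k! (p ℕ.∸ k) (ℕₚ.∸-monoʳ-< 0<k (ℕₚ.<⇒≤ k<p)) z)

  ∣⇒∣ʳ : ∀ {k} → p ℕD.∣ k → pR ∣ʳ ιₙ k
  ∣⇒∣ʳ {k} (ℕD.divides q e) = ιₙ q , trans (reflexive (≡.cong ιₙ e)) (trans (ιₙ-* q p) (*-comm _ _))

  freshman : ∀ y → (1# + y) ^ p ≡ₚ 1# + y ^ p
  freshman y = ∣ʳ-resp (sym expand) (∣ʳ-Σ M (λ i i<M → ∣ʳ-*ʳ _ (∣⇒∣ʳ (p∣pCk (suc i) (ℕ.s≤s ℕ.z≤n) (ℕ.s≤s i<M)))))
    where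
    f : ℕ → Carrier
    f i = ιₙ (p C i) * y ^ i
    expand : (1# + y) ^ p - (1# + y ^ p) ≈ Σ< M (λ i → f (suc i))
    expand = begin
      (1# + y) ^ p - (1# + y ^ p)
        ≈⟨ +-congʳ (trans (binomial p y) (+-congʳ (Σ-head M f))) ⟩
      f 0 + Σ< M (λ i → f (suc i)) + f p - (1# + y ^ p)
        ≈⟨ +-congʳ (+-cong (+-congʳ (trans (*-congʳ (reflexive (≡.cong ιₙ (nC0≡1 p)))) (*-identityˡ _)))
             (trans (*-congʳ (reflexive (≡.cong ιₙ (nCn≡1 p)))) (*-identityˡ _))) ⟩
      1# + Σ< M (λ i → f (suc i)) + y ^ p - (1# + y ^ p)
        ≈⟨ solve 2 (λ s y → ♯ 1 :+ s :+ y :- (♯ 1 :+ y) := s) refl _ _ ⟩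
      Σ< M (λ i → f (suc i)) ∎

  fermatₙ : ∀ r → ιₙ r ^ p ≡ₚ ιₙ r
  fermatₙ zero = ≡ₚ-refl (zeroˡ _)
  fermatₙ (suc r) = ≡ₚ-trans (≡ₚ-^ p (≡ₚ-refl (ιₙ-suc r))) (≡ₚ-trans (freshman (ιₙ r))
    (≡ₚ-trans (≡ₚ-+ (≡ₚ-refl refl) (fermatₙ r)) (≡ₚ-refl (sym (ιₙ-suc r)))))

  fermat : ∀ z → ι z ^ p ≡ₚ ι z
  fermat z with residue z
  ... | r , _ , h = ≡ₚ-trans (≡ₚ-^ p (≅⇒≡ₚ h)) (≡ₚ-trans (fermatₙ r) (≡ₚ-sym (≅⇒≡ₚ h)))

  fermat-unit : ∀ {z} → ¬ (+ p ∣ᶻ z) → ι z ^ M ≡ₚ 1#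
  fermat-unit {z} h = ∣ʳ-resp e (∣ʳ-*ˡ w (fermat z))
    where
    w = proj₁ (unit-ι z h)
    e : w * (ι z * ι z ^ M - ι z) ≈ ι z ^ M - 1#
    e = begin
      w * (ι z * ι z ^ M - ι z)      ≈⟨ solve 3 (λ w z x → w :* (z :* x :- z) := (z :* w) :* (x :- ♯ 1)) refl w (ι z) (ι z ^ M) ⟩
      (ι z * w) * (ι z ^ M - 1#)     ≈⟨ *-congʳ (proj₂ (unit-ι z h)) ⟩
      1# * (ι z ^ M - 1#)            ≈⟨ *-identityˡ _ ⟩
      ι z ^ M - 1#                   ∎

  ^M+ : ∀ {z} → ¬ (+ p ∣ᶻ z) → ∀ q r → ι z ^ (r ℕ.+ q ℕ.* M) ≡ₚ ι z ^ r
  ^M+ {z} h q r = ≡ₚ-trans (≡ₚ-refl (trans (^-homo-* (ι z) r (q ℕ.* M)) (*-congˡ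
      (trans (reflexive (≡.cong (ι z ^_) (ℕₚ.*-comm q M))) (sym (^-assocʳ (ι z) M q))))))
    (≡ₚ-trans (≡ₚ-* (≡ₚ-refl refl) (≡ₚ-trans (≡ₚ-^ q (fermat-unit h)) (≡ₚ-refl (1^n≈1 q)))) (≡ₚ-refl (*-identityʳ _)))

  -- Power sums modulo p

  powerSum : ℕ → Carrier
  powerSum j = Σ< p (λ x → ιₙ x ^ j)

  telescope : ∀ j m → Σ< m (λ x → (1# + ιₙ x) ^ suc j - ιₙ x ^ suc j) ≈ ιₙ m ^ suc j
  telescope j zero = sym (zeroˡ _)
  telescope j (suc m) = trans (+-congʳ (telescope j m))
    (trans (solve 2 (λ a b → a :+ (b :- a) := b) refl _ _) (^-congˡ (suc j) (sym (ιₙ-suc m))))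

  -- Summing (x+1)^(j+1) - x^(j+1) over the residues gives p^(j+1). The binomial theorem turns this
  -- into a relation among power sums in which the lower ones are divisible by p by induction and
  -- the coefficient j + 1 of the top one is a unit.
  powerSum≡0 : ∀ j → j ℕ.< M → pR ∣ʳ powerSum j
  powerSum≡0 = <-rec _ step
    where
    step : ∀ j → (∀ {i} → i ℕ.< j → i ℕ.< M → pR ∣ʳ powerSum i) → j ℕ.< M → pR ∣ʳ powerSum j
    step j rec j<M = ∣ʳ-resp (unit-solve (unit-ι (+ suc j) (¬p∣small (suc j) (ℕ.s≤s ℕ.z≤n) (ℕ.s≤s j<M)))) (∣ʳ-*ˡ _ key)
      where
      unit-solve : (u : Unit (ιₙ (suc j))) → proj₁ u * (ιₙ (suc j) * powerSum j) ≈ powerSum j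
      unit-solve (w , h) = trans (solve 3 (λ w u s → w :* (u :* s) := (u :* w) :* s) refl w _ _) (trans (*-congʳ h) (*-identityˡ _))
      lower : Carrier
      lower = Σ< j (λ i → ιₙ (suc j C i) * powerSum i)
      total : lower + ιₙ (suc j) * powerSum j ≈ ιₙ p ^ suc j
      total = begin
        lower + ιₙ (suc j) * powerSum j
          ≈⟨ +-congˡ (*-congʳ (reflexive (≡.cong ιₙ Cj))) ⟨
        Σ< (suc j) (λ i → ιₙ (suc j C i) * powerSum i)
          ≈⟨ Σ-cong (suc j) (λ i _ → Σ-*ˡ p (ιₙ (suc j C i)) (λ x → ιₙ x ^ i)) ⟨
        Σ< (suc j) (λ i → Σ< p (λ x → ιₙ (suc j C i) * ιₙ x ^ i))
          ≈⟨ Σ-swap (suc j) p _ ⟩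
        Σ< p (λ x → Σ< (suc j) (λ i → ιₙ (suc j C i) * ιₙ x ^ i))
          ≈⟨ Σ-cong p (λ x _ → trans (solve 2 (λ a b → a := a :+ b :- b) refl _ (ιₙ x ^ suc j))
               (+-congʳ (sym (trans (binomial (suc j) (ιₙ x)) (+-congˡ (trans (*-congʳ (reflexive (≡.cong ιₙ (nCn≡1 (suc j))))) (*-identityˡ _))))))) ⟩
        Σ< p (λ x → (1# + ιₙ x) ^ suc j - ιₙ x ^ suc j)
          ≈⟨ telescope j p ⟩
        ιₙ p ^ suc j ∎
        where
        Cj : suc j C j ≡ suc j
        Cj = ≡.trans (nCk≡nC[n∸k] (ℕₚ.n≤1+n j)) (≡.trans (≡.cong (suc j C_) (ℕₚ.m+n∸n≡m 1 j)) (nC1≡n (suc j)))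
      key : pR ∣ʳ ιₙ (suc j) * powerSum j
      key = ∣ʳ-resp (trans (+-congʳ (sym total)) (solve 2 (λ a b → (a :+ b) :- a := b) refl lower _))
        (∣ʳ-+ (ιₙ p ^ j , refl) (∣ʳ-neg (∣ʳ-Σ j (λ i i<j → ∣ʳ-*ˡ _ (rec i<j (ℕₚ.<-trans i<j j<M))))))

  -- For 0 < r < p - 1 some residue is not an r-th root of unity.
  nonroot : ∀ r → 0 ℕ.< r → r ℕ.< M → ∃ λ g → ¬ (+ p ∣ᶻ g) × Unit (ι g ^ r - 1#)
  nonroot r@(suc r′) _ r<M with ℕₚ.anyUpTo? (λ x → ¬? ((+ suc x) ℤ.^ r ≅? + 1)) M
    where open import Relation.Nullary.Decidable using (¬?)
  ... | yes (x , x<M , h) = + suc x , ¬p∣small (suc x) (ℕ.s≤s ℕ.z≤n) (ℕ.s≤s x<M)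
        , unit-cong (trans (ι-+ ((+ suc x) ℤ.^ r) (ℤ.- + 1)) (+-congʳ (ι-^ (+ suc x) r))) (unit-ι _ (λ d → h (≅-from d)))
  -- If every nonzero residue were an r-th root of unity, the r-th power sum would be p - 1 modulo
  -- p, contradicting `powerSum≡0`.
  ... | no none = ⊥-elim (p≢1 (∣ʳ-resp (solve 1 (λ p → p :- (p :- ♯ 1) := ♯ 1) refl pR)
        (∣ʳ-+ (1# , sym (*-identityʳ _)) (∣ʳ-neg (∣ʳ-resp (solve 2 (λ a b → b :- (b :- a) := a) refl (pR - 1#) (powerSum r))
           (∣ʳ-+ (powerSum≡0 r r<M) (∣ʳ-neg all-one)))))))
    where
    root : ∀ x → x ℕ.< M → (+ suc x) ℤ.^ r ≅ + 1
    root x x<M with (+ suc x) ℤ.^ r ≅? + 1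
    ... | yes e = e
    ... | no e = ⊥-elim (none (x , x<M , e))
    all-one : powerSum r ≡ₚ pR - 1#
    all-one = ≡ₚ-trans (≡ₚ-refl (trans (Σ-head M _) (trans (+-congʳ (zeroˡ _)) (+-identityˡ _))))
      (≡ₚ-trans (≡ₚ-Σ M (λ x x<M → ≡ₚ-trans (≡ₚ-refl (sym (ι-^ (+ suc x) r))) (≅⇒≡ₚ (root x x<M))))
        (≡ₚ-refl (trans (Σ-const M 1#) (trans (*-identityʳ _)
          (trans (solve 1 (λ m → m := ♯ 1 :+ m :- ♯ 1) refl (ιₙ M)) (+-congʳ (sym (ιₙ-suc M))))))))

  -- Teichmüller representatives modulo p³

  lift : ∀ {a b} → a ≡ₚ b → (a ^ p) ^ p ≈ (b ^ p) ^ p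
  lift {a} {b} (c , h) with expand₁ b (pR * c) M
  ... | e , h₁ = trans (^-congˡ p (trans (^-congˡ p a≈) (trans h₁ d₁))) (trans (proj₂ second) d₂)
    where
    a≈ : a ≈ b + pR * c
    a≈ = trans (solve 2 (λ a b → a := b :+ (a :- b)) refl a b) (+-congˡ h)
    f : Carrier
    f = b ^ M * c + c * c * e
    d₁ : b ^ p + pR * b ^ M * (pR * c) + pR * c * (pR * c) * e ≈ b ^ p + pR * pR * f
    d₁ = solve 5 (λ b B p c e → b :+ p :* B :* (p :* c) :+ p :* c :* (p :* c) :* e := b :+ p :* p :* (B :* c :+ c :* c :* e)) refl (b ^ p) (b ^ M) pR c e
    second = expand₁ (b ^ p) (pR * pR * f) M
    d₂ : (b ^ p) ^ p + pR * (b ^ p) ^ M * (pR * pR * f) + pR * pR * f * (pR * pR * f) * proj₁ second ≈ (b ^ p) ^ p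
    d₂ = ≈-mod-zero (solve 5 (λ b B p f e → b :+ p :* B :* (p :* p :* f) :+ p :* p :* f :* (p :* p :* f) :* e
        := b :+ (p :* p :* p) :* (B :* f :+ p :* f :* f :* e)) refl ((b ^ p) ^ p) ((b ^ p) ^ M) pR f (proj₁ second)) p³≈0

  -- z^(p^2) is the Teichmüller representative modulo p^3: each p-th power improves a congruence by
  -- one factor p, so two of them make the value depend on z modulo p alone.
  t : ℤ → Carrier
  t z = (ι z ^ p) ^ p

  t-periodic : Periodic t
  t-periodic h = lift (≅⇒≡ₚ h)

  t-* : ∀ a b → t (a ℤ.* b) ≈ t a * t b
  t-* a b = trans (^-congˡ p (trans (^-congˡ p (ι-* a b)) (^-distrib-* (ι a) (ι b) p))) (^-distrib-* (ι a ^ p) (ι b ^ p) p)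

  t-1 : t (+ 1) ≈ 1#
  t-1 = trans (^-congˡ p (1^n≈1 p)) (1^n≈1 p)

  t-0 : t (+ 0) ≈ 0#
  t-0 = trans (^-congˡ p (0^1+n≈0 M)) (0^1+n≈0 M)

  t≡ι : ∀ z → t z ≡ₚ ι z
  t≡ι z = ≡ₚ-trans (≡ₚ-refl (^-congˡ p (sym (ι-^ z p)))) (≡ₚ-trans (fermat (z ℤ.^ p)) (≡ₚ-trans (≡ₚ-refl (ι-^ z p)) (fermat z)))

  t^M : ∀ {z} → ¬ (+ p ∣ᶻ z) → t z ^ M ≈ 1#
  t^M {z} h = begin
    ((ι z ^ p) ^ p) ^ M     ≈⟨ ^-assocʳ (ι z ^ p) p M ⟩
    (ι z ^ p) ^ (p ℕ.* M)   ≡⟨ ≡.cong ((ι z ^ p) ^_) (ℕₚ.*-comm p M) ⟩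
    (ι z ^ p) ^ (M ℕ.* p)   ≈⟨ ^-assocʳ (ι z ^ p) M p ⟨
    ((ι z ^ p) ^ M) ^ p     ≈⟨ ^-congˡ p (trans (^-assocʳ (ι z) p M) (trans (reflexive (≡.cong (ι z ^_) (ℕₚ.*-comm p M))) (sym (^-assocʳ (ι z) M p)))) ⟩
    ((ι z ^ M) ^ p) ^ p     ≈⟨ lift (fermat-unit h) ⟩
    (1# ^ p) ^ p            ≈⟨ t-1 ⟩
    1#                      ∎

  t^suc-zero : ∀ k {z} → + p ∣ᶻ z → t z ^ suc k ≈ 0#
  t^suc-zero k h = trans (^-congˡ (suc k) (trans (t-periodic (∣⇒≅0 h)) t-0)) (0^1+n≈0 k)

  -- 1 - t(z) and 1 - z agree modulo p, and the p^2-th power forgets the rest. This makes t(1-z) a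
  -- power of 1 - t(z), open to the binomial theorem.
  t-complement : ∀ z → t (+ 1 ℤ.- z) ≈ ((1# - t z) ^ p) ^ p
  t-complement z = lift (≡ₚ-trans (≡ₚ-refl (trans (ι-+ (+ 1) (ℤ.- z)) (+-congˡ (ι-- z)))) (≡ₚ-+ (≡ₚ-refl refl) (≡ₚ-neg (≡ₚ-sym (t≡ι z)))))

  teichSum : ℕ → Carrier
  teichSum i = Σₚ (λ z → t z ^ i)

  -- Multiplying the variable by some g with g^r ≠ 1 modulo p permutes the terms, so the sum is
  -- fixed by t(g)^i, and t(g)^i - 1 is a unit.
  teichSum-zero : ∀ q r → 0 ℕ.< r → r ℕ.< M → teichSum (r ℕ.+ q ℕ.* M) ≈ 0#
  teichSum-zero q r 0<r r<M with nonroot r 0<r r<M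
  ... | g , ¬g , u = unit-zero (unit-≡ₚ u tg) (begin
    (t g ^ i - 1#) * teichSum i         ≈⟨ solve 2 (λ a s → (a :- ♯ 1) :* s := a :* s :- s) refl _ _ ⟩
    t g ^ i * teichSum i - teichSum i   ≈⟨ a≈b⇒a-b≈0 shift ⟩
    0# ∎)
    where
    i = r ℕ.+ q ℕ.* M
    tg : t g ^ i - 1# ≡ₚ ι g ^ r - 1#
    tg = ≡ₚ-+ (≡ₚ-trans (≡ₚ-^ i (t≡ι g)) (^M+ ¬g q r)) (≡ₚ-refl refl)
    f : ℤ → Carrier
    f z = t z ^ i
    shift : t g ^ i * teichSum i ≈ teichSum i
    shift = begin
      t g ^ i * teichSum i                          ≈⟨ Σ-*ˡ p (t g ^ i) _ ⟨
      Σₚ (λ z → t g ^ i * t z ^ i)                  ≈⟨ Σ-cong p (λ z _ → trans (sym (^-distrib-* (t g) (t (+ z)) i))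
                                                         (^-congˡ i (trans (sym (t-* g (+ z))) (reflexive (≡.cong t (≡.sym (ℤₚ.+-identityʳ (g ℤ.* + z)))))))) ⟩
      Σₚ (λ z → f (g ℤ.* z ℤ.+ + 0))                ≈⟨ reindex-affine f g (+ 0) (λ h → ^-congˡ i (t-periodic h)) ¬g ⟩
      teichSum i ∎

  teichSum-full : ∀ q → 0 ℕ.< q ℕ.* M → teichSum (q ℕ.* M) ≈ ιₙ M
  teichSum-full q 0<qM = begin
    teichSum i                        ≈⟨ Σ-head M _ ⟩
    t (+ 0) ^ i + Σ< M (λ x → t (+ suc x) ^ i)
      ≈⟨ +-cong (zero-term i 0<qM) (Σ-cong M (λ x x<M → trans (reflexive (≡.cong (t (+ suc x) ^_) (ℕₚ.*-comm q M)))
           (trans (sym (^-assocʳ (t (+ suc x)) M q)) (trans (^-congˡ q (t^M (¬p∣small (suc x) (ℕ.s≤s ℕ.z≤n) (ℕ.s≤s x<M)))) (1^n≈1 q))))) ⟩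
    0# + Σ< M (λ x → 1#)              ≈⟨ trans (+-identityˡ _) (trans (Σ-const M 1#) (*-identityʳ _)) ⟩
    ιₙ M ∎
    where
    i = q ℕ.* M
    zero-term : ∀ i → 0 ℕ.< i → t (+ 0) ^ i ≈ 0#
    zero-term (suc i) _ = t^suc-zero i (ℤD.divides (+ 0) ≡.refl)

-- The p-adic Jacobi sum by Newton interpolation in the exponent.

module TeichmüllerSums {c ℓ} (R : CommutativeRing c ℓ) (M : ℕ) (p-prime : Prime (suc M)) (Λ : CubeNilpotent R (suc M))
  (n′ : ℕ) (M≡6n : M ≡ 6 ℕ.* suc n′) where
  open RingKit R
  private
    p n : ℕ
    p = suc M
    n = suc n′


  open RingBinomials R
  open PrimeModulus p p-prime
  open ResidueSums R p p-prime
  open Teichmüller R M p-prime Λ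
  open import Data.Nat using (_!)
  open import Data.Nat.Combinatorics using (_C_; nCk≡nC[n∸k])
  open import Relation.Binary.Definitions using (tri<; tri≈; tri>)

  open NaturalBinomials using (module ℕS)

  -- Sums of t^a (1-t)^s over Teichmüller representatives

  tsum : ℕ → ℕ → Carrier
  tsum a s = Σₚ (λ z → t z ^ a * (1# - t z) ^ s)

  [-y]^i : ∀ y i → (- y) ^ i ≈ (- 1#) ^ i * y ^ i
  [-y]^i y i = trans (^-congˡ i (solve 1 (λ y → :- y := (:- (♯ 1)) :* y) refl y)) (^-distrib-* (- 1#) y i)

  tsum-expand : ∀ a s → tsum a s ≈ Σ< (suc s) (λ i → ιₙ (s C i) * ((- 1#) ^ i * teichSum (a ℕ.+ i)))
  tsum-expand a s = begin
    tsum a s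
      ≈⟨ Σ-cong p (λ z _ → trans (*-congˡ (binomial s (- t (+ z)))) (sym (Σ-*ˡ (suc s) (t (+ z) ^ a) _))) ⟩
    Σ< p (λ z → Σ< (suc s) (λ i → t (+ z) ^ a * (ιₙ (s C i) * (- t (+ z)) ^ i)))
      ≈⟨ Σ-swap p (suc s) _ ⟩
    Σ< (suc s) (λ i → Σ< p (λ z → t (+ z) ^ a * (ιₙ (s C i) * (- t (+ z)) ^ i)))
      ≈⟨ Σ-cong (suc s) (λ i _ → trans (Σ-cong p (λ z _ → term i (+ z))) (trans (Σ-*ˡ p _ _) (*-assoc _ _ _))) ⟩
    Σ< (suc s) (λ i → ιₙ (s C i) * ((- 1#) ^ i * teichSum (a ℕ.+ i))) ∎
    where
    term : ∀ i z → t z ^ a * (ιₙ (s C i) * (- t z) ^ i) ≈ (ιₙ (s C i) * (- 1#) ^ i) * t z ^ (a ℕ.+ i)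
    term i z = trans (*-congˡ (*-congˡ ([-y]^i (t z) i)))
      (trans (solve 4 (λ A c s x → A :* (c :* (s :* x)) := c :* s :* (A :* x)) refl _ _ _ _) (*-congˡ (sym (^-homo-* (t z) a i))))

  Σ-blocks : ∀ q b f → Σ< (q ℕ.* b) f ≈ Σ< q (λ l → Σ< b (λ j → f (l ℕ.* b ℕ.+ j)))
  Σ-blocks zero b f = refl
  Σ-blocks (suc q) b f = trans (reflexive (≡.cong (λ k → Σ< k f) (ℕₚ.+-comm b (q ℕ.* b))))
    (trans (Σ-split (q ℕ.* b) b f) (+-congʳ (Σ-blocks q b f)))

  even-sign : ∀ k → (- 1#) ^ (2 ℕ.* k) ≈ 1#
  even-sign k = trans (sym (^-assocʳ (- 1#) 2 k)) (trans (^-congˡ k (solve 0 (:- (♯ 1) :* (:- (♯ 1) :* ♯ 1) := ♯ 1) refl)) (1^n≈1 k))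

  sign-M : ∀ l → (- 1#) ^ (l ℕ.* M) ≈ 1#
  sign-M l = trans (reflexive (≡.cong ((- 1#) ^_) e)) (even-sign (l ℕ.* (3 ℕ.* n)))
    where
    e : l ℕ.* M ≡ 2 ℕ.* (l ℕ.* (3 ℕ.* n))
    e = ≡.trans (≡.cong (l ℕ.*_) M≡6n) (ℕS.solve 2 (λ l n → l ℕS.:* (ℕS.con 6 ℕS.:* n) ℕS.:= ℕS.con 2 ℕS.:* (l ℕS.:* (ℕS.con 3 ℕS.:* n))) ≡.refl l n)

  5n+n≡M : 5 ℕ.* n ℕ.+ n ≡ M
  5n+n≡M = ≡.trans (ℕₚ.+-comm (5 ℕ.* n) n) (≡.sym M≡6n)

  0<5n : 0 ℕ.< 5 ℕ.* n
  0<5n = ℕ.s≤s ℕ.z≤n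

  kn<M : ∀ k → k ℕ.< 6 → k ℕ.* n ℕ.< M
  kn<M k k<6 = ≡.subst (k ℕ.* n ℕ.<_) (≡.sym M≡6n) (ℕₚ.*-monoˡ-< n k<6)

  n<M : n ℕ.< M
  n<M = ≡.subst (ℕ._< M) (ℕₚ.*-identityˡ n) (kn<M 1 (ℕ.s≤s (ℕ.s≤s ℕ.z≤n)))

  -- Only exponents 5n + i divisible by M = 6n survive the sum over residues, that is i = lM + n.
  -- The range of i is cut into q blocks of length M and a last one of length 2n + 1, each
  -- containing one such i.
  tsum-value : ∀ q → tsum (5 ℕ.* n) (q ℕ.* M ℕ.+ 2 ℕ.* n) ≈
    ιₙ M * (- 1#) ^ n * Σ< (suc q) (λ l → ιₙ ((q ℕ.* M ℕ.+ 2 ℕ.* n) C (l ℕ.* M ℕ.+ n)))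
  tsum-value q = begin
    tsum (5 ℕ.* n) s
      ≈⟨ tsum-expand (5 ℕ.* n) s ⟩
    Σ< (suc s) h
      ≡⟨ ≡.cong (λ k → Σ< k h) (≡.sym (ℕₚ.+-suc (q ℕ.* M) (2 ℕ.* n))) ⟩
    Σ< (q ℕ.* M ℕ.+ suc (2 ℕ.* n)) h
      ≈⟨ trans (Σ-split (q ℕ.* M) (suc (2 ℕ.* n)) h) (+-congʳ (Σ-blocks q M h)) ⟩
    Σ< q (λ l → Σ< M (λ j → h (l ℕ.* M ℕ.+ j))) + Σ< (suc (2 ℕ.* n)) (λ j → h (q ℕ.* M ℕ.+ j))
      ≈⟨ +-cong (Σ-cong q (λ l _ → block l M n<M ℕₚ.≤-refl)) (block q (suc (2 ℕ.* n)) (ℕ.s≤s (ℕₚ.m≤m+n n _)) (kn<M 2 (ℕ.s≤s (ℕ.s≤s (ℕ.s≤s ℕ.z≤n))))) ⟩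
    Σ< (suc q) (λ l → ιₙ M * (- 1#) ^ n * ιₙ (s C (l ℕ.* M ℕ.+ n)))
      ≈⟨ Σ-*ˡ (suc q) _ _ ⟩
    ιₙ M * (- 1#) ^ n * Σ< (suc q) (λ l → ιₙ (s C (l ℕ.* M ℕ.+ n))) ∎
    where
    s = q ℕ.* M ℕ.+ 2 ℕ.* n
    h : ℕ → Carrier
    h i = ιₙ (s C i) * ((- 1#) ^ i * teichSum (5 ℕ.* n ℕ.+ i))
    vanish : ∀ l j → j ℕ.< M → ¬ j ≡ n → teichSum (5 ℕ.* n ℕ.+ (l ℕ.* M ℕ.+ j)) ≈ 0#
    vanish l j j<M j≢n with ℕₚ.<-cmp j n
    ... | tri< j<n _ _ = trans (reflexive (≡.cong teichSum e)) (teichSum-zero l (5 ℕ.* n ℕ.+ j) (ℕₚ.<-≤-trans 0<5n (ℕₚ.m≤m+n _ j))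
                           (≡.subst (5 ℕ.* n ℕ.+ j ℕ.<_) 5n+n≡M (ℕₚ.+-monoʳ-< (5 ℕ.* n) j<n)))
      where
      e : 5 ℕ.* n ℕ.+ (l ℕ.* M ℕ.+ j) ≡ (5 ℕ.* n ℕ.+ j) ℕ.+ l ℕ.* M
      e = ℕS.solve 3 (λ a b c → a ℕS.:+ (b ℕS.:+ c) ℕS.:= (a ℕS.:+ c) ℕS.:+ b) ≡.refl (5 ℕ.* n) (l ℕ.* M) j
    ... | tri≈ _ e _ = ⊥-elim (j≢n e)
    ... | tri> _ _ n<j = trans (reflexive (≡.cong teichSum e)) (teichSum-zero (suc l) (j ℕ.∸ n) (ℕₚ.m<n⇒0<n∸m n<j) (ℕₚ.≤-<-trans (ℕₚ.m∸n≤m j n) j<M))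
      where
      e : 5 ℕ.* n ℕ.+ (l ℕ.* M ℕ.+ j) ≡ (j ℕ.∸ n) ℕ.+ suc l ℕ.* M
      e = ≡.trans (≡.cong (λ k → 5 ℕ.* n ℕ.+ (l ℕ.* M ℕ.+ k)) (≡.sym (ℕₚ.m+[n∸m]≡n (ℕₚ.<⇒≤ n<j))))
        (≡.trans (ℕS.solve 4 (λ a b c d → a ℕS.:+ (b ℕS.:+ (c ℕS.:+ d)) ℕS.:= d ℕS.:+ ((a ℕS.:+ c) ℕS.:+ b)) ≡.refl (5 ℕ.* n) (l ℕ.* M) n (j ℕ.∸ n))
          (≡.cong (λ k → (j ℕ.∸ n) ℕ.+ (k ℕ.+ l ℕ.* M)) 5n+n≡M))
    value : ∀ l → h (l ℕ.* M ℕ.+ n) ≈ ιₙ M * (- 1#) ^ n * ιₙ (s C (l ℕ.* M ℕ.+ n))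
    value l = begin
      ιₙ (s C (l ℕ.* M ℕ.+ n)) * ((- 1#) ^ (l ℕ.* M ℕ.+ n) * teichSum (5 ℕ.* n ℕ.+ (l ℕ.* M ℕ.+ n)))
        ≈⟨ *-congˡ (*-cong (trans (^-homo-* (- 1#) (l ℕ.* M) n) (trans (*-congʳ (sign-M l)) (*-identityˡ _)))
             (trans (reflexive (≡.cong teichSum e)) (teichSum-full (suc l) (ℕₚ.<-≤-trans (ℕₚ.≤-<-trans ℕ.z≤n n<M) (ℕₚ.m≤m+n M _))))) ⟩
      ιₙ (s C (l ℕ.* M ℕ.+ n)) * ((- 1#) ^ n * ιₙ M)
        ≈⟨ solve 3 (λ a b c → a :* (b :* c) := c :* b :* a) refl _ _ _ ⟩
      ιₙ M * (- 1#) ^ n * ιₙ (s C (l ℕ.* M ℕ.+ n)) ∎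
      where
      e : 5 ℕ.* n ℕ.+ (l ℕ.* M ℕ.+ n) ≡ suc l ℕ.* M
      e = ≡.trans (ℕS.solve 3 (λ a b c → a ℕS.:+ (b ℕS.:+ c) ℕS.:= (a ℕS.:+ c) ℕS.:+ b) ≡.refl (5 ℕ.* n) (l ℕ.* M) n)
            (≡.cong (ℕ._+ l ℕ.* M) 5n+n≡M)
    block : ∀ l b → n ℕ.< b → b ℕ.≤ M → Σ< b (λ j → h (l ℕ.* M ℕ.+ j)) ≈ ιₙ M * (- 1#) ^ n * ιₙ (s C (l ℕ.* M ℕ.+ n))
    block l b n<b b≤M = trans (Σ-pick b n _ n<b (λ j j<b j≢n → trans (*-congˡ (trans (*-congˡ (vanish l j (ℕₚ.<-≤-trans j<b b≤M) j≢n)) (zeroʳ _))) (zeroʳ _)))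
                              (value l)

  -- All exponents 2n + i with i ≤ 2n lie strictly between 0 and M. This is what makes the cubic
  -- Jacobi sum vanish modulo p.
  tsum-2n-zero : tsum (2 ℕ.* n) (2 ℕ.* n) ≈ 0#
  tsum-2n-zero = trans (tsum-expand (2 ℕ.* n) (2 ℕ.* n)) (Σ-zero (suc (2 ℕ.* n)) (λ i i<1+2n →
    trans (*-congˡ (trans (*-congˡ (trans (reflexive (≡.cong teichSum (≡.sym (ℕₚ.+-identityʳ (2 ℕ.* n ℕ.+ i)))))
      (teichSum-zero 0 (2 ℕ.* n ℕ.+ i) (ℕ.s≤s ℕ.z≤n) (ℕₚ.≤-<-trans (ℕₚ.+-monoʳ-≤ (2 ℕ.* n) (ℕₚ.≤-pred i<1+2n))
         (≡.subst (ℕ._< M) (ℕS.solve 1 (λ n → ℕS.con 4 ℕS.:* n ℕS.:= ℕS.con 2 ℕS.:* n ℕS.:+ ℕS.con 2 ℕS.:* n) ≡.refl n) (kn<M 4 (ℕ.s≤s (ℕ.s≤s (ℕ.s≤s (ℕ.s≤s (ℕ.s≤s ℕ.z≤n)))))))))))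
       (zeroʳ _))) (zeroʳ _)))

  -- The Jacobi sum of t ↦ t^(5n) and t ↦ t^(2n), by Newton interpolation.

  J : Carrier
  J = Σₚ (λ z → t z ^ (5 ℕ.* n) * t (+ 1 ℤ.- z) ^ (2 ℕ.* n))

  -- Chosen so that 2n p^2 = 2n + M K, by p^2 - 1 = M(p + 1).
  K : ℕ
  K = 2 ℕ.* n ℕ.* suc p

  f : ℕ → Carrier
  f q = tsum (5 ℕ.* n) (q ℕ.* M ℕ.+ 2 ℕ.* n)

  -- With u = 1 - t(z), t(1-z)^(2n) = u^(2n) (u^M)^K. By Fermat u^M = 1 + e with p dividing e, so (1
  -- + e)^K stops at e^2; rewriting e and e^2 by powers of u^M gives second-order interpolation from
  -- the nodes q = 0, 1, 2, evaluated at q = K.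
  J-newton : ιₙ 2 * J ≈ ιₙ 2 * f 0 + ιₙ 2 * ιₙ K * (f 1 - f 0) + ιₙ K * (ιₙ K - 1#) * (f 2 - ιₙ 2 * f 1 + f 0)
  J-newton = begin
    ιₙ 2 * J
      ≈⟨ Σ-*ˡ p (ιₙ 2) _ ⟨
    Σₚ (λ z → ιₙ 2 * (t z ^ (5 ℕ.* n) * t (+ 1 ℤ.- z) ^ (2 ℕ.* n)))
      ≈⟨ Σ-cong p (λ z _ → pointwise (+ z)) ⟩
    Σₚ (λ z → ιₙ 2 * g 0 z + ιₙ 2 * ιₙ K * (g 1 z - g 0 z) + ιₙ K * (ιₙ K - 1#) * (g 2 z - ιₙ 2 * g 1 z + g 0 z))
      ≈⟨ trans (Σ-+ p _ _) (+-cong (trans (Σ-+ p _ _) (+-cong (Σ-*ˡ p _ _) (trans (Σ-*ˡ p _ _) (*-congˡ (trans (Σ-+ p _ _) (+-congˡ (Σ-neg p _)))))))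
           (trans (Σ-*ˡ p _ _) (*-congˡ (trans (Σ-+ p _ _) (+-congʳ (trans (Σ-+ p _ _) (+-congˡ (trans (Σ-neg p _) (-‿cong (Σ-*ˡ p _ _)))))))))) ⟩
    ιₙ 2 * f 0 + ιₙ 2 * ιₙ K * (f 1 - f 0) + ιₙ K * (ιₙ K - 1#) * (f 2 - ιₙ 2 * f 1 + f 0) ∎
    where
    g : ℕ → ℤ → Carrier
    g q z = t z ^ (5 ℕ.* n) * (1# - t z) ^ (q ℕ.* M ℕ.+ 2 ℕ.* n)
    module _ (z : ℤ) where
      u = 1# - t z
      A = t z ^ (5 ℕ.* n)
      e = u ^ M - 1#
      complement : t (+ 1 ℤ.- z) ^ (2 ℕ.* n) ≈ u ^ (2 ℕ.* n) * (u ^ M) ^ K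
      complement = begin
        t (+ 1 ℤ.- z) ^ (2 ℕ.* n)                ≈⟨ ^-congˡ (2 ℕ.* n) (t-complement z) ⟩
        ((u ^ p) ^ p) ^ (2 ℕ.* n)                ≈⟨ ^-assocʳ (u ^ p) p (2 ℕ.* n) ⟩
        (u ^ p) ^ (p ℕ.* (2 ℕ.* n))              ≈⟨ ^-assocʳ u p (p ℕ.* (2 ℕ.* n)) ⟩
        u ^ (p ℕ.* (p ℕ.* (2 ℕ.* n)))            ≡⟨ ≡.cong (u ^_) ex ⟩
        u ^ (2 ℕ.* n ℕ.+ M ℕ.* K)                ≈⟨ ^-homo-* u (2 ℕ.* n) (M ℕ.* K) ⟩
        u ^ (2 ℕ.* n) * u ^ (M ℕ.* K)            ≈⟨ *-congˡ (^-assocʳ u M K) ⟨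
        u ^ (2 ℕ.* n) * (u ^ M) ^ K ∎
        where
        ex : p ℕ.* (p ℕ.* (2 ℕ.* n)) ≡ 2 ℕ.* n ℕ.+ M ℕ.* K
        ex = ℕS.solve 2 (λ M b → let p = ℕS.con 1 ℕS.:+ M in p ℕS.:* (p ℕS.:* b) ℕS.:= b ℕS.:+ M ℕS.:* (b ℕS.:* (ℕS.con 1 ℕS.:+ p))) ≡.refl M (2 ℕ.* n)
      g-power : ∀ q → g q z ≈ A * (u ^ (2 ℕ.* n) * (u ^ M) ^ q)
      g-power q = *-congˡ (trans (reflexive (≡.cong (u ^_) (≡.trans (ℕₚ.+-comm (q ℕ.* M) _) (≡.cong (2 ℕ.* n ℕ.+_) (ℕₚ.*-comm q M)))))
        (trans (^-homo-* u (2 ℕ.* n) (M ℕ.* q)) (*-congˡ (sym (^-assocʳ u M q)))))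
      expansion : u ^ (2 ℕ.* n) * (ιₙ 2 * (u ^ M) ^ K) ≈ u ^ (2 ℕ.* n) * (ιₙ 2 + ιₙ 2 * ιₙ K * e + ιₙ K * (ιₙ K - 1#) * (e * e))
      expansion with + p ℤD.∣? (+ 1 ℤ.- z)
      -- At z = 1 Fermat's theorem fails for u = 0, but the factor u^(2n) annihilates both sides.
      ... | yes h = trans (trans (*-congʳ u0) (zeroˡ _)) (sym (trans (*-congʳ u0) (zeroˡ _)))
        where
        u0 : u ^ (2 ℕ.* n) ≈ 0#
        u0 = trans (^-congˡ (2 ℕ.* n) (trans (+-congˡ (-‿cong (trans (t-periodic {z} {+ 1} (≅-sym {+ 1} {z} (≅-from h))) t-1))) (-‿inverseʳ 1#)))
                   (0^1+n≈0 (n′ ℕ.+ 1 ℕ.* n))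
      ... | no h = *-congˡ (trans (*-congˡ (^-congˡ K (solve 1 (λ a → a := ♯ 1 :+ (a :- ♯ 1)) refl _)))
                              ([1+e]^k e K (p∣cube≈0 (≡ₚ-trans (≡ₚ-^ M (≡ₚ-trans (≡ₚ-+ (≡ₚ-refl refl) (≡ₚ-neg (t≡ι z)))
                                (≡ₚ-refl (sym (trans (ι-+ (+ 1) (ℤ.- z)) (+-congˡ (ι-- z))))))) (fermat-unit h)))))
      pointwise : ιₙ 2 * (A * t (+ 1 ℤ.- z) ^ (2 ℕ.* n)) ≈ ιₙ 2 * g 0 z + ιₙ 2 * ιₙ K * (g 1 z - g 0 z) + ιₙ K * (ιₙ K - 1#) * (g 2 z - ιₙ 2 * g 1 z + g 0 z)
      pointwise = begin
        ιₙ 2 * (A * t (+ 1 ℤ.- z) ^ (2 ℕ.* n))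
          ≈⟨ *-congˡ (*-congˡ complement) ⟩
        ιₙ 2 * (A * (U * (u ^ M) ^ K))
          ≈⟨ solve 4 (λ c A U W → c :* (A :* (U :* W)) := A :* (U :* (c :* W))) refl _ _ _ _ ⟩
        A * (U * (ιₙ 2 * (u ^ M) ^ K))
          ≈⟨ *-congˡ expansion ⟩
        A * (U * (ιₙ 2 + ιₙ 2 * ιₙ K * e + ιₙ K * (ιₙ K - 1#) * (e * e)))
          ≈⟨ solve 4 (λ A U V K → A :* (U :* (♯ 2 :+ ♯ 2 :* K :* (V :- ♯ 1) :+ K :* (K :- ♯ 1) :* ((V :- ♯ 1) :* (V :- ♯ 1))))
                := ♯ 2 :* (A :* (U :* ♯ 1)) :+ ♯ 2 :* K :* (A :* (U :* (V :* ♯ 1)) :- A :* (U :* ♯ 1))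
                   :+ K :* (K :- ♯ 1) :* (A :* (U :* (V :* (V :* ♯ 1))) :- ♯ 2 :* (A :* (U :* (V :* ♯ 1))) :+ A :* (U :* ♯ 1))) refl A U (u ^ M) (ιₙ K) ⟩
        _ ≈⟨ +-cong (+-cong (*-congˡ (g-power 0)) (*-congˡ (+-cong (g-power 1) (-‿cong (g-power 0)))))
               (*-congˡ (+-cong (+-cong (g-power 2) (-‿cong (*-congˡ (g-power 1)))) (g-power 0))) ⟨
        ιₙ 2 * g 0 z + ιₙ 2 * ιₙ K * (g 1 z - g 0 z) + ιₙ K * (ιₙ K - 1#) * (g 2 z - ιₙ 2 * g 1 z + g 0 z) ∎
        where U = u ^ (2 ℕ.* n)

-- Evaluation of the p-adic Jacobi sum modulo p^3.

module JacobiEvaluation {c ℓ} (R : CommutativeRing c ℓ) (M : ℕ) (p-prime : Prime (suc M)) (Λ : CubeNilpotent R (suc M))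
  (n′ : ℕ) (M≡6n : M ≡ 6 ℕ.* suc n′) where
  open RingKit R
  open CubeNilpotent Λ using (p³≈0; unit-ι; ι-reflects)
  private
    p n : ℕ
    p = suc M
    n = suc n′


  open NaturalBinomials
  open RingBinomials R
  open PrimeModulus p p-prime
  open ResidueSums R p p-prime
  open Teichmüller R M p-prime Λ
  open TeichmüllerSums R M p-prime Λ n′ M≡6n
  open import Data.Nat using (_!)
  open import Data.Nat.Combinatorics using (_C_; nCk≡nC[n∸k])

  iv : ℕ → Carrier
  iv i with + p ℤD.∣? + suc i
  ... | yes _ = 0#
  ... | no h = proj₁ (unit-ι (+ suc i) h)

  iv-inv : ∀ i → i ℕ.< M → ιₙ (suc i) * iv i ≈ 1#
  iv-inv i i<M with + p ℤD.∣? + suc i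
  ... | yes h = ⊥-elim (¬p∣small (suc i) (ℕ.s≤s ℕ.z≤n) (ℕ.s≤s i<M) h)
  ... | no h = proj₂ (unit-ι (+ suc i) h)

  unit-small : ∀ i → i ℕ.< M → Unit (ιₙ (suc i))
  unit-small i i<M = iv i , iv-inv i i<M

  -- Wolstenholme

  fact : ℕ → Carrier
  fact k = Π< k (λ i → ιₙ (suc i))

  unit-fact : ∀ k → k ℕ.≤ M → Unit (fact k)
  unit-fact k k≤M = Π-unit k (λ i i<k → unit-small i (ℕₚ.<-≤-trans i<k k≤M))

  shifted-fact : ∀ k y → k ℕ.≤ M → Π< k (λ i → y + ιₙ (suc i)) ≈ fact k * Π< k (λ i → 1# + iv i * y)
  shifted-fact k y k≤M = trans (Π-cong k (λ i i<k → begin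
      y + ιₙ (suc i)                             ≈⟨ +-congʳ (trans (sym (*-identityˡ _)) (*-congʳ (sym (iv-inv i (ℕₚ.<-≤-trans i<k k≤M))))) ⟩
      ιₙ (suc i) * iv i * y + ιₙ (suc i)         ≈⟨ solve 3 (λ a b y → a :* b :* y :+ a := a :* (♯ 1 :+ b :* y)) refl _ _ _ ⟩
      ιₙ (suc i) * (1# + iv i * y)               ∎)) (Π-* k _ _)

  h₁ h₂ : ℕ → Carrier
  h₁ k = Σ< k iv
  h₂ k = Σ< k (λ i → iv i * iv i)

  -- By Fermat 1/i^2 is i^(p-3) modulo p, and the power sum of exponent p - 3 is divisible by p.
  p∣h₂ : pR ∣ʳ h₂ M
  p∣h₂ = ∣ʳ-resp (solve 2 (λ a b → (a :- b) :+ b := a) refl (h₂ M) (Σ< M w))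
    (∣ʳ-+ (≡ₚ-Σ M step) (∣ʳ-resp power (powerSum≡0 M₂ M₂<M)))
    where
    M₂ : ℕ
    M₂ = M ℕ.∸ 2
    M≥6 : 6 ℕ.≤ M
    M≥6 = ≡.subst (6 ℕ.≤_) (≡.sym M≡6n) (ℕₚ.m≤m*n 6 n)
    M≡2+M₂ : M ≡ suc (suc M₂)
    M≡2+M₂ = ≡.sym (ℕₚ.m+[n∸m]≡n (ℕₚ.≤-trans (ℕ.s≤s (ℕ.s≤s ℕ.z≤n)) M≥6))
    M₂<M : M₂ ℕ.< M
    M₂<M = ≡.subst (M₂ ℕ.<_) (≡.sym M≡2+M₂) (ℕₚ.m<n⇒m<1+n ℕₚ.≤-refl)
    w : ℕ → Carrier
    w i = ιₙ (suc i) ^ M₂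
    zero-head : ∀ k → 0 ℕ.< k → ιₙ 0 ^ k ≈ 0#
    zero-head (suc k) _ = 0^1+n≈0 k
    power : powerSum M₂ ≈ Σ< M w
    power = trans (Σ-head M _) (trans (+-congʳ (zero-head M₂ (ℕₚ.<-≤-trans (ℕ.s≤s ℕ.z≤n) (ℕₚ.∸-monoˡ-≤ 2 M≥6)))) (+-identityˡ _))
    step : ∀ i → i ℕ.< M → iv i * iv i ≡ₚ w i
    step i i<M = ≡ₚ-trans (≡ₚ-refl (sym (*-identityʳ _))) (≡ₚ-trans (≡ₚ-* (≡ₚ-refl refl)
        (≡ₚ-trans (≡ₚ-sym (fermat-unit (¬p∣small (suc i) (ℕ.s≤s ℕ.z≤n) (ℕ.s≤s i<M)))) (≡ₚ-refl (reflexive (≡.cong (ιₙ (suc i) ^_) M≡2+M₂)))))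
        (≡ₚ-refl (trans (solve 3 (λ v s x → v :* v :* (s :* (s :* x)) := (s :* v) :* (s :* v) :* x) refl (iv i) (ιₙ (suc i)) (w i))
          (trans (*-congʳ (trans (*-cong e e) (*-identityˡ _))) (*-identityˡ _)))))
      where e = iv-inv i i<M

  -- Let V(y) be the product of the 1 + y/i. Reflecting i into p - i gives V(-p) = 1, since M is
  -- even. To second order, with a = h₁ and g = h₂, this reads 2ap = (a^2 - g)p^2; as p divides g,
  -- both the linear and the quadratic correction vanish, so V(p) = 1 too.
  wolstenholme : Π< M (λ i → pR + ιₙ (suc i)) ≈ fact M
  wolstenholme = trans (shifted-fact M pR ℕₚ.≤-refl) (trans (*-congˡ V≈1) (*-identityʳ _))
    where
    V : Carrier → Carrier
    V y = Π< M (λ i → 1# + iv i * y)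
    a g : Carrier
    a = h₁ M
    g = h₂ M
    reflect : ∀ i → i ℕ.< M → ιₙ (suc (M ℕ.∸ suc i)) ≈ - 1# * (- pR + ιₙ (suc i))
    reflect i i<M = begin
      ιₙ (suc (M ℕ.∸ suc i))                              ≈⟨ solve 2 (λ a b → a := a :+ b :- b) refl _ (ιₙ (suc i)) ⟩
      ιₙ (suc (M ℕ.∸ suc i)) + ιₙ (suc i) - ιₙ (suc i)    ≈⟨ +-congʳ (ιₙ-+ (suc (M ℕ.∸ suc i)) (suc i)) ⟨
      ιₙ (suc (M ℕ.∸ suc i ℕ.+ suc i)) - ιₙ (suc i)       ≡⟨ ≡.cong (λ k → ιₙ (suc k) - ιₙ (suc i)) (ℕₚ.m∸n+n≡m i<M) ⟩
      pR - ιₙ (suc i)                                     ≈⟨ solve 2 (λ p s → p :- s := :- (♯ 1) :* (:- p :+ s)) refl _ _ ⟩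
      - 1# * (- pR + ιₙ (suc i))                          ∎
    even-M : (- 1#) ^ M ≈ 1#
    even-M = trans (reflexive (≡.cong ((- 1#) ^_) (≡.sym (ℕₚ.*-identityˡ M)))) (sign-M 1)
    V-neg : V (- pR) ≈ 1#
    V-neg = unit-cancel (unit-fact M ℕₚ.≤-refl) (begin
      fact M * V (- pR)                                  ≈⟨ shifted-fact M (- pR) ℕₚ.≤-refl ⟨
      Π< M (λ i → - pR + ιₙ (suc i))                     ≈⟨ trans (sym (*-identityˡ _)) (*-congʳ (sym even-M)) ⟩
      (- 1#) ^ M * Π< M (λ i → - pR + ιₙ (suc i))        ≈⟨ trans (*-congʳ (sym (Π-const M (- 1#)))) (sym (Π-* M _ _)) ⟩
      Π< M (λ i → - 1# * (- pR + ιₙ (suc i)))            ≈⟨ Π-cong M reflect ⟨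
      Π< M (λ i → ιₙ (suc (M ℕ.∸ suc i)))                ≈⟨ Π-rev M (λ i → ιₙ (suc i)) ⟨
      fact M                                             ≈⟨ *-identityʳ _ ⟨
      fact M * 1#                                        ∎)
    -p³ : - pR * - pR * - pR ≈ 0#
    -p³ = trans (solve 1 (λ p → :- p :* :- p :* :- p := :- (p :* p :* p)) refl pR) (trans (-‿cong p³≈0) -0#≈0#)
    eq₁ : ιₙ 2 * a * pR ≈ (a * a - g) * (pR * pR)
    eq₁ = begin
      ιₙ 2 * a * pR
        ≈⟨ solve 3 (λ a p g → ♯ 2 :* a :* p := (a :* a :- g) :* (p :* p) :+ ♯ 2 :- (♯ 2 :+ ♯ 2 :* a :* (:- p) :+ (a :* a :- g) :* (:- p :* (:- p)))) refl a pR g ⟩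
      (a * a - g) * (pR * pR) + ιₙ 2 - (ιₙ 2 + ιₙ 2 * a * - pR + (a * a - g) * (- pR * - pR))
        ≈⟨ +-congˡ (-‿cong (trans (sym (Π-expand₂ M iv (- pR) -p³)) (trans (*-congˡ V-neg) (*-identityʳ _)))) ⟩
      (a * a - g) * (pR * pR) + ιₙ 2 - ιₙ 2
        ≈⟨ solve 2 (λ u v → u :+ v :- v := u) refl _ _ ⟩
      (a * a - g) * (pR * pR) ∎
    gp² : g * (pR * pR) ≈ 0#
    gp² = trans (*-congʳ (proj₂ p∣h₂)) (trans (solve 2 (λ p c → p :* c :* (p :* p) := p :* p :* p :* c) refl _ _) (trans (*-congʳ p³≈0) (zeroˡ _)))
    ap² : a * (pR * pR) ≈ 0#
    ap² = unit-zero (unit-small 1 (ℕₚ.<-≤-trans (ℕ.s≤s (ℕ.s≤s ℕ.z≤n)) (≡.subst (6 ℕ.≤_) (≡.sym M≡6n) (ℕₚ.m≤m*n 6 n)))) (begin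
      ιₙ 2 * (a * (pR * pR))             ≈⟨ solve 2 (λ a p → ♯ 2 :* (a :* (p :* p)) := ♯ 2 :* a :* p :* p) refl a pR ⟩
      ιₙ 2 * a * pR * pR                 ≈⟨ *-congʳ eq₁ ⟩
      (a * a - g) * (pR * pR) * pR       ≈⟨ solve 2 (λ u p → u :* (p :* p) :* p := p :* p :* p :* u) refl _ pR ⟩
      pR * pR * pR * (a * a - g)         ≈⟨ trans (*-congʳ p³≈0) (zeroˡ _) ⟩
      0# ∎)
    quad : (a * a - g) * (pR * pR) ≈ 0#
    quad = begin
      (a * a - g) * (pR * pR)            ≈⟨ solve 3 (λ a g p → (a :* a :- g) :* (p :* p) := a :* (a :* (p :* p)) :- g :* (p :* p)) refl a g pR ⟩
      a * (a * (pR * pR)) - g * (pR * pR) ≈⟨ +-cong (trans (*-congˡ ap²) (zeroʳ _)) (-‿cong gp²) ⟩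
      0# - 0#                             ≈⟨ -‿inverseʳ _ ⟩
      0# ∎
    V≈1 : V pR ≈ 1#
    V≈1 = unit-cancel (unit-small 1 (ℕₚ.<-≤-trans (ℕ.s≤s (ℕ.s≤s ℕ.z≤n)) (≡.subst (6 ℕ.≤_) (≡.sym M≡6n) (ℕₚ.m≤m*n 6 n)))) (begin
      ιₙ 2 * V pR                                               ≈⟨ Π-expand₂ M iv pR p³≈0 ⟩
      ιₙ 2 + ιₙ 2 * a * pR + (a * a - g) * (pR * pR)            ≈⟨ +-cong (+-congˡ (trans eq₁ quad)) quad ⟩
      ιₙ 2 + 0# + 0#                                            ≈⟨ solve 0 (♯ 2 :+ ♯ 0 :+ ♯ 0 := ♯ 2 :* ♯ 1) refl ⟩
      ιₙ 2 * 1# ∎)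

  -- The product (n+1+y) ⋯ (2n+y)

  Q : Carrier → Carrier
  Q y = Π< n (λ i → ιₙ (suc (n ℕ.+ i)) + y)

  N : Carrier
  N = ιₙ n

  -- The binomial coefficients of orders 8n and 14n are Q at p - 1 and 2p - 2 up to n!. One or two
  -- shifts move the argument to p and 2p, at the cost of linear factors.
  Q-shift : ∀ y → Q (y - 1#) * (ιₙ 2 * N + y) ≈ (N + y) * Q y
  Q-shift y = begin
    Q (y - 1#) * (ιₙ 2 * N + y)
      ≈⟨ *-cong (Π-cong n (λ i _ → trans (+-congʳ (ιₙ-suc (n ℕ.+ i))) (solve 2 (λ a y → ♯ 1 :+ a :+ (y :- ♯ 1) := a :+ y) refl _ _)))
           (+-congʳ (trans (solve 1 (λ a → ♯ 2 :* a := a :+ a) refl N) (sym (ιₙ-+ n n)))) ⟩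
    Π< (suc n) (λ i → ιₙ (n ℕ.+ i) + y)
      ≈⟨ Π-head n _ ⟩
    (ιₙ (n ℕ.+ 0) + y) * Π< n (λ i → ιₙ (n ℕ.+ suc i) + y)
      ≈⟨ *-cong (+-congʳ (reflexive (≡.cong ιₙ (ℕₚ.+-identityʳ n)))) (Π-cong n (λ i _ → +-congʳ (reflexive (≡.cong ιₙ (ℕₚ.+-suc n i))))) ⟩
    (N + y) * Q y ∎

  Q-cong : ∀ {y z} → y ≈ z → Q y ≈ Q z
  Q-cong h = Π-cong n (λ i _ → +-congˡ h)

  fact-n! : ∀ k → ιₙ (k !) ≈ fact k
  fact-n! k = trans (reflexive (≡.cong ιₙ (≡.trans (!-rising 0 k) (ℕₚ.*-identityˡ _)))) (ιₙ-rising 0 k)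

  nCk-Π : ∀ m y → ιₙ (suc m) ≈ 1# + N + y → ιₙ ((m ℕ.+ n) C n) * fact n ≈ Q y
  nCk-Π m y h = begin
    ιₙ ((m ℕ.+ n) C n) * fact n                ≈⟨ *-congˡ (fact-n! n) ⟨
    ιₙ ((m ℕ.+ n) C n) * ιₙ (n !)              ≈⟨ ιₙ-* ((m ℕ.+ n) C n) (n !) ⟨
    ιₙ (((m ℕ.+ n) C n) ℕ.* n !)               ≡⟨ ≡.cong ιₙ (nCk-rising m n) ⟩
    ιₙ (rising m n)                            ≈⟨ ιₙ-rising m n ⟩
    Π< n (λ i → ιₙ (suc (m ℕ.+ i)))            ≈⟨ Π-cong n (λ i _ → trans (ιₙ-+ (suc m) i) (trans (+-congʳ h)
                                                   (trans (solve 3 (λ n y i → ♯ 1 :+ n :+ y :+ i := ♯ 1 :+ (n :+ i) :+ y) refl _ _ _)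
                                                     (+-congʳ (sym (trans (ιₙ-suc (n ℕ.+ i)) (+-congˡ (ιₙ-+ n i)))))))) ⟩
    Q y                                        ∎

  pR≈6N+1 : pR ≈ 1# + ιₙ 6 * N
  pR≈6N+1 = trans (ιₙ-suc M) (+-congˡ (trans (reflexive (≡.cong ιₙ M≡6n)) (ιₙ-* 6 n)))

  -- The coefficients produced by `tsum-value` for q = 0, 1, 2; by symmetry of binomial coefficients
  -- c₁ and c₂ each occur twice.
  c₀ c₁ c₂ c₃ : Carrier
  c₀ = ιₙ ((2 ℕ.* n) C n)
  c₁ = ιₙ ((8 ℕ.* n) C n)
  c₂ = ιₙ ((14 ℕ.* n) C n)
  c₃ = ιₙ ((14 ℕ.* n) C (7 ℕ.* n))

  index : ∀ a → ιₙ (suc (a ℕ.* n)) ≈ 1# + ιₙ a * N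
  index a = trans (ιₙ-suc (a ℕ.* n)) (+-congˡ (ιₙ-* a n))

  c₀-value : c₀ * fact n ≈ Q 0#
  c₀-value = trans (*-congʳ (reflexive (≡.cong (λ k → ιₙ (k C n)) (≡.cong (n ℕ.+_) (ℕₚ.+-identityʳ n)))))
    (nCk-Π n 0# (trans (ιₙ-suc n) (sym (+-identityʳ _))))

  c₁-value : c₁ * fact n * (ιₙ 2 * N + pR) ≈ (N + pR) * Q pR
  c₁-value = trans (*-congʳ (trans (*-congʳ (reflexive (≡.cong (λ k → ιₙ (k C n)) (ℕₚ.+-comm n (7 ℕ.* n)))))
    (nCk-Π (7 ℕ.* n) (pR - 1#) (trans (index 7) (sym (trans (+-congˡ (+-congʳ pR≈6N+1))
      (solve 1 (λ n → ♯ 1 :+ n :+ (♯ 1 :+ ♯ 6 :* n :- ♯ 1) := ♯ 1 :+ ♯ 7 :* n) refl N))))))) (Q-shift pR)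

  2p : Carrier
  2p = ιₙ 2 * pR

  c₂-value : c₂ * fact n * (ιₙ 2 * N + (2p - 1#)) * (ιₙ 2 * N + 2p) ≈ (N + (2p - 1#)) * (N + 2p) * Q 2p
  c₂-value = begin
    c₂ * fact n * (ιₙ 2 * N + (2p - 1#)) * (ιₙ 2 * N + 2p)
      ≈⟨ *-congʳ (*-congʳ (trans (*-congʳ (reflexive (≡.cong (λ k → ιₙ (k C n)) (ℕₚ.+-comm n (13 ℕ.* n)))))
           (nCk-Π (13 ℕ.* n) (2p - 1# - 1#) (trans (index 13) (sym (trans (+-congˡ (+-congʳ (+-congʳ (*-congˡ pR≈6N+1))))
              (solve 1 (λ n → ♯ 1 :+ n :+ (♯ 2 :* (♯ 1 :+ ♯ 6 :* n) :- ♯ 1 :- ♯ 1) := ♯ 1 :+ ♯ 13 :* n) refl N))))))) ⟩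
    Q (2p - 1# - 1#) * (ιₙ 2 * N + (2p - 1#)) * (ιₙ 2 * N + 2p)
      ≈⟨ *-congʳ (Q-shift (2p - 1#)) ⟩
    (N + (2p - 1#)) * Q (2p - 1#) * (ιₙ 2 * N + 2p)
      ≈⟨ trans (*-assoc _ _ _) (trans (*-congˡ (Q-shift 2p)) (sym (*-assoc _ _ _))) ⟩
    (N + (2p - 1#)) * (N + 2p) * Q 2p ∎

  ιₙ-rising-shift : ∀ m k → ιₙ (rising m k) ≈ Π< k (λ i → ιₙ m + ιₙ (suc i))
  ιₙ-rising-shift m k = trans (ιₙ-rising m k) (Π-cong k (λ i _ → trans (reflexive (≡.cong ιₙ (≡.sym (ℕₚ.+-suc m i)))) (ιₙ-+ m (suc i))))

  -- In (14n)! / (7n)!^2 the factors p and 2p cancel to leave 2 (`central`), and Wolstenholme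
  -- removes the product of the p + i over a full period. The remaining squares are compared through
  -- (p+i)^2 = i(2p+i)(1 + p^2/i^2) modulo p^3, which is the source of the correction with h₂.
  c₃-value : c₃ * fact n * (1# + pR * pR * h₂ n) * (ιₙ 2 * N + (2p - 1#)) * (ιₙ 2 * N + 2p)
           ≈ ιₙ 2 * ((N + pR) * (N + pR)) * Q 2p
  c₃-value = unit-cancel unit-G (begin
    G * (c₃ * F * (1# + pR * pR * h₂ n) * u * v)
      ≈⟨ solve 6 (λ G c F w u v → G :* (c :* F :* w :* u :* v) := c :* (F :* G :* w) :* u :* v) refl _ _ _ _ _ _ ⟩
    c₃ * (F * G * (1# + pR * pR * h₂ n)) * u * v
      ≈⟨ *-congʳ (*-congʳ (*-congˡ square)) ⟨
    c₃ * (B * B) * u * v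
      ≈⟨ solve 5 (λ c r s u v → c :* ((r :* s) :* (r :* s)) :* u :* v := (c :* (r :* r)) :* (s :* s) :* u :* v) refl _ _ _ _ _ ⟩
    c₃ * (R₁ * R₁) * ((pR + N) * (pR + N)) * u * v
      ≈⟨ *-congʳ (*-congʳ (*-congʳ cancelled)) ⟩
    ιₙ 2 * R₂ * ((pR + N) * (pR + N)) * u * v
      ≈⟨ solve 5 (λ R p N u v → ♯ 2 :* R :* ((p :+ N) :* (p :+ N)) :* u :* v := ♯ 2 :* ((N :+ p) :* (N :+ p)) :* (R :* u :* v)) refl _ _ _ _ _ ⟩
    ιₙ 2 * ((N + pR) * (N + pR)) * (R₂ * u * v)
      ≈⟨ *-congˡ full ⟩
    ιₙ 2 * ((N + pR) * (N + pR)) * (G * Q 2p)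
      ≈⟨ solve 3 (λ a G Q → a :* (G :* Q) := G :* (a :* Q)) refl _ _ _ ⟩
    G * (ιₙ 2 * ((N + pR) * (N + pR)) * Q 2p) ∎)
    where
    F = fact n
    u = ιₙ 2 * N + (2p - 1#)
    v = ιₙ 2 * N + 2p
    R₁ = Π< n′ (λ i → pR + ιₙ (suc i))
    R₂ = Π< (2 ℕ.* n′) (λ i → 2p + ιₙ (suc i))
    B = Π< n (λ i → pR + ιₙ (suc i))
    G = Π< n (λ i → 2p + ιₙ (suc i))
    unit-G : Unit G
    unit-G = Π-unit n (λ i i<n → unit-≡ₚ (unit-small i (ℕₚ.<-trans i<n n<M)) (ιₙ 2 , solve 2 (λ p s → ♯ 2 :* p :+ s :- s := p :* ♯ 2) refl _ _))
    square : B * B ≈ F * G * (1# + pR * pR * h₂ n)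
    square = go n (ℕₚ.<⇒≤ n<M)
      where
      go : ∀ k → k ℕ.≤ M → Π< k (λ i → pR + ιₙ (suc i)) * Π< k (λ i → pR + ιₙ (suc i))
             ≈ fact k * Π< k (λ i → 2p + ιₙ (suc i)) * (1# + pR * pR * h₂ k)
      go zero _ = solve 1 (λ p → ♯ 1 :* ♯ 1 := ♯ 1 :* ♯ 1 :* (♯ 1 :+ p :* p :* ♯ 0)) refl pR
      go (suc k) k<M = begin
        (b * (pR + s)) * (b * (pR + s))
          ≈⟨ solve 3 (λ b p s → (b :* (p :+ s)) :* (b :* (p :+ s)) := (b :* b) :* (s :* (♯ 2 :* p :+ s) :+ p :* p)) refl b pR s ⟩
        (b * b) * (s * (2p + s) + pR * pR)
          ≈⟨ *-cong (go k (ℕₚ.<⇒≤ k<M)) factor ⟩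
        f₀ * g₀ * (1# + pR * pR * h₂ k) * (s * (2p + s) * (1# + pR * pR * (w * w)))
          ≈⟨ ≈-mod-zero (solve 7 (λ f g p h s w t → f :* g :* (♯ 1 :+ p :* p :* h) :* (s :* t :* (♯ 1 :+ p :* p :* (w :* w)))
               := f :* s :* (g :* t) :* (♯ 1 :+ p :* p :* (h :+ w :* w)) :+ (p :* p :* p) :* (p :* h :* (w :* w) :* (f :* s :* (g :* t)))) refl
               f₀ g₀ pR (h₂ k) s w (2p + s)) p³≈0 ⟩
        f₀ * s * (g₀ * (2p + s)) * (1# + pR * pR * (h₂ k + w * w)) ∎
        where
        b = Π< k (λ i → pR + ιₙ (suc i))
        s = ιₙ (suc k)
        w = iv k
        f₀ = fact k
        g₀ = Π< k (λ i → 2p + ιₙ (suc i))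
        factor : s * (2p + s) + pR * pR ≈ s * (2p + s) * (1# + pR * pR * (w * w))
        factor = sym (begin
          s * (2p + s) * (1# + pR * pR * (w * w))
            ≈⟨ solve 3 (λ s p w → s :* (♯ 2 :* p :+ s) :* (♯ 1 :+ p :* p :* (w :* w))
                 := s :* (♯ 2 :* p :+ s) :+ p :* p :+ p :* p :* ((s :* w) :* (s :* w) :- ♯ 1) :+ (p :* p :* p) :* (♯ 2 :* s :* w :* w)) refl s pR w ⟩
          s * (2p + s) + pR * pR + pR * pR * ((s * w) * (s * w) - 1#) + (pR * pR * pR) * (ιₙ 2 * s * w * w)
            ≈⟨ +-cong (+-congˡ (*-congˡ (a≈b⇒a-b≈0 (trans (*-cong e e) (*-identityˡ _))))) (*-congʳ p³≈0) ⟩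
          s * (2p + s) + pR * pR + pR * pR * 0# + 0# * (ιₙ 2 * s * w * w)
            ≈⟨ solve 3 (λ a b d → a :+ b :+ b :* ♯ 0 :+ ♯ 0 :* d := a :+ b) refl _ _ _ ⟩
          s * (2p + s) + pR * pR ∎)
          where e = iv-inv k k<M
    cancelled : c₃ * (R₁ * R₁) ≈ ιₙ 2 * R₂
    cancelled = unit-cancel (unit-fact M ℕₚ.≤-refl) (begin
      fact M * (c₃ * (R₁ * R₁))
        ≈⟨ solve 3 (λ f c r → f :* (c :* r) := c :* f :* r) refl _ _ _ ⟩
      c₃ * fact M * (R₁ * R₁)
        ≈⟨ *-cong (*-congˡ (fact-n! M)) (*-cong (ιₙ-rising-shift p n′) (ιₙ-rising-shift p n′)) ⟨
      c₃ * ιₙ (M !) * (ιₙ (rising p n′) * ιₙ (rising p n′))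
        ≈⟨ trans (ιₙ-* (((14 ℕ.* n) C (7 ℕ.* n)) ℕ.* M !) _) (*-cong (ιₙ-* ((14 ℕ.* n) C (7 ℕ.* n)) (M !)) (ιₙ-* (rising p n′) (rising p n′))) ⟨
      ιₙ (((14 ℕ.* n) C (7 ℕ.* n)) ℕ.* M ! ℕ.* (rising p n′ ℕ.* rising p n′))
        ≡⟨ ≡.cong ιₙ (central M n′ M≡6n) ⟩
      ιₙ (2 ℕ.* rising p M ℕ.* rising (p ℕ.+ p) (2 ℕ.* n′))
        ≈⟨ trans (ιₙ-* (2 ℕ.* rising p M) _) (*-congʳ (ιₙ-* 2 (rising p M))) ⟩
      ιₙ 2 * ιₙ (rising p M) * ιₙ (rising (p ℕ.+ p) (2 ℕ.* n′))
        ≈⟨ *-cong (*-congˡ (trans (ιₙ-rising-shift p M) wolstenholme)) (trans (ιₙ-rising-shift (p ℕ.+ p) (2 ℕ.* n′))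
             (Π-cong (2 ℕ.* n′) (λ i _ → +-congʳ (trans (ιₙ-+ p p) (solve 1 (λ p → p :+ p := ♯ 2 :* p) refl pR))))) ⟩
      ιₙ 2 * fact M * R₂
        ≈⟨ solve 2 (λ f r → ♯ 2 :* f :* r := f :* (♯ 2 :* r)) refl _ _ ⟩
      fact M * (ιₙ 2 * R₂) ∎)
    full : R₂ * u * v ≈ G * Q 2p
    full = begin
      R₂ * u * v
        ≈⟨ *-cong (*-congˡ u≈) v≈ ⟩
      Π< (suc (suc (2 ℕ.* n′))) (λ i → 2p + ιₙ (suc i))
        ≡⟨ ≡.cong (λ k → Π< k (λ i → 2p + ιₙ (suc i))) 2n ⟩
      Π< (n ℕ.+ n) (λ i → 2p + ιₙ (suc i))
        ≈⟨ Π-split n n _ ⟩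
      G * Π< n (λ i → 2p + ιₙ (suc (n ℕ.+ i)))
        ≈⟨ *-congˡ (Π-cong n (λ i _ → +-comm _ _)) ⟩
      G * Q 2p ∎
      where
      2n : suc (suc (2 ℕ.* n′)) ≡ n ℕ.+ n
      2n = ℕS.solve 1 (λ k → ℕS.con 1 ℕS.:+ (ℕS.con 1 ℕS.:+ ℕS.con 2 ℕS.:* k) ℕS.:= (ℕS.con 1 ℕS.:+ k) ℕS.:+ (ℕS.con 1 ℕS.:+ k)) ≡.refl n′
      NN : ιₙ (suc (suc (2 ℕ.* n′))) ≈ ιₙ 2 * N
      NN = trans (reflexive (≡.cong ιₙ 2n)) (trans (ιₙ-+ n n) (solve 1 (λ a → a :+ a := ♯ 2 :* a) refl N))
      v≈ : v ≈ 2p + ιₙ (suc (suc (2 ℕ.* n′)))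
      v≈ = trans (+-comm _ _) (+-congˡ (sym NN))
      u≈ : u ≈ 2p + ιₙ (suc (2 ℕ.* n′))
      u≈ = trans (solve 2 (λ a b → a :+ (b :- ♯ 1) := b :+ (a :- ♯ 1)) refl _ _) (+-congˡ (trans (+-congʳ (sym NN))
        (solve 1 (λ a → ♯ 1 :+ a :- ♯ 1 := a) refl _)))

  module Final (x : Carrier) (6x≈p : ιₙ 6 * x ≈ pR) (x³≈0 : x * x * x ≈ 0#) where

    -- 2 Q(y) = q₀ + q₁ y + q₂ y² for y³ = 0, all coefficients being multiples of n!⁻¹(2n)!.
    w : ℕ → Carrier
    w i = iv (n ℕ.+ i)

    q₀ q₁ q₂ : Carrier
    q₀ = Q 0#
    q₁ = q₀ * Σ< n w
    q₂ = q₀ * (Σ< n w * Σ< n w - Σ< n (λ i → w i * w i))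

    2Q : Carrier → Carrier
    2Q y = ιₙ 2 * q₀ + ιₙ 2 * q₁ * y + q₂ * (y * y)

    n+i<M : ∀ i → i ℕ.< n → n ℕ.+ i ℕ.< M
    n+i<M i i<n = ℕₚ.<-trans (ℕₚ.+-monoʳ-< n i<n) (≡.subst (ℕ._< M) (≡.cong (n ℕ.+_) (ℕₚ.+-identityʳ n)) (kn<M 2 (ℕ.s≤s (ℕ.s≤s (ℕ.s≤s ℕ.z≤n)))))

    Q-expand : ∀ y → y * y * y ≈ 0# → ιₙ 2 * Q y ≈ 2Q y
    Q-expand y y³ = begin
      ιₙ 2 * Q y
        ≈⟨ *-congˡ (trans (Π-cong n (λ i i<n → factor i i<n)) (Π-* n _ _)) ⟩
      ιₙ 2 * (q₀ * Π< n (λ i → 1# + w i * y))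
        ≈⟨ solve 2 (λ q V → ♯ 2 :* (q :* V) := q :* (♯ 2 :* V)) refl _ _ ⟩
      q₀ * (ιₙ 2 * Π< n (λ i → 1# + w i * y))
        ≈⟨ *-congˡ (Π-expand₂ n w y y³) ⟩
      q₀ * (ιₙ 2 + ιₙ 2 * Σ< n w * y + (Σ< n w * Σ< n w - Σ< n (λ i → w i * w i)) * (y * y))
        ≈⟨ solve 4 (λ q a b y → q :* (♯ 2 :+ ♯ 2 :* a :* y :+ b :* (y :* y)) := ♯ 2 :* q :+ ♯ 2 :* (q :* a) :* y :+ (q :* b) :* (y :* y)) refl q₀ (Σ< n w) (Σ< n w * Σ< n w - Σ< n (λ i → w i * w i)) y ⟩
      2Q y ∎
      where
      factor : ∀ i → i ℕ.< n → ιₙ (suc (n ℕ.+ i)) + y ≈ (ιₙ (suc (n ℕ.+ i)) + 0#) * (1# + w i * y)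
      factor i i<n = sym (begin
        (s + 0#) * (1# + w i * y)    ≈⟨ solve 3 (λ s w y → (s :+ ♯ 0) :* (♯ 1 :+ w :* y) := s :+ (s :* w) :* y) refl s (w i) y ⟩
        s + (s * w i) * y            ≈⟨ +-congˡ (trans (*-congʳ (iv-inv (n ℕ.+ i) (n+i<M i i<n))) (*-identityˡ _)) ⟩
        s + y                        ∎)
        where s = ιₙ (suc (n ℕ.+ i))

    6N : ιₙ 6 * N ≈ ιₙ 6 * x - 1#
    6N = sym (trans (+-congʳ (trans 6x≈p pR≈6N+1)) (solve 1 (λ n → ♯ 1 :+ ♯ 6 :* n :- ♯ 1 := ♯ 6 :* n) refl N))

    x∣p : ∀ c → (ιₙ c * x) * (ιₙ c * x) * (ιₙ c * x) ≈ 0#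
    x∣p c = trans (solve 2 (λ c x → (c :* x) :* (c :* x) :* (c :* x) := (x :* x :* x) :* (c :* c :* c)) refl (ιₙ c) x) (trans (*-congʳ x³≈0) (zeroˡ _))

    mod-x³ : ∀ {a b e} → a ≈ b + x * x * x * e → a ≈ b
    mod-x³ h = ≈-mod-zero h x³≈0

    F h : Carrier
    F = fact n
    h = h₂ n

    Q₆ Q₁₂ : Carrier
    Q₆ = Q (ιₙ 6 * x)
    Q₁₂ = Q (ιₙ 12 * x)

    2p≈12x : 2p ≈ ιₙ 12 * x
    2p≈12x = trans (*-congˡ (sym 6x≈p)) (solve 1 (λ x → ♯ 2 :* (♯ 6 :* x) := ♯ 12 :* x) refl x)

    unit-2 : Unit (ιₙ 2)
    unit-2 = unit-small 1 (ℕₚ.<-≤-trans (ℕ.s≤s (ℕ.s≤s ℕ.z≤n)) (≡.subst (6 ℕ.≤_) (≡.sym M≡6n) (ℕₚ.m≤m*n 6 n)))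

    unit-3 : Unit (ιₙ 3)
    unit-3 = unit-small 2 (ℕₚ.<-≤-trans (ℕ.s≤s (ℕ.s≤s (ℕ.s≤s ℕ.z≤n))) (≡.subst (6 ℕ.≤_) (≡.sym M≡6n) (ℕₚ.m≤m*n 6 n)))

    unit-6 : Unit (ιₙ 6)
    unit-6 = unit-cong (solve 0 (♯ 2 :* ♯ 3 := ♯ 6) refl) (unit-* unit-2 unit-3)

    -- Times 6, the linear factor 2N + p is 48x - 2 = -2(1 - 24x), and 1 + 24x + 576x^2 inverts 1 -
    -- 24x modulo x^3.
    X₁-value : ιₙ 2 * (ιₙ 2 * c₁ * F) ≈ (1# - ιₙ 18 * x - ιₙ 432 * x * x) * 2Q (ιₙ 6 * x)
    X₁-value = begin
      ιₙ 2 * (ιₙ 2 * c₁ * F)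
        ≈⟨ mod-x³ (solve 3 (λ c F x → let c₁F = c :* F in
              ♯ 2 :* (♯ 2 :* c :* F) := (:- (♯ 2)) :* (♯ 1 :+ ♯ 24 :* x :+ ♯ 576 :* x :* x) :* (c₁F :* (♯ 2 :* (♯ 6 :* x :- ♯ 1) :+ ♯ 6 :* (♯ 6 :* x)))
                :+ x :* x :* x :* (♯ 55296 :* c₁F)) refl c₁ F x) ⟩
      - ιₙ 2 * (1# + ιₙ 24 * x + ιₙ 576 * x * x) * (c₁ * F * (ιₙ 2 * (ιₙ 6 * x - 1#) + ιₙ 6 * (ιₙ 6 * x)))
        ≈⟨ *-congˡ key ⟩
      - ιₙ 2 * (1# + ιₙ 24 * x + ιₙ 576 * x * x) * ((ιₙ 6 * x - 1# + ιₙ 6 * (ιₙ 6 * x)) * Q₆)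
        ≈⟨ mod-x³ (solve 2 (λ x q → (:- (♯ 2)) :* (♯ 1 :+ ♯ 24 :* x :+ ♯ 576 :* x :* x) :* ((♯ 6 :* x :- ♯ 1 :+ ♯ 6 :* (♯ 6 :* x)) :* q)
             := (♯ 1 :- ♯ 18 :* x :- ♯ 432 :* x :* x) :* (♯ 2 :* q) :+ x :* x :* x :* (:- (♯ 48384 :* q))) refl x Q₆) ⟩
      (1# - ιₙ 18 * x - ιₙ 432 * x * x) * (ιₙ 2 * Q₆)
        ≈⟨ *-congˡ (Q-expand _ (x∣p 6)) ⟩
      (1# - ιₙ 18 * x - ιₙ 432 * x * x) * 2Q (ιₙ 6 * x) ∎
      where
      key : c₁ * F * (ιₙ 2 * (ιₙ 6 * x - 1#) + ιₙ 6 * (ιₙ 6 * x)) ≈ (ιₙ 6 * x - 1# + ιₙ 6 * (ιₙ 6 * x)) * Q₆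
      key = begin
        c₁ * F * (ιₙ 2 * (ιₙ 6 * x - 1#) + ιₙ 6 * (ιₙ 6 * x))
          ≈⟨ *-congˡ (+-cong (*-congˡ (sym 6N)) (*-congˡ 6x≈p)) ⟩
        c₁ * F * (ιₙ 2 * (ιₙ 6 * N) + ιₙ 6 * pR)
          ≈⟨ solve 3 (λ a N p → a :* (♯ 2 :* (♯ 6 :* N) :+ ♯ 6 :* p) := ♯ 6 :* (a :* (♯ 2 :* N :+ p))) refl (c₁ * F) N pR ⟩
        ιₙ 6 * (c₁ * F * (ιₙ 2 * N + pR))
          ≈⟨ *-congˡ c₁-value ⟩
        ιₙ 6 * ((N + pR) * Q pR)
          ≈⟨ solve 3 (λ N p q → ♯ 6 :* ((N :+ p) :* q) := (♯ 6 :* N :+ ♯ 6 :* p) :* q) refl N pR (Q pR) ⟩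
        (ιₙ 6 * N + ιₙ 6 * pR) * Q pR
          ≈⟨ *-cong (+-cong 6N (*-congˡ (sym 6x≈p))) (Q-cong (sym 6x≈p)) ⟩
        (ιₙ 6 * x - 1# + ιₙ 6 * (ιₙ 6 * x)) * Q₆ ∎

    -- 36 times (2N + 2p - 1)(2N + 2p)
    d : Carrier
    d = (ιₙ 84 * x - ιₙ 8) * (ιₙ 84 * x - ιₙ 2)

    d-value : ιₙ 36 * ((ιₙ 2 * N + (2p - 1#)) * (ιₙ 2 * N + 2p)) ≈ d
    d-value = begin
      ιₙ 36 * ((ιₙ 2 * N + (2p - 1#)) * (ιₙ 2 * N + 2p))
        ≈⟨ solve 2 (λ N p → ♯ 36 :* ((♯ 2 :* N :+ (p :- ♯ 1)) :* (♯ 2 :* N :+ p)) := (♯ 2 :* (♯ 6 :* N) :+ (♯ 6 :* p :- ♯ 6)) :* (♯ 2 :* (♯ 6 :* N) :+ ♯ 6 :* p)) refl N 2p ⟩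
      (ιₙ 2 * (ιₙ 6 * N) + (ιₙ 6 * 2p - ιₙ 6)) * (ιₙ 2 * (ιₙ 6 * N) + ιₙ 6 * 2p)
        ≈⟨ *-cong (+-cong (*-congˡ 6N) (+-congʳ (*-congˡ 2p≈12x))) (+-cong (*-congˡ 6N) (*-congˡ 2p≈12x)) ⟩
      _ ≈⟨ solve 1 (λ x → (♯ 2 :* (♯ 6 :* x :- ♯ 1) :+ (♯ 6 :* (♯ 12 :* x) :- ♯ 6)) :* (♯ 2 :* (♯ 6 :* x :- ♯ 1) :+ ♯ 6 :* (♯ 12 :* x))
             := (♯ 84 :* x :- ♯ 8) :* (♯ 84 :* x :- ♯ 2)) refl x ⟩
      d ∎

    c₂-value′ : c₂ * F * d ≈ (ιₙ 78 * x - ιₙ 7) * (ιₙ 78 * x - 1#) * Q₁₂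
    c₂-value′ = begin
      c₂ * F * d
        ≈⟨ trans (*-congˡ (sym d-value)) (solve 3 (λ a u v → a :* (♯ 36 :* (u :* v)) := ♯ 36 :* (a :* u :* v)) refl _ _ _) ⟩
      ιₙ 36 * (c₂ * F * (ιₙ 2 * N + (2p - 1#)) * (ιₙ 2 * N + 2p))
        ≈⟨ *-congˡ c₂-value ⟩
      ιₙ 36 * ((N + (2p - 1#)) * (N + 2p) * Q 2p)
        ≈⟨ solve 3 (λ N p q → ♯ 36 :* ((N :+ (p :- ♯ 1)) :* (N :+ p) :* q) := (♯ 6 :* N :+ (♯ 6 :* p :- ♯ 6)) :* (♯ 6 :* N :+ ♯ 6 :* p) :* q) refl N 2p (Q 2p) ⟩
      (ιₙ 6 * N + (ιₙ 6 * 2p - ιₙ 6)) * (ιₙ 6 * N + ιₙ 6 * 2p) * Q 2p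
        ≈⟨ *-cong (*-cong (+-cong 6N (+-congʳ (*-congˡ 2p≈12x))) (+-cong 6N (*-congˡ 2p≈12x))) (Q-cong 2p≈12x) ⟩
      _ ≈⟨ solve 2 (λ x q → (♯ 6 :* x :- ♯ 1 :+ (♯ 6 :* (♯ 12 :* x) :- ♯ 6)) :* (♯ 6 :* x :- ♯ 1 :+ ♯ 6 :* (♯ 12 :* x)) :* q
             := (♯ 78 :* x :- ♯ 7) :* (♯ 78 :* x :- ♯ 1) :* q) refl x Q₁₂ ⟩
      (ιₙ 78 * x - ιₙ 7) * (ιₙ 78 * x - 1#) * Q₁₂ ∎

    c₃-value′ : c₃ * F * d ≈ ιₙ 2 * ((ιₙ 42 * x - 1#) * (ιₙ 42 * x - 1#)) * Q₁₂ * (1# - ιₙ 36 * x * x * h)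
    c₃-value′ = begin
      c₃ * F * d
        ≈⟨ mod-x³ (solve 4 (λ c d x h → c :* d := c :* (♯ 1 :+ (♯ 6 :* x) :* (♯ 6 :* x) :* h) :* d :* (♯ 1 :- ♯ 36 :* x :* x :* h)
             :+ x :* x :* x :* (c :* d :* (♯ 1296 :* x :* h :* h))) refl (c₃ * F) d x h) ⟩
      c₃ * F * (1# + (ιₙ 6 * x) * (ιₙ 6 * x) * h) * d * z
        ≈⟨ *-congʳ (*-cong (*-congˡ (+-congˡ (*-congʳ (*-cong 6x≈p 6x≈p)))) (sym d-value)) ⟩
      c₃ * F * (1# + pR * pR * h) * (ιₙ 36 * ((ιₙ 2 * N + (2p - 1#)) * (ιₙ 2 * N + 2p))) * z
        ≈⟨ solve 4 (λ a u v z → a :* (♯ 36 :* (u :* v)) :* z := ♯ 36 :* (a :* u :* v) :* z) refl _ _ _ _ ⟩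
      ιₙ 36 * (c₃ * F * (1# + pR * pR * h) * (ιₙ 2 * N + (2p - 1#)) * (ιₙ 2 * N + 2p)) * z
        ≈⟨ *-congʳ (*-congˡ c₃-value) ⟩
      ιₙ 36 * (ιₙ 2 * ((N + pR) * (N + pR)) * Q 2p) * z
        ≈⟨ *-congʳ (solve 3 (λ N p q → ♯ 36 :* (♯ 2 :* ((N :+ p) :* (N :+ p)) :* q) := ♯ 2 :* ((♯ 6 :* N :+ ♯ 6 :* p) :* (♯ 6 :* N :+ ♯ 6 :* p)) :* q) refl N pR (Q 2p)) ⟩
      ιₙ 2 * ((ιₙ 6 * N + ιₙ 6 * pR) * (ιₙ 6 * N + ιₙ 6 * pR)) * Q 2p * z
        ≈⟨ *-congʳ (*-cong (*-congˡ (*-cong e e)) (Q-cong 2p≈12x)) ⟩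
      ιₙ 2 * ((ιₙ 42 * x - 1#) * (ιₙ 42 * x - 1#)) * Q₁₂ * z ∎
      where
      z = 1# - ιₙ 36 * x * x * h
      e : ιₙ 6 * N + ιₙ 6 * pR ≈ ιₙ 42 * x - 1#
      e = trans (+-cong 6N (*-congˡ (sym 6x≈p))) (solve 1 (λ x → ♯ 6 :* x :- ♯ 1 :+ ♯ 6 :* (♯ 6 :* x) := ♯ 42 :* x :- ♯ 1) refl x)

    -- Here 4 + 210x + 9261x^2 is 64/d modulo x^3, d = 16 - 840x + 7056x^2.
    X₂-value : ιₙ 64 * ((ιₙ 2 * c₂ + c₃) * F) ≈ (ιₙ 32 - ιₙ 144 * h * x * x - ιₙ 1152 * x - ιₙ 43200 * x * x) * 2Q (ιₙ 12 * x)
    X₂-value = begin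
      ιₙ 64 * ((ιₙ 2 * c₂ + c₃) * F)
        ≈⟨ mod-x³ (solve 4 (λ a b F x → ♯ 64 :* ((♯ 2 :* a :+ b) :* F) := (♯ 4 :+ ♯ 210 :* x :+ ♯ 9261 :* x :* x) :*
              (♯ 2 :* (a :* F :* ((♯ 84 :* x :- ♯ 8) :* (♯ 84 :* x :- ♯ 2))) :+ b :* F :* ((♯ 84 :* x :- ♯ 8) :* (♯ 84 :* x :- ♯ 2)))
              :+ x :* x :* x :* ((♯ 2 :* a :+ b) :* F :* (♯ 6297480 :- ♯ 65345616 :* x))) refl c₂ c₃ F x) ⟩
      k * (ιₙ 2 * (c₂ * F * d) + c₃ * F * d)
        ≈⟨ *-congˡ (+-cong (*-congˡ c₂-value′) c₃-value′) ⟩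
      k * (ιₙ 2 * ((ιₙ 78 * x - ιₙ 7) * (ιₙ 78 * x - 1#) * Q₁₂) + ιₙ 2 * ((ιₙ 42 * x - 1#) * (ιₙ 42 * x - 1#)) * Q₁₂ * (1# - ιₙ 36 * x * x * h))
        ≈⟨ mod-x³ (solve 3 (λ x h q → (♯ 4 :+ ♯ 210 :* x :+ ♯ 9261 :* x :* x) :* (♯ 2 :* ((♯ 78 :* x :- ♯ 7) :* (♯ 78 :* x :- ♯ 1) :* q)
                :+ ♯ 2 :* ((♯ 42 :* x :- ♯ 1) :* (♯ 42 :* x :- ♯ 1)) :* q :* (♯ 1 :- ♯ 36 :* x :* x :* h))
              := (♯ 32 :- ♯ 144 :* h :* x :* x :- ♯ 1152 :* x :- ♯ 43200 :* x :* x) :* (♯ 2 :* q)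
                 :+ x :* x :* x :* ((:- (♯ 4908708) :+ ♯ 4536 :* h :+ ♯ 47628 :* h :* x :+ ♯ 14669424 :* h :* x :* x :- ♯ 588110544 :* h :* x :* x :* x :+ ♯ 72680328 :* x) :* (♯ 2 :* q))) refl x h Q₁₂) ⟩
      (ιₙ 32 - ιₙ 144 * h * x * x - ιₙ 1152 * x - ιₙ 43200 * x * x) * (ιₙ 2 * Q₁₂)
        ≈⟨ *-congˡ (Q-expand _ (x∣p 12)) ⟩
      (ιₙ 32 - ιₙ 144 * h * x * x - ιₙ 1152 * x - ιₙ 43200 * x * x) * 2Q (ιₙ 12 * x) ∎
      where k = ιₙ 4 + ιₙ 210 * x + ιₙ 9261 * x * x

    sgn : Carrier
    sgn = (- 1#) ^ n

    f₀-value : f 0 ≈ ιₙ M * sgn * c₀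
    f₀-value = trans (tsum-value 0) (*-congˡ (+-identityˡ _))

    f₁-value : f 1 ≈ ιₙ M * sgn * (ιₙ 2 * c₁)
    f₁-value = trans (tsum-value 1) (*-congˡ (begin
      0# + ιₙ ((M ℕ.+ 0 ℕ.+ 2 ℕ.* n) C n) + ιₙ ((M ℕ.+ 0 ℕ.+ 2 ℕ.* n) C (M ℕ.+ 0 ℕ.+ n))
        ≡⟨ ≡.cong₂ (λ a b → 0# + ιₙ (a C n) + ιₙ (a C b)) 8n 7n ⟩
      0# + c₁ + ιₙ ((8 ℕ.* n) C (7 ℕ.* n))
        ≡⟨ ≡.cong (λ k → 0# + c₁ + ιₙ k) (≡.trans (nCk≡nC[n∸k] (ℕₚ.m≤n+m (7 ℕ.* n) n)) (≡.cong ((8 ℕ.* n) C_) (ℕₚ.m+n∸n≡m n (7 ℕ.* n)))) ⟩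
      0# + c₁ + c₁
        ≈⟨ solve 1 (λ a → ♯ 0 :+ a :+ a := ♯ 2 :* a) refl c₁ ⟩
      ιₙ 2 * c₁ ∎))
      where
      8n : M ℕ.+ 0 ℕ.+ 2 ℕ.* n ≡ 8 ℕ.* n
      8n = ≡.trans (≡.cong (λ m → m ℕ.+ 0 ℕ.+ 2 ℕ.* n) M≡6n) (ℕS.solve 1 (λ n → ℕS.con 6 ℕS.:* n ℕS.:+ ℕS.con 0 ℕS.:+ ℕS.con 2 ℕS.:* n ℕS.:= ℕS.con 8 ℕS.:* n) ≡.refl n)
      7n : M ℕ.+ 0 ℕ.+ n ≡ 7 ℕ.* n
      7n = ≡.trans (≡.cong (λ m → m ℕ.+ 0 ℕ.+ n) M≡6n) (ℕS.solve 1 (λ n → ℕS.con 6 ℕS.:* n ℕS.:+ ℕS.con 0 ℕS.:+ n ℕS.:= ℕS.con 7 ℕS.:* n) ≡.refl n)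

    f₂-value : f 2 ≈ ιₙ M * sgn * (ιₙ 2 * c₂ + c₃)
    f₂-value = trans (tsum-value 2) (*-congˡ (begin
      0# + ιₙ (s C n) + ιₙ (s C (1 ℕ.* M ℕ.+ n)) + ιₙ (s C (2 ℕ.* M ℕ.+ n))
        ≡⟨ ≡.cong (λ a → 0# + ιₙ (a C n) + ιₙ (a C (1 ℕ.* M ℕ.+ n)) + ιₙ (a C (2 ℕ.* M ℕ.+ n))) 14n ⟩
      0# + c₂ + ιₙ ((14 ℕ.* n) C (1 ℕ.* M ℕ.+ n)) + ιₙ ((14 ℕ.* n) C (2 ℕ.* M ℕ.+ n))
        ≡⟨ ≡.cong₂ (λ a b → 0# + c₂ + ιₙ ((14 ℕ.* n) C a) + ιₙ ((14 ℕ.* n) C b)) 7n 13n ⟩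
      0# + c₂ + c₃ + ιₙ ((14 ℕ.* n) C (13 ℕ.* n))
        ≡⟨ ≡.cong (λ k → 0# + c₂ + c₃ + ιₙ k) (≡.trans (nCk≡nC[n∸k] (ℕₚ.m≤n+m (13 ℕ.* n) n)) (≡.cong ((14 ℕ.* n) C_) (ℕₚ.m+n∸n≡m n (13 ℕ.* n)))) ⟩
      0# + c₂ + c₃ + c₂
        ≈⟨ solve 2 (λ a b → ♯ 0 :+ a :+ b :+ a := ♯ 2 :* a :+ b) refl c₂ c₃ ⟩
      ιₙ 2 * c₂ + c₃ ∎))
      where
      s = 2 ℕ.* M ℕ.+ 2 ℕ.* n
      14n : s ≡ 14 ℕ.* n
      14n = ≡.trans (≡.cong (λ m → 2 ℕ.* m ℕ.+ 2 ℕ.* n) M≡6n) (ℕS.solve 1 (λ n → ℕS.con 2 ℕS.:* (ℕS.con 6 ℕS.:* n) ℕS.:+ ℕS.con 2 ℕS.:* n ℕS.:= ℕS.con 14 ℕS.:* n) ≡.refl n)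
      7n : 1 ℕ.* M ℕ.+ n ≡ 7 ℕ.* n
      7n = ≡.trans (≡.cong (λ m → 1 ℕ.* m ℕ.+ n) M≡6n) (ℕS.solve 1 (λ n → ℕS.con 1 ℕS.:* (ℕS.con 6 ℕS.:* n) ℕS.:+ n ℕS.:= ℕS.con 7 ℕS.:* n) ≡.refl n)
      13n : 2 ℕ.* M ℕ.+ n ≡ 13 ℕ.* n
      13n = ≡.trans (≡.cong (λ m → 2 ℕ.* m ℕ.+ n) M≡6n) (ℕS.solve 1 (λ n → ℕS.con 2 ℕS.:* (ℕS.con 6 ℕS.:* n) ℕS.:+ n ℕS.:= ℕS.con 13 ℕS.:* n) ≡.refl n)

    M-value : ιₙ M ≈ ιₙ 6 * x - 1#
    M-value = trans (solve 1 (λ m → m := ♯ 1 :+ m :- ♯ 1) refl _) (+-congʳ (trans (sym (ιₙ-suc M)) (sym 6x≈p)))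

    3K : ιₙ 3 * ιₙ K ≈ ιₙ 36 * x * x - 1#
    3K = begin
      ιₙ 3 * ιₙ K                               ≈⟨ *-congˡ (trans (ιₙ-* (2 ℕ.* n) (suc p)) (*-cong (ιₙ-* 2 n) (trans (ιₙ-suc p) (+-congˡ (sym 6x≈p))))) ⟩
      ιₙ 3 * (ιₙ 2 * N * (1# + ιₙ 6 * x))       ≈⟨ solve 2 (λ n x → ♯ 3 :* (♯ 2 :* n :* (♯ 1 :+ ♯ 6 :* x)) := (♯ 6 :* n) :* (♯ 1 :+ ♯ 6 :* x)) refl N x ⟩
      (ιₙ 6 * N) * (1# + ιₙ 6 * x)              ≈⟨ *-congʳ 6N ⟩
      (ιₙ 6 * x - 1#) * (1# + ιₙ 6 * x)         ≈⟨ solve 1 (λ x → (♯ 6 :* x :- ♯ 1) :* (♯ 1 :+ ♯ 6 :* x) := ♯ 36 :* x :* x :- ♯ 1) refl x ⟩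
      ιₙ 36 * x * x - 1#                        ∎

    a₁ a₂ : Carrier
    a₁ = ιₙ 2 * q₀ - ιₙ 36 * q₀ * x - ιₙ 864 * q₀ * x * x + ιₙ 12 * q₁ * x - ιₙ 216 * q₁ * x * x + ιₙ 36 * q₂ * x * x
    a₂ = - (ιₙ 288 * h * q₀ * x * x) + ιₙ 64 * q₀ - ιₙ 2304 * q₀ * x - ιₙ 86400 * q₀ * x * x + ιₙ 768 * q₁ * x - ιₙ 27648 * q₁ * x * x + ιₙ 4608 * q₂ * x * x

    X₁≈a₁ : ιₙ 2 * (ιₙ 2 * c₁ * F) ≈ a₁
    X₁≈a₁ = trans X₁-value (mod-x³ (solve 4 (λ x q0 q1 q2 →
        (♯ 1 :- ♯ 18 :* x :- ♯ 432 :* x :* x) :* (♯ 2 :* q0 :+ ♯ 2 :* q1 :* (♯ 6 :* x) :+ q2 :* ((♯ 6 :* x) :* (♯ 6 :* x)))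
        := ♯ 2 :* q0 :- ♯ 36 :* q0 :* x :- ♯ 864 :* q0 :* x :* x :+ ♯ 12 :* q1 :* x :- ♯ 216 :* q1 :* x :* x :+ ♯ 36 :* q2 :* x :* x
           :+ x :* x :* x :* (:- (♯ 5184 :* q1) :- ♯ 648 :* q2 :- ♯ 15552 :* q2 :* x)) refl x q₀ q₁ q₂))

    X₂≈a₂ : ιₙ 64 * ((ιₙ 2 * c₂ + c₃) * F) ≈ a₂
    X₂≈a₂ = trans X₂-value (mod-x³ (solve 5 (λ x h q0 q1 q2 →
        (♯ 32 :- ♯ 144 :* h :* x :* x :- ♯ 1152 :* x :- ♯ 43200 :* x :* x) :* (♯ 2 :* q0 :+ ♯ 2 :* q1 :* (♯ 12 :* x) :+ q2 :* ((♯ 12 :* x) :* (♯ 12 :* x)))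
        := :- (♯ 288 :* h :* q0 :* x :* x) :+ ♯ 64 :* q0 :- ♯ 2304 :* q0 :* x :- ♯ 86400 :* q0 :* x :* x :+ ♯ 768 :* q1 :* x :- ♯ 27648 :* q1 :* x :* x :+ ♯ 4608 :* q2 :* x :* x
           :+ x :* x :* x :* (:- (♯ 3456 :* h :* q1) :- ♯ 20736 :* h :* q2 :* x :- ♯ 1036800 :* q1 :- ♯ 165888 :* q2 :- ♯ 6220800 :* q2 :* x)) refl x h q₀ q₁ q₂))

    -- The nodes q = 0, 1, 2 carry Q(0), Q(6x), Q(12x) with their corrections, and K is -1/3 up to a
    -- multiple of x^2. Interpolation therefore lands on Q(-2x), with 1 - x^2 h₂ as the remaining
    -- correction; everything else is a multiple of x^3.
    interpolated : (ιₙ 6 * x - 1#) * (ιₙ 576 * (ιₙ 2 * q₀) + ιₙ 192 * (ιₙ 36 * x * x - 1#) * (a₁ - ιₙ 2 * q₀)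
        + (ιₙ 36 * x * x - 1#) * (ιₙ 36 * x * x - ιₙ 4) * (a₂ - ιₙ 64 * a₁ + ιₙ 32 * (ιₙ 2 * q₀)))
      ≈ - (ιₙ 576 * (1# - x * x * h) * 2Q (- (ιₙ 2 * x)))
    interpolated = mod-x³ (solve 5 (λ x h q0 q1 q2 →
      let a1 = ♯ 2 :* q0 :- ♯ 36 :* q0 :* x :- ♯ 864 :* q0 :* x :* x :+ ♯ 12 :* q1 :* x :- ♯ 216 :* q1 :* x :* x :+ ♯ 36 :* q2 :* x :* x
          a2 = :- (♯ 288 :* h :* q0 :* x :* x) :+ ♯ 64 :* q0 :- ♯ 2304 :* q0 :* x :- ♯ 86400 :* q0 :* x :* x :+ ♯ 768 :* q1 :* x :- ♯ 27648 :* q1 :* x :* x :+ ♯ 4608 :* q2 :* x :* x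
          y = :- (♯ 2 :* x) in
      (♯ 6 :* x :- ♯ 1) :* (♯ 576 :* (♯ 2 :* q0) :+ ♯ 192 :* (♯ 36 :* x :* x :- ♯ 1) :* (a1 :- ♯ 2 :* q0)
        :+ (♯ 36 :* x :* x :- ♯ 1) :* (♯ 36 :* x :* x :- ♯ 4) :* (a2 :- ♯ 64 :* a1 :+ ♯ 32 :* (♯ 2 :* q0)))
      := :- (♯ 576 :* (♯ 1 :- x :* x :* h) :* (♯ 2 :* q0 :+ ♯ 2 :* q1 :* y :+ q2 :* (y :* y)))
         :+ x :* x :* x :* (:- (♯ 6912 :* h :* q0) :- ♯ 51840 :* h :* q0 :* x :+ ♯ 311040 :* h :* q0 :* x :* x :+ ♯ 373248 :* h :* q0 :* x :* x :* x :- ♯ 2239488 :* h :* q0 :* x :* x :* x :* x :+ ♯ 2304 :* h :* q1 :- ♯ 2304 :* h :* q2 :* x :+ ♯ 497664 :* q0 :- ♯ 1119744 :* q0 :* x :- ♯ 2239488 :* q0 :* x :* x :+ ♯ 40310784 :* q0 :* x :* x :* x :- ♯ 241864704 :* q0 :* x :* x :* x :* x :- ♯ 165888 :* q1 :- ♯ 497664 :* q1 :* x :+ ♯ 5971968 :* q1 :* x :* x :+ ♯ 17915904 :* q1 :* x :* x :* x :- ♯ 107495424 :* q1 :* x :* x :* x :* x :+ ♯ 13824 :* q2 :+ ♯ 165888 :* q2 :* x :- ♯ 995328 :* q2 :* x :* x :- ♯ 2985984 :* q2 :* x :* x :* x :+ ♯ 17915904 :* q2 :* x :* x :* x :* x))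 refl x h q₀ q₁ q₂)

    J-value : J * F ≈ - (sgn * (1# - x * x * h) * Q (- (ιₙ 2 * x)))
    -- 1152 = 2 · 9 · 64: the 2 is that of Newton's formula, 9 clears the denominators of K, and 64
    -- is the scale of `X₂≈a₂`.
    J-value = unit-cancel unit-1152 (begin
      ιₙ 1152 * (J * F)
        ≈⟨ solve 2 (λ j f → ♯ 1152 :* (j :* f) := ♯ 576 :* (♯ 2 :* j) :* f) refl J F ⟩
      ιₙ 576 * (ιₙ 2 * J) * F
        ≈⟨ *-congʳ (*-congˡ (trans J-newton (+-cong (+-cong (*-congˡ f₀-value) (*-congˡ (+-cong f₁-value (-‿cong f₀-value))))
             (*-congˡ (+-cong (+-cong f₂-value (-‿cong (*-congˡ f₁-value))) f₀-value))))) ⟩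
      ιₙ 576 * (ιₙ 2 * (m * c₀) + ιₙ 2 * k * (m * (ιₙ 2 * c₁) - m * c₀) + k * (k - 1#) * (m * (ιₙ 2 * c₂ + c₃) - ιₙ 2 * (m * (ιₙ 2 * c₁)) + m * c₀)) * F
        ≈⟨ solve 6 (λ m k c₀ c₁ e F → ♯ 576 :* (♯ 2 :* (m :* c₀) :+ ♯ 2 :* k :* (m :* (♯ 2 :* c₁) :- m :* c₀) :+ k :* (k :- ♯ 1) :* (m :* e :- ♯ 2 :* (m :* (♯ 2 :* c₁)) :+ m :* c₀)) :* F
             := m :* (♯ 576 :* (♯ 2 :* (c₀ :* F)) :+ ♯ 192 :* (♯ 3 :* k) :* (♯ 2 :* (♯ 2 :* c₁ :* F) :- ♯ 2 :* (c₀ :* F))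
                  :+ (♯ 3 :* k) :* (♯ 3 :* k :- ♯ 3) :* (♯ 64 :* (e :* F) :- ♯ 64 :* (♯ 2 :* (♯ 2 :* c₁ :* F)) :+ ♯ 32 :* (♯ 2 :* (c₀ :* F))))) refl m k c₀ c₁ (ιₙ 2 * c₂ + c₃) F ⟩
      m * (ιₙ 576 * (ιₙ 2 * (c₀ * F)) + ιₙ 192 * (ιₙ 3 * k) * (ιₙ 2 * (ιₙ 2 * c₁ * F) - ιₙ 2 * (c₀ * F))
         + (ιₙ 3 * k) * (ιₙ 3 * k - ιₙ 3) * (ιₙ 64 * ((ιₙ 2 * c₂ + c₃) * F) - ιₙ 64 * (ιₙ 2 * (ιₙ 2 * c₁ * F)) + ιₙ 32 * (ιₙ 2 * (c₀ * F))))
        ≈⟨ *-cong (*-congʳ M-value) (+-cong (+-cong (*-congˡ X₀) (*-cong (*-congˡ 3K) (+-cong X₁≈a₁ (-‿cong X₀))))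
             (*-cong (*-cong 3K (trans (+-congʳ 3K) (solve 1 (λ a → a :- ♯ 1 :- ♯ 3 := a :- ♯ 4) refl _))) (+-cong (+-cong X₂≈a₂ (-‿cong (*-congˡ X₁≈a₁))) (*-congˡ X₀)))) ⟩
      (ιₙ 6 * x - 1#) * sgn * b
        ≈⟨ solve 3 (λ a s b → a :* s :* b := s :* (a :* b)) refl _ _ _ ⟩
      sgn * ((ιₙ 6 * x - 1#) * b)
        ≈⟨ *-congˡ interpolated ⟩
      sgn * (- (ιₙ 576 * (1# - x * x * h) * 2Q (- (ιₙ 2 * x))))
        ≈⟨ *-congˡ (-‿cong (*-congˡ (Q-expand _ -2x³))) ⟨
      sgn * (- (ιₙ 576 * (1# - x * x * h) * (ιₙ 2 * Q (- (ιₙ 2 * x)))))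
        ≈⟨ solve 3 (λ s a q → s :* (:- (♯ 576 :* a :* (♯ 2 :* q))) := ♯ 1152 :* (:- (s :* a :* q))) refl _ _ _ ⟩
      ιₙ 1152 * - (sgn * (1# - x * x * h) * Q (- (ιₙ 2 * x))) ∎)
      where
      m = ιₙ M * sgn
      k = ιₙ K
      b = ιₙ 576 * (ιₙ 2 * q₀) + ιₙ 192 * (ιₙ 36 * x * x - 1#) * (a₁ - ιₙ 2 * q₀)
        + (ιₙ 36 * x * x - 1#) * (ιₙ 36 * x * x - ιₙ 4) * (a₂ - ιₙ 64 * a₁ + ιₙ 32 * (ιₙ 2 * q₀))
      X₀ : ιₙ 2 * (c₀ * F) ≈ ιₙ 2 * q₀
      X₀ = *-congˡ c₀-value
      unit-1152 : Unit (ιₙ 1152)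
      unit-1152 = unit-cong (solve 0 (♯ 6 :* ♯ 6 :* (♯ 2 :* ♯ 2 :* (♯ 2 :* ♯ 2 :* ♯ 2)) := ♯ 1152) refl)
        (unit-* (unit-* unit-6 unit-6) (unit-* (unit-* unit-2 unit-2) (unit-* (unit-* unit-2 unit-2) unit-2)))
      -2x³ : - (ιₙ 2 * x) * - (ιₙ 2 * x) * - (ιₙ 2 * x) ≈ 0#
      -2x³ = trans (solve 1 (λ x → :- (♯ 2 :* x) :* :- (♯ 2 :* x) :* :- (♯ 2 :* x) := (x :* x :* x) :* (:- (♯ 8))) refl x) (trans (*-congʳ x³≈0) (zeroˡ _))

    -- As x^3 = 0, the cubic product is n!^3, the product of the x^2 - i^2 is (-1)^n n!^2 (1 - x^2
    -- h₂), and the product over 2n factors is L Q(-2x). So the hypothesis says that y n! is the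
    -- negative of `J-value`.
    J-closed-form : ∀ y →
      y * (Π< n (λ i → ιₙ (suc i) - ιₙ 2 * x) * Π< n (λ i → ιₙ (suc i) * ιₙ (suc i) * ιₙ (suc i) + x * x * x))
        ≈ Π< n (λ i → x * x - ιₙ (suc i) * ιₙ (suc i)) * Π< (2 ℕ.* n) (λ i → ιₙ (suc i) - ιₙ 2 * x) →
      J ≈ - y
    J-closed-form y hyp = unit-cancel (unit-* unit-L (unit-* unit-F (unit-* unit-F unit-F))) (begin
      L * (F * (F * F)) * J
        ≈⟨ solve 3 (λ L F J → L :* (F :* (F :* F)) :* J := L :* (F :* F) :* (J :* F)) refl L F J ⟩
      L * (F * F) * (J * F)
        ≈⟨ *-congˡ J-value ⟩
      L * (F * F) * - (sgn * (1# - x * x * h) * Q z)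
        ≈⟨ solve 5 (λ L F s a q → L :* (F :* F) :* (:- (s :* a :* q)) := :- ((s :* (F :* F :* a)) :* (L :* q))) refl L F sgn (1# - x * x * h) (Q z) ⟩
      - ((sgn * (F * F * (1# - x * x * h))) * (L * Q z))
        ≈⟨ -‿cong (*-cong (sym squares) (sym L-split)) ⟩
      - (Π< n (λ i → x * x - ιₙ (suc i) * ιₙ (suc i)) * Π< (2 ℕ.* n) (λ i → ιₙ (suc i) - ιₙ 2 * x))
        ≈⟨ -‿cong hyp ⟨
      - (y * (L * Π< n (λ i → ιₙ (suc i) * ιₙ (suc i) * ιₙ (suc i) + x * x * x)))
        ≈⟨ -‿cong (*-congˡ (*-congˡ cubes)) ⟩
      - (y * (L * (F * (F * F))))
        ≈⟨ solve 2 (λ a y → :- (y :* a) := a :* (:- y)) refl _ _ ⟩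
      L * (F * (F * F)) * - y ∎)
      where
      z = - (ιₙ 2 * x)
      L = Π< n (λ i → ιₙ (suc i) - ιₙ 2 * x)
      unit-F : Unit F
      unit-F = unit-fact n (ℕₚ.<⇒≤ n<M)
      unit-L : Unit L
      unit-L = Π-unit n (λ i i<n → unit-≡ₚ (unit-small i (ℕₚ.<-trans i<n n<M)) p∣2x)
        where
        p∣2x : ∀ {s} → pR ∣ʳ s - ιₙ 2 * x - s
        p∣2x {s} = ∣ʳ-resp (solve 2 (λ s x → :- (♯ 2 :* x) := s :- ♯ 2 :* x :- s) refl s x) (∣ʳ-neg (∣ʳ-*ˡ (ιₙ 2) p∣x))
          where
          p∣x : pR ∣ʳ x
          p∣x = proj₁ unit-6 , (begin
            x                               ≈⟨ trans (sym (*-identityʳ _)) (*-congˡ (sym (proj₂ unit-6))) ⟩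
            x * (ιₙ 6 * proj₁ unit-6)       ≈⟨ solve 3 (λ x s u → x :* (s :* u) := (s :* x) :* u) refl _ _ _ ⟩
            ιₙ 6 * x * proj₁ unit-6         ≈⟨ *-congʳ 6x≈p ⟩
            pR * proj₁ unit-6 ∎)
      cubes : Π< n (λ i → ιₙ (suc i) * ιₙ (suc i) * ιₙ (suc i) + x * x * x) ≈ F * (F * F)
      cubes = trans (Π-cong n (λ i _ → trans (+-congˡ x³≈0) (trans (+-identityʳ _) (*-assoc _ _ _)))) (trans (Π-* n _ _) (*-congˡ (Π-* n _ _)))
      squares : Π< n (λ i → x * x - ιₙ (suc i) * ιₙ (suc i)) ≈ sgn * (F * F * (1# - x * x * h))
      squares = go n (ℕₚ.<⇒≤ n<M)
        where
        go : ∀ k → k ℕ.≤ M → Π< k (λ i → x * x - ιₙ (suc i) * ιₙ (suc i)) ≈ (- 1#) ^ k * (fact k * fact k * (1# - x * x * h₂ k))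
        go zero _ = solve 1 (λ x → ♯ 1 := ♯ 1 :* (♯ 1 :* ♯ 1 :* (♯ 1 :- x :* x :* ♯ 0))) refl x
        go (suc k) k<M = begin
          _ * (x * x - s * s)
            ≈⟨ *-cong (go k (ℕₚ.<⇒≤ k<M)) factor ⟩
          (- 1#) ^ k * (fact k * fact k * (1# - x * x * h₂ k)) * - (s * s * (1# - x * x * (v * v)))
            ≈⟨ mod-x³ (solve 6 (λ g f x h s v → g :* (f :* f :* (♯ 1 :- x :* x :* h)) :* (:- (s :* s :* (♯ 1 :- x :* x :* (v :* v))))
                 := :- (♯ 1) :* g :* ((f :* s) :* (f :* s) :* (♯ 1 :- x :* x :* (h :+ v :* v))) :+ x :* x :* x :* (:- (x :* h :* v :* v :* g :* (f :* s) :* (f :* s)))) refl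
                 ((- 1#) ^ k) (fact k) x (h₂ k) s v) ⟩
          (- 1#) ^ suc k * (fact (suc k) * fact (suc k) * (1# - x * x * h₂ (suc k))) ∎
          where
          s = ιₙ (suc k)
          v = iv k
          factor : x * x - s * s ≈ - (s * s * (1# - x * x * (v * v)))
          factor = sym (trans (solve 3 (λ s x v → :- (s :* s :* (♯ 1 :- x :* x :* (v :* v))) := x :* x :* ((s :* v) :* (s :* v)) :- s :* s) refl s x v)
            (+-congʳ (trans (*-congˡ (trans (*-cong (iv-inv k k<M) (iv-inv k k<M)) (*-identityˡ _))) (*-identityʳ _))))
      L-split : Π< (2 ℕ.* n) (λ i → ιₙ (suc i) - ιₙ 2 * x) ≈ L * Q z
      L-split = trans (reflexive (≡.cong (λ k → Π< k (λ i → ιₙ (suc i) - ιₙ 2 * x)) (≡.cong (n ℕ.+_) (ℕₚ.+-identityʳ n)))) (Π-split n n _)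

-- The ring of Eisenstein integers.

module EisensteinIntegers where
  open import Data.Integer.Solver using (module +-*-Solver)
  open +-*-Solver
  open import Relation.Binary.PropositionalEquality using (_≡_; refl; cong; cong₂; isEquivalence)

  -- ⟨ a , b ⟩ stands for a + b ω with ω² + ω + 1 = 0.
  record Eisenstein : Set where
    no-eta-equality
    pattern
    constructor ⟨_,_⟩
    field re im : ℤ
  open Eisenstein public

  infixl 6 _⊕_
  infixl 7 _⊗_
  _⊕_ _⊗_ : Eisenstein → Eisenstein → Eisenstein
  ⟨ a , b ⟩ ⊕ ⟨ c , d ⟩ = ⟨ a ℤ.+ c , b ℤ.+ d ⟩
  ⟨ a , b ⟩ ⊗ ⟨ c , d ⟩ = ⟨ a ℤ.* c ℤ.- b ℤ.* d , a ℤ.* d ℤ.+ b ℤ.* c ℤ.- b ℤ.* d ⟩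

  ⊖_ : Eisenstein → Eisenstein
  ⊖ ⟨ a , b ⟩ = ⟨ ℤ.- a , ℤ.- b ⟩

  ⊗-comm : ∀ x y → x ⊗ y ≡ y ⊗ x
  ⊗-comm ⟨ a , b ⟩ ⟨ c , d ⟩ = cong₂ ⟨_,_⟩
    (solve 4 (λ a b c d → a :* c :- b :* d := c :* a :- d :* b) refl a b c d)
    (solve 4 (λ a b c d → a :* d :+ b :* c :- b :* d := c :* b :+ d :* a :- d :* b) refl a b c d)

  ⊗-assoc : ∀ x y z → (x ⊗ y) ⊗ z ≡ x ⊗ (y ⊗ z)
  ⊗-assoc ⟨ a , b ⟩ ⟨ c , d ⟩ ⟨ e , f ⟩ = cong₂ ⟨_,_⟩
    (solve 6 (λ a b c d e f → (a :* c :- b :* d) :* e :- (a :* d :+ b :* c :- b :* d) :* f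
      := a :* (c :* e :- d :* f) :- b :* (c :* f :+ d :* e :- d :* f)) refl a b c d e f)
    (solve 6 (λ a b c d e f → (a :* c :- b :* d) :* f :+ (a :* d :+ b :* c :- b :* d) :* e :- (a :* d :+ b :* c :- b :* d) :* f
      := a :* (c :* f :+ d :* e :- d :* f) :+ b :* (c :* e :- d :* f) :- b :* (c :* f :+ d :* e :- d :* f)) refl a b c d e f)

  ⊗-identityˡ : ∀ x → ⟨ + 1 , + 0 ⟩ ⊗ x ≡ x
  ⊗-identityˡ ⟨ a , b ⟩ = cong₂ ⟨_,_⟩
    (solve 2 (λ a b → con (+ 1) :* a :- con (+ 0) :* b := a) refl a b)
    (solve 2 (λ a b → con (+ 1) :* b :+ con (+ 0) :* a :- con (+ 0) :* b := b) refl a b)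

  ⊗-distribˡ : ∀ x y z → x ⊗ (y ⊕ z) ≡ x ⊗ y ⊕ x ⊗ z
  ⊗-distribˡ ⟨ a , b ⟩ ⟨ c , d ⟩ ⟨ e , f ⟩ = cong₂ ⟨_,_⟩
    (solve 6 (λ a b c d e f → a :* (c :+ e) :- b :* (d :+ f) := (a :* c :- b :* d) :+ (a :* e :- b :* f)) refl a b c d e f)
    (solve 6 (λ a b c d e f → a :* (d :+ f) :+ b :* (c :+ e) :- b :* (d :+ f)
      := (a :* d :+ b :* c :- b :* d) :+ (a :* f :+ b :* e :- b :* f)) refl a b c d e f)

  eisenstein : CommutativeRing 0ℓ 0ℓ
  eisenstein = record
    { Carrier = Eisenstein ; _≈_ = _≡_ ; _+_ = _⊕_ ; _*_ = _⊗_ ; -_ = ⊖_ ; 0# = ⟨ + 0 , + 0 ⟩ ; 1# = ⟨ + 1 , + 0 ⟩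
    ; isCommutativeRing = record
      { isRing = record
        { +-isAbelianGroup = record
          { isGroup = record
            { isMonoid = record
              { isSemigroup = record
                { isMagma = record { isEquivalence = isEquivalence ; ∙-cong = cong₂ _⊕_ }
                ; assoc = λ { ⟨ a , b ⟩ ⟨ c , d ⟩ ⟨ e , f ⟩ → cong₂ ⟨_,_⟩ (ℤₚ.+-assoc a c e) (ℤₚ.+-assoc b d f) } }
              ; identity = (λ { ⟨ a , b ⟩ → cong₂ ⟨_,_⟩ (ℤₚ.+-identityˡ a) (ℤₚ.+-identityˡ b) })
                         , (λ { ⟨ a , b ⟩ → cong₂ ⟨_,_⟩ (ℤₚ.+-identityʳ a) (ℤₚ.+-identityʳ b) }) }
            ; inverse = (λ { ⟨ a , b ⟩ → cong₂ ⟨_,_⟩ (ℤₚ.+-inverseˡ a) (ℤₚ.+-inverseˡ b) })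
                      , (λ { ⟨ a , b ⟩ → cong₂ ⟨_,_⟩ (ℤₚ.+-inverseʳ a) (ℤₚ.+-inverseʳ b) })
            ; ⁻¹-cong = cong ⊖_ }
          ; comm = λ { ⟨ a , b ⟩ ⟨ c , d ⟩ → cong₂ ⟨_,_⟩ (ℤₚ.+-comm a c) (ℤₚ.+-comm b d) } }
        ; *-cong = cong₂ _⊗_
        ; *-assoc = ⊗-assoc
        ; *-identity = ⊗-identityˡ , λ x → Relation.Binary.PropositionalEquality.trans (⊗-comm x _) (⊗-identityˡ x)
        ; distrib = ⊗-distribˡ , λ x y z → Relation.Binary.PropositionalEquality.trans (⊗-comm (y ⊕ z) x)
            (Relation.Binary.PropositionalEquality.trans (⊗-distribˡ x y z) (cong₂ _⊕_ (⊗-comm x y) (⊗-comm x z))) }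
      ; *-comm = ⊗-comm } }

  conjᴱ : Eisenstein → Eisenstein
  conjᴱ ⟨ a , b ⟩ = ⟨ a ℤ.- b , ℤ.- b ⟩

  conjᴱ-* : ∀ x y → conjᴱ (x ⊗ y) ≡ conjᴱ x ⊗ conjᴱ y
  conjᴱ-* ⟨ a , b ⟩ ⟨ c , d ⟩ = cong₂ ⟨_,_⟩
    (solve 4 (λ a b c d → (a :* c :- b :* d) :- (a :* d :+ b :* c :- b :* d) := (a :- b) :* (c :- d) :- (:- b) :* (:- d)) refl a b c d)
    (solve 4 (λ a b c d → :- (a :* d :+ b :* c :- b :* d) := (a :- b) :* (:- d) :+ (:- b) :* (c :- d) :- (:- b) :* (:- d)) refl a b c d)

  conjᴱ-+ : ∀ x y → conjᴱ (x ⊕ y) ≡ conjᴱ x ⊕ conjᴱ y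
  conjᴱ-+ ⟨ a , b ⟩ ⟨ c , d ⟩ = cong₂ ⟨_,_⟩
    (solve 4 (λ a b c d → (a :+ c) :- (b :+ d) := (a :- b) :+ (c :- d)) refl a b c d)
    (solve 2 (λ b d → :- (b :+ d) := (:- b) :+ (:- d)) refl b d)

  norm : Eisenstein → ℤ
  norm ⟨ a , b ⟩ = a ℤ.* a ℤ.- a ℤ.* b ℤ.+ b ℤ.* b

  norm-conjᴱ : ∀ x → x ⊗ conjᴱ x ≡ ⟨ norm x , + 0 ⟩
  norm-conjᴱ ⟨ a , b ⟩ = cong₂ ⟨_,_⟩
    (solve 2 (λ a b → a :* (a :- b) :- b :* (:- b) := a :* a :- a :* b :+ b :* b) refl a b)
    (solve 2 (λ a b → a :* (:- b) :+ b :* (a :- b) :- b :* (:- b) := con (+ 0)) refl a b)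

  -- 1 + ω = -ω^2, a primitive sixth root of unity.
  ζ : Eisenstein
  ζ = ⟨ + 1 , + 1 ⟩

  _≟ᴱ_ : ∀ (x y : Eisenstein) → Dec (x ≡ y)
  ⟨ a , b ⟩ ≟ᴱ ⟨ c , d ⟩ with a ℤₚ.≟ c | b ℤₚ.≟ d
  ... | yes refl | yes refl = yes refl
  ... | no h | _ = no (λ { refl → h refl })
  ... | yes _ | no h = no (λ { refl → h refl })

  module E = RingKit eisenstein

-- The sextic residue character modulo p.

module SexticCharacter {c ℓ} (R : CommutativeRing c ℓ) (M : ℕ) (p-prime : Prime (suc M)) (Λ : CubeNilpotent R (suc M))
  (n′ : ℕ) (M≡6n : M ≡ 6 ℕ.* suc n′)
  (ρ : ℤ) (ρ-root : PrimeModulus._≅_ (suc M) p-prime (ρ ℤ.* ρ ℤ.- ρ ℤ.+ + 1) (+ 0)) where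
  private
    module R = RingKit R
  private
    p n : ℕ
    p = suc M
    n = suc n′


  open EisensteinIntegers
  open E using (_^_; Σ<; Π<; Σ-+; Σ-*ˡ; Σ-neg; Σ-cong; Σ-const; ∣ʳ-Σ; _∣ʳ_; ∣ʳ-+; ^-homo-*; 1^n≈1; ^-distrib-*; unit-cancel; Unit; ιₙ; ^-assocʳ) 
  open PrimeModulus p p-prime
  module S = ResidueSums eisenstein p p-prime
  open S using (Character; χ; χ-periodic; χ-*; χ-1; χ-0; _·_; jacobi; Nontrivial; χ-zero; χ-recip; conj; Σₚ)
  open Teichmüller R M p-prime Λ
  open TeichmüllerSums R M p-prime Λ n′ M≡6n using (tsum; tsum-2n-zero; kn<M; even-sign) renaming (J to Jᴿ)
  open import Data.Integer.Solver using (module +-*-Solver)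
  open +-*-Solver using (solve; _:=_; _:+_; _:*_; _:-_; :-_; con)
  open import Data.Fin as Fin using (Fin; toℕ)
  open import Data.Fin.Properties using (all?; any?)
  open import Relation.Nullary.Decidable using (toWitness; _×-dec_; _⊎-dec_)
  open ≡ using (refl; sym; trans; cong; cong₂; subst)

  -- The six units

  u : Fin 6 → Eisenstein
  u i = ζ ^ toℕ i

  abstract
    u-* : ∀ i j → ∃ λ k → u i ⊗ u j ≡ u k
    u-* = toWitness {a? = all? (λ i → all? (λ j → any? (λ k → (u i ⊗ u j) ≟ᴱ u k)))} tt

    -- Distinct units differ by an element of norm between 1 and 4. The norm is therefore prime to p
    -- ≥ 7 and nonzero, which serves both for injectivity of reduction modulo p and for cancellation
    -- in `nontrivial`.
    u-distinct : ∀ i j → u i ≡ u j ⊎ (∃ λ (k : Fin 4) → norm (u i ⊕ ⊖ u j) ≡ + suc (toℕ k))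
    u-distinct = toWitness {a? = all? (λ i → all? (λ j → (u i ≟ᴱ u j) ⊎-dec any? (λ k → norm (u i ⊕ ⊖ u j) ℤₚ.≟ + suc (toℕ k))))} tt

    u-conj : ∀ i → u i ⊗ conjᴱ (u i) ≡ ⟨ + 1 , + 0 ⟩
    u-conj = toWitness {a? = all? (λ i → (u i ⊗ conjᴱ (u i)) ≟ᴱ ⟨ + 1 , + 0 ⟩)} tt

  -- Reduction modulo p, sending ζ to ρ

  h₀ : Eisenstein → ℤ
  h₀ ⟨ a , b ⟩ = a ℤ.+ b ℤ.* (ρ ℤ.- + 1)

  h₀-* : ∀ x y → h₀ (x ⊗ y) ≅ h₀ x ℤ.* h₀ y
  h₀-* ⟨ a , b ⟩ ⟨ c , d ⟩ = ≅-sym (≅-trans (≅-reflexive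
      (solve 5 (λ a b c d r → (a :+ b :* (r :- con (+ 1))) :* (c :+ d :* (r :- con (+ 1)))
        := (a :* c :- b :* d) :+ (a :* d :+ b :* c :- b :* d) :* (r :- con (+ 1)) :+ b :* d :* (r :* r :- r :+ con (+ 1))) refl a b c d ρ))
    (≅-trans (≅-+ (≅-refl {h₀ (⟨ a , b ⟩ ⊗ ⟨ c , d ⟩)}) (≅-* (≅-refl {b ℤ.* d}) ρ-root))
      (≅-reflexive (solve 2 (λ h k → h :+ k :* con (+ 0) := h) refl (h₀ (⟨ a , b ⟩ ⊗ ⟨ c , d ⟩)) (b ℤ.* d)))))

  h₀-ζ^ : ∀ k → h₀ (ζ ^ k) ≅ ρ ℤ.^ k
  h₀-ζ^ zero = ≅-refl
  h₀-ζ^ (suc k) = ≅-trans (h₀-* ζ (ζ ^ k)) (≅-* (≅-reflexive (solve 1 (λ r → con (+ 1) :+ con (+ 1) :* (r :- con (+ 1)) := r) refl ρ)) (h₀-ζ^ k))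

  p≥7 : 7 ℕ.≤ p
  p≥7 = ℕ.s≤s (subst (6 ℕ.≤_) (sym M≡6n) (ℕₚ.m≤m*n 6 n))

  h₀-injective : ∀ i j → h₀ (u i) ≅ h₀ (u j) → u i ≡ u j
  h₀-injective i j e with u-distinct i j
  ... | inj₁ h = h
  ... | inj₂ (k , h) = ⊥-elim (¬p∣small (suc (toℕ k)) (ℕ.s≤s ℕ.z≤n)
          (ℕₚ.≤-<-trans (ℕ.s≤s (ℕₚ.<⇒≤ (Data.Fin.Properties.toℕ<n k))) (ℕₚ.≤-trans (ℕ.s≤s (ℕ.s≤s (ℕ.s≤s (ℕ.s≤s (ℕ.s≤s (ℕ.s≤s ℕ.z≤n)))))) p≥7))
          (subst (+ p ∣ᶻ_) h (≅0⇒∣ norm≅0)))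
    where
    d = u i ⊕ ⊖ u j
    hd : h₀ d ≅ + 0
    hd = ≅-trans (≅-reflexive (linear (u i) (u j))) (≅-trans (≅-- e (≅-refl {h₀ (u j)})) (≅-reflexive (ℤₚ.+-inverseʳ (h₀ (u j)))))
      where
      linear : ∀ x y → h₀ (x ⊕ ⊖ y) ≡ h₀ x ℤ.- h₀ y
      linear ⟨ a , b ⟩ ⟨ c , d ⟩ = solve 5 (λ a b c d r → (a :+ :- c) :+ (b :+ :- d) :* r := (a :+ b :* r) :- (c :+ d :* r)) refl a b c d (ρ ℤ.- + 1)
    norm≅0 : norm d ≅ + 0
    norm≅0 = ≅-trans (≅-reflexive (solve 2 (λ a r → a := a :+ con (+ 0) :* r) refl (norm d) (ρ ℤ.- + 1)))
      (≅-trans (≅-reflexive (cong h₀ (sym (norm-conjᴱ d)))) (≅-trans (h₀-* d (conjᴱ d))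
        (≅-trans (≅-* hd (≅-refl {h₀ (conjᴱ d)})) (≅-reflexive (ℤₚ.*-zeroˡ (h₀ (conjᴱ d)))))))

  -- Sixth roots of unity modulo p are powers of ρ.

  root-cases : ∀ w → w ℤ.^ 6 ≅ + 1 → ∃ λ (i : Fin 6) → h₀ (u i) ≅ w
  root-cases w h = find (euclid (a ℤ.* b) (e₁ ℤ.* e₂) (≅0⇒∣ (≅-trans factored (≅⇒0 h))))
    where
    ≅⇒0 : ∀ {x} → x ≅ + 1 → x ℤ.- + 1 ≅ + 0
    ≅⇒0 k = ≅-- k (≅-refl {+ 1})
    a = w ℤ.- + 1
    b = w ℤ.+ + 1
    e₁ = (w ℤ.- ρ) ℤ.* (w ℤ.+ ρ)
    e₂ = (w ℤ.- (ρ ℤ.- + 1)) ℤ.* (w ℤ.+ (ρ ℤ.- + 1))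
    factored : a ℤ.* b ℤ.* (e₁ ℤ.* e₂) ≅ w ℤ.^ 6 ℤ.- + 1
    factored = ≅-trans (≅-reflexive (solve 2 (λ w r → let s = r :* r :- r :+ con (+ 1) ; w2 = w :* w in
         (w :- con (+ 1)) :* (w :+ con (+ 1)) :* ((w :- r) :* (w :+ r) :* ((w :- (r :- con (+ 1))) :* (w :+ (r :- con (+ 1)))))
         := (w :* (w :* (w :* (w :* (w :* (w :* con (+ 1)))))) :- con (+ 1)) :+ s :* ((w2 :- con (+ 1)) :* (r :* r :- r :- con (+ 1) :- con (+ 2) :* w2)))
         refl w ρ))
      (≅-trans (≅-+ (≅-refl {w ℤ.^ 6 ℤ.- + 1}) (≅-* ρ-root (≅-refl {e}))) (≅-reflexive (solve 2 (λ x y → x :+ con (+ 0) :* y := x) refl (w ℤ.^ 6 ℤ.- + 1) e)))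
      where e = (w ℤ.* w ℤ.- + 1) ℤ.* (ρ ℤ.* ρ ℤ.- ρ ℤ.- + 1 ℤ.- + 2 ℤ.* (w ℤ.* w))
    pick : ∀ i {z} → h₀ (u i) ≡ z → + p ∣ᶻ w ℤ.- z → ∃ λ i → h₀ (u i) ≅ w
    pick i e k = i , ≅-trans (≅-reflexive e) (≅-sym (≅-from k))
    find : + p ∣ᶻ a ℤ.* b ⊎ + p ∣ᶻ e₁ ℤ.* e₂ → ∃ λ i → h₀ (u i) ≅ w
    find (inj₁ k) with euclid a b k
    ... | inj₁ l = pick Fin.zero refl l
    ... | inj₂ l = pick (Fin.suc (Fin.suc (Fin.suc Fin.zero))) refl l
    find (inj₂ k) with euclid e₁ e₂ k
    ... | inj₁ l with euclid (w ℤ.- ρ) (w ℤ.+ ρ) l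
    ...   | inj₁ m = pick (Fin.suc Fin.zero) (solve 1 (λ r → con (+ 1) :+ con (+ 1) :* (r :- con (+ 1)) := r) refl ρ) m
    ...   | inj₂ m = pick (Fin.suc (Fin.suc (Fin.suc (Fin.suc Fin.zero)))) (solve 1 (λ r → con -[1+ 0 ] :+ con -[1+ 0 ] :* (r :- con (+ 1)) := :- r) refl ρ)
                       (subst (+ p ∣ᶻ_) (cong (ℤ._+_ w) (sym (ℤₚ.neg-involutive ρ))) m)
    find (inj₂ k) | inj₂ l with euclid (w ℤ.- (ρ ℤ.- + 1)) (w ℤ.+ (ρ ℤ.- + 1)) l
    ...   | inj₁ m = pick (Fin.suc (Fin.suc Fin.zero)) (solve 1 (λ r → con (+ 0) :+ con (+ 1) :* (r :- con (+ 1)) := r :- con (+ 1)) refl ρ) m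
    ...   | inj₂ m = pick (Fin.suc (Fin.suc (Fin.suc (Fin.suc (Fin.suc Fin.zero))))) (solve 1 (λ r → con (+ 0) :+ con -[1+ 0 ] :* (r :- con (+ 1)) := :- (r :- con (+ 1))) refl ρ)
                       (subst (+ p ∣ᶻ_) (cong (ℤ._+_ w) (sym (ℤₚ.neg-involutive (ρ ℤ.- + 1)))) m)

  z^n-root : ∀ z → ¬ (+ p ∣ᶻ z) → (z ℤ.^ n) ℤ.^ 6 ≅ + 1
  z^n-root z h = ≅-trans (≅-reflexive (trans (ℤₚ.^-*-assoc z n 6) (cong (ℤ._^_ z) (trans (ℕₚ.*-comm n 6) (sym M≡6n)))))
    (ι≡ₚ⇒≅ (≡ₚ-trans (≡ₚ-refl (RingBinomials.ι-^ R z M)) (fermat-unit h)))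

  index : ∀ z → ¬ (+ p ∣ᶻ z) → ∃ λ i → h₀ (u i) ≅ z ℤ.^ n
  index z h = root-cases (z ℤ.^ n) (z^n-root z h)

  -- The power residue symbol: the sixth root of unity whose reduction, with ζ sent to ρ, is z^n
  -- with n = (p-1)/6.
  θ-value : ℤ → Eisenstein
  θ-value z with + p ℤD.∣? z
  ... | yes _ = ⟨ + 0 , + 0 ⟩
  ... | no h = u (proj₁ (index z h))

  θ-zero : ∀ {z} → + p ∣ᶻ z → θ-value z ≡ ⟨ + 0 , + 0 ⟩
  θ-zero {z} h with + p ℤD.∣? z
  ... | yes _ = refl
  ... | no k = ⊥-elim (k h)

  θ-unit : ∀ {z} → ¬ (+ p ∣ᶻ z) → ∃ λ i → θ-value z ≡ u i × h₀ (u i) ≅ z ℤ.^ n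
  θ-unit {z} h with + p ℤD.∣? z
  ... | yes k = ⊥-elim (h k)
  ... | no k = proj₁ (index z k) , refl , proj₂ (index z k)

  θ-determined : ∀ {z} i → ¬ (+ p ∣ᶻ z) → h₀ (u i) ≅ z ℤ.^ n → θ-value z ≡ u i
  θ-determined {z} i h e with θ-unit h
  ... | j , eq , k = trans eq (h₀-injective j i (≅-trans k (≅-sym e)))

  ¬p∣* : ∀ {a b} → ¬ (+ p ∣ᶻ a) → ¬ (+ p ∣ᶻ b) → ¬ (+ p ∣ᶻ a ℤ.* b)
  ¬p∣* {a} {b} ha hb h with euclid a b h
  ... | inj₁ k = ha k
  ... | inj₂ k = hb k

  ^-distribℤ : ∀ a b k → (a ℤ.* b) ℤ.^ k ≡ a ℤ.^ k ℤ.* b ℤ.^ k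
  ^-distribℤ a b zero = refl
  ^-distribℤ a b (suc k) = trans (cong (ℤ._*_ (a ℤ.* b)) (^-distribℤ a b k))
    (solve 4 (λ a b c d → (a :* b) :* (c :* d) := (a :* c) :* (b :* d)) refl a b (a ℤ.^ k) (b ℤ.^ k))

  θ : Character
  θ = record
    { χ = θ-value
    ; χ-periodic = λ {a} {b} h → periodic a b h (+ p ℤD.∣? a)
    ; χ-* = λ a b → mult a b (+ p ℤD.∣? a) (+ p ℤD.∣? b)
    ; χ-1 = θ-determined Fin.zero ¬p∣1 (≅-trans (h₀-ζ^ 0) (≅-reflexive (sym (ℤₚ.^-zeroˡ n))))
    ; χ-0 = θ-zero (ℤD.divides (+ 0) refl)
    }
    where
    periodic : ∀ a b → a ≅ b → Dec (+ p ∣ᶻ a) → θ-value a ≡ θ-value b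
    periodic a b e (yes h) = trans (θ-zero h) (sym (θ-zero (≅0⇒∣ (≅-trans (≅-sym e) (∣⇒≅0 h)))))
    periodic a b e (no h) with θ-unit h
    ... | i , eq , k = trans eq (sym (θ-determined i (λ l → h (≅0⇒∣ (≅-trans e (∣⇒≅0 l)))) (≅-trans k (≅-^ n e))))
    mult : ∀ a b → Dec (+ p ∣ᶻ a) → Dec (+ p ∣ᶻ b) → θ-value (a ℤ.* b) ≡ θ-value a ⊗ θ-value b
    mult a b (yes h) _ = trans (θ-zero (ℤD.∣m⇒∣m*n b h)) (sym (trans (cong (_⊗ θ-value b) (θ-zero h)) (E.zeroˡ (θ-value b))))
    mult a b (no _) (yes h) = trans (θ-zero (ℤD.∣n⇒∣m*n a h)) (sym (trans (cong (θ-value a ⊗_) (θ-zero h)) (E.zeroʳ (θ-value a))))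
    mult a b (no ha) (no hb) with θ-unit ha | θ-unit hb
    ... | i , ei , ki | j , ej , kj with u-* i j
    ... | k , ek = trans (θ-determined k (¬p∣* ha hb) (≅-trans (≅-reflexive (cong h₀ (sym ek))) (≅-trans (h₀-* (u i) (u j))
             (≅-trans (≅-* ki kj) (≅-reflexive (sym (^-distribℤ a b n))))))) (trans (sym ek) (cong₂ _⊗_ (sym ei) (sym ej)))

-- Jacobi sums of powers of the sextic character: norms, congruences, p-adic images.

module SexticJacobi {c ℓ} (R : CommutativeRing c ℓ) (M : ℕ) (p-prime : Prime (suc M)) (Λ : CubeNilpotent R (suc M))
  (n′ : ℕ) (M≡6n : M ≡ 6 ℕ.* suc n′)
  (ρ : ℤ) (ρ-root : PrimeModulus._≅_ (suc M) p-prime (ρ ℤ.* ρ ℤ.- ρ ℤ.+ + 1) (+ 0)) where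
  open CubeNilpotent Λ using (p³≈0; unit-ι; ι-reflects)
  private
    module R = RingKit R
  private
    p n : ℕ
    p = suc M
    n = suc n′


  open EisensteinIntegers
  open E using (_^_)
  open PrimeModulus p p-prime
  module S = ResidueSums eisenstein p p-prime
  open S using (Character; χ; χ-periodic; χ-*; χ-1; χ-0; _·_; jacobi; Nontrivial; χ-zero; χ-recip; conj; Σₚ; δ)
  module RS = ResidueSums R p p-prime
  open Teichmüller R M p-prime Λ
  open TeichmüllerSums R M p-prime Λ n′ M≡6n using (tsum; tsum-2n-zero; kn<M; even-sign) renaming (J to Jᴿ)
  open SexticCharacter R M p-prime Λ n′ M≡6n ρ ρ-root hiding (module S)
  open import Data.Integer.Solver using (module +-*-Solver)
  open +-*-Solver using (solve; _:=_; _:+_; _:*_; _:-_; :-_; con)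
  open import Data.Fin as Fin using (Fin; toℕ)
  open import Data.Fin.Properties using (all?; any?)
  open import Relation.Nullary.Decidable using (toWitness; _×-dec_; _⊎-dec_; _→-dec_)
  open ≡ using (refl; sym; trans; cong; cong₂; subst)
  open ≡.≡-Reasoning

  ιₙ-re : ∀ k → E.ιₙ k ≡ ⟨ + k , + 0 ⟩
  ιₙ-re zero = refl
  ιₙ-re (suc k) = trans (E.ιₙ-suc k) (cong (⟨ + 1 , + 0 ⟩ ⊕_) (ιₙ-re k))

  -- Powers of θ

  θ^ : ℕ → Character
  θ^ zero = θ
  θ^ (suc k) = θ · θ^ k

  θ^-value : ∀ k z → χ (θ^ k) z ≡ χ θ z ^ suc k
  θ^-value zero z = sym (E.*-identityʳ (χ θ z))
  θ^-value (suc k) z = cong (χ θ z ⊗_) (θ^-value k z)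

  θ^-unit : ∀ k {z} → ¬ (+ p ∣ᶻ z) → ∃ λ i → χ (θ^ k) z ≡ u i × h₀ (u i) ≅ (z ℤ.^ n) ℤ.^ suc k
  θ^-unit zero {z} h with θ-unit h
  ... | i , e , l = i , e , ≅-trans l (≅-reflexive (sym (ℤₚ.*-identityʳ (z ℤ.^ n))))
  θ^-unit (suc k) h with θ-unit h | θ^-unit k h
  ... | i , ei , li | j , ej , lj with u-* i j
  ... | l , e = l , trans (cong₂ _⊗_ ei ej) e , ≅-trans (≅-reflexive (cong h₀ (sym e))) (≅-trans (h₀-* (u i) (u j)) (≅-* li lj))

  cancel-integer : ∀ k x → ⟨ + suc k , + 0 ⟩ ⊗ x ≡ ⟨ + 0 , + 0 ⟩ → x ≡ ⟨ + 0 , + 0 ⟩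
  cancel-integer k ⟨ a , b ⟩ h = cong₂ ⟨_,_⟩
    (cancel a (trans (solve 3 (λ s a b → s :* a := s :* a :- con (+ 0) :* b) refl (+ suc k) a b) (cong re h)))
    (cancel b (trans (solve 3 (λ s a b → s :* b := s :* b :+ con (+ 0) :* a :- con (+ 0) :* b) refl (+ suc k) a b) (cong im h)))
    where
    cancel : ∀ z → + suc k ℤ.* z ≡ + 0 → z ≡ + 0
    cancel z e with ℤₚ.i*j≡0⇒i≡0∨j≡0 (+ suc k) e
    ... | inj₂ f = f

  -- Translation by g gives X(g) V = V for the sum V. Multiplying X(g) - 1 by its conjugate yields a
  -- positive integer that annihilates V, and the Eisenstein integers are torsion free.
  nontrivial : ∀ (X : Character) g i → ¬ (+ p ∣ᶻ g) → χ X g ≡ u i → ¬ (u i ≡ ⟨ + 1 , + 0 ⟩) → Nontrivial X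
  nontrivial X g i ¬g Xg u≢1 with u-distinct i Fin.zero
  ... | inj₁ e = ⊥-elim (u≢1 e)
  ... | inj₂ (k , e) = cancel-integer (toℕ k) V (begin
      ⟨ + suc (toℕ k) , + 0 ⟩ ⊗ V          ≡⟨ cong (_⊗ V) (trans (cong (λ m → ⟨ m , + 0 ⟩) (sym e)) (sym (norm-conjᴱ d))) ⟩
      d ⊗ conjᴱ d ⊗ V                      ≡⟨ cong (_⊗ V) (⊗-comm d (conjᴱ d)) ⟩
      conjᴱ d ⊗ d ⊗ V                      ≡⟨ ⊗-assoc (conjᴱ d) d V ⟩
      conjᴱ d ⊗ (d ⊗ V)                    ≡⟨ cong (conjᴱ d ⊗_) dV ⟩
      conjᴱ d ⊗ ⟨ + 0 , + 0 ⟩              ≡⟨ E.zeroʳ (conjᴱ d) ⟩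
      ⟨ + 0 , + 0 ⟩                        ∎)
    where
    V = Σₚ (χ X)
    d = u i ⊕ ⊖ ⟨ + 1 , + 0 ⟩
    shift : u i ⊗ V ≡ V
    shift = begin
      u i ⊗ V                                   ≡⟨ cong (_⊗ V) (sym Xg) ⟩
      χ X g ⊗ V                                 ≡⟨ E.Σ-*ˡ p (χ X g) _ ⟨
      Σₚ (λ z → χ X g ⊗ χ X z)                  ≡⟨ E.Σ-cong p (λ z _ → trans (sym (χ-* X g (+ z))) (cong (χ X) (sym (ℤₚ.+-identityʳ (g ℤ.* + z))))) ⟩
      Σₚ (λ z → χ X (g ℤ.* z ℤ.+ + 0))          ≡⟨ S.reindex-affine (χ X) g (+ 0) (χ-periodic X) ¬g ⟩
      V                                         ∎
    dV : d ⊗ V ≡ ⟨ + 0 , + 0 ⟩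
    dV = begin
      d ⊗ V                                     ≡⟨ E.distribʳ V (u i) _ ⟩
      u i ⊗ V ⊕ (⊖ ⟨ + 1 , + 0 ⟩) ⊗ V           ≡⟨ cong₂ _⊕_ shift (trans (sym (E.-‿distribˡ-* ⟨ + 1 , + 0 ⟩ V)) (cong ⊖_ (⊗-identityˡ V))) ⟩
      V ⊕ ⊖ V                                   ≡⟨ E.-‿inverseʳ V ⟩
      ⟨ + 0 , + 0 ⟩                             ∎

  witness : ∀ k → suc k ℕ.< 6 → ∃ λ g → ¬ (+ p ∣ᶻ g) × ¬ ((g ℤ.^ n) ℤ.^ suc k ≅ + 1)
  witness k k<6 with nonroot (suc k ℕ.* n) (ℕ.s≤s ℕ.z≤n) (kn<M (suc k) k<6)
  ... | g , ¬g , unit = g , ¬g , λ e → nonunit unit (≡ₚ-trans (≡ₚ-refl (R.trans (R.reflexive (cong (R._^_ (R.ι g)) (ℕₚ.*-comm (suc k) n)))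
        (R.trans (R.sym (RingBinomials.ι-^ R g (n ℕ.* suc k))) (R.reflexive (cong R.ι (sym (ℤₚ.^-*-assoc g n (suc k)))))))) (≅⇒≡ₚ e))

  u≢1 : ∀ i {w} → h₀ (u i) ≅ w → ¬ (w ≅ + 1) → ¬ (u i ≡ ⟨ + 1 , + 0 ⟩)
  u≢1 i hw ¬w e = ¬w (≅-trans (≅-sym hw) (≅-reflexive (cong h₀ e)))

  θ^-nontrivial : ∀ k → suc k ℕ.< 6 → Nontrivial (θ^ k)
  θ^-nontrivial k k<6 = nontrivial (θ^ k) g (proj₁ v) ¬g (proj₁ (proj₂ v)) (u≢1 (proj₁ v) (proj₂ (proj₂ v)) (proj₂ (proj₂ (witness k k<6))))
    where
    g = proj₁ (witness k k<6)
    ¬g = proj₁ (proj₂ (witness k k<6))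
    v = θ^-unit k ¬g

  -- `θ^ k` has exponent k + 1, hence the indices 1 and 4.
  θ² θ⁵ : Character
  θ² = θ^ 1
  θ⁵ = θ^ 4

  abstract
    u⁷ : ∀ i → (u i ^ 5) ⊗ (u i ^ 2) ≡ u i
    u⁷ = toWitness {a? = all? (λ i → ((u i ^ 5) ⊗ (u i ^ 2)) ≟ᴱ u i)} tt

  θ⁷-nontrivial : Nontrivial (θ⁵ · θ²)
  θ⁷-nontrivial = nontrivial (θ⁵ · θ²) g i ¬g
      (trans (cong₂ _⊗_ (trans (θ^-value 4 g) (cong (_^ 5) e)) (trans (θ^-value 1 g) (cong (_^ 2) e))) (u⁷ i))
      (u≢1 i (proj₂ (proj₂ v)) (λ k → proj₂ (proj₂ w) (≅-trans (≅-reflexive (ℤₚ.*-identityʳ (g ℤ.^ n))) k)))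
    where
    w = witness 0 (ℕ.s≤s (ℕ.s≤s ℕ.z≤n))
    g = proj₁ w
    ¬g = proj₁ (proj₂ w)
    v = θ-unit ¬g
    i = proj₁ v
    e = proj₁ (proj₂ v)

  -- θ⁴ = θ² · θ² up to the bracketing of θ^ 3.
  θ²θ²-nontrivial : Nontrivial (θ² · θ²)
  θ²θ²-nontrivial = trans (E.Σ-cong p (λ z _ → ⊗-assoc (χ θ (+ z)) (χ θ (+ z)) (χ θ² (+ z)))) (θ^-nontrivial 3 (ℕ.s≤s (ℕ.s≤s (ℕ.s≤s (ℕ.s≤s (ℕ.s≤s ℕ.z≤n))))))

  -- Complex conjugation

  conj-θ : ∀ z → χ θ (recip z) ≡ conjᴱ (χ θ z)
  conj-θ z = go (+ p ℤD.∣? z)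
    where
    go : Dec (+ p ∣ᶻ z) → χ θ (recip z) ≡ conjᴱ (χ θ z)
    go (yes h) = trans (trans (cong (χ θ) (recip-zero h)) (χ-0 θ)) (cong conjᴱ (sym (χ-zero θ h)))
    go (no h) = E.unit-cancel {u i} (conjᴱ (u i) , u-conj i)
          (trans (trans (cong (_⊗ χ θ (recip z)) (sym e)) (χ-recip θ h)) (trans (sym (u-conj i)) (cong (λ w → u i ⊗ conjᴱ w) (sym e))))
      where
      i = proj₁ (θ-unit h)
      e = proj₁ (proj₂ (θ-unit h))

  conj-θ^ : ∀ k z → χ (θ^ k) (recip z) ≡ conjᴱ (χ (θ^ k) z)
  conj-θ^ zero z = conj-θ z
  conj-θ^ (suc k) z = trans (cong₂ _⊗_ (conj-θ z) (conj-θ^ k z)) (sym (conjᴱ-* (χ θ z) (χ (θ^ k) z)))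

  conj-Σ : ∀ m (f : ℕ → Eisenstein) → E.Σ< m (λ i → conjᴱ (f i)) ≡ conjᴱ (E.Σ< m f)
  conj-Σ zero f = refl
  conj-Σ (suc m) f = trans (cong (_⊕ conjᴱ (f m)) (conj-Σ m f)) (sym (conjᴱ-+ (E.Σ< m f) (f m)))

  conj-jacobi : ∀ j k → jacobi (conj (θ^ j)) (conj (θ^ k)) ≡ conjᴱ (jacobi (θ^ j) (θ^ k))
  conj-jacobi j k = trans (E.Σ-cong p (λ z _ → trans (cong₂ _⊗_ (conj-θ^ j (+ z)) (conj-θ^ k (+ 1 ℤ.- + z)))
      (sym (conjᴱ-* (χ (θ^ j) (+ z)) (χ (θ^ k) (+ 1 ℤ.- + z))))))
    (conj-Σ p (λ z → χ (θ^ j) (+ z) ⊗ χ (θ^ k) (+ 1 ℤ.- + z)))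

  -- The trace of `Jᴱ` is the number u sought. The cubic sum `Cᴱ` is an auxiliary: it is known
  -- modulo 3, and it agrees with `Jᴱ` modulo 2.
  Jᴱ Cᴱ : Eisenstein
  Jᴱ = jacobi θ⁵ θ²
  Cᴱ = jacobi θ² θ²

  norm-jacobi : ∀ j k → Nontrivial (θ^ j) → Nontrivial (θ^ k) → Nontrivial (θ^ j · θ^ k) → norm (jacobi (θ^ j) (θ^ k)) ≡ + p
  norm-jacobi j k hj hk hjk = cong re (begin
    ⟨ norm J , + 0 ⟩                                       ≡⟨ norm-conjᴱ J ⟨
    J ⊗ conjᴱ J                                            ≡⟨ cong (J ⊗_) (conj-jacobi j k) ⟨
    J ⊗ jacobi (conj (θ^ j)) (conj (θ^ k))                 ≡⟨ S.JacobiNorm.jacobi-norm (θ^ j) (θ^ k) hj hk hjk ⟩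
    E.ιₙ p                                                 ≡⟨ ιₙ-re p ⟩
    ⟨ + p , + 0 ⟩                                          ∎)
    where J = jacobi (θ^ j) (θ^ k)

  θ²-nontrivial : Nontrivial θ²
  θ²-nontrivial = θ^-nontrivial 1 (ℕ.s≤s (ℕ.s≤s (ℕ.s≤s ℕ.z≤n)))

  θ⁵-nontrivial : Nontrivial θ⁵
  θ⁵-nontrivial = θ^-nontrivial 4 (ℕ.s≤s (ℕ.s≤s (ℕ.s≤s (ℕ.s≤s (ℕ.s≤s (ℕ.s≤s ℕ.z≤n))))))

  norm-J : norm Jᴱ ≡ + p
  norm-J = norm-jacobi 4 1 θ⁵-nontrivial θ²-nontrivial θ⁷-nontrivial

  norm-C : norm Cᴱ ≡ + p
  norm-C = norm-jacobi 1 1 θ²-nontrivial θ²-nontrivial θ²θ²-nontrivial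

  -- Congruences modulo 2, 3 and 1 - ω

  infix 4 _∣ᴱ_ _∣ᴱ?_
  _∣ᴱ_ : ℤ → Eisenstein → Set
  d ∣ᴱ x = d ∣ᶻ re x × d ∣ᶻ im x

  _∣ᴱ?_ : ∀ d x → Dec (d ∣ᴱ x)
  d ∣ᴱ? x = (d ℤD.∣? re x) ×-dec (d ℤD.∣? im x)

  ∣ᴱ-⊗ : ∀ {d} x y → d ∣ᴱ x → d ∣ᴱ (x ⊗ y)
  ∣ᴱ-⊗ ⟨ _ , _ ⟩ ⟨ a , b ⟩ (h , k) = ℤD.∣m∣n⇒∣m-n (ℤD.∣m⇒∣m*n a h) (ℤD.∣m⇒∣m*n b k)
    , ℤD.∣m∣n⇒∣m-n (ℤD.∣m∣n⇒∣m+n (ℤD.∣m⇒∣m*n b h) (ℤD.∣m⇒∣m*n a k)) (ℤD.∣m⇒∣m*n b k)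

  ∣ᴱ-⊕ : ∀ {d} x y → d ∣ᴱ x → d ∣ᴱ y → d ∣ᴱ (x ⊕ y)
  ∣ᴱ-⊕ ⟨ _ , _ ⟩ ⟨ _ , _ ⟩ (h , k) (h′ , k′) = ℤD.∣m∣n⇒∣m+n h h′ , ℤD.∣m∣n⇒∣m+n k k′

  ∣ᴱ-Σ : ∀ {d} m (f : ℕ → Eisenstein) → (∀ i → d ∣ᴱ f i) → d ∣ᴱ E.Σ< m f
  ∣ᴱ-Σ zero f h = ℤD.divides (+ 0) refl , ℤD.divides (+ 0) refl
  ∣ᴱ-Σ (suc m) f h = ∣ᴱ-⊕ (E.Σ< m f) (f m) (∣ᴱ-Σ m f h) (h m)

  ∣ᴱ-0 : ∀ {d} → d ∣ᴱ ⟨ + 0 , + 0 ⟩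
  ∣ᴱ-0 = ℤD.divides (+ 0) refl , ℤD.divides (+ 0) refl

  abstract
    u-mod-2 : ∀ i → + 2 ∣ᴱ ((u i ^ 5) ⊕ ⊖ (u i ^ 2))
    u-mod-2 = toWitness {a? = all? (λ i → + 2 ∣ᴱ? ((u i ^ 5) ⊕ ⊖ (u i ^ 2)))} tt

    u-mod-3 : ∀ i j → + 3 ∣ᴱ ((u i ^ 2 ⊕ ⊖ ⟨ + 1 , + 0 ⟩) ⊗ (u j ^ 2 ⊕ ⊖ ⟨ + 1 , + 0 ⟩))
    u-mod-3 = toWitness {a? = all? (λ i → all? (λ j → + 3 ∣ᴱ? ((u i ^ 2 ⊕ ⊖ ⟨ + 1 , + 0 ⟩) ⊗ (u j ^ 2 ⊕ ⊖ ⟨ + 1 , + 0 ⟩))))} tt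

    -- 1 - ω has conjugate 2 + ω and norm 3.
    u-mod-√-3 : ∀ i → + 3 ∣ᴱ (⟨ + 2 , + 1 ⟩ ⊗ (u i ^ 2 ⊕ ⊖ ⟨ + 1 , + 0 ⟩))
    u-mod-√-3 = toWitness {a? = all? (λ i → + 3 ∣ᴱ? (⟨ + 2 , + 1 ⟩ ⊗ (u i ^ 2 ⊕ ⊖ ⟨ + 1 , + 0 ⟩)))} tt

  -- A sixth root of unity has cube 1 or -1, so θ^5 and θ^2 agree modulo 2 term by term.
  J≡C-mod-2 : + 2 ∣ᴱ (Jᴱ ⊕ ⊖ Cᴱ)
  J≡C-mod-2 = subst (+ 2 ∣ᴱ_) (trans (E.Σ-cong p (λ z _ → E.distribʳ (χ θ² (+ 1 ℤ.- + z)) (χ θ⁵ (+ z)) (⊖ χ θ² (+ z))))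
      (trans (E.Σ-+ p _ _) (cong (Jᴱ ⊕_) (trans (E.Σ-cong p (λ z _ → sym (E.-‿distribˡ-* (χ θ² (+ z)) (χ θ² (+ 1 ℤ.- + z))))) (E.Σ-neg p _)))))
    (∣ᴱ-Σ p (λ z → (χ θ⁵ (+ z) ⊕ ⊖ χ θ² (+ z)) ⊗ χ θ² (+ 1 ℤ.- + z)) (λ z → ∣ᴱ-⊗ (χ θ⁵ (+ z) ⊕ ⊖ χ θ² (+ z)) (χ θ² (+ 1 ℤ.- + z)) (term (+ z) (+ p ℤD.∣? + z))))
    where
    term : ∀ z → Dec (+ p ∣ᶻ z) → + 2 ∣ᴱ (χ θ⁵ z ⊕ ⊖ χ θ² z)
    term z (yes h) = subst (+ 2 ∣ᴱ_) (sym (cong₂ (λ a b → a ⊕ ⊖ b) (χ-zero θ⁵ h) (χ-zero θ² h))) ∣ᴱ-0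
    term z (no h) = subst (+ 2 ∣ᴱ_) (sym (cong₂ (λ a b → a ⊕ ⊖ b) (trans (θ^-value 4 z) (cong (_^ 5) e)) (trans (θ^-value 1 z) (cong (_^ 2) e)))) (u-mod-2 (proj₁ (θ-unit h)))
      where e = proj₁ (proj₂ (θ-unit h))

  one : Eisenstein
  one = ⟨ + 1 , + 0 ⟩

  complement-zero : ∀ {z} → + p ∣ᶻ z → χ θ² (+ 1 ℤ.- z) ≡ one
  complement-zero {z} h = trans (χ-periodic θ² {+ 1 ℤ.- z} {+ 1} (≅-trans (≅-- (≅-refl {+ 1}) (∣⇒≅0 h)) (≅-reflexive refl))) (χ-1 θ²)

  -- For z other than 0 and 1 both θ^2(z) - 1 and θ^2(1-z) - 1 are multiples of √-3, so their
  -- product is divisible by 3; at z = 0 and z = 1 one factor is zero. Expanded and summed, the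
  -- products give C + p, since the linear parts sum to zero.
  C≡-p-mod-3 : + 3 ∣ᴱ (Cᴱ ⊕ ⟨ + p , + 0 ⟩)
  C≡-p-mod-3 = subst (+ 3 ∣ᴱ_) total (∣ᴱ-Σ p (λ z → (a z ⊕ ⊖ one) ⊗ (b z ⊕ ⊖ one)) (λ z → term (+ z) (+ p ℤD.∣? + z) (+ p ℤD.∣? (+ 1 ℤ.- + z))))
    where
    a b : ℕ → Eisenstein
    a z = χ θ² (+ z)
    b z = χ θ² (+ 1 ℤ.- + z)
    term : ∀ z → Dec (+ p ∣ᶻ z) → Dec (+ p ∣ᶻ (+ 1 ℤ.- z)) → + 3 ∣ᴱ ((χ θ² z ⊕ ⊖ one) ⊗ (χ θ² (+ 1 ℤ.- z) ⊕ ⊖ one))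
    term z (yes h) _ = subst (+ 3 ∣ᴱ_) (sym (trans (cong (λ w → (χ θ² z ⊕ ⊖ one) ⊗ (w ⊕ ⊖ one)) (complement-zero h)) (E.zeroʳ _))) ∣ᴱ-0
    term z (no h) (yes k) = subst (+ 3 ∣ᴱ_) (sym (trans (cong (λ w → (w ⊕ ⊖ one) ⊗ (χ θ² (+ 1 ℤ.- z) ⊕ ⊖ one)) z1) (E.zeroˡ _))) ∣ᴱ-0
      where
      z1 : χ θ² z ≡ one
      z1 = trans (χ-periodic θ² {z} {+ 1} (≅-sym {+ 1} {z} (≅-from k))) (χ-1 θ²)
    term z (no h) (no k) = subst (+ 3 ∣ᴱ_) (sym (cong₂ (λ x y → (x ⊕ ⊖ one) ⊗ (y ⊕ ⊖ one)) (trans (θ^-value 1 z) (cong (_^ 2) ei))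
            (trans (θ^-value 1 (+ 1 ℤ.- z)) (cong (_^ 2) ej)))) (u-mod-3 (proj₁ (θ-unit h)) (proj₁ (θ-unit k)))
      where
      ei = proj₁ (proj₂ (θ-unit h))
      ej = proj₁ (proj₂ (θ-unit k))
    Σb : E.Σ< p b ≡ ⟨ + 0 , + 0 ⟩
    Σb = trans (E.Σ-cong p (λ z _ → cong (χ θ²) (solve 1 (λ z → con (+ 1) :- z := con -[1+ 0 ] :* z :+ con (+ 1)) refl (+ z))))
      (trans (S.reindex-affine (χ θ²) -[1+ 0 ] (+ 1) (χ-periodic θ²) (λ h → ¬p∣1 (ℤD.∣m⇒∣-m h))) θ²-nontrivial)
    total : E.Σ< p (λ z → (a z ⊕ ⊖ one) ⊗ (b z ⊕ ⊖ one)) ≡ Cᴱ ⊕ ⟨ + p , + 0 ⟩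
    total = begin
      E.Σ< p (λ z → (a z ⊕ ⊖ one) ⊗ (b z ⊕ ⊖ one))
        ≡⟨ E.Σ-cong p (λ z _ → E.solve 2 (λ a b → (a E.:- E.♯ 1) E.:* (b E.:- E.♯ 1) E.:= (a E.:* b E.:+ E.♯ 1) E.:+ E.:- (a E.:+ b)) refl (a z) (b z)) ⟩
      E.Σ< p (λ z → (a z ⊗ b z ⊕ one) ⊕ ⊖ (a z ⊕ b z))
        ≡⟨ trans (E.Σ-+ p _ _) (cong₂ _⊕_ (E.Σ-+ p _ _) (trans (E.Σ-neg p _) (cong ⊖_ (E.Σ-+ p a b)))) ⟩
      (Cᴱ ⊕ E.Σ< p (λ _ → one)) ⊕ ⊖ (E.Σ< p a ⊕ E.Σ< p b)
        ≡⟨ cong₂ (λ v w → (Cᴱ ⊕ v) ⊕ ⊖ w) (trans (E.Σ-const p one) (trans (E.*-identityʳ _) (ιₙ-re p))) (cong₂ _⊕_ θ²-nontrivial Σb) ⟩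
      (Cᴱ ⊕ ⟨ + p , + 0 ⟩) ⊕ ⊖ (⟨ + 0 , + 0 ⟩ ⊕ ⟨ + 0 , + 0 ⟩)
        ≡⟨ E.+-identityʳ _ ⟩
      Cᴱ ⊕ ⟨ + p , + 0 ⟩ ∎

  -- θ^2(1-z) is 1 modulo √-3 except at z = 1, where it is 0 and `δ` makes up the difference.
  -- Summing against θ^5(z) turns J + θ^5(1) minus the vanishing sum of θ^5 into a multiple of √-3.
  -- Divisibility by 1 - ω is tested by multiplying with its conjugate 2 + ω and dividing by 3.
  J≡-1-mod-√-3 : + 3 ∣ᴱ (⟨ + 2 , + 1 ⟩ ⊗ (Jᴱ ⊕ one))
  J≡-1-mod-√-3 = subst (+ 3 ∣ᴱ_) total (∣ᴱ-Σ p (λ z → (⟨ + 2 , + 1 ⟩ ⊗ (b z ⊕ (δ (+ 1) (+ z) ⊕ ⊖ one))) ⊗ a z) (λ z → ∣ᴱ-⊗ (⟨ + 2 , + 1 ⟩ ⊗ (b z ⊕ (δ (+ 1) (+ z) ⊕ ⊖ one))) (a z) (term (+ z) (+ p ℤD.∣? (+ 1 ℤ.- + z)))))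
    where
    a b : ℕ → Eisenstein
    a z = χ θ⁵ (+ z)
    b z = χ θ² (+ 1 ℤ.- + z)
    term : ∀ z → Dec (+ p ∣ᶻ (+ 1 ℤ.- z)) → + 3 ∣ᴱ (⟨ + 2 , + 1 ⟩ ⊗ (χ θ² (+ 1 ℤ.- z) ⊕ (δ (+ 1) z ⊕ ⊖ one)))
    term z (yes h) = subst (+ 3 ∣ᴱ_) (sym (cong₂ (λ v w → ⟨ + 2 , + 1 ⟩ ⊗ (v ⊕ (w ⊕ ⊖ one))) (χ-zero θ² h) (S.δ-yes {+ 1} {z} (≅-from h)))) ∣ᴱ-0
    term z (no h) = subst (+ 3 ∣ᴱ_) (sym (cong₂ (λ v w → ⟨ + 2 , + 1 ⟩ ⊗ (v ⊕ (w ⊕ ⊖ one))) (trans (θ^-value 1 (+ 1 ℤ.- z)) (cong (_^ 2) e))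
            (S.δ-no {+ 1} {z} (λ k → h (≅⇒∣ k))))) (u-mod-√-3 (proj₁ (θ-unit h)))
      where e = proj₁ (proj₂ (θ-unit h))
    total : E.Σ< p (λ z → (⟨ + 2 , + 1 ⟩ ⊗ (b z ⊕ (δ (+ 1) (+ z) ⊕ ⊖ one))) ⊗ a z) ≡ ⟨ + 2 , + 1 ⟩ ⊗ (Jᴱ ⊕ one)
    total = begin
      E.Σ< p (λ z → (⟨ + 2 , + 1 ⟩ ⊗ (b z ⊕ (δ (+ 1) (+ z) ⊕ ⊖ one))) ⊗ a z)
        ≡⟨ E.Σ-cong p (λ z _ → E.solve 4 (λ k a b d → (k E.:* (b E.:+ (d E.:- E.♯ 1))) E.:* a E.:= k E.:* ((a E.:* b E.:+ d E.:* a) E.:- a)) refl ⟨ + 2 , + 1 ⟩ (a z) (b z) (δ (+ 1) (+ z))) ⟩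
      E.Σ< p (λ z → ⟨ + 2 , + 1 ⟩ ⊗ ((a z ⊗ b z ⊕ δ (+ 1) (+ z) ⊗ a z) ⊕ ⊖ a z))
        ≡⟨ trans (E.Σ-*ˡ p _ _) (cong (⟨ + 2 , + 1 ⟩ ⊗_) (trans (E.Σ-+ p _ _) (cong₂ _⊕_ (E.Σ-+ p _ _) (E.Σ-neg p a)))) ⟩
      ⟨ + 2 , + 1 ⟩ ⊗ ((Jᴱ ⊕ Σₚ (λ z → δ (+ 1) z ⊗ χ θ⁵ z)) ⊕ ⊖ Σₚ (χ θ⁵))
        ≡⟨ cong₂ (λ v w → ⟨ + 2 , + 1 ⟩ ⊗ ((Jᴱ ⊕ v) ⊕ ⊖ w)) (trans (S.Σ-δ (+ 1) (χ θ⁵) (χ-periodic θ⁵)) (χ-1 θ⁵)) θ⁵-nontrivial ⟩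
      ⟨ + 2 , + 1 ⟩ ⊗ ((Jᴱ ⊕ one) ⊕ ⊖ ⟨ + 0 , + 0 ⟩)
        ≡⟨ cong (⟨ + 2 , + 1 ⟩ ⊗_) (E.+-identityʳ (Jᴱ ⊕ one)) ⟩
      ⟨ + 2 , + 1 ⟩ ⊗ (Jᴱ ⊕ one) ∎

  -- The embedding of ℤ[ω] into R, sending ζ to the Teichmüller representative of ρ

  Z Ω : R.Carrier
  Z = t ρ
  Ω = Z R.- R.1#

  -- Z^3 = t(ρ^3) = t(-1) = -1 because p is odd, and Z + 1 may be cancelled: p dividing ρ + 1 would
  -- have to divide 3.
  Z-root : Z R.* Z R.- Z R.+ R.1# R.≈ R.0#
  Z-root = R.unit-zero unit-Z+1 (R.begin
    (Z R.+ R.1#) R.* (Z R.* Z R.- Z R.+ R.1#)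
      R.≈⟨ R.solve 1 (λ z → (z R.:+ R.♯ 1) R.:* (z R.:* z R.:- z R.:+ R.♯ 1) R.:= z R.:* (z R.:* (z R.:* R.♯ 1)) R.:- R.:- R.♯ 1) R.refl Z ⟩
    Z R.^ 3 R.- R.- R.1#
      R.≈⟨ R.a≈b⇒a-b≈0 cube ⟩
    R.0# R.∎)
    where
    ρ³ : ρ ℤ.* (ρ ℤ.* ρ) ≅ -[1+ 0 ]
    ρ³ = ≅-trans (≅-reflexive (solve 1 (λ r → r :* (r :* r) := (r :+ con (+ 1)) :* (r :* r :- r :+ con (+ 1)) :+ con -[1+ 0 ]) refl ρ))
      (≅-trans (≅-+ (≅-* (≅-refl {ρ ℤ.+ + 1}) ρ-root) (≅-refl { -[1+ 0 ] })) (≅-reflexive (cong (ℤ._+ -[1+ 0 ]) (ℤₚ.*-zeroʳ (ρ ℤ.+ + 1)))))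
    odd : (R.- R.1#) R.^ p R.≈ R.- R.1#
    odd = R.trans (R.*-congˡ (R.trans (R.reflexive (cong (R._^_ (R.- R.1#)) (trans M≡6n (ℕₚ.*-assoc 2 3 n)))) (even-sign (3 ℕ.* n)))) (R.*-identityʳ _)
    cube : Z R.^ 3 R.≈ R.- R.1#
    cube = R.trans (R.*-congˡ (R.*-congˡ (R.*-identityʳ Z))) (R.trans (R.*-congˡ (R.sym (t-* ρ ρ)))
      (R.trans (R.sym (t-* ρ (ρ ℤ.* ρ))) (R.trans (t-periodic {ρ ℤ.* (ρ ℤ.* ρ)} { -[1+ 0 ] } ρ³) (R.trans (R.^-congˡ p odd) odd))))
    unit-Z+1 : R.Unit (Z R.+ R.1#)
    unit-Z+1 = unit-≡ₚ (unit-ι (ρ ℤ.+ + 1) ¬ρ+1) (≡ₚ-trans (≡ₚ-+ (t≡ι ρ) (≡ₚ-refl R.refl)) (≡ₚ-refl (R.sym (R.ι-+ ρ (+ 1)))))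
      where
      ¬ρ+1 : ¬ (+ p ∣ᶻ ρ ℤ.+ + 1)
      ¬ρ+1 h = ¬p∣small 3 (ℕ.s≤s ℕ.z≤n) (ℕₚ.≤-trans (ℕ.s≤s (ℕ.s≤s (ℕ.s≤s (ℕ.s≤s ℕ.z≤n)))) p≥7)
        (subst (+ p ∣ᶻ_) (solve 1 (λ r → (r :* r :- r :+ con (+ 1)) :+ (r :+ con (+ 1)) :* (con (+ 2) :- r) := con (+ 3)) refl ρ)
          (ℤD.∣m∣n⇒∣m+n (≅0⇒∣ ρ-root) (ℤD.∣m⇒∣m*n (+ 2 ℤ.- ρ) h)))

  hᴿ : Eisenstein → R.Carrier
  hᴿ ⟨ a , b ⟩ = R.ι a R.+ R.ι b R.* Ω

  hᴿ-+ : ∀ x y → hᴿ (x ⊕ y) R.≈ hᴿ x R.+ hᴿ y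
  hᴿ-+ ⟨ a , b ⟩ ⟨ c , d ⟩ = R.trans (R.+-cong (R.ι-+ a c) (R.*-congʳ (R.ι-+ b d)))
    (R.solve 5 (λ a b c d w → (a R.:+ c) R.:+ (b R.:+ d) R.:* w R.:= (a R.:+ b R.:* w) R.:+ (c R.:+ d R.:* w)) R.refl _ _ _ _ _)

  hᴿ-* : ∀ x y → hᴿ (x ⊗ y) R.≈ hᴿ x R.* hᴿ y
  hᴿ-* ⟨ a , b ⟩ ⟨ c , d ⟩ = R.trans (R.+-cong (ι-- (a ℤ.* c) (b ℤ.* d) (R.ι-* a c) (R.ι-* b d))
       (R.*-congʳ (ι-- (a ℤ.* d ℤ.+ b ℤ.* c) (b ℤ.* d) (R.trans (R.ι-+ (a ℤ.* d) (b ℤ.* c)) (R.+-cong (R.ι-* a d) (R.ι-* b c))) (R.ι-* b d))))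
    (R.≈-mod-zero (R.solve 5 (λ a b c d z → let w = z R.:- R.♯ 1 in
        (a R.:* c R.:- b R.:* d) R.:+ (a R.:* d R.:+ b R.:* c R.:- b R.:* d) R.:* w
        R.:= (a R.:+ b R.:* w) R.:* (c R.:+ d R.:* w) R.:+ (z R.:* z R.:- z R.:+ R.♯ 1) R.:* (R.:- (b R.:* d))) R.refl (R.ι a) (R.ι b) (R.ι c) (R.ι d) Z) Z-root)
    where
    ι-- : ∀ x y {v w} → R.ι x R.≈ v → R.ι y R.≈ w → R.ι (x ℤ.- y) R.≈ v R.- w
    ι-- x y e f = R.trans (R.ι-+ x (ℤ.- y)) (R.+-cong e (R.trans (R.ι-- y) (R.-‿cong f)))

  hᴿ-1 : hᴿ one R.≈ R.1#
  hᴿ-1 = R.solve 1 (λ w → R.♯ 1 R.:+ R.♯ 0 R.:* w R.:= R.♯ 1) R.refl Ω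

  hᴿ-Σ : ∀ m f → hᴿ (E.Σ< m f) R.≈ R.Σ< m (λ i → hᴿ (f i))
  hᴿ-Σ zero f = R.solve 1 (λ w → R.♯ 0 R.:+ R.♯ 0 R.:* w R.:= R.♯ 0) R.refl Ω
  hᴿ-Σ (suc m) f = R.trans (hᴿ-+ (E.Σ< m f) (f m)) (R.+-congʳ (hᴿ-Σ m f))

  hᴿ-^ : ∀ x k → hᴿ (x ^ k) R.≈ hᴿ x R.^ k
  hᴿ-^ x zero = hᴿ-1
  hᴿ-^ x (suc k) = R.trans (hᴿ-* x (x ^ k)) (R.*-congˡ (hᴿ-^ x k))

  t-^ : ∀ z k → t (z ℤ.^ k) R.≈ t z R.^ k
  t-^ z zero = t-1
  t-^ z (suc k) = R.trans (t-* z (z ℤ.^ k)) (R.*-congˡ (t-^ z k))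

  -- If θ(z) = ζ^i then ρ^i and z^n agree modulo p, and Teichmüller representatives see residues
  -- only. So the abstract Jacobi sums map to the p-adic ones.
  hᴿ-θ : ∀ z → hᴿ (χ θ z) R.≈ t z R.^ n
  hᴿ-θ z = go (+ p ℤD.∣? z)
    where
    go : Dec (+ p ∣ᶻ z) → hᴿ (χ θ z) R.≈ t z R.^ n
    go (yes h) = R.trans (R.reflexive (cong hᴿ (χ-zero θ h))) (R.trans (R.solve 1 (λ w → R.♯ 0 R.:+ R.♯ 0 R.:* w R.:= R.♯ 0) R.refl Ω)
      (R.sym (t^suc-zero n′ h)))
    go (no h) = R.begin
      hᴿ (χ θ z)                    R.≡⟨ cong hᴿ e ⟩
      hᴿ (ζ ^ toℕ i)                R.≈⟨ hᴿ-^ ζ (toℕ i) ⟩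
      hᴿ ζ R.^ toℕ i                R.≈⟨ R.^-congˡ (toℕ i) (R.solve 1 (λ z → R.♯ 1 R.:+ R.♯ 1 R.:* (z R.:- R.♯ 1) R.:= z) R.refl Z) ⟩
      t ρ R.^ toℕ i                 R.≈⟨ t-^ ρ (toℕ i) ⟨
      t (ρ ℤ.^ toℕ i)               R.≈⟨ t-periodic {ρ ℤ.^ toℕ i} {z ℤ.^ n} (≅-trans (≅-sym (h₀-ζ^ (toℕ i))) l) ⟩
      t (z ℤ.^ n)                   R.≈⟨ t-^ z n ⟩
      t z R.^ n                     R.∎
      where
      i = proj₁ (θ-unit h)
      e = proj₁ (proj₂ (θ-unit h))
      l = proj₂ (proj₂ (θ-unit h))

  hᴿ-θ^ : ∀ k z → hᴿ (χ (θ^ k) z) R.≈ t z R.^ (suc k ℕ.* n)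
  hᴿ-θ^ k z = R.trans (R.reflexive (cong hᴿ (θ^-value k z))) (R.trans (hᴿ-^ (χ θ z) (suc k)) (R.trans (R.^-congˡ (suc k) (hᴿ-θ z))
    (R.trans (R.^-assocʳ (t z) n (suc k)) (R.reflexive (cong (R._^_ (t z)) (ℕₚ.*-comm n (suc k)))))))

  hᴿ-jacobi : ∀ j k → hᴿ (jacobi (θ^ j) (θ^ k)) R.≈ RS.Σₚ (λ z → t z R.^ (suc j ℕ.* n) R.* t (+ 1 ℤ.- z) R.^ (suc k ℕ.* n))
  hᴿ-jacobi j k = R.trans (hᴿ-Σ p _) (R.Σ-cong p (λ z _ → R.trans (hᴿ-* (χ (θ^ j) (+ z)) (χ (θ^ k) (+ 1 ℤ.- + z))) (R.*-cong (hᴿ-θ^ j (+ z)) (hᴿ-θ^ k (+ 1 ℤ.- + z)))))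

  hᴿ-J : hᴿ Jᴱ R.≈ Jᴿ
  hᴿ-J = hᴿ-jacobi 4 1

  -- Modulo p, t(1-z) is 1 - t(z), so the image of C is congruent to the sum that `tsum-2n-zero`
  -- shows to vanish.
  hᴿ-C : pR R.∣ʳ hᴿ Cᴱ
  hᴿ-C = R.∣ʳ-resp (R.trans (R.+-congˡ (R.trans (R.-‿cong tsum-2n-zero) R.-0#≈0#)) (R.+-identityʳ _))
    (≡ₚ-trans (≡ₚ-refl (hᴿ-jacobi 1 1)) (≡ₚ-Σ p (λ z _ → ≡ₚ-* (≡ₚ-refl R.refl) (≡ₚ-^ (2 ℕ.* n)
      (≡ₚ-trans (t≡ι (+ 1 ℤ.- + z)) (≡ₚ-trans (≡ₚ-refl (R.trans (R.ι-+ (+ 1) (ℤ.- + z)) (R.+-congˡ (R.ι-- (+ z)))))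
        (≡ₚ-+ (≡ₚ-refl R.refl) (≡ₚ-neg (≡ₚ-sym (t≡ι (+ z)))))))))))

-- Elements of norm p and the form x^2 + 3y^2.

module QuadraticForms where
  open import Data.Nat.Primality using (Prime; euclidsLemma; prime⇒nonZero)
  open import Data.Integer.Divisibility.Signed as ℤD using (_∣_; divides)
  open import Data.Integer.Solver using (module +-*-Solver)
  open +-*-Solver using (solve; _:=_; _:+_; _:*_; _:-_; :-_; con)
  open import Relation.Binary.PropositionalEquality

  Sign : ℤ → Set
  Sign σ = (σ ≡ + 1) ⊎ (σ ≡ -[1+ 0 ])

  sign² : ∀ {σ} → Sign σ → σ ℤ.* σ ≡ + 1
  sign² (inj₁ refl) = refl
  sign² (inj₂ refl) = refl

  infixl 7 _*_
  infixl 6 _+_ _-_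
  private
    _*_ = ℤ._*_
    _+_ = ℤ._+_
    _-_ = ℤ._-_

  -- Elements (u + B √-3)/2 of norm p differ by a unit (r + m √-3)/2 and conjugation.
  Associated : (x y u B : ℤ) → Set
  Associated x y u B = ∃ λ r → ∃ λ m → ∃ λ ε → Sign ε × (r * r + + 3 * (m * m) ≡ + 4)
      × (u ≡ r * x + + 3 * ε * m * y) × (B ≡ m * x - ε * r * y)

  -- p divides (Bx - uy)(Bx + uy), hence one factor; the sign ε accounts for conjugation.
  -- Brahmagupta's identity w^2 + 3v^2 = 4p^2 then makes p divide w as well, and w/p, v/p are the
  -- coordinates r, m of the unit.
  unique-up-to-unit : ∀ p → Prime p → ∀ x y A B → + p ≡ x * x + + 3 * (y * y) → A * A - A * B + B * B ≡ + p →
    Associated x y (+ 2 * A - B) B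
  unique-up-to-unit p p-prime x y A B hx hA = result (euclid (B * x - u * y) (B * x + u * y) (divides (B * B - + 4 * (y * y)) difference))
    where
    open PrimeModulus p p-prime using (euclid)
    instance _ = prime⇒nonZero p-prime
    u = + 2 * A - B
    P = + p
    hu : u * u + + 3 * (B * B) ≡ + 4 * P
    hu = trans (solve 2 (λ A B → let u = con (+ 2) :* A :- B in u :* u :+ con (+ 3) :* (B :* B) := con (+ 4) :* (A :* A :- A :* B :+ B :* B)) refl A B) (cong (+ 4 *_) hA)
    difference : (B * x - u * y) * (B * x + u * y) ≡ (B * B - + 4 * (y * y)) * P
    difference = trans (solve 4 (λ B x u y → (B :* x :- u :* y) :* (B :* x :+ u :* y)
        := B :* B :* (x :* x :+ con (+ 3) :* (y :* y)) :- (u :* u :+ con (+ 3) :* (B :* B)) :* (y :* y)) refl B x u y)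
      (trans (cong₂ (λ a b → B * B * a - b * (y * y)) (sym hx) hu)
        (solve 3 (λ B P y → B :* B :* P :- con (+ 4) :* P :* (y :* y) := (B :* B :- con (+ 4) :* (y :* y)) :* P) refl B P y))
    main : ∀ ε → Sign ε → P ∣ B * x + ε * u * y → Associated x y u B
    main ε hε (divides m hm) = finish (euclid w w (divides (P * (+ 4 - + 3 * (m * m))) (trans w² (solve 2 (λ P m → P :* P :* (con (+ 4) :- con (+ 3) :* (m :* m)) := P :* (con (+ 4) :- con (+ 3) :* (m :* m)) :* P) refl P m))))
      where
      w = u * x - + 3 * ε * B * y
      brahmagupta : w * w + + 3 * ((B * x + ε * u * y) * (B * x + ε * u * y)) ≡ + 4 * P * P
      brahmagupta = trans (solve 5 (λ u x e B y → let w = u :* x :- con (+ 3) :* e :* B :* y ; v = B :* x :+ e :* u :* y in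
           w :* w :+ con (+ 3) :* (v :* v) := (u :* u :+ con (+ 3) :* (B :* B)) :* (x :* x :+ con (+ 3) :* (y :* y))
              :+ (e :* e :- con (+ 1)) :* (con (+ 3) :* (y :* y) :* (u :* u :+ con (+ 3) :* (B :* B)))) refl u x ε B y)
        (trans (cong₂ (λ a b → a * b + (ε * ε - + 1) * (+ 3 * (y * y) * a)) hu (sym hx))
          (trans (cong (λ a → + 4 * P * P + (a - + 1) * (+ 3 * (y * y) * (+ 4 * P))) (sign² hε)) (solve 2 (λ a b → a :+ (con (+ 1) :- con (+ 1)) :* b := a) refl (+ 4 * P * P) (+ 3 * (y * y) * (+ 4 * P)))))
      w² : w * w ≡ P * P * (+ 4 - + 3 * (m * m))
      w² = trans (solve 2 (λ w v → w :* w := (w :* w :+ con (+ 3) :* (v :* v)) :- con (+ 3) :* (v :* v)) refl w (B * x + ε * u * y))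
        (trans (cong₂ (λ a v → a - + 3 * (v * v)) brahmagupta hm)
          (solve 2 (λ P m → con (+ 4) :* P :* P :- con (+ 3) :* (m :* P :* (m :* P)) := P :* P :* (con (+ 4) :- con (+ 3) :* (m :* m))) refl P m))
      finish′ : P ∣ w → Associated x y u B
      finish′ (divides r hr) = r , m , ε , hε , norm-eq , cancelP u-eq , cancelP B-eq
        where
        cancelP : ∀ {a b} → a * P ≡ b * P → a ≡ b
        cancelP {a} {b} = ℤₚ.*-cancelʳ-≡ a b P
        norm-eq : r * r + + 3 * (m * m) ≡ + 4
        norm-eq = cancelP (cancelP (trans (solve 3 (λ r m P → (r :* r :+ con (+ 3) :* (m :* m)) :* P :* P := (r :* P) :* (r :* P) :+ con (+ 3) :* (m :* m) :* P :* P) refl r m P)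
          (trans (cong (λ a → a * a + + 3 * (m * m) * P * P) (sym hr)) (trans (cong (_+ + 3 * (m * m) * P * P) w²)
            (solve 2 (λ P m → P :* P :* (con (+ 4) :- con (+ 3) :* (m :* m)) :+ con (+ 3) :* (m :* m) :* P :* P := con (+ 4) :* P :* P) refl P m)))))
        u-eq : u * P ≡ (r * x + + 3 * ε * m * y) * P
        u-eq = trans (cong (u *_) hx) (trans (solve 5 (λ u x e B y → u :* (x :* x :+ con (+ 3) :* (y :* y))
              := (u :* x :- con (+ 3) :* e :* B :* y) :* x :+ con (+ 3) :* e :* (B :* x :+ e :* u :* y) :* y :- (e :* e :- con (+ 1)) :* (con (+ 3) :* u :* y :* y)) refl u x ε B y)
          (trans (cong₂ (λ a b → a * x + + 3 * ε * b * y - (ε * ε - + 1) * (+ 3 * u * y * y)) hr hm)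
            (trans (cong (λ a → r * P * x + + 3 * ε * (m * P) * y - (a - + 1) * (+ 3 * u * y * y)) (sign² hε))
              (solve 7 (λ r P x e m y u → r :* P :* x :+ con (+ 3) :* e :* (m :* P) :* y :- (con (+ 1) :- con (+ 1)) :* (con (+ 3) :* u :* y :* y) := (r :* x :+ con (+ 3) :* e :* m :* y) :* P) refl r P x ε m y u))))
        B-eq : B * P ≡ (m * x - ε * r * y) * P
        B-eq = trans (cong (B *_) hx) (trans (solve 5 (λ u x e B y → B :* (x :* x :+ con (+ 3) :* (y :* y))
              := (B :* x :+ e :* u :* y) :* x :- e :* (u :* x :- con (+ 3) :* e :* B :* y) :* y :- (e :* e :- con (+ 1)) :* (con (+ 3) :* B :* y :* y)) refl u x ε B y)
          (trans (cong₂ (λ a b → b * x - ε * a * y - (ε * ε - + 1) * (+ 3 * B * y * y)) hr hm)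
            (trans (cong (λ a → m * P * x - ε * (r * P) * y - (a - + 1) * (+ 3 * B * y * y)) (sign² hε))
              (solve 7 (λ r P x e m y u → m :* P :* x :- e :* (r :* P) :* y :- (con (+ 1) :- con (+ 1)) :* (con (+ 3) :* u :* y :* y) := (m :* x :- e :* r :* y) :* P) refl r P x ε m y B))))
      finish : P ∣ w ⊎ P ∣ w → Associated x y u B
      finish (inj₁ h) = finish′ h
      finish (inj₂ h) = finish′ h
    result : P ∣ B * x - u * y ⊎ P ∣ B * x + u * y → Associated x y u B
    result (inj₁ h) = main -[1+ 0 ] (inj₂ refl) (subst (P ∣_) (solve 4 (λ B x u y → B :* x :- u :* y := B :* x :+ con -[1+ 0 ] :* u :* y) refl B x u y) h)
    result (inj₂ h) = main (+ 1) (inj₁ refl) (subst (P ∣_) (solve 4 (λ B x u y → B :* x :+ u :* y := B :* x :+ con (+ 1) :* u :* y) refl B x u y) h)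

  small-square : ∀ a b → a ℕ.* a ℕ.+ 3 ℕ.* (b ℕ.* b) ≡ 4 → (a ≡ 2 × b ≡ 0) ⊎ (a ≡ 1 × b ≡ 1)
  small-square 2 0 h = inj₁ (refl , refl)
  small-square (suc (suc (suc a))) 0 h = ⊥-elim (ℕₚ.<⇒≢ (ℕₚ.<-≤-trans {4} {9} (ℕ.s≤s (ℕ.s≤s (ℕ.s≤s (ℕ.s≤s (ℕ.s≤s ℕ.z≤n)))))
    (ℕₚ.≤-trans (ℕₚ.*-mono-≤ {3} {suc (suc (suc a))} {3} {suc (suc (suc a))} 3≤ 3≤) (ℕₚ.m≤m+n _ 0))) (sym h))
    where
    3≤ : 3 ℕ.≤ suc (suc (suc a))
    3≤ = ℕ.s≤s (ℕ.s≤s (ℕ.s≤s ℕ.z≤n))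
  small-square 1 1 h = inj₂ (refl , refl)
  small-square (suc (suc a)) 1 h = ⊥-elim (ℕₚ.<⇒≢ (ℕₚ.<-≤-trans {4} {7} (ℕ.s≤s (ℕ.s≤s (ℕ.s≤s (ℕ.s≤s (ℕ.s≤s ℕ.z≤n)))))
    (ℕₚ.+-monoˡ-≤ 3 (ℕₚ.*-mono-≤ {2} {suc (suc a)} {2} {suc (suc a)} 2≤ 2≤))) (sym h))
    where
    2≤ : 2 ℕ.≤ suc (suc a)
    2≤ = ℕ.s≤s (ℕ.s≤s ℕ.z≤n)
  small-square a (suc (suc b)) h = ⊥-elim (ℕₚ.<⇒≢ (ℕₚ.<-≤-trans {4} {12} (ℕ.s≤s (ℕ.s≤s (ℕ.s≤s (ℕ.s≤s (ℕ.s≤s ℕ.z≤n)))))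
    (ℕₚ.≤-trans (ℕₚ.*-monoʳ-≤ 3 (ℕₚ.*-mono-≤ {2} {suc (suc b)} {2} {suc (suc b)} 2≤ 2≤)) (ℕₚ.m≤n+m _ (a ℕ.* a)))) (sym h))
    where
    2≤ : 2 ℕ.≤ suc (suc b)
    2≤ = ℕ.s≤s (ℕ.s≤s ℕ.z≤n)

  abs-square : ∀ z → z * z ≡ + (ℤ.∣ z ∣ ℕ.* ℤ.∣ z ∣)
  abs-square (+ n) = sym (ℤₚ.pos-* n n)
  abs-square -[1+ n ] = refl

  abs-sign : ∀ z → ℤ.∣ z ∣ ≡ 1 → Sign z
  abs-sign (+ 1) refl = inj₁ refl
  abs-sign -[1+ 0 ] refl = inj₂ refl

  two-cases : ∀ r m → r * r + + 3 * (m * m) ≡ + 4 →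
    ((r ≡ + 2 ⊎ r ≡ -[1+ 1 ]) × m ≡ + 0) ⊎ (Sign r × Sign m)
  two-cases r m h with small-square ℤ.∣ r ∣ ℤ.∣ m ∣ (ℤₚ.+-injective (trans (trans (ℤₚ.pos-+ (ℤ.∣ r ∣ ℕ.* ℤ.∣ r ∣) _)
      (cong₂ _+_ (sym (abs-square r)) (trans (ℤₚ.pos-* 3 (ℤ.∣ m ∣ ℕ.* ℤ.∣ m ∣)) (cong (+ 3 *_) (sym (abs-square m)))))) h))
  ... | inj₂ (hr , hm) = inj₂ (abs-sign r hr , abs-sign m hm)
  ... | inj₁ (hr , hm) = inj₁ (sgn2 r hr , ℤₚ.∣i∣≡0⇒i≡0 hm)
    where
    sgn2 : ∀ r → ℤ.∣ r ∣ ≡ 2 → r ≡ + 2 ⊎ r ≡ -[1+ 1 ]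
    sgn2 (+ 2) refl = inj₁ refl
    sgn2 -[1+ 1 ] refl = inj₂ refl

  -- The shapes of 2A - B and B when 2A - B ≡ x ≡ 1 modulo 3.
  data Shape (x y u B : ℤ) : Set where
    even : ∀ ε → Sign ε → u ≡ ℤ.- (+ 2 * x) → B ≡ + 2 * ε * y → Shape x y u B
    odd : ∀ σ m → Sign σ → Sign m → u ≡ x + + 3 * σ * y → B ≡ m * (x - σ * y) → Shape x y u B

  ¬3∣ : ∀ {k} → k ≡ + 1 ⊎ k ≡ + 2 → ¬ (+ 3 ∣ k)
  ¬3∣ (inj₁ refl) h with ℤD.∣⇒∣ᵤ h
  ... | h′ = ℕₚ.<⇒≱ {1} {3} (ℕ.s≤s (ℕ.s≤s ℕ.z≤n)) (Data.Nat.Divisibility.∣⇒≤ h′)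
    where import Data.Nat.Divisibility
  ¬3∣ (inj₂ refl) h with ℤD.∣⇒∣ᵤ h
  ... | h′ = ℕₚ.<⇒≱ {2} {3} (ℕ.s≤s (ℕ.s≤s (ℕ.s≤s ℕ.z≤n))) (Data.Nat.Divisibility.∣⇒≤ h′)
    where import Data.Nat.Divisibility

  ¬2∣1 : ¬ (+ 2 ∣ + 1)
  ¬2∣1 h with ℤD.∣⇒∣ᵤ h
  ... | h′ = ℕₚ.<⇒≱ {1} {2} (ℕ.s≤s (ℕ.s≤s ℕ.z≤n)) (Data.Nat.Divisibility.∣⇒≤ h′)
    where import Data.Nat.Divisibility

  -- Reducing u = rx + 3εmy modulo 3 with u ≡ x ≡ 1 gives r ≡ 1, which leaves r = -2 with m = 0, or
  -- r = 1 with m = ±1.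
  shape : ∀ p → Prime p → ∀ x y A B → + p ≡ x * x + + 3 * (y * y) → A * A - A * B + B * B ≡ + p →
    + 3 ∣ x - + 1 → + 3 ∣ (+ 2 * A - B) - + 1 → Shape x y (+ 2 * A - B) B
  shape p p-prime x y A B hx hA x≡1 u≡1 = from (unique-up-to-unit p p-prime x y A B hx hA)
   where
   from : Associated x y (+ 2 * A - B) B → Shape x y (+ 2 * A - B) B
   from (r , m , ε , hε , hn , hu , hB) = go (two-cases r m hn)
    where
    3∣ : ∀ {k} v → (+ 2 * A - B) - + 1 - v * (x - + 1) - + 3 * (ε * m * y) ≡ k → + 3 ∣ k
    3∣ v refl = ℤD.∣m∣n⇒∣m-n (ℤD.∣m∣n⇒∣m-n u≡1 (ℤD.∣n⇒∣m*n v x≡1)) (divides (ε * m * y) (ℤₚ.*-comm (+ 3) (ε * m * y)))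
    reduce : ∀ r → (r * x + + 3 * ε * m * y) - + 1 - r * (x - + 1) - + 3 * (ε * m * y) ≡ r - + 1
    reduce r = solve 5 (λ r x e m y → (r :* x :+ con (+ 3) :* e :* m :* y) :- con (+ 1) :- r :* (x :- con (+ 1)) :- con (+ 3) :* (e :* m :* y) := r :- con (+ 1)) refl r x ε m y
    r≡1 : + 3 ∣ r - + 1
    r≡1 = 3∣ r (trans (cong (λ u → u - + 1 - r * (x - + 1) - + 3 * (ε * m * y)) hu) (reduce r))
    go : ((r ≡ + 2 ⊎ r ≡ -[1+ 1 ]) × m ≡ + 0) ⊎ (Sign r × Sign m) → Shape x y (+ 2 * A - B) B
    go (inj₁ (inj₁ refl , _)) = ⊥-elim (¬3∣ (inj₁ refl) r≡1)
    go (inj₁ (inj₂ refl , refl)) = even ε hε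
      (trans hu (solve 3 (λ x e y → con -[1+ 1 ] :* x :+ con (+ 3) :* e :* con (+ 0) :* y := :- (con (+ 2) :* x)) refl x ε y))
      (trans hB (solve 3 (λ x e y → con (+ 0) :* x :- e :* con -[1+ 1 ] :* y := con (+ 2) :* e :* y) refl x ε y))
    go (inj₂ (inj₂ refl , _)) = ⊥-elim (¬3∣ (inj₂ refl) (ℤD.∣m⇒∣-m r≡1))
    go (inj₂ (inj₁ refl , hm)) = odd (ε * m) m (sign-* hε hm) hm
      (trans hu (solve 4 (λ x e m y → con (+ 1) :* x :+ con (+ 3) :* e :* m :* y := x :+ con (+ 3) :* (e :* m) :* y) refl x ε m y))
      (trans hB (trans (solve 4 (λ x e m y → m :* x :- e :* con (+ 1) :* y := m :* (x :- (e :* m) :* y) :+ (m :* m :- con (+ 1)) :* (e :* y)) refl x ε m y)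
        (trans (cong (λ a → m * (x - ε * m * y) + (a - + 1) * (ε * y)) (sign² hm)) (solve 2 (λ a b → a :+ (con (+ 1) :- con (+ 1)) :* b := a) refl (m * (x - ε * m * y)) (ε * y)))))
      where
      sign-* : ∀ {a b} → Sign a → Sign b → Sign (a * b)
      sign-* (inj₁ refl) (inj₁ refl) = inj₁ refl
      sign-* (inj₁ refl) (inj₂ refl) = inj₂ refl
      sign-* (inj₂ refl) (inj₁ refl) = inj₂ refl
      sign-* (inj₂ refl) (inj₂ refl) = inj₁ refl

  -- (A,B) and (a,b) are the coordinates of the Jacobi sums J(θ⁵,θ²) and J(θ²,θ²).
  module Identify (p : ℕ) (p-prime : Prime p) (x y A B a b : ℤ)
    (hx : + p ≡ x * x + + 3 * (y * y)) (x≡1 : + 3 ∣ x - + 1) (x+y-odd : ¬ (+ 2 ∣ x + y))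
    (norm-J : A * A - A * B + B * B ≡ + p) (norm-C : a * a - a * b + b * b ≡ + p)
    (uJ≡1 : + 3 ∣ (+ 2 * A - B) - + 1) (uC≡1 : + 3 ∣ (+ 2 * a - b) - + 1) (3∣b : + 3 ∣ b)
    (A≡a : + 2 ∣ A - a) (B≡b : + 2 ∣ B - b) (J≢C : ¬ (A ≡ a × B ≡ b)) where

    shape-J : Shape x y (+ 2 * A - B) B
    shape-J = shape p p-prime x y A B hx norm-J x≡1 uJ≡1

    shape-C : Shape x y (+ 2 * a - b) b
    shape-C = shape p p-prime x y a b hx norm-C x≡1 uC≡1

    odd-part : ∀ {σ m} → Sign σ → Sign m → ¬ (+ 2 ∣ m * (x - σ * y))
    odd-part (inj₁ refl) (inj₁ refl) h = x+y-odd (subst (+ 2 ∣_) (solve 2 (λ x y → con (+ 1) :* (x :- con (+ 1) :* y) :+ y :* con (+ 2) := x :+ y) refl x y) (ℤD.∣m∣n⇒∣m+n h (divides y refl)))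
    odd-part (inj₁ refl) (inj₂ refl) h = x+y-odd (subst (+ 2 ∣_) (solve 2 (λ x y → con -[1+ 0 ] :* (x :- con (+ 1) :* y) :+ x :* con (+ 2) := x :+ y) refl x y) (ℤD.∣m∣n⇒∣m+n h (divides x refl)))
    odd-part (inj₂ refl) (inj₁ refl) h = x+y-odd (subst (+ 2 ∣_) (solve 2 (λ x y → con (+ 1) :* (x :- con -[1+ 0 ] :* y) := x :+ y) refl x y) h)
    odd-part (inj₂ refl) (inj₂ refl) h = x+y-odd (subst (+ 2 ∣_) (solve 2 (λ x y → :- (con -[1+ 0 ] :* (x :- con -[1+ 0 ] :* y)) := x :+ y) refl x y) (ℤD.∣m⇒∣-m h))

    b⇒B : + 2 ∣ b → + 2 ∣ B
    b⇒B h = subst (+ 2 ∣_) (solve 2 (λ B b → (B :- b) :+ b := B) refl B b) (ℤD.∣m∣n⇒∣m+n B≡b h)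

    B⇒b : + 2 ∣ B → + 2 ∣ b
    B⇒b h = subst (+ 2 ∣_) (solve 2 (λ B b → B :- (B :- b) := b) refl B b) (ℤD.∣m∣n⇒∣m-n h B≡b)

    2∣ : ∀ ε → + 2 ∣ + 2 * ε * y
    2∣ ε = divides (ε * y) (solve 2 (λ e y → con (+ 2) :* e :* y := e :* y :* con (+ 2)) refl ε y)

    -- In the odd shape b would be ±x modulo 3, against 3 | b; so C has the even shape and b is
    -- even. J and C agree modulo 2, so B is even too, whereas the odd shape has B odd because x + y
    -- is odd.
    case-3∣y : + 3 ∣ y → + 2 * A - B ≡ ℤ.- (+ 2 * x)
    case-3∣y 3∣y = go shape-C shape-J
      where
      m-absurd : ∀ {σ m} → Sign m → + 3 ∣ m * (x - σ * y) → ⊥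
      m-absurd {σ} (inj₁ refl) h = ¬3∣ (inj₁ refl) (subst (+ 3 ∣_) (solve 3 (λ x s y → con (+ 1) :* (x :- s :* y) :- (x :- con (+ 1)) :+ s :* y := con (+ 1)) refl x σ y)
        (ℤD.∣m∣n⇒∣m+n (ℤD.∣m∣n⇒∣m-n h x≡1) (ℤD.∣n⇒∣m*n σ 3∣y)))
      m-absurd {σ} (inj₂ refl) h = ¬3∣ (inj₁ refl) (ℤD.∣m⇒∣-m (subst (+ 3 ∣_) (solve 3 (λ x s y → con -[1+ 0 ] :* (x :- s :* y) :+ (x :- con (+ 1)) :- s :* y := con -[1+ 0 ]) refl x σ y)
        (ℤD.∣m∣n⇒∣m-n (ℤD.∣m∣n⇒∣m+n h x≡1) (ℤD.∣n⇒∣m*n σ 3∣y))))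
      go : Shape x y (+ 2 * a - b) b → Shape x y (+ 2 * A - B) B → + 2 * A - B ≡ ℤ.- (+ 2 * x)
      go (odd σ m _ hm _ hb) _ = ⊥-elim (m-absurd {σ} hm (subst (+ 3 ∣_) hb 3∣b))
      go _ (even _ _ hu _) = hu
      go (even ε _ _ hb) (odd σ m hσ hm _ hB) = ⊥-elim (odd-part hσ hm (subst (+ 2 ∣_) hB (b⇒B (subst (+ 2 ∣_) (sym hb) (2∣ ε)))))

    -- Divisibility of b by 3 excludes the even shape (b = ±2y) and σ = -1 (b = ±(x + y)) for C. So
    -- b is odd and J also has the odd shape. If J had σ = 1, the traces would agree and B = ±b:
    -- equality means J = C, and B = -b gives A - a = -b, which is even, against b odd. Hence σ =
    -- -1.
    case-y≡1 : + 3 ∣ y - + 1 → + 2 * A - B ≡ x - + 3 * y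
    case-y≡1 y≡1 = go shape-C shape-J
      where
      2ε-absurd : ∀ {ε} → Sign ε → + 3 ∣ + 2 * ε * y → ⊥
      2ε-absurd (inj₁ refl) h = ¬3∣ (inj₂ refl) (subst (+ 3 ∣_) (solve 1 (λ y → con (+ 2) :* con (+ 1) :* y :- con (+ 2) :* (y :- con (+ 1)) := con (+ 2)) refl y) (ℤD.∣m∣n⇒∣m-n h (ℤD.∣n⇒∣m*n (+ 2) y≡1)))
      2ε-absurd (inj₂ refl) h = ¬3∣ (inj₂ refl) (ℤD.∣m⇒∣-m (subst (+ 3 ∣_) (solve 1 (λ y → con (+ 2) :* con -[1+ 0 ] :* y :+ con (+ 2) :* (y :- con (+ 1)) := con -[1+ 1 ]) refl y) (ℤD.∣m∣n⇒∣m+n h (ℤD.∣n⇒∣m*n (+ 2) y≡1))))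
      σ-absurd : ∀ {m} → Sign m → + 3 ∣ m * (x - -[1+ 0 ] * y) → ⊥
      σ-absurd (inj₁ refl) h = ¬3∣ (inj₂ refl) (subst (+ 3 ∣_) (solve 2 (λ x y → con (+ 1) :* (x :- con -[1+ 0 ] :* y) :- (x :- con (+ 1)) :- (y :- con (+ 1)) := con (+ 2)) refl x y)
        (ℤD.∣m∣n⇒∣m-n (ℤD.∣m∣n⇒∣m-n h x≡1) y≡1))
      σ-absurd (inj₂ refl) h = ¬3∣ (inj₂ refl) (ℤD.∣m⇒∣-m (subst (+ 3 ∣_) (solve 2 (λ x y → con -[1+ 0 ] :* (x :- con -[1+ 0 ] :* y) :+ (x :- con (+ 1)) :+ (y :- con (+ 1)) := con -[1+ 1 ]) refl x y)
        (ℤD.∣m∣n⇒∣m+n (ℤD.∣m∣n⇒∣m+n h x≡1) y≡1)))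
      2A≡ : + 2 * A - B ≡ + 2 * a - b → + 2 * (A - a) ≡ B - b
      2A≡ h = trans (solve 4 (λ A B a b → con (+ 2) :* (A :- a) := ((con (+ 2) :* A :- B) :- (con (+ 2) :* a :- b)) :+ (B :- b)) refl A B a b)
        (trans (cong (λ v → v - (+ 2 * a - b) + (B - b)) h) (solve 3 (λ v B b → v :- v :+ (B :- b) := B :- b) refl (+ 2 * a - b) B b))
      halve : ∀ {v w} → + 2 * v ≡ + 2 * w → v ≡ w
      halve {v} {w} = ℤₚ.*-cancelˡ-≡ (+ 2) v w
      same : ∀ {m m′} → Sign m → Sign m′ → + 2 * A - B ≡ + 2 * a - b → b ≡ m * (x - + 1 * y) → B ≡ m′ * (x - + 1 * y) → ¬ (+ 2 ∣ b) → ⊥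
      same hm hm′ hu hb hB b-odd = cases hm hm′
        where
        equal : B ≡ b → ⊥
        equal e = J≢C (trans (solve 2 (λ A a → A := (A :- a) :+ a) refl A a) (trans (cong (_+ a) (halve {A - a} {+ 0} (trans (2A≡ hu) (trans (cong (_- b) e) (trans (ℤₚ.+-inverseʳ b) (sym (ℤₚ.*-zeroʳ (+ 2)))))))) (ℤₚ.+-identityˡ a)) , e)
        opposite : B ≡ ℤ.- b → ⊥
        opposite e = b-odd (subst (+ 2 ∣_) (trans (cong ℤ.-_ (halve {A - a} {ℤ.- b} (trans (2A≡ hu) (trans (cong (_- b) e) (solve 1 (λ b → :- b :- b := con (+ 2) :* (:- b)) refl b))))) (ℤₚ.neg-involutive b)) (ℤD.∣m⇒∣-m A≡a))
        cases : Sign _ → Sign _ → ⊥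
        cases (inj₁ refl) (inj₁ refl) = equal (trans hB (sym hb))
        cases (inj₂ refl) (inj₂ refl) = equal (trans hB (sym hb))
        cases (inj₁ refl) (inj₂ refl) = opposite (trans hB (trans (solve 1 (λ v → con -[1+ 0 ] :* v := :- (con (+ 1) :* v)) refl (x - + 1 * y)) (cong ℤ.-_ (sym hb))))
        cases (inj₂ refl) (inj₁ refl) = opposite (trans hB (trans (solve 1 (λ v → con (+ 1) :* v := :- (con -[1+ 0 ] :* v)) refl (x - + 1 * y)) (cong ℤ.-_ (sym hb))))
      go : Shape x y (+ 2 * a - b) b → Shape x y (+ 2 * A - B) B → + 2 * A - B ≡ x - + 3 * y
      go (even ε hε _ hb) _ = ⊥-elim (2ε-absurd hε (subst (+ 3 ∣_) hb 3∣b))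
      go (odd _ m (inj₂ refl) hm _ hb) _ = ⊥-elim (σ-absurd hm (subst (+ 3 ∣_) hb 3∣b))
      go (odd _ m (inj₁ refl) hm _ hb) (even ε _ _ hB) = ⊥-elim (odd-part (inj₁ refl) hm (subst (+ 2 ∣_) hb (B⇒b (subst (+ 2 ∣_) (sym hB) (2∣ ε)))))
      go _ (odd _ m′ (inj₂ refl) _ hu _) = trans hu (solve 2 (λ x y → x :+ con (+ 3) :* con -[1+ 0 ] :* y := x :- con (+ 3) :* y) refl x y)
      go (odd _ m (inj₁ refl) hm hv hb) (odd _ m′ (inj₁ refl) hm′ hu hB) = ⊥-elim (same hm hm′ (trans hu (sym hv)) hb hB (λ h → odd-part (inj₁ refl) hm (subst (+ 2 ∣_) hb h)))

  IsTrace : ℤ → ℤ → ℤ → Set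
  IsTrace X Y u = (+ 3 ∣ Y → u ≡ ℤ.- (+ 2 ℤ.* X)) × (+ 3 ∣ Y ℤ.- + 1 → u ≡ X ℤ.- + 3 ℤ.* Y)

-- The quotient y as the unit root of a quadratic equation.

module UnitRoot {c ℓ} (R : CommutativeRing c ℓ) (M : ℕ) (p-prime : Prime (suc M)) (Λ : CubeNilpotent R (suc M))
  (n′ : ℕ) (M≡6n : M ≡ 6 ℕ.* suc n′)
  (X Y : ℤ) (X²+3Y² : + suc M ≡ X ℤ.* X ℤ.+ + 3 ℤ.* (Y ℤ.* Y)) (X≡1 : + 3 ∣ᶻ X ℤ.- + 1) where
  open RingKit R
  open CubeNilpotent Λ using (p³≈0; unit-ι; ι-reflects)
  private
    p n : ℕ
    p = suc M
    n = suc n′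


  open PrimeModulus p p-prime
  open Teichmüller R M p-prime Λ
  open TeichmüllerSums R M p-prime Λ n′ M≡6n using (kn<M; n<M) renaming (J to Jᴿ)
  open JacobiEvaluation R M p-prime Λ n′ M≡6n using (module Final; unit-small)
  open EisensteinIntegers

  module ℤS = Data.Integer.Solver.+-*-Solver

  p≥7 : 7 ℕ.≤ p
  p≥7 = ℕ.s≤s (≡.subst (6 ℕ.≤_) (≡.sym M≡6n) (ℕₚ.m≤m*n 6 n))

  ¬p∣2 : ¬ (+ p ∣ᶻ + 2)
  ¬p∣2 = ¬p∣small 2 (ℕ.s≤s ℕ.z≤n) (ℕₚ.≤-trans (ℕ.s≤s (ℕ.s≤s (ℕ.s≤s ℕ.z≤n))) p≥7)

  p≅ : X ℤ.* X ℤ.+ + 3 ℤ.* (Y ℤ.* Y) ≅ + 0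
  p≅ = ∣⇒≅0 (≡.subst (+ p ∣ᶻ_) X²+3Y² (ℤD.divides (+ 1) (≡.sym (ℤₚ.*-identityˡ (+ p)))))

  ¬p∣Y : ¬ (+ p ∣ᶻ Y)
  ¬p∣Y (ℤD.divides b hb) = from (euclid X X (≡.subst (+ p ∣ᶻ_) XX (ℤD.∣m∣n⇒∣m-n (≅0⇒∣ p≅) (ℤD.∣n⇒∣m*n (+ 3) (ℤD.∣m⇒∣m*n Y (ℤD.divides b hb))))))
    where
    XX : X ℤ.* X ℤ.+ + 3 ℤ.* (Y ℤ.* Y) ℤ.- + 3 ℤ.* (Y ℤ.* Y) ≡ X ℤ.* X
    XX = ℤS.solve 2 (λ a b → a ℤS.:+ b ℤS.:- b ℤS.:= a) ≡.refl (X ℤ.* X) (+ 3 ℤ.* (Y ℤ.* Y))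
    -- p² would divide p
    absurd : + p ∣ᶻ X → ⊥
    absurd (ℤD.divides a ha) = ¬p∣1 (ℤD.divides (a ℤ.* a ℤ.+ + 3 ℤ.* (b ℤ.* b)) (ℤₚ.*-cancelʳ-≡ (+ 1) _ (+ p)
      (≡.trans (ℤₚ.*-identityˡ (+ p)) (≡.trans X²+3Y² (≡.trans (≡.cong₂ (λ x y → x ℤ.* x ℤ.+ + 3 ℤ.* (y ℤ.* y)) ha hb)
        (ℤS.solve 3 (λ a b p → (a ℤS.:* p) ℤS.:* (a ℤS.:* p) ℤS.:+ ℤS.con (+ 3) ℤS.:* ((b ℤS.:* p) ℤS.:* (b ℤS.:* p)) ℤS.:= (a ℤS.:* a ℤS.:+ ℤS.con (+ 3) ℤS.:* (b ℤS.:* b)) ℤS.:* p ℤS.:* p) ≡.refl a b (+ p)))))))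
    from : _ → ⊥
    from (inj₁ h) = absurd h
    from (inj₂ h) = absurd h

  -- A square root s of -3 modulo p yields the sixth root of unity (1 + s)/2.
  ρ : ℤ
  ρ = (+ 1 ℤ.+ X ℤ.* recip Y) ℤ.* recip (+ 2)

  ρ-root : ρ ℤ.* ρ ℤ.- ρ ℤ.+ + 1 ≅ + 0
  ρ-root = ≅-cancel ¬4Y² (≅-trans scaled (≅-sym (≅-reflexive (ℤₚ.*-zeroʳ k))))
    where
    k = (+ 2 ℤ.* + 2) ℤ.* (Y ℤ.* Y)
    ¬4Y² : ¬ (+ p ∣ᶻ k)
    ¬4Y² h with euclid (+ 2 ℤ.* + 2) (Y ℤ.* Y) h
    ... | inj₁ h₁ with euclid (+ 2) (+ 2) h₁
    ...   | inj₁ h₂ = ¬p∣2 h₂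
    ...   | inj₂ h₂ = ¬p∣2 h₂
    ¬4Y² h | inj₂ h₁ with euclid Y Y h₁
    ...   | inj₁ h₂ = ¬p∣Y h₂
    ...   | inj₂ h₂ = ¬p∣Y h₂
    a = + 2 ℤ.* recip (+ 2)
    b = Y ℤ.* recip Y
    value : ℤ → ℤ → ℤ
    value a b = (Y ℤ.+ X ℤ.* b) ℤ.* (Y ℤ.+ X ℤ.* b) ℤ.* (a ℤ.* a) ℤ.- + 2 ℤ.* Y ℤ.* (Y ℤ.+ X ℤ.* b) ℤ.* a ℤ.+ + 4 ℤ.* (Y ℤ.* Y)
    scaled : k ℤ.* (ρ ℤ.* ρ ℤ.- ρ ℤ.+ + 1) ≅ + 0
    scaled = ≅-trans (≅-reflexive (ℤS.solve 4 (λ X Y r s → let ρ = (ℤS.con (+ 1) ℤS.:+ X ℤS.:* r) ℤS.:* s ; a = ℤS.con (+ 2) ℤS.:* s ; v = Y ℤS.:+ X ℤS.:* (Y ℤS.:* r) in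
         (ℤS.con (+ 2) ℤS.:* ℤS.con (+ 2)) ℤS.:* (Y ℤS.:* Y) ℤS.:* (ρ ℤS.:* ρ ℤS.:- ρ ℤS.:+ ℤS.con (+ 1))
         ℤS.:= v ℤS.:* v ℤS.:* (a ℤS.:* a) ℤS.:- ℤS.con (+ 2) ℤS.:* Y ℤS.:* v ℤS.:* a ℤS.:+ ℤS.con (+ 4) ℤS.:* (Y ℤS.:* Y)) ≡.refl X Y (recip Y) (recip (+ 2))))
      (≅-trans (≅-+ (≅-- (≅-* (≅-* vb vb) (≅-* aa aa)) (≅-* (≅-* (≅-refl {+ 2 ℤ.* Y}) vb) aa)) (≅-refl {+ 4 ℤ.* (Y ℤ.* Y)}))
        (≅-trans (≅-reflexive (ℤS.solve 2 (λ X Y → let v = Y ℤS.:+ X ℤS.:* ℤS.con (+ 1) in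
            v ℤS.:* v ℤS.:* (ℤS.con (+ 1) ℤS.:* ℤS.con (+ 1)) ℤS.:- ℤS.con (+ 2) ℤS.:* Y ℤS.:* v ℤS.:* ℤS.con (+ 1) ℤS.:+ ℤS.con (+ 4) ℤS.:* (Y ℤS.:* Y)
            ℤS.:= X ℤS.:* X ℤS.:+ ℤS.con (+ 3) ℤS.:* (Y ℤS.:* Y)) ≡.refl X Y)) p≅))
      where
      aa : a ≅ + 1
      aa = recip-inverse ¬p∣2
      vb : Y ℤ.+ X ℤ.* b ≅ Y ℤ.+ X ℤ.* + 1
      vb = ≅-+ (≅-refl {Y}) (≅-* (≅-refl {X}) (recip-inverse ¬p∣Y))

  open SexticCharacter R M p-prime Λ n′ M≡6n ρ ρ-root using ()
  open SexticJacobi R M p-prime Λ n′ M≡6n ρ ρ-root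
    using (Jᴱ; Cᴱ; norm-J; norm-C; J≡C-mod-2; C≡-p-mod-3; J≡-1-mod-√-3; hᴿ; hᴿ-J; hᴿ-C; _∣ᴱ_; Z; Z-root)

  X+Y-odd : ¬ (+ 2 ∣ᶻ X ℤ.+ Y)
  X+Y-odd h = QuadraticForms.¬2∣1 (≡.subst (+ 2 ∣ᶻ_) one (ℤD.∣m∣n⇒∣m-n (≡.subst (+ 2 ∣ᶻ_) expand (ℤD.∣m∣n⇒∣m+n (ℤD.∣m⇒∣m*n (X ℤ.+ Y) h) (ℤD.divides (Y ℤ.* Y ℤ.- X ℤ.* Y) ≡.refl))) (ℤD.divides (+ 3 ℤ.* + n) ≡.refl)))
    where
    expand : (X ℤ.+ Y) ℤ.* (X ℤ.+ Y) ℤ.+ (Y ℤ.* Y ℤ.- X ℤ.* Y) ℤ.* + 2 ≡ + p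
    expand = ≡.trans (ℤS.solve 2 (λ X Y → (X ℤS.:+ Y) ℤS.:* (X ℤS.:+ Y) ℤS.:+ (Y ℤS.:* Y ℤS.:- X ℤS.:* Y) ℤS.:* ℤS.con (+ 2) ℤS.:= X ℤS.:* X ℤS.:+ ℤS.con (+ 3) ℤS.:* (Y ℤS.:* Y)) ≡.refl X Y) (≡.sym X²+3Y²)
    one : + p ℤ.- + 3 ℤ.* + n ℤ.* + 2 ≡ + 1
    one = ≡.trans (≡.cong (λ m → + suc m ℤ.- + 3 ℤ.* + n ℤ.* + 2) M≡6n) (≡.trans (≡.cong (λ m → + 1 ℤ.+ m ℤ.- + 3 ℤ.* + n ℤ.* + 2) (ℤₚ.pos-* 6 n))
      (ℤS.solve 1 (λ n → ℤS.con (+ 1) ℤS.:+ ℤS.con (+ 6) ℤS.:* n ℤS.:- ℤS.con (+ 3) ℤS.:* n ℤS.:* ℤS.con (+ 2) ℤS.:= ℤS.con (+ 1)) ≡.refl (+ n)))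

  -- The trace of J, as prescribed by X and Y.
  trace : Eisenstein → ℤ
  trace z = + 2 ℤ.* re z ℤ.- im z

  trace-identified : ∀ J C → norm J ≡ + p → norm C ≡ + p → + 2 ∣ᴱ (J ⊕ ⊖ C) → + 3 ∣ᴱ (C ⊕ ⟨ + p , + 0 ⟩) →
    + 3 ∣ᴱ (⟨ + 2 , + 1 ⟩ ⊗ (J ⊕ ⟨ + 1 , + 0 ⟩)) → ¬ (J ≡ C) → QuadraticForms.IsTrace X Y (trace J)
  trace-identified ⟨ A , B ⟩ ⟨ a , b ⟩ nJ nC (A≡a , B≡b) (a≡-p , b≡0) (_ , A+B) J≢C = I.case-3∣y , I.case-y≡1
    where
    3∣b : + 3 ∣ᶻ b
    3∣b = ≡.subst (+ 3 ∣ᶻ_) (ℤₚ.+-identityʳ b) b≡0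
    uJ : + 3 ∣ᶻ (+ 2 ℤ.* A ℤ.- B) ℤ.- + 1
    uJ = ≡.subst (+ 3 ∣ᶻ_) (ℤS.solve 2 (λ A B → ℤS.con (+ 2) ℤS.:* (ℤS.con (+ 2) ℤS.:* (B ℤS.:+ ℤS.con (+ 0)) ℤS.:+ ℤS.con (+ 1) ℤS.:* (A ℤS.:+ ℤS.con (+ 1)) ℤS.:- ℤS.con (+ 1) ℤS.:* (B ℤS.:+ ℤS.con (+ 0)))
         ℤS.:- (B ℤS.:+ ℤS.con (+ 1)) ℤS.:* ℤS.con (+ 3) ℤS.:= (ℤS.con (+ 2) ℤS.:* A ℤS.:- B) ℤS.:- ℤS.con (+ 1)) ≡.refl A B)
      (ℤD.∣m∣n⇒∣m-n (ℤD.∣n⇒∣m*n (+ 2) A+B) (ℤD.divides (B ℤ.+ + 1) ≡.refl))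
    p-form : + p ≡ + 1 ℤ.+ + 6 ℤ.* + n
    p-form = ≡.trans (≡.cong (λ m → + suc m) M≡6n) (≡.cong (ℤ._+_ (+ 1)) (ℤₚ.pos-* 6 n))
    uC : + 3 ∣ᶻ (+ 2 ℤ.* a ℤ.- b) ℤ.- + 1
    uC = ≡.subst (+ 3 ∣ᶻ_) (≡.trans (≡.cong (λ P → + 2 ℤ.* (a ℤ.+ P) ℤ.- b ℤ.- (+ 1 ℤ.+ + 4 ℤ.* + n) ℤ.* + 3) p-form)
        (ℤS.solve 3 (λ a b n → ℤS.con (+ 2) ℤS.:* (a ℤS.:+ (ℤS.con (+ 1) ℤS.:+ ℤS.con (+ 6) ℤS.:* n)) ℤS.:- b ℤS.:- (ℤS.con (+ 1) ℤS.:+ ℤS.con (+ 4) ℤS.:* n) ℤS.:* ℤS.con (+ 3)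
           ℤS.:= (ℤS.con (+ 2) ℤS.:* a ℤS.:- b) ℤS.:- ℤS.con (+ 1)) ≡.refl a b (+ n)))
      (ℤD.∣m∣n⇒∣m-n (ℤD.∣m∣n⇒∣m-n (ℤD.∣n⇒∣m*n (+ 2) a≡-p) 3∣b) (ℤD.divides (+ 1 ℤ.+ + 4 ℤ.* + n) ≡.refl))
    distinct : ¬ (A ≡ a × B ≡ b)
    distinct (e , f) = J≢C (≡.cong₂ ⟨_,_⟩ e f)
    module I = QuadraticForms.Identify p p-prime X Y A B a b X²+3Y² X≡1 X+Y-odd nJ nC uJ uC 3∣b A≡a B≡b distinct

  quadratic : ∀ J → norm J ≡ + p → hᴿ J * hᴿ J - ι (trace J) * hᴿ J + pR ≈ 0#
  quadratic ⟨ A , B ⟩ nJ = begin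
    hᴿ ⟨ A , B ⟩ * hᴿ ⟨ A , B ⟩ - ι (+ 2 ℤ.* A ℤ.- B) * hᴿ ⟨ A , B ⟩ + pR
      ≈⟨ +-cong (+-congˡ (-‿cong (*-congʳ tr))) pR≈ ⟩
    (ι A + ι B * (Z - 1#)) * (ι A + ι B * (Z - 1#)) - (ιₙ 2 * ι A - ι B) * (ι A + ι B * (Z - 1#)) + (ι A * ι A - ι A * ι B + ι B * ι B)
      ≈⟨ ≈-mod-zero (solve 3 (λ a b z → (a :+ b :* (z :- ♯ 1)) :* (a :+ b :* (z :- ♯ 1)) :- (♯ 2 :* a :- b) :* (a :+ b :* (z :- ♯ 1)) :+ (a :* a :- a :* b :+ b :* b)
           := ♯ 0 :+ (z :* z :- z :+ ♯ 1) :* (b :* b)) refl (ι A) (ι B) Z) Z-root ⟩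
    0# ∎
    where
    ι-minus : ∀ x y → ι (x ℤ.- y) ≈ ι x - ι y
    ι-minus x y = trans (ι-+ x (ℤ.- y)) (+-congˡ (ι-- y))
    tr : ι (+ 2 ℤ.* A ℤ.- B) ≈ ιₙ 2 * ι A - ι B
    tr = trans (ι-minus (+ 2 ℤ.* A) B) (+-congʳ (ι-* (+ 2) A))
    pR≈ : pR ≈ ι A * ι A - ι A * ι B + ι B * ι B
    pR≈ = trans (reflexive (≡.cong ι (≡.sym nJ))) (trans (ι-+ (A ℤ.* A ℤ.- A ℤ.* B) (B ℤ.* B))
      (+-cong (trans (ι-minus (A ℤ.* A) (A ℤ.* B)) (+-cong (ι-* A A) (-‿cong (ι-* A B)))) (ι-* B B)))

  module _ (x y : Carrier) (6x≈p : ιₙ 6 * x ≈ pR) (x³≈0 : x * x * x ≈ 0#)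
    (y-eq : y * (Π< n (λ i → ιₙ (suc i) - ιₙ 2 * x) * Π< n (λ i → ιₙ (suc i) * ιₙ (suc i) * ιₙ (suc i) + x * x * x))
        ≈ Π< n (λ i → x * x - ιₙ (suc i) * ιₙ (suc i)) * Π< (2 ℕ.* n) (λ i → ιₙ (suc i) - ιₙ 2 * x)) where

    open Final x 6x≈p x³≈0 using (J-closed-form; unit-6)

    p∣x : pR ∣ʳ x
    p∣x = proj₁ unit-6 , (begin
      x                               ≈⟨ trans (sym (*-identityʳ _)) (*-congˡ (sym (proj₂ unit-6))) ⟩
      x * (ιₙ 6 * proj₁ unit-6)       ≈⟨ solve 3 (λ x s u → x :* (s :* u) := (s :* x) :* u) refl _ _ _ ⟩
      ιₙ 6 * x * proj₁ unit-6         ≈⟨ *-congʳ 6x≈p ⟩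
      pR * proj₁ unit-6 ∎)

    unit-y : Unit y
    unit-y = unit-factor (unit-cong (sym y-eq) (unit-* (Π-unit n (λ i i<n → unit-≡ₚ (unit-neg (unit-* (us i (ℕₚ.<-trans i<n n<M)) (us i (ℕₚ.<-trans i<n n<M))))
          (∣ʳ-resp (solve 2 (λ x s → x :* x := x :* x :- s :* s :- :- (s :* s)) refl x _) (∣ʳ-*ʳ x p∣x))))
        (Π-unit (2 ℕ.* n) (λ i i<2n → unit-≡ₚ (us i (ℕₚ.<-trans i<2n (kn<M 2 (ℕ.s≤s (ℕ.s≤s (ℕ.s≤s ℕ.z≤n))))))
          (∣ʳ-resp (solve 2 (λ x s → :- (♯ 2 :* x) := s :- ♯ 2 :* x :- s) refl x _) (∣ʳ-neg (∣ʳ-*ˡ (ιₙ 2) p∣x)))))))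
      where
      us : ∀ i → i ℕ.< M → Unit (ιₙ (suc i))
      us = unit-small

    hᴿJ≈-y : hᴿ Jᴱ ≈ - y
    hᴿJ≈-y = trans hᴿ-J (J-closed-form y y-eq)

    -- The image of J is -y, a unit, while the image of C is divisible by p.
    J≢C : ¬ (Jᴱ ≡ Cᴱ)
    J≢C e = nonunit (unit-neg unit-y) (∣ʳ-resp hᴿJ≈-y (≡.subst (λ z → pR ∣ʳ hᴿ z) (≡.sym e) hᴿ-C))

    y-quadratic : y * y + ι (trace Jᴱ) * y + pR ≈ 0#
    y-quadratic = trans (+-congʳ (trans (solve 2 (λ y u → y :* y :+ u :* y := :- y :* :- y :- u :* :- y) refl y (ι (trace Jᴱ)))
      (+-cong (*-cong (sym hᴿJ≈-y) (sym hᴿJ≈-y)) (-‿cong (*-congˡ (sym hᴿJ≈-y)))))) (quadratic Jᴱ norm-J)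

    -- Otherwise y^2 = -(uy + p) would be divisible by p, although y is a unit.
    ¬p∣trace : ¬ (+ p ∣ᶻ trace Jᴱ)
    ¬p∣trace h = nonunit (unit-* unit-y unit-y) (∣ʳ-resp e (∣ʳ-neg (∣ʳ-+ (∣ʳ-*ʳ y p∣u) (1# , sym (*-identityʳ _)))))
      where
      p∣u : pR ∣ʳ ι (trace Jᴱ)
      p∣u = ∣ʳ-resp (trans (+-congˡ -0#≈0#) (+-identityʳ _)) (≅⇒≡ₚ (∣⇒≅0 h))
      e : - (ι (trace Jᴱ) * y + pR) ≈ y * y
      e = a-b≈0⇒a≈b (trans (solve 3 (λ u y p → :- (u :* y :+ p) :- y :* y := :- (y :* y :+ u :* y :+ p)) refl (ι (trace Jᴱ)) y pR) (trans (-‿cong y-quadratic) -0#≈0#))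

    -- The unit root of y² + u y + p, to order p³
    unit-root : ∀ u v → y * y + u * y + pR ≈ 0# → u * v ≈ 1# → y ≈ - u + pR * v + pR * pR * (v * v * v)
    unit-root u v hy uv = unit-cancel-difference (begin
      (y + z + u) * (y - z)
        ≈⟨ solve 4 (λ y z u p → (y :+ z :+ u) :* (y :- z) := (y :* y :+ u :* y :+ p) :- (z :* z :+ u :* z :+ p)) refl y z u pR ⟩
      (y * y + u * y + pR) - (z * z + u * z + pR)
        ≈⟨ +-cong hy (-‿cong z-root) ⟩
      0# - 0#   ≈⟨ -‿inverseʳ _ ⟩
      0# ∎)
      where
      z = - u + pR * v + pR * pR * (v * v * v)
      -- Since z + u is divisible by p, y + z + u is a unit along with y and can be cancelled.
      unit-cancel-difference : (y + z + u) * (y - z) ≈ 0# → y ≈ z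
      unit-cancel-difference h = a-b≈0⇒a≈b (unit-zero (unit-≡ₚ unit-y (v + pR * (v * v * v) ,
        solve 4 (λ y u p v → y :+ (:- u :+ p :* v :+ p :* p :* (v :* v :* v)) :+ u :- y := p :* (v :+ p :* (v :* v :* v))) refl y u pR v)) h)
      z-root : z * z + u * z + pR ≈ 0#
      z-root = begin
        z * z + u * z + pR
          ≈⟨ solve 3 (λ u p v → let z = :- u :+ p :* v :+ p :* p :* (v :* v :* v) in z :* z :+ u :* z :+ p
               := (u :* v :- ♯ 1) :* (:- p :- p :* p :* (v :* v)) :+ (p :* p :* p) :* (♯ 2 :* (v :* v :* v :* v) :+ p :* (v :* v :* v :* v :* v :* v))) refl u pR v ⟩
        (u * v - 1#) * (- pR - pR * pR * (v * v)) + (pR * pR * pR) * (ιₙ 2 * (v * v * v * v) + pR * (v * v * v * v * v * v))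
          ≈⟨ +-cong (*-congʳ (a≈b⇒a-b≈0 uv)) (*-congʳ p³≈0) ⟩
        0# * _ + 0# * _
          ≈⟨ solve 2 (λ a b → ♯ 0 :* a :+ ♯ 0 :* b := ♯ 0) refl _ _ ⟩
        0# ∎

    result : ∃ λ u → QuadraticForms.IsTrace X Y u × ¬ (+ p ∣ᶻ u) × (∀ v → ι u * v ≈ 1# → y ≈ - ι u + pR * v + pR * pR * (v * v * v))
    result = trace Jᴱ , trace-identified Jᴱ Cᴱ norm-J norm-C J≡C-mod-2 C≡-p-mod-3 J≡-1-mod-√-3 J≢C , ¬p∣trace
      , λ v → unit-root (ι (trace Jᴱ)) v y-quadratic

-- Primes p = 6g - 1: evaluation of the unit part modulo p^2.

module UnitPart {c ℓ} (R : CommutativeRing c ℓ) (g′ : ℕ) where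
  open RingKit R
  private
    M : ℕ
    M = 6 ℕ.* g′ ℕ.+ 4
    P : Carrier
    P = ιₙ (suc M)

  module ModuloSquare (p²≈0 : P * P ≈ 0#) (iv : ℕ → Carrier) (iv-inv : ∀ i → i ℕ.< M → ιₙ (suc i) * iv i ≈ 1#) where

    open NaturalBinomials
    open RingBinomials R using (ιₙ-rising)
    open import Data.Nat using (_!)
    open import Data.Nat.Combinatorics using () renaming (_C_ to _choose_)

    unit-small : ∀ i → i ℕ.< M → Unit (ιₙ (suc i))
    unit-small i i<M = iv i , iv-inv i i<M

    fact H : ℕ → Carrier
    fact k = Π< k (λ i → ιₙ (suc i))
    H k = Σ< k iv

    unit-fact : ∀ k → k ℕ.≤ M → Unit (fact k)
    unit-fact k k≤M = Π-unit k (λ i i<k → unit-small i (ℕₚ.<-≤-trans i<k k≤M))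

    shifted : ∀ k y → k ℕ.≤ M → y * y ≈ 0# → Π< k (λ i → ιₙ (suc i) + y) ≈ fact k * (1# + H k * y)
    shifted zero y _ _ = solve 1 (λ y → ♯ 1 := ♯ 1 :* (♯ 1 :+ ♯ 0 :* y)) refl y
    shifted (suc k) y k<M y² = begin
      Π< k (λ i → ιₙ (suc i) + y) * (s + y)
        ≈⟨ *-cong (shifted k y (ℕₚ.<⇒≤ k<M) y²) (+-congˡ (trans (sym (*-identityˡ y)) (*-congʳ (sym (iv-inv k k<M))))) ⟩
      fact k * (1# + H k * y) * (s + s * v * y)
        ≈⟨ ≈-mod-zero (solve 5 (λ f h y s v → f :* (♯ 1 :+ h :* y) :* (s :+ s :* v :* y) := f :* s :* (♯ 1 :+ (h :+ v) :* y) :+ y :* y :* (f :* s :* h :* v)) refl (fact k) (H k) y s v) y² ⟩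
      fact k * s * (1# + (H k + v) * y) ∎
      where
      s = ιₙ (suc k)
      v = iv k

    complement : ∀ k l i → k ℕ.+ l ≡ M → i ℕ.< l → ιₙ (suc (k ℕ.+ (l ℕ.∸ suc i))) ≈ P - ιₙ (suc i)
    complement k l i e i<l = begin
      ιₙ j                             ≈⟨ solve 2 (λ a b → a := a :+ b :- b) refl (ιₙ j) (ιₙ (suc i)) ⟩
      ιₙ j + ιₙ (suc i) - ιₙ (suc i)   ≈⟨ +-congʳ (ιₙ-+ j (suc i)) ⟨
      ιₙ (j ℕ.+ suc i) - ιₙ (suc i)    ≡⟨ ≡.cong (λ m → ιₙ (suc m) - ιₙ (suc i)) (≡.trans (ℕₚ.+-assoc k (l ℕ.∸ suc i) (suc i)) (≡.trans (≡.cong (k ℕ.+_) (ℕₚ.m∸n+n≡m i<l)) e)) ⟩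
      P - ιₙ (suc i)                   ∎
      where j = suc (k ℕ.+ (l ℕ.∸ suc i))

    -P² : - P * - P ≈ 0#
    -P² = trans (solve 1 (λ p → :- p :* :- p := p :* p) refl P) p²≈0

    -- The top l factors of (p-1)! are the p - i with i ≤ l, expanded to first order in p.
    fact-reflect : ∀ k l → k ℕ.+ l ≡ M → fact M ≈ fact k * ((- 1#) ^ l * (fact l * (1# + H l * - P)))
    fact-reflect k l e = begin
      fact M                                                ≡⟨ ≡.cong fact e ⟨
      fact (k ℕ.+ l)                                        ≈⟨ Π-split k l _ ⟩
      fact k * Π< l (λ i → ιₙ (suc (k ℕ.+ i)))              ≈⟨ *-congˡ (trans (Π-rev l _) (Π-cong l (λ i i<l → trans (complement k l i e i<l)
                                                                 (solve 2 (λ p s → p :- s := :- (♯ 1) :* (s :+ :- p)) refl P (ιₙ (suc i)))))) ⟩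
      fact k * Π< l (λ i → - 1# * (ιₙ (suc i) + - P))       ≈⟨ *-congˡ (trans (Π-* l _ _) (*-cong (Π-const l (- 1#)) (shifted l (- P) l≤M -P²))) ⟩
      fact k * ((- 1#) ^ l * (fact l * (1# + H l * - P)))   ∎
      where l≤M = ≡.subst (l ℕ.≤_) e (ℕₚ.m≤n+m l k)

    -- If a b' = b a' = 1 and r (a + b) = 0 then r a' = - r b'.
    opposite-inverses : ∀ {r a a′ b b′} → a * a′ ≈ 1# → b * b′ ≈ 1# → r * (a + b) ≈ 0# → r * a′ ≈ - (r * b′)
    opposite-inverses {r} {a} {a′} {b} {b′} ha hb h = begin
      r * a′                                          ≈⟨ solve 3 (λ r a b → r :* a := r :* a :* ♯ 1) refl r a′ b′ ⟩
      r * a′ * 1#                                     ≈⟨ *-congˡ hb ⟨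
      r * a′ * (b * b′)                               ≈⟨ solve 5 (λ r a a′ b b′ → r :* a′ :* (b :* b′) := r :* (a :+ b) :* (a′ :* b′) :- r :* b′ :* (a :* a′)) refl r a a′ b b′ ⟩
      r * (a + b) * (a′ * b′) - r * b′ * (a * a′)     ≈⟨ +-cong (trans (*-congʳ h) (zeroˡ _)) (-‿cong (trans (*-congˡ ha) (*-identityʳ _))) ⟩
      0# - r * b′                                     ≈⟨ +-identityˡ _ ⟩
      - (r * b′)                                      ∎

    -- 1/(p - i) is -1/i modulo p. Harmonic sums only ever occur multiplied by p, so such
    -- congruences are stated with the factor `P` and hold modulo p^2.
    iv-reflect : ∀ k l i → k ℕ.+ l ≡ M → i ℕ.< l → P * iv (k ℕ.+ (l ℕ.∸ suc i)) ≈ - (P * iv i)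
    iv-reflect k l i e i<l = opposite-inverses (iv-inv j j<M) (iv-inv i (ℕₚ.<-≤-trans i<l (≡.subst (l ℕ.≤_) e (ℕₚ.m≤n+m l k))))
      (trans (*-congˡ (trans (+-congʳ (complement k l i e i<l)) (solve 2 (λ p s → p :- s :+ s := p) refl P (ιₙ (suc i))))) p²≈0)
      where
      j = k ℕ.+ (l ℕ.∸ suc i)
      j<M : j ℕ.< M
      j<M = ≡.subst (j ℕ.<_) e (ℕₚ.+-monoʳ-< k (ℕₚ.∸-monoʳ-< {l} {suc i} {0} (ℕ.s≤s ℕ.z≤n) i<l))

    H-reflect : ∀ k l → k ℕ.+ l ≡ M → P * H M ≈ P * H k - P * H l
    H-reflect k l e = begin
      P * H M                                       ≡⟨ ≡.cong (λ m → P * H m) e ⟨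
      P * H (k ℕ.+ l)                               ≈⟨ trans (*-congˡ (Σ-split k l iv)) (distribˡ _ _ _) ⟩
      P * H k + P * Σ< l (λ i → iv (k ℕ.+ i))       ≈⟨ +-congˡ (trans (*-congˡ (Σ-rev l _)) (trans (sym (Σ-*ˡ l P _)) (Σ-cong l (λ i i<l → iv-reflect k l i e i<l)))) ⟩
      P * H k + Σ< l (λ i → - (P * iv i))           ≈⟨ +-congˡ (trans (Σ-neg l _) (-‿cong (Σ-*ˡ l P iv))) ⟩
      P * H k - P * H l                             ∎

    unit-2 : Unit (ιₙ 2)
    unit-2 = unit-small 1 (ℕₚ.<-≤-trans (ℕ.s≤s (ℕ.s≤s ℕ.z≤n)) (ℕₚ.m≤n+m 4 (6 ℕ.* g′)))

    unit-3 : Unit (ιₙ 3)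
    unit-3 = unit-small 2 (ℕₚ.<-≤-trans (ℕ.s≤s (ℕ.s≤s (ℕ.s≤s ℕ.z≤n))) (ℕₚ.m≤n+m 4 (6 ℕ.* g′)))

    PH-M≈0 : P * H M ≈ 0#
    PH-M≈0 = unit-zero unit-2 (begin
      ιₙ 2 * (P * H M)             ≈⟨ solve 1 (λ a → ♯ 2 :* a := a :+ a) refl _ ⟩
      P * H M + P * H M            ≈⟨ +-congˡ (H-reflect 0 M ≡.refl) ⟩
      P * H M + (P * 0# - P * H M) ≈⟨ solve 2 (λ a p → a :+ (p :* ♯ 0 :- a) := ♯ 0) refl _ P ⟩
      0#                           ∎)

    -- Separating even and odd factors

    half y : Carrier
    half = proj₁ unit-2
    y = - (P * half)

    y² : y * y ≈ 0#
    y² = trans (solve 2 (λ p h → :- (p :* h) :* :- (p :* h) := p :* p :* (h :* h)) refl P half) (trans (*-congʳ p²≈0) (zeroˡ _))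

    2y : ιₙ 2 * y ≈ - P
    2y = trans (solve 3 (λ t p h → t :* :- (p :* h) := :- (p :* (t :* h))) refl (ιₙ 2) P half) (-‿cong (trans (*-congˡ (proj₂ unit-2)) (*-identityʳ _)))

    odds : ℕ → Carrier
    odds k = Π< k (λ i → ιₙ (suc (2 ℕ.* i)))

    2suc : ∀ k → 2 ℕ.* suc k ≡ suc (suc (2 ℕ.* k))
    2suc k = ℕₚ.*-suc 2 k

    fact-double : ∀ k → fact (2 ℕ.* k) ≈ ιₙ 2 ^ k * fact k * odds k
    fact-double zero = solve 0 (♯ 1 := ♯ 1 :* ♯ 1 :* ♯ 1) refl
    fact-double (suc k) = begin
      fact (2 ℕ.* suc k)                                           ≡⟨ ≡.cong fact (2suc k) ⟩
      fact (2 ℕ.* k) * ιₙ (suc (2 ℕ.* k)) * ιₙ (suc (suc (2 ℕ.* k))) ≈⟨ *-cong (*-congʳ (fact-double k)) (trans (reflexive (≡.cong ιₙ (≡.sym (2suc k)))) (ιₙ-* 2 (suc k))) ⟩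
      ιₙ 2 ^ k * fact k * odds k * o * (ιₙ 2 * ιₙ (suc k))         ≈⟨ solve 6 (λ t x f p o s → x :* f :* p :* o :* (t :* s) := t :* x :* (f :* s) :* (p :* o)) refl (ιₙ 2) (ιₙ 2 ^ k) (fact k) (odds k) o (ιₙ (suc k)) ⟩
      ιₙ 2 * ιₙ 2 ^ k * (fact k * ιₙ (suc k)) * (odds k * o)       ∎
      where o = ιₙ (suc (2 ℕ.* k))

    fact-double+1 : ∀ k → fact (suc (2 ℕ.* k)) ≈ ιₙ 2 ^ k * fact k * odds (suc k)
    fact-double+1 k = trans (*-congʳ (fact-double k)) (*-assoc _ _ _)

    T : ℕ
    T = 3 ℕ.* g′ ℕ.+ 2

    2T≡M : 2 ℕ.* T ≡ M
    2T≡M = ℕS.solve 1 (λ g → ℕS.con 2 ℕS.:* (ℕS.con 3 ℕS.:* g ℕS.:+ ℕS.con 2) ℕS.:= ℕS.con 6 ℕS.:* g ℕS.:+ ℕS.con 4) ≡.refl g′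

    odd-complement : ∀ k l i → k ℕ.+ l ≡ T → i ℕ.< k → ιₙ (suc (2 ℕ.* (k ℕ.∸ suc i))) ≈ P - ιₙ 2 * ιₙ (suc (l ℕ.+ i))
    odd-complement k l i e i<k = begin
      ιₙ (suc a)                                              ≈⟨ solve 2 (λ a b → a := a :+ b :- b) refl (ιₙ (suc a)) (ιₙ b) ⟩
      ιₙ (suc a) + ιₙ b - ιₙ b                                ≈⟨ +-cong (sym (ιₙ-+ (suc a) b)) (-‿cong (ιₙ-* 2 (suc (l ℕ.+ i)))) ⟩
      ιₙ (suc a ℕ.+ b) - ιₙ 2 * ιₙ (suc (l ℕ.+ i))            ≡⟨ ≡.cong (λ m → ιₙ (suc m) - ιₙ 2 * ιₙ (suc (l ℕ.+ i))) sum ⟩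
      P - ιₙ 2 * ιₙ (suc (l ℕ.+ i))                           ∎
      where
      a = 2 ℕ.* (k ℕ.∸ suc i)
      b = 2 ℕ.* suc (l ℕ.+ i)
      sum : a ℕ.+ b ≡ M
      sum = ≡.trans (ℕS.solve 3 (λ u l i → ℕS.con 2 ℕS.:* u ℕS.:+ ℕS.con 2 ℕS.:* (ℕS.con 1 ℕS.:+ (l ℕS.:+ i)) ℕS.:= ℕS.con 2 ℕS.:* ((u ℕS.:+ (ℕS.con 1 ℕS.:+ i)) ℕS.:+ l)) ≡.refl (k ℕ.∸ suc i) l i)
        (≡.trans (≡.cong (λ m → 2 ℕ.* (m ℕ.+ l)) (ℕₚ.m∸n+n≡m i<k)) (≡.trans (≡.cong (2 ℕ.*_) e) 2T≡M))

    T≤M : T ℕ.≤ M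
    T≤M = ≡.subst (T ℕ.≤_) 2T≡M (ℕₚ.m≤m+n T (T ℕ.+ 0))

    -- The odd numbers up to 2k - 1 are p - 2s for s from l + 1 to T = (p-1)/2. With y = -p/2 each
    -- equals -2(s + y), and the factors s + y complete the product up to l to the product up to T.
    odds-reflect : ∀ k l → k ℕ.+ l ≡ T → odds k * (fact l * (1# + H l * y)) ≈ (- ιₙ 2) ^ k * (fact T * (1# + H T * y))
    odds-reflect k l e = begin
      odds k * (fact l * (1# + H l * y))
        ≈⟨ *-cong (trans (Π-rev k _) (trans (Π-cong k (λ i i<k → trans (odd-complement k l i e i<k)
             (trans (solve 3 (λ p t s → p :- t :* s := :- t :* s :+ p) refl P (ιₙ 2) (ιₙ (suc (l ℕ.+ i))))
               (trans (+-congˡ (trans (sym (-‿involutive P)) (-‿cong (sym 2y)))) (solve 3 (λ t s y → :- t :* s :+ :- (t :* y) := :- t :* (s :+ y)) refl (ιₙ 2) (ιₙ (suc (l ℕ.+ i))) y)))))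
           (trans (Π-* k _ _) (*-congʳ (Π-const k (- ιₙ 2)))))) (sym (shifted l y (ℕₚ.≤-trans (≡.subst (l ℕ.≤_) e (ℕₚ.m≤n+m l k)) T≤M) y²)) ⟩
      (- ιₙ 2) ^ k * Π< k (λ i → ιₙ (suc (l ℕ.+ i)) + y) * Π< l (λ i → ιₙ (suc i) + y)
        ≈⟨ trans (*-assoc _ _ _) (*-congˡ (trans (*-comm _ _) (sym (Π-split l k _)))) ⟩
      (- ιₙ 2) ^ k * Π< (l ℕ.+ k) (λ i → ιₙ (suc i) + y)
        ≡⟨ ≡.cong (λ m → (- ιₙ 2) ^ k * Π< m (λ i → ιₙ (suc i) + y)) (≡.trans (ℕₚ.+-comm l k) e) ⟩
      (- ιₙ 2) ^ k * Π< T (λ i → ιₙ (suc i) + y)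
        ≈⟨ *-congˡ (shifted T y T≤M y²) ⟩
      (- ιₙ 2) ^ k * (fact T * (1# + H T * y)) ∎

    H-double+1 : ∀ k → suc (2 ℕ.* k) ℕ.≤ M → ιₙ 2 * H (suc (2 ℕ.* k)) ≈ ιₙ 2 * Σ< (suc k) (λ i → iv (2 ℕ.* i)) + H k
    H-double+1 zero _ = sym (+-identityʳ _)
    H-double+1 (suc k) h = begin
      ιₙ 2 * H (suc (2 ℕ.* suc k))
        ≡⟨ ≡.cong (λ m → ιₙ 2 * H (suc m)) (2suc k) ⟩
      ιₙ 2 * (H (suc (2 ℕ.* k)) + iv (suc (2 ℕ.* k)) + iv (suc (suc (2 ℕ.* k))))
        ≈⟨ solve 4 (λ t a b e → t :* (a :+ b :+ e) := t :* a :+ t :* b :+ t :* e) refl (ιₙ 2) _ _ _ ⟩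
      ιₙ 2 * H (suc (2 ℕ.* k)) + ιₙ 2 * iv (suc (2 ℕ.* k)) + ιₙ 2 * iv (suc (suc (2 ℕ.* k)))
        ≈⟨ +-cong (+-cong (H-double+1 k (ℕₚ.≤-trans (ℕₚ.n≤1+n _) (ℕₚ.≤-trans (ℕₚ.n≤1+n _) h′))) halve) (*-congˡ (reflexive (≡.cong iv (≡.sym (2suc k))))) ⟩
      ιₙ 2 * Σ< (suc k) (λ i → iv (2 ℕ.* i)) + H k + iv k + ιₙ 2 * iv (2 ℕ.* suc k)
        ≈⟨ solve 5 (λ t s h v w → t :* s :+ h :+ v :+ t :* w := t :* (s :+ w) :+ (h :+ v)) refl (ιₙ 2) _ _ _ _ ⟩
      ιₙ 2 * (Σ< (suc k) (λ i → iv (2 ℕ.* i)) + iv (2 ℕ.* suc k)) + (H k + iv k) ∎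
      where
      h′ : suc (suc (suc (2 ℕ.* k))) ℕ.≤ M
      h′ = ≡.subst (λ m → suc m ℕ.≤ M) (2suc k) h
      k<M : k ℕ.< M
      k<M = ℕₚ.≤-trans (ℕ.s≤s (ℕₚ.m≤m+n k _)) (ℕₚ.≤-trans (ℕₚ.n≤1+n _) (ℕₚ.≤-trans (ℕₚ.n≤1+n _) h′))
      halve : ιₙ 2 * iv (suc (2 ℕ.* k)) ≈ iv k
      halve = unit-cancel (unit-small k k<M) (begin
        ιₙ (suc k) * (ιₙ 2 * iv (suc (2 ℕ.* k)))        ≈⟨ solve 3 (λ s t v → s :* (t :* v) := t :* s :* v) refl _ _ _ ⟩
        ιₙ 2 * ιₙ (suc k) * iv (suc (2 ℕ.* k))          ≈⟨ *-congʳ (trans (sym (ιₙ-* 2 (suc k))) (reflexive (≡.cong ιₙ (2suc k)))) ⟩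
        ιₙ (suc (suc (2 ℕ.* k))) * iv (suc (2 ℕ.* k))   ≈⟨ iv-inv (suc (2 ℕ.* k)) (ℕₚ.≤-trans (ℕₚ.n≤1+n _) h′) ⟩
        1#                                              ≈⟨ iv-inv k k<M ⟨
        ιₙ (suc k) * iv k                               ∎)

    odd-iv-reflect : ∀ k l → k ℕ.+ l ≡ T → P * (ιₙ 2 * Σ< k (λ i → iv (2 ℕ.* i))) ≈ P * H l - P * H T
    odd-iv-reflect k l e = begin
      P * (ιₙ 2 * Σ< k (λ i → iv (2 ℕ.* i)))
        ≈⟨ *-congˡ (*-congˡ (Σ-rev k _)) ⟩
      P * (ιₙ 2 * Σ< k (λ i → iv (2 ℕ.* (k ℕ.∸ suc i))))
        ≈⟨ trans (sym (*-assoc _ _ _)) (trans (sym (Σ-*ˡ k _ _)) (Σ-cong k term)) ⟩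
      Σ< k (λ i → - (P * iv (l ℕ.+ i)))
        ≈⟨ trans (Σ-neg k _) (-‿cong (Σ-*ˡ k P _)) ⟩
      - (P * Σ< k (λ i → iv (l ℕ.+ i)))
        ≈⟨ solve 3 (λ p h s → :- (p :* s) := p :* h :- p :* (h :+ s)) refl P (H l) _ ⟩
      P * H l - P * (H l + Σ< k (λ i → iv (l ℕ.+ i)))
        ≈⟨ +-congˡ (-‿cong (*-congˡ (trans (sym (Σ-split l k iv)) (reflexive (≡.cong H (≡.trans (ℕₚ.+-comm l k) e)))))) ⟩
      P * H l - P * H T ∎
      where
      term : ∀ i → i ℕ.< k → P * ιₙ 2 * iv (2 ℕ.* (k ℕ.∸ suc i)) ≈ - (P * iv (l ℕ.+ i))
      term i i<k = trans (opposite-inverses {P * ιₙ 2} {ιₙ (suc j)} {iv j} {ιₙ 2 * s} {half * v} (iv-inv j j<M) 2s-inv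
          (trans (*-congˡ (trans (+-congʳ (odd-complement k l i e i<k)) (solve 2 (λ p s → p :- s :+ s := p) refl P (ιₙ 2 * s))))
            (trans (solve 2 (λ p t → p :* t :* p := t :* (p :* p)) refl P (ιₙ 2)) (trans (*-congˡ p²≈0) (zeroʳ _)))))
        (-‿cong (trans (solve 4 (λ p t h v → p :* t :* (h :* v) := p :* (t :* h) :* v) refl P (ιₙ 2) half v) (*-congʳ (trans (*-congˡ (proj₂ unit-2)) (*-identityʳ _)))))
        where
        j = 2 ℕ.* (k ℕ.∸ suc i)
        s = ιₙ (suc (l ℕ.+ i))
        v = iv (l ℕ.+ i)
        l+i<T : l ℕ.+ i ℕ.< T
        l+i<T = ≡.subst (l ℕ.+ i ℕ.<_) (≡.trans (ℕₚ.+-comm l k) e) (ℕₚ.+-monoʳ-< l i<k)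
        2s-inv : ιₙ 2 * s * (half * v) ≈ 1#
        2s-inv = trans (solve 4 (λ t s h v → t :* s :* (h :* v) := (t :* h) :* (s :* v)) refl (ιₙ 2) s half v)
          (trans (*-cong (proj₂ unit-2) (iv-inv (l ℕ.+ i) (ℕₚ.<-≤-trans l+i<T T≤M))) (*-identityˡ _))
        j<M : j ℕ.< M
        j<M = ≡.subst (j ℕ.<_) 2T≡M (ℕₚ.*-monoʳ-< 2 (ℕₚ.<-≤-trans (ℕₚ.∸-monoʳ-< {k} {suc i} {0} (ℕ.s≤s ℕ.z≤n) i<k) (≡.subst (k ℕ.≤_) e (ℕₚ.m≤m+n k l))))

    -- With g = g′ + 1 = (p+1)/6 these are 2g - 1, 4g - 1 and 5g - 1, while T = 3g - 1 and M = 6g -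
    -- 2; so k₂ pairs with k₄, n with g′, and T with itself under reflection.
    k₂ k₄ n : ℕ
    k₂ = suc (2 ℕ.* g′)
    k₄ = 4 ℕ.* g′ ℕ.+ 3
    n = 5 ℕ.* g′ ℕ.+ 4

    G e : Carrier
    G = ιₙ 2 ^ g′
    e = (- 1#) ^ g′

    signs : ∀ a b → (- 1#) ^ (a ℕ.+ 2 ℕ.* b) ≈ (- 1#) ^ a
    signs a b = trans (^-homo-* (- 1#) a (2 ℕ.* b)) (trans (*-congˡ (trans (sym (^-assocʳ (- 1#) 2 b))
      (trans (^-congˡ b (solve 0 (:- (♯ 1) :* (:- (♯ 1) :* ♯ 1) := ♯ 1) refl)) (1^n≈1 b)))) (*-identityʳ _))

    e²≈1 : e * e ≈ 1#
    e²≈1 = trans (sym (^-homo-* (- 1#) g′ g′)) (trans (reflexive (≡.cong ((- 1#) ^_) (≡.cong (g′ ℕ.+_) (≡.sym (ℕₚ.+-identityʳ g′))))) (signs 0 g′))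

    six : Carrier
    six = proj₁ (unit-* unit-2 unit-3)

    -- A sixth of the harmonic sum: multiplied by p/2 or by 2x = 5p/3, the sums then have integer
    -- coefficients 3 and 10 in P m.
    m : ℕ → Carrier
    m k = six * H k

    6m : ∀ k → H k ≈ ιₙ 6 * m k
    6m k = sym (trans (solve 3 (λ a b s → ♯ 6 :* (s :* a) := (♯ 2 :* ♯ 3 :* s) :* a) refl (H k) P six) (trans (*-congʳ (proj₂ (unit-* unit-2 unit-3))) (*-identityˡ _)))

    mod-P² : ∀ {u v c} → u ≈ v + P * P * c → u ≈ v
    mod-P² h = ≈-mod-zero h p²≈0

    a b q d f F : Carrier
    a = fact g′
    b = fact k₂
    q = fact T
    d = fact k₄
    f = fact n
    F = fact M

    k₂≤M : k₂ ℕ.≤ M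
    k₂≤M = ≡.subst (k₂ ℕ.≤_) (ℕS.solve 1 (λ g → (ℕS.con 1 ℕS.:+ ℕS.con 2 ℕS.:* g) ℕS.:+ (ℕS.con 4 ℕS.:* g ℕS.:+ ℕS.con 3) ℕS.:= ℕS.con 6 ℕS.:* g ℕS.:+ ℕS.con 4) ≡.refl g′) (ℕₚ.m≤m+n k₂ k₄)

    k₄+k₂ : k₄ ℕ.+ k₂ ≡ M
    k₄+k₂ = ℕS.solve 1 (λ g → (ℕS.con 4 ℕS.:* g ℕS.:+ ℕS.con 3) ℕS.:+ (ℕS.con 1 ℕS.:+ ℕS.con 2 ℕS.:* g) ℕS.:= ℕS.con 6 ℕS.:* g ℕS.:+ ℕS.con 4) ≡.refl g′

    n+g′ : n ℕ.+ g′ ≡ M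
    n+g′ = ℕS.solve 1 (λ g → (ℕS.con 5 ℕS.:* g ℕS.:+ ℕS.con 4) ℕS.:+ g ℕS.:= ℕS.con 6 ℕS.:* g ℕS.:+ ℕS.con 4) ≡.refl g′

    n≤M : n ℕ.≤ M
    n≤M = ≡.subst (n ℕ.≤_) n+g′ (ℕₚ.m≤m+n n g′)

    k₄≤M : k₄ ℕ.≤ M
    k₄≤M = ≡.subst (k₄ ℕ.≤_) k₄+k₂ (ℕₚ.m≤m+n k₄ k₂)

    g+k₂ : suc g′ ℕ.+ k₂ ≡ T
    g+k₂ = ℕS.solve 1 (λ g → (ℕS.con 1 ℕS.:+ g) ℕS.:+ (ℕS.con 1 ℕS.:+ ℕS.con 2 ℕS.:* g) ℕS.:= ℕS.con 3 ℕS.:* g ℕS.:+ ℕS.con 2) ≡.refl g′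

    reflected : ∀ k l s → k ℕ.+ l ≡ M → (- 1#) ^ l ≈ s → fact M ≈ s * (fact k * fact l) * (1# - ιₙ 6 * (P * m l))
    reflected k l s h hs = trans (fact-reflect k l h) (trans (*-congˡ (*-cong hs (*-congˡ (+-congˡ (*-congʳ (6m l))))))
      (solve 5 (λ k s l P m → k :* (s :* (l :* (♯ 1 :+ ♯ 6 :* m :* :- P))) := s :* (k :* l) :* (♯ 1 :- ♯ 6 :* (P :* m))) refl (fact k) s (fact l) P (m l)))

    F-fa : F ≈ e * (f * a) * (1# - ιₙ 6 * (P * m g′))
    F-fa = reflected n g′ e n+g′ refl

    F-db : F ≈ - 1# * (d * b) * (1# - ιₙ 6 * (P * m k₂))
    F-db = reflected k₄ k₂ (- 1#) k₄+k₂ (trans (signs 1 g′) (*-identityʳ _))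

    sign-T : (- 1#) ^ T ≈ e
    sign-T = trans (reflexive (≡.cong ((- 1#) ^_) (ℕS.solve 1 (λ g → ℕS.con 3 ℕS.:* g ℕS.:+ ℕS.con 2 ℕS.:= g ℕS.:+ ℕS.con 2 ℕS.:* (g ℕS.:+ ℕS.con 1)) ≡.refl g′))) (signs g′ (g′ ℕ.+ 1))

    sign-n : (- 1#) ^ n ≈ e
    sign-n = trans (reflexive (≡.cong ((- 1#) ^_) (ℕS.solve 1 (λ g → ℕS.con 5 ℕS.:* g ℕS.:+ ℕS.con 4 ℕS.:= g ℕS.:+ ℕS.con 2 ℕS.:* (ℕS.con 2 ℕS.:* g ℕS.:+ ℕS.con 2)) ≡.refl g′))) (signs g′ (2 ℕ.* g′ ℕ.+ 2))

    F-qq : F ≈ e * (q * q) * (1# - ιₙ 6 * (P * m T))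
    F-qq = reflected T T e (≡.trans (≡.cong (T ℕ.+_) (≡.sym (ℕₚ.+-identityʳ T))) 2T≡M) sign-T

    Hy : ∀ k → H k * y ≈ - (ιₙ 3 * (P * m k))
    Hy k = trans (*-congʳ (6m k)) (trans (solve 3 (λ m P h → ♯ 6 :* m :* :- (P :* h) := :- (♯ 3 :* (P :* m) :* (♯ 2 :* h))) refl (m k) P half)
      (-‿cong (trans (*-congˡ (proj₂ unit-2)) (*-identityʳ _))))

    neg-power : ∀ k → (- ιₙ 2) ^ k ≈ (- 1#) ^ k * ιₙ 2 ^ k
    neg-power k = trans (^-congˡ k (solve 1 (λ t → :- t := :- (♯ 1) :* t) refl (ιₙ 2))) (^-distrib-* (- 1#) (ιₙ 2) k)

    -- Duplication: k₂! = (2g′+1)! is 2^g′ g′! times the odd numbers, and `odds-reflect` turns the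
    -- odd part into T!/k₂!.
    bb-aq : b * b * (1# - ιₙ 3 * (P * m k₂)) ≈ - (ιₙ 2 * e * (G * G) * (a * q) * (1# - ιₙ 3 * (P * m T)))
    bb-aq = begin
      b * b * (1# - ιₙ 3 * (P * m k₂))
        ≈⟨ *-cong (*-congʳ (fact-double+1 g′)) (+-congˡ (sym (Hy k₂))) ⟩
      G * a * odds (suc g′) * b * (1# + H k₂ * y)
        ≈⟨ solve 5 (λ G a o b x → G :* a :* o :* b :* x := G :* a :* (o :* (b :* x))) refl G a (odds (suc g′)) b (1# + H k₂ * y) ⟩
      G * a * (odds (suc g′) * (b * (1# + H k₂ * y)))
        ≈⟨ *-congˡ (trans (odds-reflect (suc g′) k₂ g+k₂) (*-cong (neg-power (suc g′)) (*-congˡ (+-congˡ (Hy T))))) ⟩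
      G * a * ((- 1# * e) * (ιₙ 2 * G) * (q * (1# - ιₙ 3 * (P * m T))))
        ≈⟨ solve 5 (λ G a e q x → G :* a :* ((:- (♯ 1) :* e) :* (♯ 2 :* G) :* (q :* x)) := :- (♯ 2 :* e :* (G :* G) :* (a :* q) :* x)) refl G a e q (1# - ιₙ 3 * (P * m T)) ⟩
      - (ιₙ 2 * e * (G * G) * (a * q) * (1# - ιₙ 3 * (P * m T))) ∎

    -- The same duplication applied to (p-1)!, compared with its reflection into T!^2. In classical
    -- terms, the harmonic sum up to (p-1)/2 is -2 times the Fermat quotient of 2 modulo p.
    2^M-value : ιₙ 2 ^ M ≈ 1# - ιₙ 3 * (P * m T)
    2^M-value = begin
      ιₙ 2 ^ M
        ≈⟨ mod-P² (solve 3 (λ X P m → X := X :* (♯ 1 :- ♯ 3 :* (P :* m)) :* (♯ 1 :+ ♯ 3 :* (P :* m)) :+ P :* P :* (X :* ♯ 9 :* m :* m)) refl (ιₙ 2 ^ M) P (m T)) ⟩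
      ιₙ 2 ^ M * (1# - ιₙ 3 * (P * m T)) * (1# + ιₙ 3 * (P * m T))
        ≈⟨ *-congʳ (unit-cancel (unit-* unit-e (unit-* uq uq)) compare) ⟩
      (1# - ιₙ 6 * (P * m T)) * (1# + ιₙ 3 * (P * m T))
        ≈⟨ mod-P² (solve 2 (λ P m → (♯ 1 :- ♯ 6 :* (P :* m)) :* (♯ 1 :+ ♯ 3 :* (P :* m)) := ♯ 1 :- ♯ 3 :* (P :* m) :+ P :* P :* (:- (♯ 18 :* m :* m))) refl P (m T)) ⟩
      1# - ιₙ 3 * (P * m T) ∎
      where
      unit-e : Unit e
      unit-e = e , e²≈1
      uq : Unit q
      uq = unit-fact T T≤M
      compare : e * (q * q) * (ιₙ 2 ^ M * (1# - ιₙ 3 * (P * m T))) ≈ e * (q * q) * (1# - ιₙ 6 * (P * m T))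
      compare = begin
        e * (q * q) * (ιₙ 2 ^ M * (1# - ιₙ 3 * (P * m T)))
          ≈⟨ *-cong (*-congʳ (sym sign-T)) (*-cong (trans (reflexive (≡.cong (ιₙ 2 ^_) (≡.trans (≡.sym 2T≡M) (≡.cong (T ℕ.+_) (ℕₚ.+-identityʳ T))))) (^-homo-* (ιₙ 2) T T)) (+-congˡ (sym (Hy T)))) ⟩
        (- 1#) ^ T * (q * q) * (ιₙ 2 ^ T * ιₙ 2 ^ T * (1# + H T * y))
          ≈⟨ solve 4 (λ s q t x → s :* (q :* q) :* (t :* t :* x) := t :* q :* (s :* t :* (q :* x))) refl _ q _ _ ⟩
        ιₙ 2 ^ T * q * ((- 1#) ^ T * ιₙ 2 ^ T * (q * (1# + H T * y)))
          ≈⟨ *-congˡ (trans (sym (*-congʳ (neg-power T))) (sym (odds-reflect T 0 (ℕₚ.+-identityʳ T)))) ⟩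
        ιₙ 2 ^ T * q * (odds T * (1# * (1# + 0# * y)))
          ≈⟨ solve 4 (λ t q o y → t :* q :* (o :* (♯ 1 :* (♯ 1 :+ ♯ 0 :* y))) := t :* q :* o) refl _ q _ y ⟩
        ιₙ 2 ^ T * q * odds T
          ≈⟨ fact-double T ⟨
        fact (2 ℕ.* T)
          ≡⟨ ≡.cong fact 2T≡M ⟩
        F
          ≈⟨ F-qq ⟩
        e * (q * q) * (1# - ιₙ 6 * (P * m T)) ∎

    PH : ∀ k → P * H k ≈ ιₙ 6 * (P * m k)
    PH k = trans (*-congˡ (6m k)) (solve 2 (λ P m → P :* (♯ 6 :* m) := ♯ 6 :* (P :* m)) refl P (m k))

    unit-6 : Unit (ιₙ 6)
    unit-6 = unit-cong (solve 0 (♯ 2 :* ♯ 3 := ♯ 6) refl) (unit-* unit-2 unit-3)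

    -- Split the harmonic sum up to 2g′ + 1 by parity: the even terms give half the sum up to g′,
    -- and the odd ones reflect into terms between k₂ and T.
    m-relation : P * m g′ ≈ P * m k₂ + P * m T
    m-relation = unit-cancel unit-6 (begin
      ιₙ 6 * (P * m g′)                               ≈⟨ PH g′ ⟨
      P * H g′                                        ≈⟨ solve 3 (λ P o h → P :* h := P :* (♯ 2 :* o :+ h) :- P :* (♯ 2 :* o)) refl P o (H g′) ⟩
      P * (ιₙ 2 * o + H g′) - P * (ιₙ 2 * o)          ≈⟨ +-cong (*-congˡ (sym (H-double+1 g′ k₂≤M))) (-‿cong (odd-iv-reflect (suc g′) k₂ g+k₂)) ⟩
      P * (ιₙ 2 * H k₂) - (P * H k₂ - P * H T)        ≈⟨ solve 3 (λ P a b → P :* (♯ 2 :* a) :- (P :* a :- P :* b) := P :* a :+ P :* b) refl P (H k₂) (H T) ⟩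
      P * H k₂ + P * H T                              ≈⟨ +-cong (PH k₂) (PH T) ⟩
      ιₙ 6 * (P * m k₂) + ιₙ 6 * (P * m T)            ≈⟨ distribˡ _ _ _ ⟨
      ιₙ 6 * (P * m k₂ + P * m T)                     ∎)
      where o = Σ< (suc g′) (λ i → iv (2 ℕ.* i))

    PH-k₄ : P * H k₄ ≈ P * H k₂
    PH-k₄ = a-b≈0⇒a≈b (trans (sym (H-reflect k₄ k₂ k₄+k₂)) PH-M≈0)

    PH-n : P * H n ≈ P * H g′
    PH-n = a-b≈0⇒a≈b (trans (sym (H-reflect n g′ n+g′)) PH-M≈0)

    C : Carrier
    C = ιₙ ((4 ℕ.* suc g′) choose (2 ℕ.* suc g′))

    -- (4g)! = 4g k₄! and (2g)! = 2g k₂!, so binom(4g, 2g) g = k₄! / k₂!^2.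
    C-value : C * (b * b) * ιₙ (suc g′) ≈ d
    C-value = unit-cancel (unit-small (k₄) k₄<M) (begin
      ιₙ (suc k₄) * (C * (b * b) * ιₙ g)
        ≈⟨ *-congʳ (trans (reflexive (≡.cong ιₙ 4g)) (ιₙ-* 4 g)) ⟩
      ιₙ 4 * ιₙ g * (C * (b * b) * ιₙ g)
        ≈⟨ solve 3 (λ g C b → ♯ 4 :* g :* (C :* (b :* b) :* g) := C :* ((b :* (♯ 2 :* g)) :* (b :* (♯ 2 :* g)))) refl (ιₙ g) C b ⟩
      C * ((b * (ιₙ 2 * ιₙ g)) * (b * (ιₙ 2 * ιₙ g)))
        ≈⟨ *-congˡ (*-cong fact-2g fact-2g) ⟨
      C * (ιₙ ((2 ℕ.* g) !) * ιₙ ((2 ℕ.* g) !))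
        ≈⟨ trans (ιₙ-* ((4 ℕ.* g) choose (2 ℕ.* g)) _) (*-congˡ (ιₙ-* ((2 ℕ.* g) !) ((2 ℕ.* g) !))) ⟨
      ιₙ (((4 ℕ.* g) choose (2 ℕ.* g)) ℕ.* ((2 ℕ.* g) ! ℕ.* (2 ℕ.* g) !))
        ≡⟨ ≡.cong ιₙ (≡.trans (≡.cong (λ k → ((4 ℕ.* g) choose (2 ℕ.* g)) ℕ.* ((2 ℕ.* g) ! ℕ.* k !)) (≡.trans (≡.sym (ℕₚ.m+n∸m≡n (2 ℕ.* g) (2 ℕ.* g))) (≡.cong (ℕ._∸ 2 ℕ.* g) 2g+2g)))
             (nCk-factorial {4 ℕ.* g} {2 ℕ.* g} (≡.subst (2 ℕ.* g ℕ.≤_) 2g+2g (ℕₚ.m≤m+n _ _)))) ⟩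
      ιₙ ((4 ℕ.* g) !)
        ≡⟨ ≡.cong (λ k → ιₙ (k !)) 4g ⟨
      ιₙ ((suc k₄) !)
        ≈⟨ trans (ιₙ-* (suc k₄) (k₄ !)) (*-congˡ (fact-n! k₄)) ⟩
      ιₙ (suc k₄) * d ∎)
      where
      g = suc g′
      fact-n! : ∀ k → ιₙ (k !) ≈ fact k
      fact-n! k = trans (reflexive (≡.cong ιₙ (≡.trans (!-rising 0 k) (ℕₚ.*-identityˡ _)))) (ιₙ-rising 0 k)
      4g : suc k₄ ≡ 4 ℕ.* g
      4g = ℕS.solve 1 (λ g → ℕS.con 1 ℕS.:+ (ℕS.con 4 ℕS.:* g ℕS.:+ ℕS.con 3) ℕS.:= ℕS.con 4 ℕS.:* (ℕS.con 1 ℕS.:+ g)) ≡.refl g′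
      2g+2g : 2 ℕ.* g ℕ.+ 2 ℕ.* g ≡ 4 ℕ.* g
      2g+2g = ℕS.solve 1 (λ g → ℕS.con 2 ℕS.:* g ℕS.:+ ℕS.con 2 ℕS.:* g ℕS.:= ℕS.con 4 ℕS.:* g) ≡.refl g
      k₄<M : k₄ ℕ.< M
      k₄<M = ≡.subst (suc k₄ ℕ.≤_) (≡.trans (≡.sym (ℕₚ.+-suc k₄ (2 ℕ.* g′))) k₄+k₂) (ℕₚ.m≤m+n (suc k₄) (2 ℕ.* g′))
      fact-2g : ιₙ ((2 ℕ.* g) !) ≈ b * (ιₙ 2 * ιₙ g)
      fact-2g = trans (fact-n! (2 ℕ.* g)) (trans (reflexive (≡.cong fact (2suc g′))) (*-congˡ (trans (reflexive (≡.cong ιₙ (≡.sym (2suc g′)))) (ιₙ-* 2 g))))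

    unit-C : Unit C
    unit-C = unit-factor (unit-factor (unit-cong (sym C-value) (unit-fact k₄ k₄≤M)))

    -- The unit part w of the closed form, at 6x = 5p
    module Final (x w : Carrier) (6x≈5P : ιₙ 6 * x ≈ ιₙ 5 * P)
      (w-eq : w * (Π< n (λ i → ιₙ (suc i) - ιₙ 2 * x) * Π< n (λ i → ιₙ (suc i) * ιₙ (suc i) * ιₙ (suc i) + x * x * x))
        ≈ Π< n (λ i → x * x - ιₙ (suc i) * ιₙ (suc i)) * (Π< M (λ i → ιₙ (suc i) - ιₙ 2 * x) * Π< k₄ (λ i → ιₙ (suc (suc M ℕ.+ i)) - ιₙ 2 * x))) where

      z : Carrier
      z = - (ιₙ 2 * x)

      x² : x * x ≈ 0#
      x² = unit-zero (unit-* unit-6 unit-6) (trans (solve 1 (λ x → ♯ 6 :* ♯ 6 :* (x :* x) := (♯ 6 :* x) :* (♯ 6 :* x)) refl x)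
        (trans (*-cong 6x≈5P 6x≈5P) (trans (solve 1 (λ p → (♯ 5 :* p) :* (♯ 5 :* p) := (p :* p) :* ♯ 25) refl P) (trans (*-congʳ p²≈0) (zeroˡ _)))))

      z² : z * z ≈ 0#
      z² = trans (solve 1 (λ x → :- (♯ 2 :* x) :* :- (♯ 2 :* x) := x :* x :* ♯ 4) refl x) (trans (*-congʳ x²) (zeroˡ _))

      Hz : ∀ k → H k * z ≈ - (ιₙ 10 * (P * m k))
      Hz k = trans (*-congʳ (6m k)) (trans (solve 2 (λ m x → ♯ 6 :* m :* :- (♯ 2 :* x) := :- (♯ 2 :* (♯ 6 :* x) :* m)) refl (m k) x)
        (-‿cong (trans (*-congʳ (*-congˡ 6x≈5P)) (solve 2 (λ p m → ♯ 2 :* (♯ 5 :* p) :* m := ♯ 10 :* (p :* m)) refl P (m k)))))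

      P+z² : (P + z) * (P + z) ≈ 0#
      P+z² = unit-zero (unit-* unit-6 unit-6) (begin
        ιₙ 6 * ιₙ 6 * ((P + z) * (P + z))
          ≈⟨ solve 2 (λ p x → ♯ 6 :* ♯ 6 :* ((p :+ :- (♯ 2 :* x)) :* (p :+ :- (♯ 2 :* x))) := (♯ 6 :* p :- ♯ 2 :* (♯ 6 :* x)) :* (♯ 6 :* p :- ♯ 2 :* (♯ 6 :* x))) refl P x ⟩
        (ιₙ 6 * P - ιₙ 2 * (ιₙ 6 * x)) * (ιₙ 6 * P - ιₙ 2 * (ιₙ 6 * x))
          ≈⟨ *-cong (+-congˡ (-‿cong (*-congˡ 6x≈5P))) (+-congˡ (-‿cong (*-congˡ 6x≈5P))) ⟩
        _ ≈⟨ solve 1 (λ p → (♯ 6 :* p :- ♯ 2 :* (♯ 5 :* p)) :* (♯ 6 :* p :- ♯ 2 :* (♯ 5 :* p)) := p :* p :* ♯ 16) refl P ⟩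
        P * P * ιₙ 16 ≈⟨ trans (*-congʳ p²≈0) (zeroˡ _) ⟩
        0# ∎)

      m-k₄ : P * m k₄ ≈ P * m k₂
      m-k₄ = unit-cancel unit-6 (trans (sym (PH k₄)) (trans PH-k₄ (PH k₂)))

      m-n : P * m n ≈ P * m g′
      m-n = unit-cancel unit-6 (trans (sym (PH n)) (trans PH-n (PH g′)))

      L-value : Π< n (λ i → ιₙ (suc i) - ιₙ 2 * x) ≈ f * (1# - ιₙ 10 * (P * m g′))
      L-value = trans (shifted n z n≤M z²) (*-congˡ (+-congˡ (trans (Hz n) (-‿cong (*-congˡ m-n)))))

      lower-value : Π< M (λ i → ιₙ (suc i) - ιₙ 2 * x) ≈ F
      lower-value = trans (shifted M z ℕₚ.≤-refl z²) (trans (*-congˡ (trans (+-congˡ vanish) (+-identityʳ _))) (*-identityʳ _))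
        where
        vanish : H M * z ≈ 0#
        vanish = unit-zero unit-6 (trans (solve 2 (λ h x → ♯ 6 :* (h :* :- (♯ 2 :* x)) := :- (♯ 2 :* h) :* (♯ 6 :* x)) refl (H M) x)
          (trans (*-congˡ 6x≈5P) (trans (solve 2 (λ h p → :- (♯ 2 :* h) :* (♯ 5 :* p) := :- (♯ 10) :* (p :* h)) refl (H M) P) (trans (*-congˡ PH-M≈0) (zeroʳ _)))))

      upper-value : Π< k₄ (λ i → ιₙ (suc (suc M ℕ.+ i)) - ιₙ 2 * x) ≈ d * (1# - ιₙ 4 * (P * m k₂))
      upper-value = begin
        Π< k₄ (λ i → ιₙ (suc (suc M ℕ.+ i)) - ιₙ 2 * x)
          ≈⟨ Π-cong k₄ (λ i _ → trans (+-congʳ (trans (reflexive (≡.cong ιₙ (≡.sym (ℕₚ.+-suc (suc M) i)))) (ιₙ-+ (suc M) (suc i))))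
               (solve 3 (λ p s z → p :+ s :+ z := s :+ (p :+ z)) refl P (ιₙ (suc i)) z)) ⟩
        Π< k₄ (λ i → ιₙ (suc i) + (P + z))
          ≈⟨ shifted k₄ (P + z) k₄≤M P+z² ⟩
        d * (1# + H k₄ * (P + z))
          ≈⟨ *-congˡ (+-congˡ (begin
               H k₄ * (P + z)                               ≈⟨ trans (distribˡ _ _ _) (+-cong (trans (*-comm _ _) (PH k₄)) (Hz k₄)) ⟩
               ιₙ 6 * (P * m k₄) - ιₙ 10 * (P * m k₄)       ≈⟨ +-cong (*-congˡ m-k₄) (-‿cong (*-congˡ m-k₄)) ⟩
               ιₙ 6 * (P * m k₂) - ιₙ 10 * (P * m k₂)       ≈⟨ solve 1 (λ a → ♯ 6 :* a :- ♯ 10 :* a := :- (♯ 4 :* a)) refl _ ⟩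
               - (ιₙ 4 * (P * m k₂))                        ∎)) ⟩
        d * (1# - ιₙ 4 * (P * m k₂)) ∎

      cubes : Π< n (λ i → ιₙ (suc i) * ιₙ (suc i) * ιₙ (suc i) + x * x * x) ≈ f * f * f
      cubes = trans (Π-cong n (λ i _ → trans (+-congˡ (trans (*-congʳ x²) (zeroˡ _))) (+-identityʳ _)))
        (trans (Π-* n _ _) (*-congʳ (Π-* n _ _)))

      squares : Π< n (λ i → x * x - ιₙ (suc i) * ιₙ (suc i)) ≈ e * (f * f)
      squares = trans (Π-cong n (λ i _ → trans (+-congʳ x²) (solve 1 (λ s → ♯ 0 :- s :* s := :- (♯ 1) :* (s :* s)) refl (ιₙ (suc i)))))
        (trans (Π-* n _ _) (*-cong (trans (Π-const n (- 1#)) sign-n) (Π-* n _ _)))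

      uF : Unit F
      uF = unit-fact M ℕₚ.≤-refl

      uf : Unit f
      uf = unit-fact n n≤M

      m₁ m₂ m₃ : Carrier
      m₁ = m g′
      m₂ = m k₂
      m₃ = m T

      w-f² : w * (f * f) * (1# - ιₙ 10 * (P * m₁)) ≈ e * F * d * (1# - ιₙ 4 * (P * m₂))
      w-f² = unit-cancel (unit-* uf uf) (begin
        f * f * (w * (f * f) * (1# - ιₙ 10 * (P * m₁)))
          ≈⟨ solve 3 (λ f w x → f :* f :* (w :* (f :* f) :* x) := w :* (f :* x :* (f :* f :* f))) refl f w _ ⟩
        w * (f * (1# - ιₙ 10 * (P * m₁)) * (f * f * f))
          ≈⟨ *-congˡ (*-cong L-value cubes) ⟨
        w * (Π< n (λ i → ιₙ (suc i) - ιₙ 2 * x) * Π< n (λ i → ιₙ (suc i) * ιₙ (suc i) * ιₙ (suc i) + x * x * x))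
          ≈⟨ w-eq ⟩
        Π< n (λ i → x * x - ιₙ (suc i) * ιₙ (suc i)) * (Π< M (λ i → ιₙ (suc i) - ιₙ 2 * x) * Π< k₄ (λ i → ιₙ (suc (suc M ℕ.+ i)) - ιₙ 2 * x))
          ≈⟨ *-cong squares (*-cong lower-value upper-value) ⟩
        e * (f * f) * (F * (d * (1# - ιₙ 4 * (P * m₂))))
          ≈⟨ solve 5 (λ e f F d x → e :* (f :* f) :* (F :* (d :* x)) := f :* f :* (e :* F :* d :* x)) refl e f F d _ ⟩
        f * f * (e * F * d * (1# - ιₙ 4 * (P * m₂))) ∎)

      -- The reflection n + g′ = p - 1 trades n! for g′!, the first of the eliminations that leave
      -- no factorial standing.
      w-F : w * F ≈ e * d * (a * a) * (1# - ιₙ 2 * (P * m₁) - ιₙ 4 * (P * m₂))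
      w-F = unit-cancel uF (begin
        F * (w * F)
          ≈⟨ solve 2 (λ F w → F :* (w :* F) := w :* (F :* F)) refl F w ⟩
        w * (F * F)
          ≈⟨ *-congˡ (*-cong F-fa F-fa) ⟩
        w * (e * (f * a) * (1# - ιₙ 6 * (P * m₁)) * (e * (f * a) * (1# - ιₙ 6 * (P * m₁))))
          ≈⟨ mod-P² (solve 6 (λ w e f a P m → w :* (e :* (f :* a) :* (♯ 1 :- ♯ 6 :* (P :* m)) :* (e :* (f :* a) :* (♯ 1 :- ♯ 6 :* (P :* m))))
               := (e :* e) :* (a :* a) :* (w :* (f :* f) :* (♯ 1 :- ♯ 10 :* (P :* m))) :* (♯ 1 :- ♯ 2 :* (P :* m))
                  :+ P :* P :* (♯ 16 :* e :* e :* a :* a :* w :* f :* f :* m :* m)) refl w e f a P m₁) ⟩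
        (e * e) * (a * a) * (w * (f * f) * (1# - ιₙ 10 * (P * m₁))) * (1# - ιₙ 2 * (P * m₁))
          ≈⟨ *-congʳ (*-cong (trans (*-congʳ e²≈1) (*-identityˡ _)) w-f²) ⟩
        (a * a) * (e * F * d * (1# - ιₙ 4 * (P * m₂))) * (1# - ιₙ 2 * (P * m₁))
          ≈⟨ mod-P² (solve 7 (λ a e F d P m₂ m₁ → (a :* a) :* (e :* F :* d :* (♯ 1 :- ♯ 4 :* (P :* m₂))) :* (♯ 1 :- ♯ 2 :* (P :* m₁))
               := F :* (e :* d :* (a :* a) :* (♯ 1 :- ♯ 2 :* (P :* m₁) :- ♯ 4 :* (P :* m₂))) :+ P :* P :* (♯ 8 :* a :* a :* e :* F :* d :* m₁ :* m₂)) refl a e F d P m₂ m₁) ⟩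
        F * (e * d * (a * a) * (1# - ιₙ 2 * (P * m₁) - ιₙ 4 * (P * m₂))) ∎)

      V : Carrier
      V = 1# - ιₙ 2 * (P * m₁) - ιₙ 4 * (P * m₂)

      w-b⁴ : w * C * (b * b * (b * b)) * ιₙ (suc g′) * (1# - ιₙ 12 * (P * m₂)) ≈ e * F * (a * a) * V
      w-b⁴ = unit-cancel uF (begin
        F * (w * C * (b * b * (b * b)) * ιₙ (suc g′) * (1# - ιₙ 12 * (P * m₂)))
          ≈⟨ solve 6 (λ F w C b g x → F :* (w :* C :* (b :* b :* (b :* b)) :* g :* x) := (w :* F) :* (C :* (b :* b) :* g) :* (b :* b :* x)) refl F w C b (ιₙ (suc g′)) _ ⟩
        (w * F) * (C * (b * b) * ιₙ (suc g′)) * (b * b * (1# - ιₙ 12 * (P * m₂)))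
          ≈⟨ *-congʳ (*-cong w-F C-value) ⟩
        e * d * (a * a) * V * d * (b * b * (1# - ιₙ 12 * (P * m₂)))
          ≈⟨ mod-P² (solve 7 (λ e d a V b P m → e :* d :* (a :* a) :* V :* d :* (b :* b :* (♯ 1 :- ♯ 12 :* (P :* m)))
               := e :* (a :* a) :* V :* ((:- (♯ 1) :* (d :* b) :* (♯ 1 :- ♯ 6 :* (P :* m))) :* (:- (♯ 1) :* (d :* b) :* (♯ 1 :- ♯ 6 :* (P :* m))))
                  :+ P :* P :* (:- (♯ 36 :* e :* a :* a :* V :* d :* d :* b :* b :* m :* m))) refl e d a V b P m₂) ⟩
        e * (a * a) * V * ((- 1# * (d * b) * (1# - ιₙ 6 * (P * m₂))) * (- 1# * (d * b) * (1# - ιₙ 6 * (P * m₂))))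
          ≈⟨ *-congˡ (*-cong F-db F-db) ⟨
        e * (a * a) * V * (F * F)
          ≈⟨ solve 4 (λ e a V F → e :* (a :* a) :* V :* (F :* F) := F :* (e :* F :* (a :* a) :* V)) refl e a V F ⟩
        F * (e * F * (a * a) * V) ∎)

      b⁴-value : b * b * (b * b) * (1# - ιₙ 6 * (P * m₂)) ≈ ιₙ 4 * (G * G * (G * G)) * (a * a) * (e * F)
      b⁴-value = begin
        b * b * (b * b) * (1# - ιₙ 6 * (P * m₂))
          ≈⟨ mod-P² (solve 3 (λ b P m → b :* b :* (b :* b) :* (♯ 1 :- ♯ 6 :* (P :* m)) := (b :* b :* (♯ 1 :- ♯ 3 :* (P :* m))) :* (b :* b :* (♯ 1 :- ♯ 3 :* (P :* m)))
               :+ P :* P :* (:- (♯ 9 :* m :* m :* b :* b :* b :* b))) refl b P m₂) ⟩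
        (b * b * (1# - ιₙ 3 * (P * m₂))) * (b * b * (1# - ιₙ 3 * (P * m₂)))
          ≈⟨ *-cong bb-aq bb-aq ⟩
        - (ιₙ 2 * e * (G * G) * (a * q) * (1# - ιₙ 3 * (P * m₃))) * - (ιₙ 2 * e * (G * G) * (a * q) * (1# - ιₙ 3 * (P * m₃)))
          ≈⟨ mod-P² (solve 6 (λ e G a q P m → :- (♯ 2 :* e :* (G :* G) :* (a :* q) :* (♯ 1 :- ♯ 3 :* (P :* m))) :* :- (♯ 2 :* e :* (G :* G) :* (a :* q) :* (♯ 1 :- ♯ 3 :* (P :* m)))
               := ♯ 4 :* (G :* G :* (G :* G)) :* (a :* a) :* (e :* (e :* (q :* q) :* (♯ 1 :- ♯ 6 :* (P :* m))))
                  :+ P :* P :* (♯ 36 :* m :* m :* e :* e :* G :* G :* G :* G :* a :* a :* q :* q)) refl e G a q P m₃) ⟩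
        ιₙ 4 * (G * G * (G * G)) * (a * a) * (e * (e * (q * q) * (1# - ιₙ 6 * (P * m₃))))
          ≈⟨ *-congˡ (*-congˡ F-qq) ⟨
        ιₙ 4 * (G * G * (G * G)) * (a * a) * (e * F) ∎

      -- With k₄! removed by its reflection into k₂! and k₂!^4 by `b⁴-value`, every factorial
      -- cancels. Of the harmonic corrections only m(g′) - m(k₂) is left, and `m-relation` makes it
      -- m(T).
      w-C-g : w * C * ιₙ (suc g′) * (ιₙ 4 * (G * G * (G * G))) ≈ 1# - ιₙ 2 * (P * m₃)
      w-C-g = begin
        w * C * ιₙ (suc g′) * (ιₙ 4 * (G * G * (G * G)))
          ≈⟨ mod-P² (solve 3 (λ W P m → W := W :* (♯ 1 :- ♯ 12 :* (P :* m)) :* (♯ 1 :+ ♯ 12 :* (P :* m)) :+ P :* P :* (W :* ♯ 144 :* m :* m)) refl _ P m₂) ⟩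
        w * C * ιₙ (suc g′) * (ιₙ 4 * (G * G * (G * G))) * (1# - ιₙ 12 * (P * m₂)) * (1# + ιₙ 12 * (P * m₂))
          ≈⟨ *-congʳ (unit-cancel (unit-* (unit-* (e , e²≈1) uF) (unit-* ua ua)) compare) ⟩
        V * (1# - ιₙ 6 * (P * m₂)) * (1# + ιₙ 12 * (P * m₂))
          ≈⟨ mod-P² (solve 3 (λ P m₁ m₂ → (♯ 1 :- ♯ 2 :* (P :* m₁) :- ♯ 4 :* (P :* m₂)) :* (♯ 1 :- ♯ 6 :* (P :* m₂)) :* (♯ 1 :+ ♯ 12 :* (P :* m₂))
               := ♯ 1 :- ♯ 2 :* (P :* m₁ :- P :* m₂) :+ P :* P :* (:- (♯ 12 :* m₁ :* m₂) :- ♯ 96 :* m₂ :* m₂ :+ ♯ 144 :* P :* m₁ :* m₂ :* m₂ :+ ♯ 288 :* P :* m₂ :* m₂ :* m₂)) refl P m₁ m₂) ⟩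
        1# - ιₙ 2 * (P * m₁ - P * m₂)
          ≈⟨ +-congˡ (-‿cong (*-congˡ (trans (+-congʳ m-relation) (solve 2 (λ a b → a :+ b :- a := b) refl _ _)))) ⟩
        1# - ιₙ 2 * (P * m₃) ∎
        where
        ua : Unit a
        ua = unit-fact g′ (≡.subst (g′ ℕ.≤_) n+g′ (ℕₚ.m≤n+m g′ n))
        compare : e * F * (a * a) * (w * C * ιₙ (suc g′) * (ιₙ 4 * (G * G * (G * G))) * (1# - ιₙ 12 * (P * m₂))) ≈ e * F * (a * a) * (V * (1# - ιₙ 6 * (P * m₂)))
        compare = begin
          e * F * (a * a) * (w * C * ιₙ (suc g′) * (ιₙ 4 * (G * G * (G * G))) * (1# - ιₙ 12 * (P * m₂)))
            ≈⟨ solve 7 (λ e F a W g G x → e :* F :* (a :* a) :* (W :* g :* (♯ 4 :* (G :* G :* (G :* G))) :* x) := W :* (♯ 4 :* (G :* G :* (G :* G)) :* (a :* a) :* (e :* F)) :* g :* x) refl e F a (w * C) (ιₙ (suc g′)) G _ ⟩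
          w * C * (ιₙ 4 * (G * G * (G * G)) * (a * a) * (e * F)) * ιₙ (suc g′) * (1# - ιₙ 12 * (P * m₂))
            ≈⟨ *-congʳ (*-congʳ (*-congˡ b⁴-value)) ⟨
          w * C * (b * b * (b * b) * (1# - ιₙ 6 * (P * m₂))) * ιₙ (suc g′) * (1# - ιₙ 12 * (P * m₂))
            ≈⟨ solve 5 (λ W B s g t → W :* (B :* s) :* g :* t := W :* B :* g :* t :* s) refl (w * C) (b * b * (b * b)) _ _ _ ⟩
          w * C * (b * b * (b * b)) * ιₙ (suc g′) * (1# - ιₙ 12 * (P * m₂)) * (1# - ιₙ 6 * (P * m₂))
            ≈⟨ *-congʳ w-b⁴ ⟩
          e * F * (a * a) * V * (1# - ιₙ 6 * (P * m₂))
            ≈⟨ *-assoc _ _ _ ⟩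
          e * F * (a * a) * (V * (1# - ιₙ 6 * (P * m₂))) ∎

      2^M : ιₙ 2 ^ M ≈ ιₙ 16 * (G * G * (G * G) * (G * G))
      2^M = begin
        ιₙ 2 ^ (6 ℕ.* g′ ℕ.+ 4)         ≈⟨ ^-homo-* (ιₙ 2) (6 ℕ.* g′) 4 ⟩
        ιₙ 2 ^ (6 ℕ.* g′) * ιₙ 2 ^ 4    ≈⟨ *-congʳ (trans (reflexive (≡.cong (ιₙ 2 ^_) (ℕₚ.*-comm 6 g′))) (sym (^-assocʳ (ιₙ 2) g′ 6))) ⟩
        G ^ 6 * ιₙ 2 ^ 4                ≈⟨ solve 1 (λ G → (G :* (G :* (G :* (G :* (G :* (G :* ♯ 1)))))) :* (♯ 2 :* (♯ 2 :* (♯ 2 :* (♯ 2 :* ♯ 1)))) := ♯ 16 :* (G :* G :* (G :* G) :* (G :* G))) refl G ⟩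
        ιₙ 16 * (G * G * (G * G) * (G * G)) ∎

      2^2g : ιₙ 2 ^ (2 ℕ.* suc g′) ≈ ιₙ 4 * (G * G)
      2^2g = begin
        ιₙ 2 ^ (2 ℕ.* suc g′)           ≈⟨ trans (reflexive (≡.cong (ιₙ 2 ^_) (ℕₚ.*-comm 2 (suc g′)))) (sym (^-assocʳ (ιₙ 2) (suc g′) 2)) ⟩
        (ιₙ 2 * G) ^ 2                  ≈⟨ solve 1 (λ G → (♯ 2 :* G) :* ((♯ 2 :* G) :* ♯ 1) := ♯ 4 :* (G :* G)) refl G ⟩
        ιₙ 4 * (G * G)                  ∎

      6g : ιₙ 6 * ιₙ (suc g′) ≈ 1# + P
      6g = begin
        ιₙ 6 * ιₙ (suc g′)     ≈⟨ ιₙ-* 6 (suc g′) ⟨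
        ιₙ (6 ℕ.* suc g′)      ≡⟨ ≡.cong ιₙ (ℕS.solve 1 (λ g → ℕS.con 6 ℕS.:* (ℕS.con 1 ℕS.:+ g) ℕS.:= ℕS.con 2 ℕS.:+ (ℕS.con 6 ℕS.:* g ℕS.:+ ℕS.con 4)) ≡.refl g′) ⟩
        1# + P                 ∎

      -- Insert 6g = p + 1 and 16 G^6 = 2^(p-1) = 1 - 3Pm, m = m(T), into `w-C-g`. Both sides become
      -- 24 G^2 (1 + Pm - P), because 2^(p-1) + 3p - 4 = -3(1 + Pm - P) modulo p^2.
      unit-part : w * C ≈ - (ιₙ 2 * ιₙ 2 ^ (2 ℕ.* suc g′) * (ιₙ 2 ^ M + ιₙ 3 * P - ιₙ 4))
      unit-part = begin
        w * C
          ≈⟨ mod-P² (solve 3 (λ W P m → W := W :* (♯ 1 :+ P) :* (♯ 1 :- ♯ 3 :* (P :* m)) :* ((♯ 1 :- P) :* (♯ 1 :+ ♯ 3 :* (P :* m)))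
               :+ P :* P :* (W :* (♯ 1 :+ ♯ 9 :* m :* m :- ♯ 9 :* P :* P :* m :* m))) refl (w * C) P m₃) ⟩
        w * C * (1# + P) * (1# - ιₙ 3 * (P * m₃)) * ((1# - P) * (1# + ιₙ 3 * (P * m₃)))
          ≈⟨ *-congʳ (*-cong (*-congˡ (sym 6g)) (trans (sym 2^M-value) 2^M)) ⟩
        w * C * (ιₙ 6 * ιₙ (suc g′)) * (ιₙ 16 * (G * G * (G * G) * (G * G))) * ((1# - P) * (1# + ιₙ 3 * (P * m₃)))
          ≈⟨ solve 4 (λ W g G x → W :* (♯ 6 :* g) :* (♯ 16 :* (G :* G :* (G :* G) :* (G :* G))) :* x := (W :* g :* (♯ 4 :* (G :* G :* (G :* G)))) :* (♯ 24 :* (G :* G) :* x)) refl (w * C) (ιₙ (suc g′)) G _ ⟩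
        (w * C * ιₙ (suc g′) * (ιₙ 4 * (G * G * (G * G)))) * (ιₙ 24 * (G * G) * ((1# - P) * (1# + ιₙ 3 * (P * m₃))))
          ≈⟨ *-congʳ w-C-g ⟩
        (1# - ιₙ 2 * (P * m₃)) * (ιₙ 24 * (G * G) * ((1# - P) * (1# + ιₙ 3 * (P * m₃))))
          ≈⟨ mod-P² (solve 3 (λ P m G → (♯ 1 :- ♯ 2 :* (P :* m)) :* (♯ 24 :* (G :* G) :* ((♯ 1 :- P) :* (♯ 1 :+ ♯ 3 :* (P :* m))))
               := :- (♯ 2 :* (♯ 4 :* (G :* G)) :* (♯ 1 :- ♯ 3 :* (P :* m) :+ ♯ 3 :* P :- ♯ 4))
                  :+ P :* P :* (♯ 24 :* (G :* G) :* (:- m :- ♯ 6 :* m :* m :+ ♯ 6 :* P :* m :* m))) refl P m₃ G) ⟩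
        - (ιₙ 2 * (ιₙ 4 * (G * G)) * (1# - ιₙ 3 * (P * m₃) + ιₙ 3 * P - ιₙ 4))
          ≈⟨ -‿cong (*-cong (*-congˡ (sym 2^2g)) (+-congʳ (+-congʳ (sym 2^M-value)))) ⟩
        - (ιₙ 2 * ιₙ 2 ^ (2 ℕ.* suc g′) * (ιₙ 2 ^ M + ιₙ 3 * P - ιₙ 4)) ∎

-- Integers inside the rationals, and the total reciprocal.

module RationalNumbers where
  open import Defs
  open import Data.Rational as ℚ using (ℚ; mkℚ; 0ℚ; 1ℚ; ↥_; ↧_; ↧ₙ_; toℚᵘ; fromℚᵘ; _+_; _*_; _-_; -_)
  import Data.Rational.Properties as ℚₚ
  open import Data.Rational.Unnormalised as ℚᵘ using (mkℚᵘ; *≡*) renaming (ℚᵘ to ℚᵘ′)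
  import Data.Rational.Unnormalised.Properties as ℚᵘₚ
  open import Relation.Binary.PropositionalEquality as ≡ using (_≡_; refl; sym; trans; cong; cong₂; subst)

  module Q = RingKit ℚₚ.+-*-commutativeRing

  -- The detour through unnormalised rationals reduces the claim to cross multiplication with
  -- denominator 1, free of common-divisor computations.
  ℤtoℚ-homo : ∀ (f : ℤ → ℤ → ℤ) (g : ℚ → ℚ → ℚ) (h : ℚᵘ′ → ℚᵘ′ → ℚᵘ′) →
    (∀ q r → toℚᵘ (g q r) ℚᵘ.≃ h (toℚᵘ q) (toℚᵘ r)) →
    (∀ {q q′ r r′} → q ℚᵘ.≃ q′ → r ℚᵘ.≃ r′ → h q r ℚᵘ.≃ h q′ r′) →
    (∀ a b → mkℚᵘ (f a b) 0 ℚᵘ.≃ h (mkℚᵘ a 0) (mkℚᵘ b 0)) →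
    ∀ a b → ℤtoℚ (f a b) ≡ g (ℤtoℚ a) (ℤtoℚ b)
  ℤtoℚ-homo f g h homo cong′ base a b = ℚₚ.toℚᵘ-injective (ℚᵘₚ.≃-trans (ℚₚ.toℚᵘ-fromℚᵘ (mkℚᵘ (f a b) 0))
    (ℚᵘₚ.≃-trans (base a b) (ℚᵘₚ.≃-trans (cong′ (ℚᵘₚ.≃-sym (ℚₚ.toℚᵘ-fromℚᵘ (mkℚᵘ a 0))) (ℚᵘₚ.≃-sym (ℚₚ.toℚᵘ-fromℚᵘ (mkℚᵘ b 0))))
      (ℚᵘₚ.≃-sym (homo (ℤtoℚ a) (ℤtoℚ b))))))

  ℤtoℚ-+ : ∀ a b → ℤtoℚ (a ℤ.+ b) ≡ ℤtoℚ a + ℤtoℚ b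
  ℤtoℚ-+ = ℤtoℚ-homo ℤ._+_ _+_ ℚᵘ._+_ ℚₚ.toℚᵘ-homo-+ ℚᵘₚ.+-cong
    (λ a b → *≡* (cong₂ ℤ._*_ (cong₂ ℤ._+_ (sym (ℤₚ.*-identityʳ a)) (sym (ℤₚ.*-identityʳ b))) refl))

  ℤtoℚ-* : ∀ a b → ℤtoℚ (a ℤ.* b) ≡ ℤtoℚ a * ℤtoℚ b
  ℤtoℚ-* = ℤtoℚ-homo ℤ._*_ _*_ ℚᵘ._*_ ℚₚ.toℚᵘ-homo-* ℚᵘₚ.*-cong (λ a b → *≡* refl)

  ℤtoℚ-neg : ∀ a → ℤtoℚ (ℤ.- a) ≡ - ℤtoℚ a
  ℤtoℚ-neg a = Q.a-b≈0⇒a≈b (trans (Q.solve 2 (λ x y → x Q.:- Q.:- y Q.:= x Q.:+ y) refl (ℤtoℚ (ℤ.- a)) (ℤtoℚ a))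
    (trans (sym (ℤtoℚ-+ (ℤ.- a) a)) (cong ℤtoℚ (ℤₚ.+-inverseˡ a))))

  ℤtoℚ-- : ∀ a b → ℤtoℚ (a ℤ.- b) ≡ ℤtoℚ a - ℤtoℚ b
  ℤtoℚ-- a b = trans (ℤtoℚ-+ a (ℤ.- b)) (cong (_+_ (ℤtoℚ a)) (ℤtoℚ-neg b))

  ℤtoℚ-injective : ∀ a b → ℤtoℚ a ≡ ℤtoℚ b → a ≡ b
  ℤtoℚ-injective a b h with ℚᵘₚ.≃-trans (ℚᵘₚ.≃-sym (ℚₚ.toℚᵘ-fromℚᵘ (mkℚᵘ a 0))) (ℚᵘₚ.≃-trans (ℚᵘₚ.≃-reflexive (cong toℚᵘ h)) (ℚₚ.toℚᵘ-fromℚᵘ (mkℚᵘ b 0)))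
  ... | *≡* e = trans (sym (ℤₚ.*-identityʳ a)) (trans e (ℤₚ.*-identityʳ b))

  ℕtoℚ-* : ∀ a b → ℕtoℚ (a ℕ.* b) ≡ ℕtoℚ a * ℕtoℚ b
  ℕtoℚ-* a b = trans (cong ℤtoℚ (ℤₚ.pos-* a b)) (ℤtoℚ-* (+ a) (+ b))

  ℕtoℚ-^ : ∀ a k → ℕtoℚ (a ℕ.^ k) ≡ ℕtoℚ a Q.^ k
  ℕtoℚ-^ a zero = refl
  ℕtoℚ-^ a (suc k) = trans (ℕtoℚ-* a (a ℕ.^ k)) (cong (_*_ (ℕtoℚ a)) (ℕtoℚ-^ a k))

  /-inverse : ∀ n .{{nz : ℕ.NonZero n}} → ((+ 1) ℚ./ n) * ℕtoℚ n ≡ 1ℚ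
  /-inverse (suc m) = ℚₚ.toℚᵘ-injective (ℚᵘₚ.≃-trans (ℚₚ.toℚᵘ-homo-* ((+ 1) ℚ./ suc m) (ℕtoℚ (suc m)))
    (ℚᵘₚ.≃-trans (ℚᵘₚ.*-cong (ℚₚ.toℚᵘ-fromℚᵘ (mkℚᵘ (+ 1) m)) (ℚₚ.toℚᵘ-fromℚᵘ (mkℚᵘ (+ suc m) 0)))
      (*≡* (trans (ℤₚ.*-identityʳ (+ 1 ℤ.* + suc m)) (cong (λ k → + 1 ℤ.* + k) (sym (ℕₚ.*-identityʳ (suc m))))))))

  inv-inverse : ∀ q → ¬ (q ≡ 0ℚ) → q * inv q ≡ 1ℚ
  inv-inverse (mkℚ (+ 0) d c) h = ⊥-elim (h (ℚₚ.↥p≡0⇒p≡0 (mkℚ (+ 0) d c) refl))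
  inv-inverse q@(mkℚ +[1+ n ] d c) h = ℚₚ.*-inverseʳ q
  inv-inverse q@(mkℚ -[1+ n ] d c) h = ℚₚ.*-inverseʳ q

  ℤtoℚ-nonzero : ∀ {z} → ¬ (z ≡ + 0) → ¬ (ℤtoℚ z ≡ 0ℚ)
  ℤtoℚ-nonzero {z} h e = h (ℤtoℚ-injective z (+ 0) e)

  inv-unique : ∀ {a b} → a * b ≡ 1ℚ → inv a ≡ b
  inv-unique {a} {b} h = Q.unit-cancel {a} (b , h) (trans (inv-inverse a nonzero) (sym h))
    where
    1≢0 : ¬ (1ℚ ≡ 0ℚ)
    1≢0 ()
    nonzero : ¬ (a ≡ 0ℚ)
    nonzero e = 1≢0 (trans (sym h) (trans (cong (_* b) e) (ℚₚ.*-zeroˡ b)))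

-- The p-integral rationals modulo p^N as commutative rings.

module PadicRationals (p : ℕ) (p-prime : Prime p) where
  open import Data.Nat.Primality using (Prime; prime⇒nonZero)

  open import Defs
  open PrimeModulus p p-prime using (euclid; ¬p∣1)
  open import Data.Nat.Coprimality as Coprimality using (coprime-divisor)
  open import Data.Rational as ℚ using (ℚ; mkℚ; 0ℚ; 1ℚ; ↥_; ↧_; ↧ₙ_; toℚᵘ; fromℚᵘ; _+_; _*_; _-_; -_)
  import Data.Rational.Properties as ℚₚ
  open import Data.Rational.Unnormalised as ℚᵘ using (mkℚᵘ; *≡*) renaming (ℚᵘ to ℚᵘ′)
  import Data.Rational.Unnormalised.Properties as ℚᵘₚ
  open import Relation.Binary.PropositionalEquality as ≡ using (_≡_; refl; sym; trans; cong; cong₂; subst)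
  open RationalNumbers

  -- p-integral rationals

  record Integral : Set where
    no-eta-equality
    pattern
    constructor integral
    field
      val : ℚ
      den num : ℤ
      ¬p∣den : ¬ (+ p ∣ᶻ den)
      fraction : val * ℤtoℚ den ≡ ℤtoℚ num
  open Integral public

  -- `den` may be any denominator prime to p; the reduced denominator divides it by coprimality.
  val-pIntegral : ∀ r → pIntegral p (val r)
  val-pIntegral (integral r@(mkℚ a d-1 c) d n ¬d e) p∣ = ¬d (ℤD.∣ᵤ⇒∣ (ℕD.∣-trans p∣ divides))
    where
    cross : a ℤ.* d ≡ n ℤ.* + suc d-1
    cross with ℚᵘₚ.≃-trans (ℚᵘₚ.≃-trans (ℚᵘₚ.≃-sym (ℚᵘₚ.≃-trans (ℚₚ.toℚᵘ-homo-* r (ℤtoℚ d)) (ℚᵘₚ.*-congˡ {toℚᵘ r} (ℚₚ.toℚᵘ-fromℚᵘ (mkℚᵘ d 0)))))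
                 (ℚᵘₚ.≃-reflexive (cong toℚᵘ e))) (ℚₚ.toℚᵘ-fromℚᵘ (mkℚᵘ n 0))
    ... | *≡* h = trans (sym (ℤₚ.*-identityʳ _)) (trans h (cong (λ k → n ℤ.* + k) (ℕₚ.*-identityʳ (suc d-1))))
    divides : suc d-1 ℕD.∣ ℤ.∣ d ∣
    divides = coprime-divisor (Coprimality.sym (Coprimality.recompute c))
      (subst (suc d-1 ℕD.∣_) (ℤₚ.abs-* a d) (ℤD.∣⇒∣ᵤ {+ suc d-1} {a ℤ.* d} (ℤD.divides n cross)))

  ¬p∣* : ∀ {a b} → ¬ (+ p ∣ᶻ a) → ¬ (+ p ∣ᶻ b) → ¬ (+ p ∣ᶻ a ℤ.* b)
  ¬p∣* {a} {b} ha hb h with euclid a b h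
  ... | inj₁ k = ha k
  ... | inj₂ k = hb k

  infixl 6 _+ᵢ_
  infixl 7 _*ᵢ_
  _+ᵢ_ _*ᵢ_ : Integral → Integral → Integral
  integral a d n ¬d e +ᵢ integral a′ d′ n′ ¬d′ e′ = integral (a + a′) (d ℤ.* d′) (n ℤ.* d′ ℤ.+ n′ ℤ.* d) (¬p∣* ¬d ¬d′)
    (trans (cong (_*_ (a + a′)) (ℤtoℚ-* d d′)) (trans (Q.solve 4 (λ a a′ d d′ → (a Q.:+ a′) Q.:* (d Q.:* d′) Q.:= (a Q.:* d) Q.:* d′ Q.:+ (a′ Q.:* d′) Q.:* d) refl a a′ (ℤtoℚ d) (ℤtoℚ d′))
      (trans (cong₂ _+_ (trans (cong (_* ℤtoℚ d′) e) (sym (ℤtoℚ-* n d′))) (trans (cong (_* ℤtoℚ d) e′) (sym (ℤtoℚ-* n′ d)))) (sym (ℤtoℚ-+ (n ℤ.* d′) (n′ ℤ.* d))))))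
  integral a d n ¬d e *ᵢ integral a′ d′ n′ ¬d′ e′ = integral (a * a′) (d ℤ.* d′) (n ℤ.* n′) (¬p∣* ¬d ¬d′)
    (trans (cong (_*_ (a * a′)) (ℤtoℚ-* d d′)) (trans (Q.solve 4 (λ a a′ d d′ → (a Q.:* a′) Q.:* (d Q.:* d′) Q.:= (a Q.:* d) Q.:* (a′ Q.:* d′)) refl a a′ (ℤtoℚ d) (ℤtoℚ d′))
      (trans (cong₂ _*_ e e′) (sym (ℤtoℚ-* n n′)))))

  -ᵢ_ : Integral → Integral
  -ᵢ integral a d n ¬d e = integral (- a) d (ℤ.- n) ¬d (trans (sym (ℚₚ.neg-distribˡ-* a (ℤtoℚ d))) (trans (cong -_ e) (sym (ℤtoℚ-neg n))))

  ιᵢ : ℤ → Integral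
  ιᵢ z = integral (ℤtoℚ z) (+ 1) z ¬p∣1 (ℚₚ.*-identityʳ (ℤtoℚ z))

  recipᵢ : ∀ z → ¬ (+ p ∣ᶻ z) → Integral
  recipᵢ z h = integral (inv (ℤtoℚ z)) z (+ 1) h (trans (ℚₚ.*-comm (inv (ℤtoℚ z)) (ℤtoℚ z)) (inv-inverse (ℤtoℚ z) (ℤtoℚ-nonzero {z} (λ { refl → h (ℤD.divides (+ 0) refl) }))))

  val-+ : ∀ a b → val (a +ᵢ b) ≡ val a + val b
  val-+ (integral _ _ _ _ _) (integral _ _ _ _ _) = refl

  val-* : ∀ a b → val (a *ᵢ b) ≡ val a * val b
  val-* (integral _ _ _ _ _) (integral _ _ _ _ _) = refl

  val-neg : ∀ a → val (-ᵢ a) ≡ - val a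
  val-neg (integral _ _ _ _ _) = refl

  record _≈[_]_ (a : Integral) (N : ℕ) (b : Integral) : Set where
    constructor multiple
    field
      cofactor : Integral
      difference : val a - val b ≡ ℕtoℚ (p ℕ.^ N) * val cofactor
  open _≈[_]_ public

  val⇒≈ : ∀ {N a b} → val a ≡ val b → a ≈[ N ] b
  val⇒≈ {N} {a} {b} h = multiple (ιᵢ (+ 0)) (trans (cong (_- val b) h) (trans (ℚₚ.+-inverseʳ (val b)) (sym (ℚₚ.*-zeroʳ (ℕtoℚ (p ℕ.^ N))))))

  module _ {N : ℕ} where
    private P = ℕtoℚ (p ℕ.^ N)

    ≈-sym : ∀ {a b} → a ≈[ N ] b → b ≈[ N ] a
    ≈-sym {a} {b} (multiple c h) = multiple (-ᵢ c) (trans (Q.solve 2 (λ a b → b Q.:- a Q.:= Q.:- (a Q.:- b)) refl (val a) (val b))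
      (trans (cong -_ h) (trans (ℚₚ.neg-distribʳ-* P (val c)) (cong (_*_ P) (sym (val-neg c))))))

    ≈-trans : ∀ {a b c} → a ≈[ N ] b → b ≈[ N ] c → a ≈[ N ] c
    ≈-trans {a} {b} {c} (multiple d h) (multiple e k) = multiple (d +ᵢ e) (trans (Q.solve 3 (λ a b c → a Q.:- c Q.:= (a Q.:- b) Q.:+ (b Q.:- c)) refl (val a) (val b) (val c))
      (trans (cong₂ _+_ h k) (trans (sym (ℚₚ.*-distribˡ-+ P (val d) (val e))) (cong (_*_ P) (sym (val-+ d e))))))

    +ᵢ-cong : ∀ {a b c d} → a ≈[ N ] b → c ≈[ N ] d → (a +ᵢ c) ≈[ N ] (b +ᵢ d)
    +ᵢ-cong {a} {b} {c} {d} (multiple e h) (multiple f k) = multiple (e +ᵢ f) (trans (cong₂ _-_ (val-+ a c) (val-+ b d))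
      (trans (Q.solve 4 (λ a b c d → (a Q.:+ c) Q.:- (b Q.:+ d) Q.:= (a Q.:- b) Q.:+ (c Q.:- d)) refl (val a) (val b) (val c) (val d))
        (trans (cong₂ _+_ h k) (trans (sym (ℚₚ.*-distribˡ-+ P (val e) (val f))) (cong (_*_ P) (sym (val-+ e f)))))))

    *ᵢ-cong : ∀ {a b c d} → a ≈[ N ] b → c ≈[ N ] d → (a *ᵢ c) ≈[ N ] (b *ᵢ d)
    *ᵢ-cong {a} {b} {c} {d} (multiple e h) (multiple f k) = multiple (e *ᵢ c +ᵢ b *ᵢ f) (trans (cong₂ _-_ (val-* a c) (val-* b d))
      (trans (Q.solve 4 (λ a b c d → a Q.:* c Q.:- b Q.:* d Q.:= (a Q.:- b) Q.:* c Q.:+ b Q.:* (c Q.:- d)) refl (val a) (val b) (val c) (val d))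
        (trans (cong₂ (λ x y → x * val c + val b * y) h k) (trans (Q.solve 5 (λ p e c b f → p Q.:* e Q.:* c Q.:+ b Q.:* (p Q.:* f) Q.:= p Q.:* (e Q.:* c Q.:+ b Q.:* f)) refl P (val e) (val c) (val b) (val f))
          (cong (_*_ P) (sym (trans (val-+ (e *ᵢ c) (b *ᵢ f)) (cong₂ _+_ (val-* e c) (val-* b f)))))))))

    -ᵢ-cong : ∀ {a b} → a ≈[ N ] b → (-ᵢ a) ≈[ N ] (-ᵢ b)
    -ᵢ-cong {a} {b} (multiple c h) = multiple (-ᵢ c) (trans (cong₂ _-_ (val-neg a) (val-neg b)) (trans (Q.solve 2 (λ a b → Q.:- a Q.:- Q.:- b Q.:= Q.:- (a Q.:- b)) refl (val a) (val b))
      (trans (cong -_ h) (trans (ℚₚ.neg-distribʳ-* P (val c)) (cong (_*_ P) (sym (val-neg c)))))))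

  -- All N share one carrier and only the equality changes, so an element found modulo p^4 can be
  -- read modulo p^2 or p^3 through its rational value.
  integers-mod : ℕ → CommutativeRing 0ℓ 0ℓ
  integers-mod N = record
    { Carrier = Integral ; _≈_ = λ a b → a ≈[ N ] b ; _+_ = _+ᵢ_ ; _*_ = _*ᵢ_ ; -_ = -ᵢ_ ; 0# = ιᵢ (+ 0) ; 1# = ιᵢ (+ 1)
    ; isCommutativeRing = record
      { isRing = record
        { +-isAbelianGroup = record
          { isGroup = record
            { isMonoid = record
              { isSemigroup = record
                { isMagma = record { isEquivalence = record { refl = val⇒≈ refl ; sym = ≈-sym ; trans = ≈-trans } ; ∙-cong = +ᵢ-cong }
                ; assoc = λ { (integral a _ _ _ _) (integral b _ _ _ _) (integral c _ _ _ _) → val⇒≈ (ℚₚ.+-assoc a b c) } }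
              ; identity = (λ { (integral a _ _ _ _) → val⇒≈ (ℚₚ.+-identityˡ a) }) , (λ { (integral a _ _ _ _) → val⇒≈ (ℚₚ.+-identityʳ a) }) }
            ; inverse = (λ { (integral a _ _ _ _) → val⇒≈ (ℚₚ.+-inverseˡ a) }) , (λ { (integral a _ _ _ _) → val⇒≈ (ℚₚ.+-inverseʳ a) })
            ; ⁻¹-cong = -ᵢ-cong }
          ; comm = λ { (integral a _ _ _ _) (integral b _ _ _ _) → val⇒≈ (ℚₚ.+-comm a b) } }
        ; *-cong = *ᵢ-cong
        ; *-assoc = λ { (integral a _ _ _ _) (integral b _ _ _ _) (integral c _ _ _ _) → val⇒≈ (ℚₚ.*-assoc a b c) }
        ; *-identity = (λ { (integral a _ _ _ _) → val⇒≈ (ℚₚ.*-identityˡ a) }) , (λ { (integral a _ _ _ _) → val⇒≈ (ℚₚ.*-identityʳ a) })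
        ; distrib = (λ { (integral a _ _ _ _) (integral b _ _ _ _) (integral c _ _ _ _) → val⇒≈ (ℚₚ.*-distribˡ-+ a b c) })
                  , (λ { (integral a _ _ _ _) (integral b _ _ _ _) (integral c _ _ _ _) → val⇒≈ (ℚₚ.*-distribʳ-+ a b c) }) }
      ; *-comm = λ { (integral a _ _ _ _) (integral b _ _ _ _) → val⇒≈ (ℚₚ.*-comm a b) } } }

  -- val on the derived operations

  module Val (N : ℕ) where
    private module K = RingKit (integers-mod N)

    val-ιₙ : ∀ n → val (K.ιₙ n) ≡ ℕtoℚ n
    val-ιₙ zero = refl
    val-ιₙ (suc zero) = refl
    val-ιₙ (suc (suc n)) = trans (val-+ (ιᵢ (+ 1)) (K.ιₙ (suc n))) (trans (cong (_+_ 1ℚ) (val-ιₙ (suc n))) (sym (ℤtoℚ-+ (+ 1) (+ suc n))))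

    val-ι : ∀ z → val (K.ι z) ≡ ℤtoℚ z
    val-ι (+ n) = val-ιₙ n
    val-ι -[1+ n ] = trans (val-neg (K.ιₙ (suc n))) (trans (cong -_ (val-ιₙ (suc n))) (sym (ℤtoℚ-neg (+ suc n))))

    val-Σ : ∀ n f → val (K.Σ< n f) ≡ Q.Σ< n (λ i → val (f i))
    val-Σ zero f = refl
    val-Σ (suc n) f = trans (val-+ (K.Σ< n f) (f n)) (cong (_+ val (f n)) (val-Σ n f))

    val-Π : ∀ n f → val (K.Π< n f) ≡ Q.Π< n (λ i → val (f i))
    val-Π zero f = refl
    val-Π (suc n) f = trans (val-* (K.Π< n f) (f n)) (cong (_* val (f n)) (val-Π n f))

    val-^ : ∀ a n → val (a K.^ n) ≡ val a Q.^ n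
    val-^ a zero = refl
    val-^ a (suc n) = trans (val-* a (a K.^ n)) (cong (_*_ (val a)) (val-^ a n))

    unit-ι : ∀ z → ¬ (+ p ∣ᶻ z) → K.Unit (K.ι z)
    unit-ι z h = recipᵢ z h , val⇒≈ (trans (val-* (K.ι z) (recipᵢ z h)) (trans (cong (_* inv (ℤtoℚ z)) (val-ι z))
      (inv-inverse (ℤtoℚ z) (ℤtoℚ-nonzero {z} (λ { refl → h (ℤD.divides (+ 0) refl) })))))

    p^N≈0 : K.ιₙ (p ℕ.^ N) K.≈ K.0#
    p^N≈0 = multiple (ιᵢ (+ 1)) (trans (cong (_- 0ℚ) (val-ιₙ (p ℕ.^ N))) (trans (ℚₚ.+-identityʳ (ℕtoℚ (p ℕ.^ N))) (sym (ℚₚ.*-identityʳ (ℕtoℚ (p ℕ.^ N))))))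

    private instance _ = prime⇒nonZero p-prime

    ι-reflects : 0 ℕ.< N → ∀ z → K.ιₙ p K.∣ʳ K.ι z → + p ∣ᶻ z
    ι-reflects 0<N z (c , multiple d h) = go c d value
      where
      N′ = ℕ.pred N
      N≡ : N ≡ suc N′
      N≡ = sym (ℕₚ.suc-pred N {{ℕ.>-nonZero 0<N}})
      value : ℤtoℚ z ≡ ℕtoℚ p * (val c + ℕtoℚ (p ℕ.^ N′) * val d)
      value = trans (Q.solve 2 (λ z y → z Q.:= (z Q.:- y) Q.:+ y) refl (ℤtoℚ z) (ℕtoℚ p * val c))
        (trans (cong (_+ ℕtoℚ p * val c) (trans (cong₂ _-_ (sym (val-ι z)) (sym (trans (val-* (K.ιₙ p) c) (cong (_* val c) (val-ιₙ p)))))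
            (trans h (cong (_* val d) (trans (cong (λ k → ℕtoℚ (p ℕ.^ k)) N≡) (trans (cong ℤtoℚ (ℤₚ.pos-* p (p ℕ.^ N′))) (ℤtoℚ-* (+ p) (+ (p ℕ.^ N′)))))))))
          (Q.solve 4 (λ p q d c → p Q.:* q Q.:* d Q.:+ p Q.:* c Q.:= p Q.:* (c Q.:+ q Q.:* d)) refl (ℕtoℚ p) (ℕtoℚ (p ℕ.^ N′)) (val d) (val c)))
      go : ∀ c d → ℤtoℚ z ≡ ℕtoℚ p * (val c + ℕtoℚ (p ℕ.^ N′) * val d) → + p ∣ᶻ z
      go (integral c dc nc ¬dc ec) (integral d dd nd ¬dd ed) e = from (euclid z (dc ℤ.* dd) (ℤD.divides w (ℤtoℚ-injective (z ℤ.* (dc ℤ.* dd)) (w ℤ.* + p) equation)))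
        where
        w = nc ℤ.* dd ℤ.+ + (p ℕ.^ N′) ℤ.* (nd ℤ.* dc)
        equation : ℤtoℚ (z ℤ.* (dc ℤ.* dd)) ≡ ℤtoℚ (w ℤ.* + p)
        equation = trans (trans (ℤtoℚ-* z (dc ℤ.* dd)) (cong₂ _*_ e (ℤtoℚ-* dc dd)))
          (trans (Q.solve 6 (λ p c q d x y → p Q.:* (c Q.:+ q Q.:* d) Q.:* (x Q.:* y) Q.:= ((c Q.:* x) Q.:* y Q.:+ q Q.:* ((d Q.:* y) Q.:* x)) Q.:* p) refl (ℕtoℚ p) c (ℕtoℚ (p ℕ.^ N′)) d (ℤtoℚ dc) (ℤtoℚ dd))
          (trans (cong (_* ℕtoℚ p) (cong₂ _+_ (trans (cong (_* ℤtoℚ dd) ec) (sym (ℤtoℚ-* nc dd)))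
                (trans (cong (λ v → ℕtoℚ (p ℕ.^ N′) * (v * ℤtoℚ dc)) ed) (trans (cong (_*_ (ℕtoℚ (p ℕ.^ N′))) (sym (ℤtoℚ-* nd dc))) (sym (ℤtoℚ-* (+ (p ℕ.^ N′)) (nd ℤ.* dc)))))))
            (trans (cong (_* ℕtoℚ p) (sym (ℤtoℚ-+ (nc ℤ.* dd) (+ (p ℕ.^ N′) ℤ.* (nd ℤ.* dc))))) (sym (ℤtoℚ-* w (+ p))))))
        from : + p ∣ᶻ z ⊎ + p ∣ᶻ dc ℤ.* dd → + p ∣ᶻ z
        from (inj₁ k) = k
        from (inj₂ k) = ⊥-elim (¬p∣* ¬dc ¬dd k)

  congMod : ∀ a b → a ≈[ 4 ] b → CongMod p (val a) (val b) (ℕtoℚ (p ℕ.^ 4))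
  congMod a b (multiple c h) = val c , val-pIntegral c , h

-- The sum S as a value of the hypergeometric function F.

module SumValue (M : ℕ) (p-prime : Prime (suc M)) (3<p : 3 ℕ.< suc M) (e n : ℕ) (ep : e ℕ.* suc M ≡ suc (6 ℕ.* n)) (n≤M : n ℕ.≤ M) where
  private
    p : ℕ
    p = suc M

  open import Data.Nat as ℕ using (ℕ; zero; suc; _!)
  open import Relation.Binary.PropositionalEquality as ≡ using (_≡_; refl; sym; trans; cong; cong₂; subst)

  open import Defs
  open import Data.Nat.Properties using (_!≢0)
  open import Data.Rational as ℚ using (ℚ; 0ℚ; 1ℚ; _+_; _*_; _-_; -_)
  import Data.Rational.Properties as ℚₚ
  open PrimeModulus p p-prime using (¬p∣small)
  open RationalNumbers
  open PadicRationals p p-prime public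
  module V = Val 4
  module K = RingKit (integers-mod 4)

  ¬p∣6 : ¬ (+ p ∣ᶻ + 6)
  ¬p∣6 = ¬p∣* {+ 2} {+ 3} (¬p∣small 2 (ℕ.s≤s ℕ.z≤n) (ℕₚ.<-trans (ℕ.s≤s (ℕ.s≤s (ℕ.s≤s ℕ.z≤n))) 3<p)) (¬p∣small 3 (ℕ.s≤s ℕ.z≤n) 3<p)

  -- x = e p / 6, so that x - n = 1/6 by e p = 6n + 1.
  sixth x : Integral
  sixth = recipᵢ (+ 6) ¬p∣6
  x = ιᵢ (+ (e ℕ.* p)) *ᵢ sixth

  iv : ℕ → Integral
  iv j with + p ℤD.∣? + suc j
  ... | yes _ = ιᵢ (+ 0)
  ... | no h = recipᵢ (+ suc j) h

  val-iv : ∀ j → j ℕ.< M → ℕtoℚ (suc j) * val (iv j) ≡ 1ℚ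
  val-iv j j<M with + p ℤD.∣? + suc j
  ... | yes h = ⊥-elim (¬p∣small (suc j) (ℕ.s≤s ℕ.z≤n) (ℕ.s≤s j<M) h)
  ... | no h = inv-inverse (ℕtoℚ (suc j)) (ℤtoℚ-nonzero {+ suc j} λ ())

  iv-inv : ∀ j → j ℕ.< M → K.ιₙ (suc j) K.* iv j K.≈ K.1#
  iv-inv j j<M = val⇒≈ (trans (val-* (K.ιₙ (suc j)) (iv j)) (trans (cong (_* val (iv j)) (V.val-ιₙ (suc j))) (val-iv j j<M)))

  6·sixth : ℕtoℚ 6 * val sixth ≡ 1ℚ
  6·sixth = inv-inverse (ℕtoℚ 6) (ℤtoℚ-nonzero {+ 6} λ ())

  val-6x : ℕtoℚ 6 * val x ≡ ℕtoℚ (e ℕ.* p)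
  val-6x = trans (cong (_*_ (ℕtoℚ 6)) (val-* (ιᵢ (+ (e ℕ.* p))) sixth)) (trans (Q.solve 3 (λ a b c → a Q.:* (b Q.:* c) Q.:= (a Q.:* c) Q.:* b) refl (ℕtoℚ 6) (ℕtoℚ (e ℕ.* p)) (val sixth))
    (trans (cong (_* ℕtoℚ (e ℕ.* p)) 6·sixth) (ℚₚ.*-identityˡ _)))

  p⁴≈0 : K.ιₙ p K.* K.ιₙ p K.* K.ιₙ p K.* K.ιₙ p K.≈ K.0#
  p⁴≈0 = K.trans (val⇒≈ (trans (val-* (P K.* P K.* P) P) (trans (cong (_* val P) (trans (val-* (P K.* P) P) (cong (_* val P) (val-* P P))))
      (trans (cong (λ v → v * v * v * v) (V.val-ιₙ p)) (sym (trans (V.val-ιₙ (p ℕ.^ 4)) (trans (ℕtoℚ-^ p 4) (Q.solve 1 (λ p → p Q.:* (p Q.:* (p Q.:* (p Q.:* Q.♯ 1))) Q.:= p Q.:* p Q.:* p Q.:* p) refl (ℕtoℚ p)))))))))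
    V.p^N≈0
    where
    P = K.ιₙ p

  x⁴≈0 : x K.* x K.* x K.* x K.≈ K.0#
  x⁴≈0 = K.fourth-power≈0 {x} {K.ιₙ p} c x≈ p⁴≈0
    where
    c = ιᵢ (+ e) *ᵢ sixth
    x≈ : x K.≈ K.ιₙ p K.* c
    x≈ = val⇒≈ (trans (val-* (ιᵢ (+ (e ℕ.* p))) sixth) (trans (cong (_* val sixth) (trans (cong ℤtoℚ (ℤₚ.pos-* e p)) (ℤtoℚ-* (+ e) (+ p))))
      (trans (Q.solve 3 (λ e p s → e Q.:* p Q.:* s Q.:= p Q.:* (e Q.:* s)) refl (ℕtoℚ e) (ℕtoℚ p) (val sixth))
        (sym (trans (val-* (K.ιₙ p) c) (cong₂ _*_ (V.val-ιₙ p) (val-* (ιᵢ (+ e)) sixth)))))))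

  unit-2 : K.Unit (K.ιₙ 2)
  unit-2 = V.unit-ι (+ 2) (¬p∣small 2 (ℕ.s≤s ℕ.z≤n) (ℕₚ.<-trans (ℕ.s≤s (ℕ.s≤s (ℕ.s≤s ℕ.z≤n))) 3<p))

  module H = HypergeometricSum.ClosedForm (integers-mod 4) x x⁴≈0 M iv iv-inv unit-2

  aᵢ : Integral
  aᵢ = x K.- K.ιₙ n

  A : ℚ
  A = val aᵢ

  6A : ℕtoℚ 6 * A ≡ 1ℚ
  6A = trans (cong (_*_ (ℕtoℚ 6)) (trans (val-+ x (-ᵢ K.ιₙ n)) (cong (_+_ (val x)) (trans (val-neg (K.ιₙ n)) (cong -_ (V.val-ιₙ n))))))
    (trans (Q.solve 3 (λ s x n → s Q.:* (x Q.:+ Q.:- n) Q.:= s Q.:* x Q.:- s Q.:* n) refl (ℕtoℚ 6) (val x) (ℕtoℚ n))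
      (trans (cong₂ _-_ (trans val-6x (trans (cong ℕtoℚ ep) (ℤtoℚ-+ (+ 1) (+ (6 ℕ.* n))))) (sym (trans (cong ℤtoℚ (ℤₚ.pos-* 6 n)) (ℤtoℚ-* (+ 6) (+ n)))))
        (Q.solve 1 (λ s → Q.♯ 1 Q.:+ s Q.:- s Q.:= Q.♯ 1) refl (ℕtoℚ (6 ℕ.* n)))))

  -A : (-[1+ 0 ] ℚ./ 6) ≡ - A
  -A = Q.unit-cancel {ℕtoℚ 6} (val sixth , 6·sixth) (trans refl (sym (trans (sym (ℚₚ.neg-distribʳ-* (ℕtoℚ 6) A)) (cong -_ 6A))))

  B : ℕ → ℚ
  B = binom (-[1+ 0 ] ℚ./ 6)

  r : ℕ → ℚ
  r k = ((+ 1) ℚ./ (k !)) {{k !≢0}}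

  r-inverse : ∀ k → r k * ℕtoℚ (k !) ≡ 1ℚ
  r-inverse k = /-inverse (k !) {{k !≢0}}

  r-step : ∀ k → r (suc k) * ℕtoℚ (suc k) ≡ r k
  r-step k = Q.unit-cancel {ℕtoℚ (k !)} (r k , trans (ℚₚ.*-comm (ℕtoℚ (k !)) (r k)) (r-inverse k))
    (trans (Q.solve 3 (λ f r s → f Q.:* (r Q.:* s) Q.:= r Q.:* (s Q.:* f)) refl (ℕtoℚ (k !)) (r (suc k)) (ℕtoℚ (suc k)))
      (trans (cong (_*_ (r (suc k))) (trans (sym (ℤtoℚ-* (+ suc k) (+ (k !)))) (cong ℤtoℚ (sym (ℤₚ.pos-* (suc k) (k !))))))
        (trans (r-inverse (suc k)) (sym (trans (ℚₚ.*-comm (ℕtoℚ (k !)) (r k)) (r-inverse k))))))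

  B-step : ∀ k → B (suc k) * ℕtoℚ (suc k) ≡ - (B k * (A + ℕtoℚ k))
  B-step k = trans (Q.solve 4 (λ r f q s → r Q.:* (f Q.:* q) Q.:* s Q.:= (r Q.:* s) Q.:* f Q.:* q) refl (r (suc k)) (fall q k) (q - ℕtoℚ k) (ℕtoℚ (suc k)))
    (trans (cong₂ (λ a b → a * fall q k * (b - ℕtoℚ k)) (r-step k) -A)
      (Q.solve 4 (λ r f A k → r Q.:* f Q.:* (Q.:- A Q.:- k) Q.:= Q.:- (r Q.:* f Q.:* (A Q.:+ k))) refl (r k) (fall q k) A (ℕtoℚ k)))
    where q = -[1+ 0 ] ℚ./ 6

  -- Consecutive coefficients binom(-1/6, k) have ratio -(1/6 + k)/(k + 1), and the fourth power
  -- absorbs the sign.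
  val-T : ∀ k → k ℕ.≤ M → val (H.T aᵢ K.0# k) ≡ B k ^ℚ 4
  val-T zero _ = refl
  val-T (suc k) k<M = Q.unit-cancel {s * s * s * s} (v * v * v * v , trans (Q.solve 2 (λ s v → s Q.:* s Q.:* s Q.:* s Q.:* (v Q.:* v Q.:* v Q.:* v) Q.:= (s Q.:* v) Q.:* (s Q.:* v) Q.:* (s Q.:* v) Q.:* (s Q.:* v)) refl s v)
        (cong (λ a → a * a * a * a) sv))
    (trans (cong (_*_ (s * s * s * s)) (trans (val-* (H.T aᵢ K.0# k) (ratio)) (cong₂ _*_ (val-T k (ℕₚ.<⇒≤ k<M)) val-ratio)))
    (trans (Q.solve 4 (λ s b a v → s Q.:* s Q.:* s Q.:* s Q.:* (b Q.:* (b Q.:* (b Q.:* (b Q.:* Q.♯ 1))) Q.:* (a Q.:* (a Q.:* a Q.:* a) Q.:* (v Q.:* (v Q.:* v Q.:* v))))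
        Q.:= (b Q.:* a) Q.:* (b Q.:* a) Q.:* (b Q.:* a) Q.:* (b Q.:* a) Q.:* ((s Q.:* v) Q.:* (s Q.:* v) Q.:* (s Q.:* v) Q.:* (s Q.:* v))) refl s (B k) a v)
    (trans (cong₂ (λ y z → y * y * y * y * (z * z * z * z)) (Q.a-b≈0⇒a≈b {B k * a} { - (B (suc k) * s)} (trans (cong (λ y → B k * a - - y) (B-step k)) (Q.solve 1 (λ y → y Q.:- Q.:- Q.:- y Q.:= Q.♯ 0) refl (B k * a)))) sv)
      (Q.solve 2 (λ b s → Q.:- (b Q.:* s) Q.:* Q.:- (b Q.:* s) Q.:* Q.:- (b Q.:* s) Q.:* Q.:- (b Q.:* s) Q.:* (Q.♯ 1 Q.:* Q.♯ 1 Q.:* Q.♯ 1 Q.:* Q.♯ 1) Q.:= s Q.:* s Q.:* s Q.:* s Q.:* (b Q.:* (b Q.:* (b Q.:* (b Q.:* Q.♯ 1))))) refl (B (suc k)) s))))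
    where
    s v a : ℚ
    s = ℕtoℚ (suc k)
    v = val (iv k)
    a = A + ℕtoℚ k
    sv : s * v ≡ 1ℚ
    sv = val-iv k k<M
    ratio : Integral
    ratio = H.numer aᵢ K.0# k K.* (iv k K.* H.W K.0# k)
    u w : Integral
    u = aᵢ K.+ K.ιₙ k
    w = iv k
    val-u : val u ≡ a
    val-u = trans (val-+ aᵢ (K.ιₙ k)) (cong (_+_ A) (V.val-ιₙ k))
    cube : ∀ y → val (y K.* y K.* y) ≡ val y * val y * val y
    cube y = trans (val-* (y K.* y) y) (cong (_* val y) (val-* y y))
    val-ratio : val ratio ≡ a * (a * a * a) * (v * (v * v * v))
    val-ratio = trans (val-* (H.numer aᵢ K.0# k) (iv k K.* H.W K.0# k)) (cong₂ _*_
      (trans (val-* u (u K.* u K.* u K.- K.0#)) (cong₂ _*_ val-u (trans (val-+ (u K.* u K.* u) (K.- K.0#)) (trans (cong₂ _+_ (trans (cube u) (cong (λ y → y * y * y) val-u)) (val-neg K.0#)) (ℚₚ.+-identityʳ (a * a * a))))))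
      (trans (val-* w (H.W K.0# k)) (cong (_*_ v) (trans (val-+ (w K.* w K.* w) (K.- (K.0# K.* (w K.* w K.* w K.* (w K.* w K.* w)))))
        (trans (cong₂ _+_ (cube w) (trans (val-neg (K.0# K.* (w K.* w K.* w K.* (w K.* w K.* w)))) (cong -_ (trans (val-* K.0# (w K.* w K.* w K.* (w K.* w K.* w))) (ℚₚ.*-zeroˡ (val (w K.* w K.* w K.* (w K.* w K.* w)))))))) (ℚₚ.+-identityʳ (v * v * v)))))))

  sumTo-Σ : ∀ m f → sumTo m f ≡ Q.Σ< m f
  sumTo-Σ zero f = refl
  sumTo-Σ (suc m) f = cong (_+ f m) (sumTo-Σ m f)

  summand : ℕ → Integral
  summand k = (K.ιₙ 2 K.* K.ιₙ k K.+ aᵢ) K.* H.T aᵢ K.0# k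

  val-summand : ∀ k → k ℕ.≤ M → ℕtoℚ 6 * val (summand k) ≡ ℕtoℚ (12 ℕ.* k ℕ.+ 1) * (B k ^ℚ 4)
  val-summand k k≤M = trans (cong (_*_ (ℕtoℚ 6)) (trans (val-* (K.ιₙ 2 K.* K.ιₙ k K.+ aᵢ) (H.T aᵢ K.0# k)) (cong₂ _*_
        (trans (val-+ (K.ιₙ 2 K.* K.ιₙ k) aᵢ) (cong (_+ A) (trans (val-* (K.ιₙ 2) (K.ιₙ k)) (cong₂ _*_ (V.val-ιₙ 2) (V.val-ιₙ k))))) (val-T k k≤M))))
    (trans (Q.solve 5 (λ s t A k b → s Q.:* ((t Q.:* k Q.:+ A) Q.:* b) Q.:= (s Q.:* t Q.:* k Q.:+ s Q.:* A) Q.:* b) refl (ℕtoℚ 6) (ℕtoℚ 2) A (ℕtoℚ k) (B k ^ℚ 4))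
      (cong (_* (B k ^ℚ 4)) (trans (cong₂ _+_ (trans (cong (_* ℕtoℚ k) (sym (ℕtoℚ-* 6 2))) (sym (ℕtoℚ-* 12 k))) 6A) (sym (ℤtoℚ-+ (+ (12 ℕ.* k)) (+ 1))))))

  S-value : val (K.ιₙ 6 K.* H.F aᵢ K.0#) ≡ S p
  S-value = trans (trans (val-* (K.ιₙ 6) (H.F aᵢ K.0#)) (cong₂ _*_ (V.val-ιₙ 6) (V.val-Σ p summand)))
    (trans (sym (Q.Σ-*ˡ p (ℕtoℚ 6) (λ k → val (summand k))))
      (trans (Q.Σ-cong p (λ k k<p → val-summand k (ℕₚ.≤-pred k<p))) (sym (sumTo-Σ p (λ k → ℕtoℚ (12 ℕ.* k ℕ.+ 1) * (B k ^ℚ 4))))))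

  module Products (N : ℕ) where
    private module KN = RingKit (integers-mod N)
    open Val N public
    linear cube square : ℕ → Integral
    linear i = KN.ιₙ (suc i) KN.- KN.ιₙ 2 KN.* x
    cube i = KN.ιₙ (suc i) KN.* KN.ιₙ (suc i) KN.* KN.ιₙ (suc i) KN.+ x KN.* x KN.* x
    square i = x KN.* x KN.- KN.ιₙ (suc i) KN.* KN.ιₙ (suc i)

    val-linear : ∀ i → val (linear i) ≡ ℕtoℚ (suc i) - ℕtoℚ 2 * val x
    val-linear i = trans (val-+ (KN.ιₙ (suc i)) (KN.- (KN.ιₙ 2 KN.* x))) (cong₂ _+_ (val-ιₙ (suc i))
      (trans (val-neg (KN.ιₙ 2 KN.* x)) (cong -_ (trans (val-* (KN.ιₙ 2) x) (cong (_* val x) (val-ιₙ 2))))))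

    val-cube : ∀ i → val (cube i) ≡ ℕtoℚ (suc i) * ℕtoℚ (suc i) * ℕtoℚ (suc i) + val x * val x * val x
    val-cube i = trans (val-+ (s KN.* s KN.* s) (x KN.* x KN.* x)) (cong₂ _+_ (trans (cubed s) (cong (λ v → v * v * v) (val-ιₙ (suc i)))) (cubed x))
      where
      s = KN.ιₙ (suc i)
      cubed : ∀ y → val (y KN.* y KN.* y) ≡ val y * val y * val y
      cubed y = trans (val-* (y KN.* y) y) (cong (_* val y) (val-* y y))

    val-square : ∀ i → val (square i) ≡ val x * val x - ℕtoℚ (suc i) * ℕtoℚ (suc i)
    val-square i = trans (val-+ (x KN.* x) (KN.- (s KN.* s))) (cong₂ _+_ (val-* x x)
      (trans (val-neg (s KN.* s)) (cong -_ (trans (val-* s s) (cong (λ v → v * v) (val-ιₙ (suc i)))))))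
      where s = KN.ιₙ (suc i)

    val-Π′ : ∀ k f g → (∀ i → val (f i) ≡ g i) → val (KN.Π< k f) ≡ Q.Π< k g
    val-Π′ k f g h = trans (val-Π k f) (Q.Π-cong k (λ i _ → h i))

  weaken : ∀ N {a b} → a ≈[ 4 ] b → N ℕ.≤ 4 → a ≈[ N ] b
  weaken N (multiple c h) N≤4 = multiple (ιᵢ (+ (p ℕ.^ (4 ℕ.∸ N))) *ᵢ c) (trans h
    (trans (cong (_* val c) (trans (cong (λ k → ℕtoℚ (p ℕ.^ k)) (sym (ℕₚ.m+[n∸m]≡n N≤4))) (trans (cong ℕtoℚ (ℕₚ.^-distribˡ-+-* p N (4 ℕ.∸ N))) (ℕtoℚ-* (p ℕ.^ N) (p ℕ.^ (4 ℕ.∸ N))))))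
      (trans (ℚₚ.*-assoc (ℕtoℚ (p ℕ.^ N)) (ℕtoℚ (p ℕ.^ (4 ℕ.∸ N))) (val c)) (cong (_*_ (ℕtoℚ (p ℕ.^ N))) (sym (val-* (ιᵢ (+ (p ℕ.^ (4 ℕ.∸ N)))) c))))))

  module P₄ = Products 4

  -- The closed-form equation is produced modulo p^4 but evaluated modulo p^2 or p^3. The products
  -- in the two rings are different terms with the same rational value, so the passage goes through
  -- `val`.
  module Transport (N : ℕ) (N≤4 : N ℕ.≤ 4) where
    private
      module KN = RingKit (integers-mod N)
      module P = Products N

    LD : val (H.L n K.* H.D n) ≡ val (KN.Π< n P.linear KN.* KN.Π< n P.cube)
    LD = trans (val-* (H.L n) (H.D n)) (trans (cong₂ _*_
        (trans (P₄.val-Π′ n P₄.linear _ P₄.val-linear) (sym (P.val-Π′ n P.linear _ P.val-linear)))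
        (trans (P₄.val-Π′ n P₄.cube _ P₄.val-cube) (sym (P.val-Π′ n P.cube _ P.val-cube))))
      (sym (val-* (KN.Π< n P.linear) (KN.Π< n P.cube))))

    transport : ∀ y e e′ → y K.* (H.L n K.* H.D n) K.≈ e → val e ≡ val e′ → (y KN.* (KN.Π< n P.linear KN.* KN.Π< n P.cube)) KN.≈ e′
    transport y e e′ h he = KN.trans (val⇒≈ (trans (val-* y (KN.Π< n P.linear KN.* KN.Π< n P.cube))
        (sym (trans (val-* y (H.L n K.* H.D n)) (cong (_*_ (val y)) LD)))))
      (KN.trans (weaken N h N≤4) (val⇒≈ he))

  S≈6xy : ∀ y → y K.* (H.L n K.* H.D n) K.≈ H.E n → (K.ιₙ 6 K.* H.F aᵢ K.0#) K.≈ (K.ιₙ 6 K.* (x K.* y))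
  S≈6xy y h = *ᵢ-cong {4} {K.ιₙ 6} {K.ιₙ 6} (val⇒≈ refl) (H.F-closed-form n y n≤M h)

  val-6xy : ∀ y → val (K.ιₙ 6 K.* (x K.* y)) ≡ ℕtoℚ (e ℕ.* p) * val y
  val-6xy y = trans (val-* (K.ιₙ 6) (x K.* y)) (trans (cong₂ _*_ (V.val-ιₙ 6) (val-* x y))
    (trans (sym (ℚₚ.*-assoc (ℕtoℚ 6) (val x) (val y))) (cong (_* val y) val-6x)))

  power-val : ∀ N → val (RingKit.ιₙ (integers-mod N) (p ℕ.^ N)) ≡ ℕtoℚ p Q.^ N
  power-val N = trans (Val.val-ιₙ N (p ℕ.^ N)) (ℕtoℚ-^ p N)

module Congruences where
  open import Defs
  open import Data.Nat.Combinatorics using (_C_)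
  open import Data.Rational as ℚ using (ℚ; 0ℚ; 1ℚ; _+_; _*_; _-_; -_)
  import Data.Rational.Properties as ℚₚ
  open ≡ using (refl; sym; trans; cong; cong₂; subst)
  open NaturalBinomials using (module ℕS)
  open RationalNumbers

  expansion : ℕ → ℤ → ℚ
  expansion p u = let U = ℤtoℚ u in (- (ℕtoℚ p * U)) + (ℕtoℚ (p ℕ.^ 2) ÷' U) + (ℕtoℚ (p ℕ.^ 3) ÷' (U ^ℚ 3))

  -- Primes p = 6n + 1.

  module Residue-1 (M : ℕ) (p-prime : Prime (suc M)) (3<p : 3 ℕ.< suc M) (n′ : ℕ) (M≡6n : M ≡ 6 ℕ.* suc n′)
    (X Y : ℤ) (X²+3Y² : + suc M ≡ X ℤ.* X ℤ.+ + 3 ℤ.* (Y ℤ.* Y)) (X≡1 : + 3 ∣ᶻ X ℤ.- + 1) where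
    private
      p : ℕ
      p = suc M
      n : ℕ
      n = suc n′

    open SumValue M p-prime 3<p 1 n (trans (ℕₚ.*-identityˡ p) (cong suc M≡6n)) (subst (n ℕ.≤_) (sym M≡6n) (ℕₚ.m≤n*m n 6))

    module P₃ = Products 3
    module K₃ = RingKit (integers-mod 3)

    p³≈0 : K₃.ιₙ p K₃.* K₃.ιₙ p K₃.* K₃.ιₙ p K₃.≈ K₃.0#
    p³≈0 = K₃.trans (val⇒≈ (trans (val-* (P K₃.* P) P) (trans (cong (_* val P) (val-* P P)) (trans (cong (λ v → v * v * v) (P₃.val-ιₙ p))
        (sym (trans (power-val 3) (Q.solve 1 (λ p → p Q.:* (p Q.:* (p Q.:* Q.♯ 1)) Q.:= p Q.:* p Q.:* p) refl (ℕtoℚ p)))))))) P₃.p^N≈0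
      where P = K₃.ιₙ p

    Λ : CubeNilpotent (integers-mod 3) p
    Λ = record { p³≈0 = p³≈0 ; unit-ι = P₃.unit-ι ; ι-reflects = P₃.ι-reflects (ℕ.s≤s ℕ.z≤n) }

    6x≈p : K₃.ιₙ 6 K₃.* x K₃.≈ K₃.ιₙ p
    6x≈p = val⇒≈ (trans (val-* (K₃.ιₙ 6) x) (trans (cong (_* val x) (P₃.val-ιₙ 6)) (trans val-6x (trans (cong ℕtoℚ (ℕₚ.*-identityˡ p)) (sym (P₃.val-ιₙ p))))))

    x³≈0 : x K₃.* x K₃.* x K₃.≈ K₃.0#
    x³≈0 = K₃.third-power≈0 {x} {K₃.ιₙ p} sixth x≈ p³≈0
      where
      x≈ : x K₃.≈ K₃.ιₙ p K₃.* sixth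
      x≈ = val⇒≈ (trans (val-* (ιᵢ (+ (1 ℕ.* p))) sixth) (trans (cong (λ k → ℕtoℚ k * val sixth) (ℕₚ.*-identityˡ p))
        (sym (trans (val-* (K₃.ιₙ p) sixth) (cong (_* val sixth) (P₃.val-ιₙ p))))))

    abstract
      solution : ∃ λ y → y K.* (H.L n K.* H.D n) K.≈ H.E n
      solution = H.quotient n (H.E n) (subst (n ℕ.≤_) (sym M≡6n) (ℕₚ.m≤n*m n 6))

    y : Integral
    y = proj₁ solution

    y-eq₃ : y K₃.* (K₃.Π< n P₃.linear K₃.* K₃.Π< n P₃.cube) K₃.≈ (K₃.Π< n P₃.square K₃.* K₃.Π< (2 ℕ.* n) P₃.linear)
    y-eq₃ = Transport.transport 3 (ℕ.s≤s (ℕ.s≤s (ℕ.s≤s ℕ.z≤n))) y (H.E n) (K₃.Π< n P₃.square K₃.* K₃.Π< (2 ℕ.* n) P₃.linear) (proj₂ solution)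
      (trans (val-* (K.Π< n P₄.square) (K.Π< (2 ℕ.* n) P₄.linear)) (trans (cong₂ _*_
          (trans (P₄.val-Π′ n P₄.square _ P₄.val-square) (sym (P₃.val-Π′ n P₃.square _ P₃.val-square)))
          (trans (P₄.val-Π′ (2 ℕ.* n) P₄.linear _ P₄.val-linear) (sym (P₃.val-Π′ (2 ℕ.* n) P₃.linear _ P₃.val-linear))))
        (sym (val-* (K₃.Π< n P₃.square) (K₃.Π< (2 ℕ.* n) P₃.linear)))))

    module _ (u : ℤ) (¬u : ¬ (+ p ∣ᶻ u))
      (root : ∀ v → K₃.ι u K₃.* v K₃.≈ K₃.1# → y K₃.≈ K₃.- K₃.ι u K₃.+ K₃.ιₙ p K₃.* v K₃.+ K₃.ιₙ p K₃.* K₃.ιₙ p K₃.* (v K₃.* v K₃.* v)) where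

      v z : Integral
      v = recipᵢ u ¬u
      z = K₃.- K₃.ι u K₃.+ K₃.ιₙ p K₃.* v K₃.+ K₃.ιₙ p K₃.* K₃.ιₙ p K₃.* (v K₃.* v K₃.* v)

      U V P : ℚ
      U = ℤtoℚ u
      V = inv U
      P = ℕtoℚ p

      UV : U * V ≡ 1ℚ
      UV = trans (cong (_* V) (sym (P₃.val-ι u))) (trans (sym (val-* (K₃.ι u) v)) (trans (val-* (K₃.ι u) v) (trans (cong (_* V) (P₃.val-ι u))
        (inv-inverse U (ℤtoℚ-nonzero {u} (λ { refl → ¬u (ℤD.divides (+ 0) refl) }))))))

      y≈z : y K₃.≈ z
      y≈z = root v (val⇒≈ (trans (val-* (K₃.ι u) v) (trans (cong (_* V) (P₃.val-ι u)) UV)))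

      val-z : val z ≡ - U + P * V + P * P * (V * V * V)
      val-z = trans (val-+ (K₃.- K₃.ι u K₃.+ K₃.ιₙ p K₃.* v) w) (cong₂ _+_
          (trans (val-+ (K₃.- K₃.ι u) (K₃.ιₙ p K₃.* v)) (cong₂ _+_ (trans (val-neg (K₃.ι u)) (cong -_ (P₃.val-ι u))) (trans (val-* (K₃.ιₙ p) v) (cong (_* V) (P₃.val-ιₙ p)))))
          (trans (val-* (K₃.ιₙ p K₃.* K₃.ιₙ p) (v K₃.* v K₃.* v)) (cong₂ _*_ (trans (val-* (K₃.ιₙ p) (K₃.ιₙ p)) (cong (λ a → a * a) (P₃.val-ιₙ p)))
            (trans (val-* (v K₃.* v) v) (cong (_* V) (val-* v v))))))
        where w = K₃.ιₙ p K₃.* K₃.ιₙ p K₃.* (v K₃.* v K₃.* v)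

      val-target : P * val z ≡ expansion p u
      val-target = trans (cong (_*_ P) val-z) (trans (Q.solve 3 (λ P U V → P Q.:* (Q.:- U Q.:+ P Q.:* V Q.:+ P Q.:* P Q.:* (V Q.:* V Q.:* V))
          Q.:= Q.:- (P Q.:* U) Q.:+ (P Q.:* (P Q.:* Q.♯ 1)) Q.:* V Q.:+ (P Q.:* (P Q.:* (P Q.:* Q.♯ 1))) Q.:* (V Q.:* V Q.:* V)) refl P U V)
        (cong₂ _+_ (cong (λ a → - (P * U) + a * V) (sym (ℕtoℚ-^ p 2))) (cong₂ _*_ (sym (ℕtoℚ-^ p 3)) (sym (inv-unique {U ^ℚ 3} {V * V * V}
          (trans (Q.solve 2 (λ U V → U Q.:* (U Q.:* (U Q.:* Q.♯ 1)) Q.:* (V Q.:* V Q.:* V) Q.:= (U Q.:* V) Q.:* (U Q.:* V) Q.:* (U Q.:* V)) refl U V) (cong (λ a → a * a * a) UV)))))))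

      -- Since 6x = p, a congruence for y modulo p^3 becomes one for 6xy modulo p^4, with the same
      -- cofactor.
      py≈pz : (K.ιₙ 6 K.* (x K.* y)) K.≈ (ιᵢ (+ p) K.* z)
      py≈pz = from y≈z
        where
        from : y K₃.≈ z → (K.ιₙ 6 K.* (x K.* y)) K.≈ (ιᵢ (+ p) K.* z)
        from (multiple c h) = multiple c (trans (cong₂ _-_ (trans (val-6xy y) (cong (λ k → ℕtoℚ k * val y) (ℕₚ.*-identityˡ p))) (val-* (ιᵢ (+ p)) z))
          (trans (Q.solve 3 (λ P y z → P Q.:* y Q.:- P Q.:* z Q.:= P Q.:* (y Q.:- z)) refl P (val y) (val z))
            (trans (cong (_*_ P) h) (trans (sym (ℚₚ.*-assoc P (ℕtoℚ (p ℕ.^ 3)) (val c))) (cong (_* val c) (sym (ℕtoℚ-* p (p ℕ.^ 3))))))))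

      conclusion : CongMod p (S p) (expansion p u) (ℕtoℚ (p ℕ.^ 4))
      conclusion = subst₂′ S-value (trans (val-* (ιᵢ (+ p)) z) val-target)
        (congMod (K.ιₙ 6 K.* H.F aᵢ K.0#) (ιᵢ (+ p) K.* z) (K.trans (S≈6xy y (proj₂ solution)) py≈pz))
        where
        subst₂′ : ∀ {a a′ b b′} → a ≡ a′ → b ≡ b′ → CongMod p a b (ℕtoℚ (p ℕ.^ 4)) → CongMod p a′ b′ (ℕtoℚ (p ℕ.^ 4))
        subst₂′ refl refl h = h

    result : ∃ λ u → QuadraticForms.IsTrace X Y u × CongMod p (S p) (expansion p u) (ℕtoℚ (p ℕ.^ 4))
    result = from (UnitRoot.result (integers-mod 3) M p-prime Λ n′ M≡6n X Y X²+3Y² X≡1 x y 6x≈p x³≈0 y-eq₃)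
      where
      from : (∃ λ u → QuadraticForms.IsTrace X Y u × ¬ (+ p ∣ᶻ u) × (∀ v → K₃.ι u K₃.* v K₃.≈ K₃.1# → y K₃.≈ K₃.- K₃.ι u K₃.+ K₃.ιₙ p K₃.* v K₃.+ K₃.ιₙ p K₃.* K₃.ιₙ p K₃.* (v K₃.* v K₃.* v))) →
        ∃ λ u → QuadraticForms.IsTrace X Y u × CongMod p (S p) (expansion p u) (ℕtoℚ (p ℕ.^ 4))
      from (u , tr , ¬u , root) = u , tr , conclusion u ¬u root

  -- Primes p = 6g - 1.

  module Residue-5 (g′ : ℕ) (p-prime : Prime (suc (6 ℕ.* g′ ℕ.+ 4))) (3<p : 3 ℕ.< suc (6 ℕ.* g′ ℕ.+ 4)) where
    private
      M p n k₄ : ℕ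
      M = 6 ℕ.* g′ ℕ.+ 4
      p = suc M
      n = 5 ℕ.* g′ ℕ.+ 4
      k₄ = 4 ℕ.* g′ ℕ.+ 3

    open PrimeModulus p p-prime using (¬p∣small; ¬p∣1)

    5p≡6n+1 : 5 ℕ.* p ≡ suc (6 ℕ.* n)
    5p≡6n+1 = ℕS.solve 1 (λ g → ℕS.con 5 ℕS.:* (ℕS.con 1 ℕS.:+ (ℕS.con 6 ℕS.:* g ℕS.:+ ℕS.con 4)) ℕS.:= ℕS.con 1 ℕS.:+ ℕS.con 6 ℕS.:* (ℕS.con 5 ℕS.:* g ℕS.:+ ℕS.con 4)) refl g′

    n≤M : n ℕ.≤ M
    n≤M = subst (n ℕ.≤_) (ℕS.solve 1 (λ g → (ℕS.con 5 ℕS.:* g ℕS.:+ ℕS.con 4) ℕS.:+ g ℕS.:= ℕS.con 6 ℕS.:* g ℕS.:+ ℕS.con 4) refl g′) (ℕₚ.m≤m+n n g′)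

    open SumValue M p-prime 3<p 5 n 5p≡6n+1 n≤M

    module P₂ = Products 2
    module K₂ = RingKit (integers-mod 2)

    p²≈0 : K₂.ιₙ p K₂.* K₂.ιₙ p K₂.≈ K₂.0#
    p²≈0 = K₂.trans (val⇒≈ (trans (val-* P P) (trans (cong (λ v → v * v) (P₂.val-ιₙ p))
        (sym (trans (power-val 2) (cong (_*_ (ℕtoℚ p)) (ℚₚ.*-identityʳ (ℕtoℚ p)))))))) P₂.p^N≈0
      where P = K₂.ιₙ p

    iv-inv₂ : ∀ i → i ℕ.< M → K₂.ιₙ (suc i) K₂.* iv i K₂.≈ K₂.1#
    iv-inv₂ i i<M = val⇒≈ (trans (val-* (K₂.ιₙ (suc i)) (iv i)) (trans (cong (_* val (iv i)) (P₂.val-ιₙ (suc i))) (val-iv i i<M)))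

    -- The factor j = p of the closed form is split off.
    upper₄ upper₂ : ℕ → Integral
    upper₄ i = K.ιₙ (suc (suc M ℕ.+ i)) K.- K.ιₙ 2 K.* x
    upper₂ i = K₂.ιₙ (suc (suc M ℕ.+ i)) K₂.- K₂.ιₙ 2 K₂.* x

    E′ : Integral
    E′ = K.Π< n P₄.square K.* (K.Π< M P₄.linear K.* K.Π< k₄ upper₄)

    f : Integral
    f = K.ιₙ p K.- K.ιₙ 2 K.* x

    E-split : H.E n K.≈ (f K.* E′)
    E-split = K.trans (K.*-congˡ {K.Π< n P₄.square} split) (K.pull-out {K.Π< n P₄.square} {K.Π< M P₄.linear} {f} {K.Π< k₄ upper₄})
      where
      2n : 2 ℕ.* n ≡ M ℕ.+ suc k₄
      2n = ℕS.solve 1 (λ g → ℕS.con 2 ℕS.:* (ℕS.con 5 ℕS.:* g ℕS.:+ ℕS.con 4) ℕS.:= (ℕS.con 6 ℕS.:* g ℕS.:+ ℕS.con 4) ℕS.:+ (ℕS.con 1 ℕS.:+ (ℕS.con 4 ℕS.:* g ℕS.:+ ℕS.con 3))) refl g′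
      split : K.Π< (2 ℕ.* n) P₄.linear K.≈ (K.Π< M P₄.linear K.* (f K.* K.Π< k₄ upper₄))
      split = K.trans (K.reflexive (cong (λ k → K.Π< k P₄.linear) 2n)) (K.trans (K.Π-split M (suc k₄) P₄.linear)
        (K.*-congˡ {K.Π< M P₄.linear} (K.trans (K.Π-head k₄ (λ i → P₄.linear (M ℕ.+ i)))
          (K.*-cong (K.reflexive (cong P₄.linear (ℕₚ.+-identityʳ M))) (K.Π-cong k₄ (λ i _ → K.reflexive (cong P₄.linear (ℕₚ.+-suc M i))))))))

    abstract
      solution : ∃ λ w → w K.* (H.L n K.* H.D n) K.≈ E′
      solution = H.quotient n E′ n≤M

    -- `f` is p - 2x = -2p/3 and 6x = 5p, so 6xy carries p^2 and a value of w modulo p^2 suffices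
    -- modulo p^4.
    w y : Integral
    w = proj₁ solution
    y = f K.* w

    y-eq : y K.* (H.L n K.* H.D n) K.≈ H.E n
    y-eq = K.trans (K.*-assoc f w (H.L n K.* H.D n)) (K.trans (K.*-congˡ {f} (proj₂ solution)) (K.sym E-split))

    val-upper₄ : ∀ i → val (upper₄ i) ≡ val (upper₂ i)
    val-upper₄ i = trans (P₄.val-linear (suc M ℕ.+ i)) (sym (P₂.val-linear (suc M ℕ.+ i)))

    w-eq₂ : w K₂.* (K₂.Π< n P₂.linear K₂.* K₂.Π< n P₂.cube) K₂.≈ (K₂.Π< n P₂.square K₂.* (K₂.Π< M P₂.linear K₂.* K₂.Π< k₄ upper₂))
    w-eq₂ = Transport.transport 2 (ℕ.s≤s (ℕ.s≤s ℕ.z≤n)) w E′ (K₂.Π< n P₂.square K₂.* (K₂.Π< M P₂.linear K₂.* K₂.Π< k₄ upper₂)) (proj₂ solution)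
      (trans (val-* (K.Π< n P₄.square) (K.Π< M P₄.linear K.* K.Π< k₄ upper₄)) (trans (cong₂ _*_
          (trans (P₄.val-Π′ n P₄.square _ P₄.val-square) (sym (P₂.val-Π′ n P₂.square _ P₂.val-square)))
          (trans (val-* (K.Π< M P₄.linear) (K.Π< k₄ upper₄)) (trans (cong₂ _*_
            (trans (P₄.val-Π′ M P₄.linear _ P₄.val-linear) (sym (P₂.val-Π′ M P₂.linear _ P₂.val-linear)))
            (trans (P₄.val-Π′ k₄ upper₄ _ val-upper₄) (sym (P₂.val-Π k₄ upper₂))))
            (sym (val-* (K₂.Π< M P₂.linear) (K₂.Π< k₄ upper₂))))))
        (sym (val-* (K₂.Π< n P₂.square) (K₂.Π< M P₂.linear K₂.* K₂.Π< k₄ upper₂)))))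

    6x≈5p : K₂.ιₙ 6 K₂.* x K₂.≈ (K₂.ιₙ 5 K₂.* K₂.ιₙ p)
    6x≈5p = val⇒≈ (trans (val-* (K₂.ιₙ 6) x) (trans (cong (_* val x) (P₂.val-ιₙ 6)) (trans val-6x
      (trans (ℕtoℚ-* 5 p) (sym (trans (val-* (K₂.ιₙ 5) (K₂.ιₙ p)) (cong₂ _*_ (P₂.val-ιₙ 5) (P₂.val-ιₙ p))))))))

    evaluate : ∀ w c h m q → w K₂.* K₂.ιₙ c K₂.≈ (K₂.- (K₂.ιₙ 2 K₂.* K₂.ιₙ 2 K₂.^ h K₂.* (K₂.ιₙ 2 K₂.^ m K₂.+ K₂.ιₙ 3 K₂.* K₂.ιₙ q K₂.- K₂.ιₙ 4))) →
      ∃ λ (d : Integral) → val w * ℕtoℚ c + ℕtoℚ 2 * ℕtoℚ (2 ℕ.^ h) * ℤtoℚ (+ (2 ℕ.^ m) ℤ.+ + (3 ℕ.* q) ℤ.- + 4) ≡ ℕtoℚ (p ℕ.^ 2) * val d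
    evaluate w c h m q (multiple d e) = d , trans (sym (trans (cong₂ _-_ (trans (val-* w (K₂.ιₙ c)) (cong (_*_ (val w)) (P₂.val-ιₙ c))) val-rhs)
        (Q.solve 2 (λ a b → a Q.:- Q.:- b Q.:= a Q.:+ b) refl (val w * ℕtoℚ c) (ℕtoℚ 2 * ℕtoℚ (2 ℕ.^ h) * t)))) e
      where
      t : ℚ
      t = ℤtoℚ (+ (2 ℕ.^ m) ℤ.+ + (3 ℕ.* q) ℤ.- + 4)
      tᵢ rhs : Integral
      tᵢ = K₂.ιₙ 2 K₂.^ m K₂.+ K₂.ιₙ 3 K₂.* K₂.ιₙ q K₂.- K₂.ιₙ 4
      rhs = K₂.ιₙ 2 K₂.* K₂.ιₙ 2 K₂.^ h K₂.* tᵢ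
      val-2^ : ∀ k → val (K₂.ιₙ 2 K₂.^ k) ≡ ℕtoℚ (2 ℕ.^ k)
      val-2^ k = trans (P₂.val-^ (K₂.ιₙ 2) k) (trans (cong (Q._^ k) (P₂.val-ιₙ 2)) (sym (ℕtoℚ-^ 2 k)))
      val-t : val tᵢ ≡ t
      val-t = trans (val-+ (K₂.ιₙ 2 K₂.^ m K₂.+ K₂.ιₙ 3 K₂.* K₂.ιₙ q) (K₂.- K₂.ιₙ 4))
        (trans (cong₂ _+_ (trans (val-+ (K₂.ιₙ 2 K₂.^ m) (K₂.ιₙ 3 K₂.* K₂.ιₙ q)) (cong₂ _+_ (val-2^ m)
            (trans (val-* (K₂.ιₙ 3) (K₂.ιₙ q)) (trans (cong₂ _*_ (P₂.val-ιₙ 3) (P₂.val-ιₙ q)) (sym (ℕtoℚ-* 3 q))))))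
          (trans (val-neg (K₂.ιₙ 4)) (cong -_ (P₂.val-ιₙ 4))))
        (sym (trans (ℤtoℚ-- (+ (2 ℕ.^ m) ℤ.+ + (3 ℕ.* q)) (+ 4)) (cong (_- ℕtoℚ 4) (ℤtoℚ-+ (+ (2 ℕ.^ m)) (+ (3 ℕ.* q)))))))
      val-neg-* : ∀ a b c {a′ b′ c′} → val a ≡ a′ → val b ≡ b′ → val c ≡ c′ → val (K₂.- (a K₂.* b K₂.* c)) ≡ - (a′ * b′ * c′)
      val-neg-* a b c refl refl refl = trans (val-neg (a K₂.* b K₂.* c)) (cong -_ (trans (val-* (a K₂.* b) c) (cong (_* val c) (val-* a b))))
      val-rhs : val (K₂.- rhs) ≡ - (ℕtoℚ 2 * ℕtoℚ (2 ℕ.^ h) * t)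
      val-rhs = val-neg-* (K₂.ιₙ 2) (K₂.ιₙ 2 K₂.^ h) tᵢ (P₂.val-ιₙ 2) (val-2^ h) val-t

    h c : ℕ
    h = 2 ℕ.* suc g′
    c = (4 ℕ.* suc g′) C h

    t : ℤ
    t = + (2 ℕ.^ M) ℤ.+ + (3 ℕ.* p) ℤ.- + 4

    P W Cℚ T G : ℚ
    P = ℕtoℚ p
    W = val w
    Cℚ = ℕtoℚ c
    T = ℤtoℚ t
    G = ℕtoℚ (2 ℕ.^ h)

    unit-part : ∃ λ (d : Integral) → W * Cℚ + ℕtoℚ 2 * G * T ≡ ℕtoℚ (p ℕ.^ 2) * val d
    unit-part = evaluate w c h M p (UnitPart.ModuloSquare.Final.unit-part (integers-mod 2) g′ p²≈0 iv iv-inv₂ x w 6x≈5p w-eq₂)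

    unit-C : K₂.Unit (K₂.ιₙ c)
    unit-C = UnitPart.ModuloSquare.unit-C (integers-mod 2) g′ p²≈0 iv iv-inv₂

    ¬p∣c : ¬ (+ p ∣ᶻ + c)
    ¬p∣c (ℤD.divides q e) = ¬p∣1 (P₂.ι-reflects (ℕ.s≤s ℕ.z≤n) (+ 1) (K₂.∣ʳ-resp (proj₂ unit-C) (K₂.∣ʳ-*ʳ (proj₁ unit-C) (K₂.ι q ,
      val⇒≈ (trans (P₂.val-ι (+ c)) (trans (cong ℤtoℚ e) (trans (ℤtoℚ-* q (+ p)) (trans (ℚₚ.*-comm (ℤtoℚ q) P)
        (sym (trans (val-* (K₂.ιₙ p) (K₂.ι q)) (cong₂ _*_ (P₂.val-ιₙ p) (P₂.val-ι q))))))))))))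

    ¬p∣3c : ¬ (+ p ∣ᶻ + (3 ℕ.* c))
    ¬p∣3c h = ¬p∣* {+ 3} {+ c} (¬p∣small 3 (ℕ.s≤s ℕ.z≤n) 3<p) ¬p∣c (subst (+ p ∣ᶻ_) (ℤₚ.pos-* 3 c) h)

    target : ℚ
    target = (ℕtoℚ (20 ℕ.* 2 ℕ.^ h) * T * ℕtoℚ (p ℕ.^ 2)) ÷' ℕtoℚ (3 ℕ.* c)

    I : Integral
    I = recipᵢ (+ (3 ℕ.* c)) ¬p∣3c

    rhsᵢ : Integral
    rhsᵢ = ιᵢ (+ (20 ℕ.* 2 ℕ.^ h)) K.* ιᵢ t K.* ιᵢ (+ (p ℕ.^ 2)) K.* I

    val-rhsᵢ : val rhsᵢ ≡ target
    val-rhsᵢ = trans (val-* (ιᵢ (+ (20 ℕ.* 2 ℕ.^ h)) K.* ιᵢ t K.* ιᵢ (+ (p ℕ.^ 2))) I) (cong (_* val I)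
      (trans (val-* (ιᵢ (+ (20 ℕ.* 2 ℕ.^ h)) K.* ιᵢ t) (ιᵢ (+ (p ℕ.^ 2)))) (cong (_* ℕtoℚ (p ℕ.^ 2)) (val-* (ιᵢ (+ (20 ℕ.* 2 ℕ.^ h))) (ιᵢ t)))))

    3C·I : ℕtoℚ (3 ℕ.* c) * val I ≡ 1ℚ
    3C·I = inv-inverse (ℕtoℚ (3 ℕ.* c)) (ℤtoℚ-nonzero {+ (3 ℕ.* c)} (λ e → ¬p∣3c (subst (+ p ∣ᶻ_) (sym e) (ℤD.divides (+ 0) refl))))

    val-y : ℕtoℚ 3 * val y ≡ - (ℕtoℚ 2 * P * W)
    val-y = trans (cong (_*_ (ℕtoℚ 3)) (trans (val-* f w) (cong (_* W) (trans (val-+ (K.ιₙ p) (K.- (K.ιₙ 2 K.* x))) (cong₂ _+_ (V.val-ιₙ p)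
        (trans (val-neg (K.ιₙ 2 K.* x)) (cong -_ (trans (val-* (K.ιₙ 2) x) (cong (_* val x) (V.val-ιₙ 2))))))))))
      (trans (Q.solve 5 (λ a P b x W → a Q.:* ((P Q.:+ Q.:- (b Q.:* x)) Q.:* W) Q.:= (a Q.:* P Q.:- (a Q.:* b) Q.:* x) Q.:* W) refl (ℕtoℚ 3) P (ℕtoℚ 2) (val x) W)
        (trans (cong (λ v → (ℕtoℚ 3 * P - v) * W) (trans (cong (_* val x) (sym (ℕtoℚ-* 3 2))) (trans val-6x (ℕtoℚ-* 5 p))))
          (trans (Q.solve 4 (λ a b P W → (a Q.:* P Q.:- b Q.:* P) Q.:* W Q.:= (a Q.:- b) Q.:* P Q.:* W) refl (ℕtoℚ 3) (ℕtoℚ 5) P W)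
            (Q.solve 3 (λ a P W → Q.:- a Q.:* P Q.:* W Q.:= Q.:- (a Q.:* P Q.:* W)) refl (ℕtoℚ 2) P W))))

    S≈rhsᵢ : (K.ιₙ 6 K.* (x K.* y)) K.≈ rhsᵢ
    S≈rhsᵢ = from unit-part
      where
      from : (∃ λ (d : Integral) → W * Cℚ + ℕtoℚ 2 * G * T ≡ ℕtoℚ (p ℕ.^ 2) * val d) → (K.ιₙ 6 K.* (x K.* y)) K.≈ rhsᵢ
      -- 3 · 6xy = 5p · 3(p - 2x)w = -10 p^2 w, so an error p^2 d in w C becomes -10 p^4 d once the
      -- denominator 3C is cleared.
      from (d , e) = multiple (ιᵢ (ℤ.- + 10) K.* val-d) (Q.unit-cancel {ℕtoℚ (3 ℕ.* c)} (val I , 3C·I) (trans lhs (sym rhs)))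
        where
        val-d = d K.* I
        P² P⁴ D : ℚ
        P² = ℕtoℚ (p ℕ.^ 2)
        P⁴ = ℕtoℚ (p ℕ.^ 4)
        D = val d
        P²-eq : P² ≡ P * P
        P²-eq = trans (ℕtoℚ-^ p 2) (cong (_*_ P) (ℚₚ.*-identityʳ P))
        P⁴-eq : P⁴ ≡ P² * P²
        P⁴-eq = trans (cong ℕtoℚ (ℕₚ.^-distribˡ-+-* p 2 2)) (ℕtoℚ-* (p ℕ.^ 2) (p ℕ.^ 2))
        -10P⁴D : ℚ
        -10P⁴D = - (ℕtoℚ 10 * (P⁴ * D))
        rhs : ℕtoℚ (3 ℕ.* c) * (P⁴ * val (ιᵢ (ℤ.- + 10) K.* val-d)) ≡ -10P⁴D
        rhs = trans (cong (λ v → ℕtoℚ (3 ℕ.* c) * (P⁴ * v)) (trans (val-* (ιᵢ (ℤ.- + 10)) val-d) (cong₂ _*_ (ℤtoℚ-neg (+ 10)) (val-* d I))))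
          (trans (Q.solve 5 (λ n a t d i → n Q.:* (a Q.:* (Q.:- t Q.:* (d Q.:* i))) Q.:= Q.:- (t Q.:* (a Q.:* d)) Q.:* (n Q.:* i)) refl (ℕtoℚ (3 ℕ.* c)) P⁴ (ℕtoℚ 10) D (val I))
            (trans (cong (_*_ -10P⁴D) 3C·I) (ℚₚ.*-identityʳ -10P⁴D)))
        left : ℕtoℚ (3 ℕ.* c) * val (K.ιₙ 6 K.* (x K.* y)) ≡ - (ℕtoℚ 10 * (P² * (W * Cℚ)))
        left = trans (cong₂ _*_ (ℕtoℚ-* 3 c) (trans (val-6xy y) (cong (_* val y) (ℕtoℚ-* 5 p))))
          (trans (Q.solve 5 (λ a Cℚ b P y → a Q.:* Cℚ Q.:* (b Q.:* P Q.:* y) Q.:= b Q.:* P Q.:* Cℚ Q.:* (a Q.:* y)) refl (ℕtoℚ 3) Cℚ (ℕtoℚ 5) P (val y))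
            (trans (cong (_*_ (ℕtoℚ 5 * P * Cℚ)) val-y)
              (trans (Q.solve 5 (λ b P Cℚ a W → b Q.:* P Q.:* Cℚ Q.:* (Q.:- (a Q.:* P Q.:* W)) Q.:= Q.:- ((b Q.:* a) Q.:* (P Q.:* P Q.:* (W Q.:* Cℚ)))) refl (ℕtoℚ 5) P Cℚ (ℕtoℚ 2) W)
                (cong₂ (λ v s → - (v * (s * (W * Cℚ)))) (sym (ℕtoℚ-* 5 2)) (sym P²-eq)))))
        right : ℕtoℚ (3 ℕ.* c) * val rhsᵢ ≡ ℕtoℚ 20 * G * T * P²
        right = trans (cong (_*_ (ℕtoℚ (3 ℕ.* c))) val-rhsᵢ) (trans (Q.solve 5 (λ n a t s i → n Q.:* (a Q.:* t Q.:* s Q.:* i) Q.:= a Q.:* t Q.:* s Q.:* (n Q.:* i)) refl (ℕtoℚ (3 ℕ.* c)) (ℕtoℚ (20 ℕ.* 2 ℕ.^ h)) T P² (val I))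
          (trans (cong₂ _*_ (cong (λ v → v * T * P²) (ℕtoℚ-* 20 (2 ℕ.^ h))) 3C·I) (ℚₚ.*-identityʳ _)))
        lhs : ℕtoℚ (3 ℕ.* c) * (val (K.ιₙ 6 K.* (x K.* y)) - val rhsᵢ) ≡ -10P⁴D
        lhs = trans (Q.solve 3 (λ n a b → n Q.:* (a Q.:- b) Q.:= n Q.:* a Q.:- n Q.:* b) refl (ℕtoℚ (3 ℕ.* c)) (val (K.ιₙ 6 K.* (x K.* y))) (val rhsᵢ))
          (trans (cong₂ _-_ left (trans right (cong (λ v → v * G * T * P²) (ℕtoℚ-* 10 2))))
            (trans (Q.solve 6 (λ a b s X G T → Q.:- (a Q.:* (s Q.:* X)) Q.:- (a Q.:* b) Q.:* G Q.:* T Q.:* s Q.:= Q.:- (a Q.:* (s Q.:* (X Q.:+ b Q.:* G Q.:* T)))) refl (ℕtoℚ 10) (ℕtoℚ 2) P² (W * Cℚ) G T)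
              (cong (λ v → - (ℕtoℚ 10 * v)) (trans (cong (_*_ P²) e) (trans (sym (ℚₚ.*-assoc P² P² D)) (cong (_* D) (sym P⁴-eq)))))))

    conclusion : CongMod p (S p) target (ℕtoℚ (p ℕ.^ 4))
    conclusion = subst₂′ S-value val-rhsᵢ (congMod (K.ιₙ 6 K.* H.F aᵢ K.0#) rhsᵢ (K.trans (S≈6xy y y-eq) S≈rhsᵢ))
      where
      subst₂′ : ∀ {a a′ b b′} → a ≡ a′ → b ≡ b′ → CongMod p a b (ℕtoℚ (p ℕ.^ 4)) → CongMod p a′ b′ (ℕtoℚ (p ℕ.^ 4))
      subst₂′ refl refl h = h

-- Splitting by p modulo 6 and assembling the two cases.

open import Defs
open import Data.Nat as ℕ using (ℕ; _<_; _%_; _/_)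
open import Data.Nat.Primality using (Prime)
open import Data.Nat.Combinatorics using (_C_)
open import Data.Integer as ℤ using (ℤ; +_)
open import Data.Integer.Divisibility using () renaming (_∣_ to _∣ℤ_)
open import Data.Rational as ℚ using (ℚ; _+_; _*_; _-_; -_)
open import Data.Product using (_×_)
open import Data.Sum using (_⊎_)
open import Relation.Binary.PropositionalEquality using (_≡_)
open import Relation.Binary.PropositionalEquality using (refl; sym; trans; cong; subst)
open import Data.Nat.Primality using (prime⇒¬composite; composite)
import Data.Nat.DivMod as DM
open NaturalBinomials using (module ℕS)
open Congruences using (expansion)

prime-residues : ∀ p → Prime p → 3 < p →
  (p % 3 ≡ 1 → ∃ λ n′ → p ≡ suc (6 ℕ.* suc n′)) × (p % 3 ≡ 2 → ∃ λ g′ → p ≡ suc (6 ℕ.* g′ ℕ.+ 4))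
prime-residues p p-prime 3<p = by-residue (p % 6) (p / 6) (DM.m%n<n p 6) (DM.m≡m%n+[m/n]*n p 6)
  where
  ¬2∣p : ∀ {A : Set} k → p ≡ k ℕ.* 2 → A
  ¬2∣p k e = ⊥-elim (prime⇒¬composite p-prime (composite {d = 2} (ℕₚ.<-trans (ℕₚ.n<1+n 2) 3<p) (ℕD.divides k e)))
  mod-3 : ∀ r q → p ≡ r ℕ.+ q ℕ.* 6 → p % 3 ≡ r % 3
  mod-3 r q e = trans (cong (_% 3) (trans e (cong (r ℕ.+_) (sym (ℕₚ.*-assoc q 2 3))))) (DM.[m+kn]%n≡m%n r (q ℕ.* 2) 3)
  even : ∀ r q → p ≡ r ℕ.* 2 ℕ.+ q ℕ.* 6 → p ≡ (r ℕ.+ q ℕ.* 3) ℕ.* 2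
  even r q e = trans e (ℕS.solve 2 (λ r q → r ℕS.:* ℕS.con 2 ℕS.:+ q ℕS.:* ℕS.con 6 ℕS.:= (r ℕS.:+ q ℕS.:* ℕS.con 3) ℕS.:* ℕS.con 2) refl r q)
  absurd : ∀ {A : Set} {r s : ℕ} → ¬ (r ≡ s) → p % 3 ≡ r → p % 3 ≡ s → A
  absurd r≢s h h′ = ⊥-elim (r≢s (trans (sym h) h′))
  by-residue : ∀ r q → r < 6 → p ≡ r ℕ.+ q ℕ.* 6 →
    (p % 3 ≡ 1 → ∃ λ n′ → p ≡ suc (6 ℕ.* suc n′)) × (p % 3 ≡ 2 → ∃ λ g′ → p ≡ suc (6 ℕ.* g′ ℕ.+ 4))
  by-residue 0 q _ e = ¬2∣p (0 ℕ.+ q ℕ.* 3) (even 0 q e)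
  by-residue 1 zero _ e = ⊥-elim (ℕₚ.<⇒≢ (ℕₚ.≤-<-trans (ℕ.s≤s ℕ.z≤n) 3<p) (sym e))
  by-residue 1 (suc n′) _ e = (λ _ → n′ , trans e (cong suc (ℕₚ.*-comm (suc n′) 6))) , absurd (λ ()) (mod-3 1 (suc n′) e)
  by-residue 2 q _ e = ¬2∣p (1 ℕ.+ q ℕ.* 3) (even 1 q e)
  by-residue 3 q _ e = absurd (λ ()) (mod-3 3 q e) , absurd (λ ()) (mod-3 3 q e)
  by-residue 4 q _ e = ¬2∣p (2 ℕ.+ q ℕ.* 3) (even 2 q e)
  by-residue 5 q _ e = absurd (λ ()) (mod-3 5 q e) , λ _ → q ,
    trans e (ℕS.solve 1 (λ q → ℕS.con 5 ℕS.:+ q ℕS.:* ℕS.con 6 ℕS.:= ℕS.con 1 ℕS.:+ (ℕS.con 6 ℕS.:* q ℕS.:+ ℕS.con 4)) refl q)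
  by-residue (suc (suc (suc (suc (suc (suc _)))))) _ (ℕ.s≤s (ℕ.s≤s (ℕ.s≤s (ℕ.s≤s (ℕ.s≤s (ℕ.s≤s ())))))) _

-- The lower and upper index of the binomial coefficient are variables tied by equations, so that
-- the quotients by 3 in the final form are replaced by matching on those equations.
residue-5-conclusion : ∀ g′ (h k : ℕ) → h ≡ 2 ℕ.* suc g′ → k ≡ 4 ℕ.* suc g′ → let p = suc (6 ℕ.* g′ ℕ.+ 4) in Prime p → 3 < p →
  CongMod p (S p) ((ℕtoℚ (20 ℕ.* 2 ℕ.^ h) * ℤtoℚ (+ (2 ℕ.^ (p ℕ.∸ 1)) ℤ.+ + (3 ℕ.* p) ℤ.- + 4) * ℕtoℚ (p ℕ.^ 2)) ÷' ℕtoℚ (3 ℕ.* (k C h))) (ℕtoℚ (p ℕ.^ 4))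
residue-5-conclusion g′ _ _ refl refl p-prime 3<p = Congruences.Residue-5.conclusion g′ p-prime 3<p

third : ∀ g′ → (suc (6 ℕ.* g′ ℕ.+ 4) ℕ.+ 1) / 3 ≡ 2 ℕ.* suc g′
third g′ = trans (cong (_/ 3) (ℕS.solve 1 (λ g → ℕS.con 1 ℕS.:+ (ℕS.con 6 ℕS.:* g ℕS.:+ ℕS.con 4) ℕS.:+ ℕS.con 1 ℕS.:= ℕS.con 2 ℕS.:* (ℕS.con 1 ℕS.:+ g) ℕS.:* ℕS.con 3) refl g′)) (DM.m*n/n≡m (2 ℕ.* suc g′) 3)

residue-1-conclusion : ∀ n′ → let p = suc (6 ℕ.* suc n′) in Prime p → 3 < p → (x y : ℤ) → + p ≡ x ℤ.* x ℤ.+ + 3 ℤ.* (y ℤ.* y) → (+ 3 ∣ℤ (x ℤ.- + 1)) →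
  ((+ 3 ∣ℤ y) → CongMod p (S p) (expansion p (ℤ.- (+ 2 ℤ.* x))) (ℕtoℚ (p ℕ.^ 4))) × ((+ 3 ∣ℤ (y ℤ.- + 1)) → CongMod p (S p) (expansion p (x ℤ.- + 3 ℤ.* y)) (ℕtoℚ (p ℕ.^ 4)))
residue-1-conclusion n′ p-prime 3<p x y p≡ x≡1 = from (Congruences.Residue-1.result (6 ℕ.* suc n′) p-prime 3<p n′ refl x y p≡ (ℤD.∣ᵤ⇒∣ x≡1))
  where
  p : ℕ
  p = suc (6 ℕ.* suc n′)
  from : (∃ λ u → QuadraticForms.IsTrace x y u × CongMod p (S p) (expansion p u) (ℕtoℚ (p ℕ.^ 4))) →
    ((+ 3 ∣ℤ y) → CongMod p (S p) (expansion p (ℤ.- (+ 2 ℤ.* x))) (ℕtoℚ (p ℕ.^ 4))) × ((+ 3 ∣ℤ (y ℤ.- + 1)) → CongMod p (S p) (expansion p (x ℤ.- + 3 ℤ.* y)) (ℕtoℚ (p ℕ.^ 4)))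
  from (u , (if-0 , if-1) , h) = (λ 3∣y → at (if-0 (ℤD.∣ᵤ⇒∣ 3∣y))) , (λ 3∣y-1 → at (if-1 (ℤD.∣ᵤ⇒∣ 3∣y-1)))
    where
    at : ∀ {v} → u ≡ v → CongMod p (S p) (expansion p v) (ℕtoℚ (p ℕ.^ 4))
    at refl = h

theorem5p6 : (p : ℕ) → Prime p → 3 < p →
    ((p % 3 ≡ 1) →
    (x y : ℤ) → + p ≡ x ℤ.* x ℤ.+ + 3 ℤ.* (y ℤ.* y) →
    (+ 3 ∣ℤ (x ℤ.- + 1)) →
    (((+ 3 ∣ℤ y) →
    CongMod p (S p)
    (let u = ℤtoℚ (ℤ.- (+ 2 ℤ.* x)) in
    (- (ℕtoℚ p * u)) + (ℕtoℚ (p ℕ.^ 2) ÷' u) + (ℕtoℚ (p ℕ.^ 3) ÷' (u ^ℚ 3)))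
    (ℕtoℚ (p ℕ.^ 4)))
    × ((+ 3 ∣ℤ (y ℤ.- + 1)) →
    CongMod p (S p)
    (let u = ℤtoℚ (x ℤ.- + 3 ℤ.* y) in
    (- (ℕtoℚ p * u)) + (ℕtoℚ (p ℕ.^ 2) ÷' u) + (ℕtoℚ (p ℕ.^ 3) ÷' (u ^ℚ 3)))
    (ℕtoℚ (p ℕ.^ 4)))))
    × ((p % 3 ≡ 2) →
    CongMod p (S p)
    ((ℕtoℚ (20 ℕ.* 2 ℕ.^ ((p ℕ.+ 1) / 3)) * ℤtoℚ (+ (2 ℕ.^ (p ℕ.∸ 1)) ℤ.+ + (3 ℕ.* p) ℤ.- + 4)
    * ℕtoℚ (p ℕ.^ 2))
    ÷' ℕtoℚ (3 ℕ.* ((2 ℕ.* ((p ℕ.+ 1) / 3)) C ((p ℕ.+ 1) / 3))))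
    (ℕtoℚ (p ℕ.^ 4)))
theorem5p6 p p-prime 3<p = (λ p%3 → case-1 (proj₁ (prime-residues p p-prime 3<p) p%3) p-prime 3<p) , λ p%3 → case-2 (proj₂ (prime-residues p p-prime 3<p) p%3) p-prime 3<p
  where
  case-1 : ∀ {p} → (∃ λ n′ → p ≡ suc (6 ℕ.* suc n′)) → Prime p → 3 < p → (x y : ℤ) → + p ≡ x ℤ.* x ℤ.+ + 3 ℤ.* (y ℤ.* y) → (+ 3 ∣ℤ (x ℤ.- + 1)) →
    ((+ 3 ∣ℤ y) → CongMod p (S p) (expansion p (ℤ.- (+ 2 ℤ.* x))) (ℕtoℚ (p ℕ.^ 4))) × ((+ 3 ∣ℤ (y ℤ.- + 1)) → CongMod p (S p) (expansion p (x ℤ.- + 3 ℤ.* y)) (ℕtoℚ (p ℕ.^ 4)))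
  case-1 (n′ , refl) = residue-1-conclusion n′
  case-2 : ∀ {p} → (∃ λ g′ → p ≡ suc (6 ℕ.* g′ ℕ.+ 4)) → Prime p → 3 < p → CongMod p (S p)
    ((ℕtoℚ (20 ℕ.* 2 ℕ.^ ((p ℕ.+ 1) / 3)) * ℤtoℚ (+ (2 ℕ.^ (p ℕ.∸ 1)) ℤ.+ + (3 ℕ.* p) ℤ.- + 4) * ℕtoℚ (p ℕ.^ 2))
      ÷' ℕtoℚ (3 ℕ.* ((2 ℕ.* ((p ℕ.+ 1) / 3)) C ((p ℕ.+ 1) / 3)))) (ℕtoℚ (p ℕ.^ 4))
  case-2 (g′ , refl) = residue-5-conclusion g′ _ _ (third g′) (trans (cong (2 ℕ.*_) (third g′)) (sym (ℕₚ.*-assoc 2 2 (suc g′))))
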